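{- Let $n\ge 1$ and $w\in S_n$. Then \[\mathfrak{G}_w=\sum_{\substack{\mathcal{B}\in\overline{\mathsf{BPD}}(w)\\ \check{\mathcal{B}}\text{ is reduced}}}(-1)^{\ell(\delta(\check{\mathcal{B}}))-\ell(w)}\,\mathfrak{S}_{\delta(\check{\mathcal{B}})}.\]
   Context: $S_n$ is the symmetric group, $s_i=(i\ i+1)$, $\ell$ is Coxeter length, $w_0=n\,n-1\cdots 1$. Schubert polynomials: $\mathfrak{S}_{w_0}=x_1^{n-1}x_2^{n-2}\cdots x_{n-1}$ and $\mathfrak{S}_{ws_i}=N_i(\mathfrak{S}_w)$ whenever $w(i)>w(i+1)$, where $N_i(f)=(f-s_i\cdot f)/(x_i-x_{i+1})$ and $s_i$ acts by swapping $x_i,x_{i+1}$. Grothendieck polynomials: $\mathfrak{G}_{w_0}=x_1^{n-1}\cdots x_{n-1}$ and $\mathfrak{G}_{ws_i}=N_i((1-x_{i+1})\mathfrak{G}_w)$ whenever $w(i)>w(i+1)$. (Both families are stable under the inclusion $S_n\subset S_{n+1}$, so they are indexed by permutations.) A bumpless pipe dream (BPD) of size $n$ is a tiling of the $n\times n$ grid (row $1$ on top, column $1$ on the left) by six tile types: an elbow joining the bottom and right edges of the cell; an elbow joining the top and left edges; a horizontal segment; a vertical segment; a crossing (horizontal and vertical segment); a blank tile; such that the segments connect into $n$ pipes, each entering through the bottom edge of a column and leaving through the right edge of a row (pipes travel only north and east). Label the pipes $1,\dots,n$ by their entry column; at a crossing tile the larger of the two incoming labels (from below and from the left) exits through the top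 and the smaller through the right. Define $\delta(\mathcal{B})\in S_n$ by $\delta(\mathcal{B})(r)=$ the label leaving the right edge of row $r$. A BPD is reduced if each pair of pipes crosses at most once. $\overline{\mathsf{BPD}}(w)$ is the set of BPDs of size $n$ with $\delta(\mathcal{B})=w$. A co-BPD of size $n$ is a tiling of the $n\times n$ grid by: an elbow joining top and right edges; an elbow joining bottom and left edges; a crossing; a blank tile; a horizontal segment; a vertical segment; such that the segments form $n$ pipes each entering through the top edge of a column and leaving through the right edge of a row (travelling only south and east). Label pipes $1,\dots,n$ by their entry column; at a crossing the larger of the two incoming labels (from above and from the left) exits through the bottom and the smaller through the right; $\delta$ of a co-BPD is read as the labels on the right edge from top to bottom. A co-BPD is reduced if each pair of pipes crosses at most once. For a BPD $\mathcal{B}$, $\check{\mathcal{B}}$ is the co-BPD obtained by the tile-by-tile replacement: bottom–right elbow $\mapsto$ top–right elbow; top–left elbow $\mapsto$ bottom–left elbow; horizontal $\mapsto$ crossing; vertical $\mapsto$ blank; crossing $\mapsto$ horizontal; blank $\mapsto$ vertical. -}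

module Defs where

open import Data.Nat as ℕ using (ℕ; zero; suc; _∸_; _<ᵇ_; _⊔_; _⊓_)
open import Data.Integer as ℤ using (ℤ; +_; -_; _+_; _*_; ∣_∣)
open import Data.Fin as Fin using (Fin; toℕ; inject₁)
open import Data.Fin.Permutation using (Permutation′; _⟨$⟩ʳ_)
open import Data.Bool using (Bool; true; false; _∧_; if_then_else_)
open import Data.Maybe as Maybe using (Maybe; just; nothing; fromMaybe)
open import Data.Product using (_×_; _,_; proj₁; proj₂)
open import Data.List as List using (List; []; _∷_; _++_; upTo; allFin; concatMap)
open import Data.Vec as Vec using (Vec; []; _∷_; lookup; tabulate; _[_]≔_; replicate)
import Data.Vec.Properties as VecP
import Data.Maybe.Properties as MaybeP
import Data.Product.Properties as ProdP
open import Relation.Nullary.Decidable using (⌊_⌋)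
open import Relation.Binary.PropositionalEquality using (_≡_)

-- Polynomials in the variables x_1,...,x_n (x_{j+1} ↔ index j : Fin n)
-- with integer coefficients: formal (unnormalised) lists of terms
-- c · x^e, compared by their coefficient of every monomial x^e.

Mono : ℕ → Set
Mono n = Vec ℕ n

Poly : ℕ → Set
Poly n = List (ℤ × Mono n)

coeff : ∀ {n} → Poly n → Mono n → ℤ
coeff [] e = + 0
coeff ((c , e′) ∷ p) e =
  (if ⌊ VecP.≡-dec ℕ._≟_ e′ e ⌋ then c else + 0) + coeff p e

infix 4 _≈P_
_≈P_ : ∀ {n} → Poly n → Poly n → Set
p ≈P q = ∀ e → coeff p e ≡ coeff q e

scaleP : ∀ {n} → ℤ → Poly n → Poly n
scaleP s = List.map (λ { (c , e) → (s * c , e) })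

mulX : ∀ {n} → Fin n → Poly n → Poly n
mulX b = List.map (λ { (c , e) → (c , e [ b ]≔ suc (lookup e b)) })

oneMinusX : ∀ {n} → Fin n → Poly n → Poly n
oneMinusX b p = p ++ scaleP (- (+ 1)) (mulX b p)

-- Divided difference N_{i+1} (i : Fin m, acting on x_{i+1}, x_{i+2}),
-- N(f) = (f - s·f)/(x_a - x_b), computed on each monomial by exact division:
-- (x_a^p x_b^q - x_a^q x_b^p)/(x_a - x_b)
--   =  Σ_{k<p-q} x_a^{p-1-k} x_b^{q+k}   if p > q
--   = -Σ_{k<q-p} x_a^{q-1-k} x_b^{p+k}   if q > p,   = 0 if p = q.
ddMono : ∀ {m} → Fin m → ℤ × Mono (suc m) → Poly (suc m)
ddMono i (c , e) =
  List.map (λ k → (c , (e [ a ]≔ (p ∸ 1 ∸ k)) [ b ]≔ (q ℕ.+ k))) (upTo (p ∸ q))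
  ++ List.map (λ k → (- c , (e [ a ]≔ (q ∸ 1 ∸ k)) [ b ]≔ (p ℕ.+ k))) (upTo (q ∸ p))
  where
  a b : Fin _
  a = inject₁ i
  b = Fin.suc i
  p q : ℕ
  p = lookup e a
  q = lookup e b

divDiff : ∀ {m} → Fin m → Poly (suc m) → Poly (suc m)
divDiff i = concatMap (ddMono i)

-- Permutations of {1..n}, n = suc m, written in one-line notation as
-- functions w : Fin n → ℕ (value w(j) = label, 0-indexed).

swapAt : ∀ {m} → Fin m → Fin (suc m) → Fin (suc m)
swapAt i j =
  if ⌊ j Fin.≟ inject₁ i ⌋ then Fin.suc i
  else if ⌊ j Fin.≟ Fin.suc i ⌋ then inject₁ i else j

firstAscent : ∀ {m} → (Fin (suc m) → ℕ) → Maybe (Fin m)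
firstAscent {m} w = go (allFin m)
  where
  go : List (Fin m) → Maybe (Fin m)
  go [] = nothing
  go (i ∷ is) = if w (inject₁ i) <ᵇ w (Fin.suc i) then just i else go is

countTrue : List Bool → ℕ
countTrue [] = 0
countTrue (true ∷ bs) = suc (countTrue bs)
countTrue (false ∷ bs) = countTrue bs

len : ∀ {n} → (Fin n → ℕ) → ℕ
len {n} w = countTrue
  (concatMap (λ i → List.map (λ j → (toℕ i <ᵇ toℕ j) ∧ (w j <ᵇ w i)) (allFin n))
             (allFin n))

staircase : ∀ {m} → Mono (suc m)
staircase {m} = tabulate (λ j → m ∸ toℕ j)

-- 𝔖_w: 𝔖_{w0} = staircase; otherwise take the first ascent i of w
-- (so w s_i has a descent at i and ℓ(w s_i) = ℓ(w)+1) and set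
-- 𝔖_w = N_i 𝔖_{w s_i}.  Fuel n*n ≥ ℓ(w0) suffices for permutations.
schubAux : ∀ {m} → ℕ → (Fin (suc m) → ℕ) → Poly (suc m)
schubAux zero w = (+ 1 , staircase) ∷ []
schubAux (suc k) w with firstAscent w
... | nothing = (+ 1 , staircase) ∷ []
... | just i = divDiff i (schubAux k (λ j → w (swapAt i j)))

Schubert : ∀ {m} → (Fin (suc m) → ℕ) → Poly (suc m)
Schubert {m} = schubAux (suc m ℕ.* suc m)

-- 𝔊_w: same recursion with 𝔊_{w} = N_i((1 - x_{i+1}) 𝔊_{w s_i})
-- (x_{i+1} in 1-indexed notation is position suc i here).
grothAux : ∀ {m} → ℕ → (Fin (suc m) → ℕ) → Poly (suc m)
grothAux zero w = (+ 1 , staircase) ∷ []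
grothAux (suc k) w with firstAscent w
... | nothing = (+ 1 , staircase) ∷ []
... | just i = divDiff i (oneMinusX (Fin.suc i) (grothAux k (λ j → w (swapAt i j))))

Grothendieck : ∀ {m} → (Fin (suc m) → ℕ) → Poly (suc m)
Grothendieck {m} = grothAux (suc m ℕ.* suc m)

-- Tiles.  Edges record (top , bottom , left , right) pipe occupancy.

record Edges : Set where
  constructor edges
  field top bottom left right : Bool

data BTile : Set where
  elbowBR : BTile
  elbowTL : BTile
  horiz   : BTile
  vert    : BTile
  cross   : BTile
  blank   : BTile

data CTile : Set where
  elbowTR : CTile
  elbowBL : CTile
  cross   : CTile
  blank   : CTile
  horiz   : CTile
  vert    : CTile

bEdges : BTile → Edges
bEdges elbowBR = edges false true false true
bEdges elbowTL = edges true false true false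
bEdges horiz   = edges false false true true
bEdges vert    = edges true true false false
bEdges cross   = edges true true true true
bEdges blank   = edges false false false false

cEdges : CTile → Edges
cEdges elbowTR = edges true false false true
cEdges elbowBL = edges false true true false
cEdges cross   = edges true true true true
cEdges blank   = edges false false false false
cEdges horiz   = edges false false true true
cEdges vert    = edges true true false false

-- grids: a vector of rows, row 1 first; each row lists columns 1..n
Grid : Set → ℕ → Set
Grid T n = Vec (Vec T n) n

_==_ : Bool → Bool → Bool
true == b = b
false == true = false
false == false = true

allB : ∀ {k} → Vec Bool k → Bool
allB = Vec.foldr _ _∧_ true

rowOK : ∀ {T : Set} {k} → (T → Edges) → Bool → Vec T k → Bool
rowOK E b [] = b
rowOK E b (t ∷ ts) = (Edges.left (E t) == b) ∧ rowOK E (Edges.right (E t)) ts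

vertOK : ∀ {T : Set} {n k} → (T → Edges) → Bool → Vec Bool n → Vec (Vec T n) k → Bool
vertOK E bot exp [] = allB (Vec.map (_== bot) exp)
vertOK E bot exp (row ∷ rows) =
  allB (Vec.zipWith (λ t e → Edges.top (E t) == e) row exp)
  ∧ vertOK E bot (Vec.map (λ t → Edges.bottom (E t)) row) rows

gridOK : ∀ {T : Set} {n} → (T → Edges) → (topB botB : Bool) → Grid T n → Bool
gridOK E topB botB g =
  allB (Vec.map (rowOK E false) g) ∧ vertOK E botB (replicate _ topB) g

isBPD : ∀ {n} → Grid BTile n → Bool
isBPD = gridOK bEdges false true

isCoBPD : ∀ {n} → Grid CTile n → Bool
isCoBPD = gridOK cEdges true false

-- Label propagation.  Labels are 0-indexed entry columns.

Lab : Set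
Lab = Maybe ℕ

-- BPD tile: inputs (from bottom, from left) ↦ outputs (to top, to right)
bTile : BTile → Lab → Lab → Lab × Lab
bTile elbowBR b l = nothing , b
bTile elbowTL b l = l , nothing
bTile horiz   b l = nothing , l
bTile vert    b l = b , nothing
bTile cross (just x) (just y) = just (x ⊔ y) , just (x ⊓ y)
bTile cross   b l = b , l
bTile blank   b l = nothing , nothing

bRow : ∀ {k} → Vec BTile k → Lab → Vec Lab k → Vec Lab k × Lab
bRow [] l [] = [] , l
bRow (t ∷ ts) l (b ∷ bs) =
  let (up , r) = bTile t b l
      (ups , rr) = bRow ts r bs
  in (up ∷ ups) , rr

bRun : ∀ {n k} → Vec (Vec BTile n) k → Vec Lab n → Vec Lab n × Vec Lab k
bRun [] inp = inp , []
bRun (row ∷ rows) inp =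
  let (t , rs) = bRun rows inp
      (t′ , r) = bRow row nothing t
  in t′ , (r ∷ rs)

δB : ∀ {n} → Grid BTile n → Vec Lab n
δB {n} g = proj₂ (bRun g (tabulate (λ c → just (toℕ c))))

-- co-BPD tile: inputs (from top, from left) ↦ outputs (to bottom, to right),
-- plus the pair of labels meeting at a crossing
cTile : CTile → Lab → Lab → Lab × Lab × List (ℕ × ℕ)
cTile elbowTR t l = nothing , t , []
cTile elbowBL t l = l , nothing , []
cTile horiz   t l = nothing , l , []
cTile vert    t l = t , nothing , []
cTile cross (just x) (just y) = just (x ⊔ y) , just (x ⊓ y) , ((x ⊓ y , x ⊔ y) ∷ [])
cTile cross   t l = t , l , []
cTile blank   t l = nothing , nothing , []

cRow : ∀ {k} → Vec CTile k → Lab → Vec Lab k → Vec Lab k × Lab × List (ℕ × ℕ)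
cRow [] l [] = [] , l , []
cRow (t ∷ ts) l (a ∷ as) =
  let (dn , r , xs) = cTile t a l
      (dns , rr , ys) = cRow ts r as
  in (dn ∷ dns) , rr , (xs ++ ys)

cRun : ∀ {n k} → Vec (Vec CTile n) k → Vec Lab n → Vec Lab k × List (ℕ × ℕ)
cRun [] inp = [] , []
cRun (row ∷ rows) inp =
  let (dns , r , xs) = cRow row nothing inp
      (rs , ys) = cRun rows dns
  in (r ∷ rs) , (xs ++ ys)

cStart : ∀ {n} → Vec Lab n
cStart = tabulate (λ c → just (toℕ c))

δC : ∀ {n} → Grid CTile n → (Fin n → ℕ)
δC g r = fromMaybe 0 (lookup (proj₁ (cRun g cStart)) r)

crossPairs : ∀ {n} → Grid CTile n → List (ℕ × ℕ)
crossPairs g = proj₂ (cRun g cStart)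

pairEq : ℕ × ℕ → ℕ × ℕ → Bool
pairEq p q = ⌊ ProdP.≡-dec ℕ._≟_ ℕ._≟_ p q ⌋

memB : ℕ × ℕ → List (ℕ × ℕ) → Bool
memB p [] = false
memB p (q ∷ qs) = if pairEq p q then true else memB p qs

noDup : List (ℕ × ℕ) → Bool
noDup [] = true
noDup (p ∷ ps) = if memB p ps then false else noDup ps

isReducedCo : ∀ {n} → Grid CTile n → Bool
isReducedCo g = isCoBPD g ∧ noDup (crossPairs g)

checkTile : BTile → CTile
checkTile elbowBR = elbowTR
checkTile elbowTL = elbowBL
checkTile horiz   = cross
checkTile vert    = blank
checkTile cross   = horiz
checkTile blank   = vert

check : ∀ {n} → Grid BTile n → Grid CTile n
check = Vec.map (Vec.map checkTile)

allVecs : ∀ {A : Set} → List A → (k : ℕ) → List (Vec A k)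
allVecs xs zero = [] ∷ []
allVecs xs (suc k) = concatMap (λ x → List.map (x ∷_) (allVecs xs k)) xs

bTiles : List BTile
bTiles = elbowBR ∷ elbowTL ∷ horiz ∷ vert ∷ cross ∷ blank ∷ []

allBGrids : (n : ℕ) → List (Grid BTile n)
allBGrids n = allVecs (allVecs bTiles n) n

oneLine : ∀ {n} → Permutation′ n → (Fin n → ℕ)
oneLine w r = toℕ (w ⟨$⟩ʳ r)

inBPD : ∀ {n} → Permutation′ n → Grid BTile n → Bool
inBPD w g = isBPD g ∧
  ⌊ VecP.≡-dec (MaybeP.≡-dec ℕ._≟_) (δB g) (tabulate (λ r → just (oneLine w r))) ⌋

negOnePow : ℤ → ℤ
negOnePow k = go ∣ k ∣
  where
  go : ℕ → ℤ
  go zero = + 1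
  go (suc j) = - (go j)

rhs : ∀ {m} → Permutation′ (suc m) → Poly (suc m)
rhs {m} w = concatMap term (allBGrids (suc m))
  where
  term : Grid BTile (suc m) → Poly (suc m)
  term g = if inBPD w g ∧ isReducedCo (check g)
    then scaleP (negOnePow (+ len (δC (check g)) ℤ.- + len (oneLine w)))
                (Schubert (δC (check g)))
    else []

-- A polynomial supported below the staircase is determined by the constant terms of all its iterated divided
-- differences, so both sides are compared through these. For Schubert polynomials the constant terms are 0 or 1.
-- On the other side, the divided difference of the generating function of Grothendieck polynomials is a multiple
-- of it, so every N_u 𝔊_w is a combination of the 𝔊_a. Its coefficients, multiplied by ∏ (1 - x_j)^n, are partition
-- functions of a lattice model superposing B and B̌: each vertical edge carries either a pipe of B, moving up and
-- crossing as in the 0-Hecke algebra, or a pipe of B̌, moving down and crossing as in the nilCoxeter algebra. The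
-- twisted Leibniz rule for N_i becomes the exchange of two adjacent columns, a Yang–Baxter equation. At x = 0 the
-- partition function is the signed count of the BPDs B of w with B̌ reduced and δ(B̌) prescribed.
-- Polynomials are handled through their values at integer points with distinct coordinates, none equal to 1:
-- there N_i is an honest quotient, and these values determine the polynomial.

module Submission where

open import Defs
open import Data.Nat as ℕ using (ℕ; zero; suc; _∸_; _<ᵇ_; _⊔_; _⊓_; z≤n; s≤s)
import Data.Nat.Properties as ℕP
open import Data.Integer as ℤ using (ℤ; +_; -[1+_]; -_; _+_; _*_; _-_; _^_; ∣_∣; 0ℤ; 1ℤ; -1ℤ)
import Data.Integer.Properties as ℤP
open import Data.Integer.Tactic.RingSolver using (solve-∀)
open import Data.Fin as Fin using (Fin; zero; suc; toℕ; inject₁)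
import Data.Fin.Properties as FinP
open import Data.Fin.Permutation using (Permutation′; _⟨$⟩ʳ_)
import Data.Fin.Permutation as Perm
open import Data.Fin.Induction using (>-weakInduction)
open import Data.Bool using (Bool; true; false; _∧_; if_then_else_; not; T)
import Data.Bool.Properties as BoolP
open import Data.Maybe as Maybe using (Maybe; just; nothing; fromMaybe)
import Data.Maybe.Properties as MaybeP
open import Data.Product using (∃; _×_; _,_; proj₁; proj₂)
import Data.Product.Properties as ProdP
open import Data.Sum using (_⊎_; inj₁; inj₂)
open import Data.Empty using (⊥; ⊥-elim)
open import Data.Unit using (⊤; tt)
open import Data.List as List using (List; []; _∷_; _++_; upTo; allFin; concatMap; length; reverse)
import Data.List.Properties as ListP
open import Data.List.Relation.Unary.All as All using (All; []; _∷_)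
import Data.List.Relation.Unary.All.Properties as AllP
open import Data.List.Membership.Propositional using (_∈_)
open import Data.List.Membership.Propositional.Properties using (∈-allFin; ∈-map⁻; ∈-++⁻; ∈-tabulate⁺; ∈-tabulate⁻)
open import Data.List.Relation.Unary.Any using (here; there)
open import Data.List.Relation.Unary.Any.Properties using (reverse⁺)
open import Relation.Binary.Definitions using (tri<; tri≈; tri>)
open import Data.Vec as Vec using (Vec; []; _∷_; lookup; tabulate; _[_]≔_; replicate)
import Data.Vec.Properties as VecP
open import Function using (_∘_; id; case_of_)
open import Relation.Nullary using (¬_; Dec; yes; no; contradiction)
open import Relation.Nullary.Decidable using (⌊_⌋; _→-dec_)
open import Relation.Binary.PropositionalEquality
  using (_≡_; _≢_; refl; sym; trans; cong; cong₂; subst; subst₂; _≗_; module ≡-Reasoning)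

-- The labels with which co-BPD pipes enter record the word `u` of N_u, and these pipes must leave
-- in increasing order. For `u` empty this admits a single filling, of weight ± ∏ (1 - x_j)^n: this
-- is the origin of that factor, which is symmetric and so passes through every N_i. Each N_i then
-- exchanges two entry labels, or gives 0 if they already descend, so a derivative is only a new
-- boundary condition of the same model. At x = 0 every 𝔊_a except that of the identity vanishes,
-- and the labels of `u` must be inverse to δ(B̌). This is also the condition under which N_u 𝔖_v
-- has constant term 1: `u` is reduced and its permutation is inverse to v = δ(B̌). The obstacle is
-- that the definitions recur at the first ascent only, while the exchange of columns needs the
-- relation between 𝔊_w and 𝔊_{w s_i} at every i. Independence of the ascent is the braid relation
-- for f ↦ N_i((1 - t x_{i+1}) f), proved for both families at once, with t = 0 and t = 1.

Pt : ℕ → Set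
Pt n = Fin n → ℤ

evalM : ∀ {n} → Mono n → Pt n → ℤ
evalM []      x = 1ℤ
evalM (k ∷ e) x = x zero ^ k * evalM e (x ∘ suc)

eval : ∀ {n} → Poly n → Pt n → ℤ
eval []            x = 0ℤ
eval ((c , e) ∷ p) x = c * evalM e x + eval p x

evalM-cong : ∀ {n} (e : Mono n) {x y : Pt n} → x ≗ y → evalM e x ≡ evalM e y
evalM-cong []      h = refl
evalM-cong (k ∷ e) h = cong₂ _*_ (cong (_^ k) (h zero)) (evalM-cong e (h ∘ suc))

eval-cong : ∀ {n} (p : Poly n) {x y : Pt n} → x ≗ y → eval p x ≡ eval p y
eval-cong []            h = refl
eval-cong ((c , e) ∷ p) h = cong₂ _+_ (cong (_*_ c) (evalM-cong e h)) (eval-cong p h)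

eval-++ : ∀ {n} (p q : Poly n) x → eval (p ++ q) x ≡ eval p x + eval q x
eval-++ []            q x = sym (ℤP.+-identityˡ _)
eval-++ ((c , e) ∷ p) q x =
  trans (cong (_+_ (c * evalM e x)) (eval-++ p q x)) (sym (ℤP.+-assoc (c * evalM e x) (eval p x) (eval q x)))

eval-scaleP : ∀ {n} s (p : Poly n) x → eval (scaleP s p) x ≡ s * eval p x
eval-scaleP s []            x = sym (ℤP.*-zeroʳ s)
eval-scaleP s ((c , e) ∷ p) x =
  trans (cong (_+_ (s * c * evalM e x)) (eval-scaleP s p x)) (alg s c (evalM e x) (eval p x))
  where
  alg : ∀ s c m q → s * c * m + s * q ≡ s * (c * m + q)
  alg = solve-∀

evalM-incr : ∀ {n} (j : Fin n) (e : Mono n) x →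
  evalM (e [ j ]≔ suc (lookup e j)) x ≡ x j * evalM e x
evalM-incr zero    (k ∷ e) x = ℤP.*-assoc (x zero) (x zero ^ k) _
evalM-incr (suc j) (k ∷ e) x =
  trans (cong (_*_ (x zero ^ k)) (evalM-incr j e (x ∘ suc))) (alg (x zero ^ k) (x (suc j)) _)
  where
  alg : ∀ a b c → a * (b * c) ≡ b * (a * c)
  alg = solve-∀

eval-mulX : ∀ {n} (j : Fin n) (p : Poly n) x → eval (mulX j p) x ≡ x j * eval p x
eval-mulX j []            x = sym (ℤP.*-zeroʳ (x j))
eval-mulX j ((c , e) ∷ p) x =
  trans (cong₂ (λ u v → c * u + v) (evalM-incr j e x) (eval-mulX j p x))
        (alg c (x j) (evalM e x) (eval p x))
  where
  alg : ∀ c a m q → c * (a * m) + a * q ≡ a * (c * m + q)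
  alg = solve-∀

eval-oneMinusX : ∀ {n} (j : Fin n) (p : Poly n) x → eval (oneMinusX j p) x ≡ (1ℤ - x j) * eval p x
eval-oneMinusX j p x =
  trans (eval-++ p _ x)
  (trans (cong (_+_ (eval p x)) (trans (eval-scaleP (- 1ℤ) (mulX j p) x) (cong (_*_ (- 1ℤ)) (eval-mulX j p x))))
         (alg (eval p x) (x j)))
  where
  alg : ∀ q a → q + - 1ℤ * (a * q) ≡ (1ℤ - a) * q
  alg = solve-∀

-- Recovering coefficients from values at integer points.

-- Polynomials in x₀ over polynomials in the remaining variables, in Horner form.

insertTerm : ∀ {n} → ℕ → ℤ × Mono n → List (Poly n) → List (Poly n)
insertTerm zero    t []       = (t ∷ []) ∷ []
insertTerm zero    t (q ∷ qs) = (t ∷ q) ∷ qs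
insertTerm (suc k) t []       = [] ∷ insertTerm k t []
insertTerm (suc k) t (q ∷ qs) = q ∷ insertTerm k t qs

byFirst : ∀ {n} → Poly (suc n) → List (Poly n)
byFirst []                = []
byFirst ((c , k ∷ e) ∷ p) = insertTerm k (c , e) (byFirst p)

horner : ∀ {n} → List (Poly n) → ℤ → Pt n → ℤ
horner []       t x = 0ℤ
horner (q ∷ qs) t x = eval q x + t * horner qs t x

horner-insert : ∀ {n} k c (e : Mono n) qs t x →
  horner (insertTerm k (c , e) qs) t x ≡ c * (t ^ k * evalM e x) + horner qs t x
horner-insert zero c e [] t x = alg c (evalM e x) t
  where
  alg : ∀ c m t → c * m + 0ℤ + t * 0ℤ ≡ c * (1ℤ * m) + 0ℤ
  alg = solve-∀
horner-insert zero c e (q ∷ qs) t x = alg c (evalM e x) (eval q x) (t * horner qs t x)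
  where
  alg : ∀ c m q r → c * m + q + r ≡ c * (1ℤ * m) + (q + r)
  alg = solve-∀
horner-insert (suc k) c e [] t x =
  trans (cong (λ z → 0ℤ + t * z) (horner-insert k c e [] t x)) (alg c (evalM e x) t (t ^ k))
  where
  alg : ∀ c m t u → 0ℤ + t * (c * (u * m) + 0ℤ) ≡ c * (t * u * m) + 0ℤ
  alg = solve-∀
horner-insert (suc k) c e (q ∷ qs) t x =
  trans (cong (λ z → eval q x + t * z) (horner-insert k c e qs t x))
        (alg c (evalM e x) t (t ^ k) (eval q x) (horner qs t x))
  where
  alg : ∀ c m t u q r → q + t * (c * (u * m) + r) ≡ c * (t * u * m) + (q + t * r)
  alg = solve-∀

eval-byFirst : ∀ {n} (p : Poly (suc n)) x → eval p x ≡ horner (byFirst p) (x zero) (x ∘ suc)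
eval-byFirst []                x = refl
eval-byFirst ((c , k ∷ e) ∷ p) x =
  trans (cong (_+_ (c * (x zero ^ k * evalM e (x ∘ suc)))) (eval-byFirst p x))
        (sym (horner-insert k c e (byFirst p) (x zero) (x ∘ suc)))

nth : ∀ {n} → ℕ → List (Poly n) → Poly n
nth k       []       = []
nth zero    (q ∷ qs) = q
nth (suc k) (q ∷ qs) = nth k qs

isYes-cong : ∀ {A B : Set} → (A → B) → (B → A) → (p : Dec A) (q : Dec B) → ⌊ p ⌋ ≡ ⌊ q ⌋
isYes-cong f g (yes a) (yes b) = refl
isYes-cong f g (yes a) (no ¬b) = contradiction (f a) ¬b
isYes-cong f g (no ¬a) (yes b) = contradiction (g b) ¬a
isYes-cong f g (no ¬a) (no ¬b) = refl

bump : ∀ {n} k k′ (e e′ : Mono n) →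
  ⌊ VecP.≡-dec ℕ._≟_ (k′ ∷ e′) (k ∷ e) ⌋ ≡ ⌊ VecP.≡-dec ℕ._≟_ (suc k′ ∷ e′) (suc k ∷ e) ⌋
bump k k′ e e′ = isYes-cong
  (λ eq → cong₂ _∷_ (cong suc (VecP.∷-injectiveˡ eq)) (VecP.∷-injectiveʳ eq))
  (λ eq → cong₂ _∷_ (ℕP.suc-injective (VecP.∷-injectiveˡ eq)) (VecP.∷-injectiveʳ eq))
  (VecP.≡-dec ℕ._≟_ (k′ ∷ e′) (k ∷ e)) (VecP.≡-dec ℕ._≟_ (suc k′ ∷ e′) (suc k ∷ e))

coeff-insert : ∀ {n} k k′ c (e e′ : Mono n) qs →
  coeff (nth k (insertTerm k′ (c , e′) qs)) e ≡
  (if ⌊ VecP.≡-dec ℕ._≟_ (k′ ∷ e′) (k ∷ e) ⌋ then c else 0ℤ) + coeff (nth k qs) e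
coeff-insert zero zero c e e′ [] with VecP.≡-dec ℕ._≟_ e′ e
... | yes _ = refl
... | no  _ = refl
coeff-insert zero zero c e e′ (q ∷ qs) with VecP.≡-dec ℕ._≟_ e′ e
... | yes _ = refl
... | no  _ = refl
coeff-insert zero    (suc k′) c e e′ []       = refl
coeff-insert zero    (suc k′) c e e′ (q ∷ qs) = sym (ℤP.+-identityˡ _)
coeff-insert (suc k) zero     c e e′ []       = refl
coeff-insert (suc k) zero     c e e′ (q ∷ qs) = sym (ℤP.+-identityˡ _)
coeff-insert (suc k) (suc k′) c e e′ [] =
  trans (coeff-insert k k′ c e e′ []) (cong (λ b → (if b then c else 0ℤ) + 0ℤ) (bump k k′ e e′))
coeff-insert (suc k) (suc k′) c e e′ (q ∷ qs) =
  trans (coeff-insert k k′ c e e′ qs) (cong (λ b → (if b then c else 0ℤ) + coeff (nth k qs) e) (bump k k′ e e′))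

coeff-byFirst : ∀ {n} (p : Poly (suc n)) k e → coeff p (k ∷ e) ≡ coeff (nth k (byFirst p)) e
coeff-byFirst []                  k e = refl
coeff-byFirst ((c , k′ ∷ e′) ∷ p) k e =
  trans (cong (_+_ (if ⌊ VecP.≡-dec ℕ._≟_ (k′ ∷ e′) (k ∷ e) ⌋ then c else 0ℤ)) (coeff-byFirst p k e)) (sym (coeff-insert k k′ c e e′ (byFirst p)))

-- Points built up from the last coordinate, each new one large against those already chosen: the
-- shape that suits induction on the number of variables. Their coordinates are distinct and above
-- 1, hence `Good`.
Decreasing : ∀ {n} → Pt n → Set
Decreasing {zero}  x = ⊤
Decreasing {suc n} x = (1ℤ ℤ.< x zero) × (∀ j → x (suc j) ℤ.< x zero) × Decreasing (x ∘ suc)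

consPt : ∀ {n} → ℤ → Pt n → Pt (suc n)
consPt t x zero    = t
consPt t x (suc j) = x j

upperBound : ∀ {n} (x : Pt n) → ∃ λ N → ∀ t → + N ℤ.≤ t → (1ℤ ℤ.< t) × (∀ j → x j ℤ.< t)
upperBound {zero}  x = 2 , λ t h → ℤP.<-≤-trans (ℤ.+<+ (s≤s (s≤s z≤n))) h , λ ()
upperBound {suc n} x with upperBound (x ∘ suc)
... | N , h = suc ∣ x zero ∣ ℕ.+ N , λ t le →
  let le′ = ℤP.≤-trans (ℤ.+≤+ (ℕP.m≤n+m N (suc ∣ x zero ∣))) le in
  proj₁ (h t le′) ,
  λ { zero    → ℤP.≤-<-trans (x≤∣x∣ (x zero))
                  (ℤP.<-≤-trans (ℤ.+<+ (ℕP.m≤m+n (suc ∣ x zero ∣) N)) le)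
    ; (suc j) → proj₂ (h t le′) j }
  where
  x≤∣x∣ : ∀ z → z ℤ.≤ + ∣ z ∣
  x≤∣x∣ (+ k)      = ℤP.≤-refl
  x≤∣x∣ (-[1+ k ]) = ℤ.-≤+

-- The hypothesis covers only large `t`, with a bound that may depend on `x`. Once the constant term
-- is known to vanish, a factor `t` is cancelled and the other coefficients follow by induction.
horner-vanishes : ∀ {n} (qs : List (Poly n)) (x : Pt n) N →
  (∀ t → + N ℤ.≤ t → horner qs t x ≡ 0ℤ) → All (λ q → eval q x ≡ 0ℤ) qs
horner-vanishes []       x N h = []
horner-vanishes (q ∷ qs) x N h = q0 ∷ horner-vanishes qs x (suc N) rest
  where
  -- a constant term divisible by an integer exceeding its absolute value is zero
  M : ℕ
  M = suc ∣ eval q x ∣ ℕ.+ N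

  divides0 : ∀ a r → a + + M * r ≡ 0ℤ → ∣ a ∣ ℕ.< M → a ≡ 0ℤ
  divides0 a r eq lt = ℤP.∣i∣≡0⇒i≡0 (small ∣ r ∣ (trans abs (ℤP.abs-* (+ M) r)))
    where
    a≡ : a ≡ - (+ M * r)
    a≡ = begin
      a                          ≡⟨ alg a (+ M * r) ⟩
      (a + + M * r) - + M * r    ≡⟨ cong (_- + M * r) eq ⟩
      0ℤ - + M * r               ≡⟨ ℤP.+-identityˡ _ ⟩
      - (+ M * r)                ∎
      where
      open ≡-Reasoning
      alg : ∀ a b → a ≡ (a + b) - b
      alg = solve-∀
    abs : ∣ a ∣ ≡ ∣ + M * r ∣
    abs = trans (cong ∣_∣ a≡) (ℤP.∣-i∣≡∣i∣ (+ M * r))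
    small : ∀ s → ∣ a ∣ ≡ M ℕ.* s → ∣ a ∣ ≡ 0
    small zero    e = trans e (ℕP.*-zeroʳ M)
    small (suc s) e = contradiction lt (ℕP.≤⇒≯ (subst (M ℕ.≤_) (sym e) (ℕP.m≤m*n M (suc s))))

  q0 : eval q x ≡ 0ℤ
  q0 = divides0 (eval q x) _ (h (+ M) (ℤ.+≤+ (ℕP.m≤n+m N _))) (s≤s (ℕP.m≤m+n _ N))

  -- The bound grows by one so that `t` is nonzero and can be cancelled.
  rest : ∀ t → + suc N ℤ.≤ t → horner qs t x ≡ 0ℤ
  rest t le with ℤP.i*j≡0⇒i≡0∨j≡0 t
                   (trans (sym (ℤP.+-identityˡ _))
                     (trans (cong (_+ t * horner qs t x) (sym q0)) (h t (ℤP.≤-trans (ℤ.+≤+ (ℕP.n≤1+n N)) le))))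
  ... | inj₂ r    = r
  rest .0ℤ (ℤ.+≤+ ()) | inj₁ refl

All-nth : ∀ {n} {P : Poly n → Set} → P [] → ∀ {qs} → All P qs → ∀ k → P (nth k qs)
All-nth p0 []       k       = p0
All-nth p0 (p ∷ ps) zero    = p
All-nth p0 (p ∷ ps) (suc k) = All-nth p0 ps k

-- Induction on the number of variables: over a fixed decreasing tail the polynomial vanishes for
-- all large values of the first variable, so each Horner coefficient vanishes there, and it has one
-- variable less. Coefficients and values are treated together because a list of terms representing
-- zero need not be empty.
identity-theorem : ∀ {n} (p : Poly n) → (∀ x → Decreasing x → eval p x ≡ 0ℤ) →
  (∀ e → coeff p e ≡ 0ℤ) × (∀ x → eval p x ≡ 0ℤ)
identity-theorem {zero} p h = (λ { [] → trans (coeff≡eval p) (h (λ ()) tt) }) , ev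
  where
  coeff≡eval : ∀ (p : Poly 0) → coeff p [] ≡ eval p (λ ())
  coeff≡eval []             = refl
  coeff≡eval ((c , []) ∷ p) = cong₂ _+_ (sym (ℤP.*-identityʳ c)) (coeff≡eval p)
  ev : ∀ x → eval p x ≡ 0ℤ
  ev x = trans (eval-cong p {x} {λ ()} (λ ())) (h (λ ()) tt)
identity-theorem {suc n} p h =
  (λ { (k ∷ e) → trans (coeff-byFirst p k e) (All-nth {P = Z} ((λ _ → refl) , (λ _ → refl)) zeros k .proj₁ e) }) ,
  (λ x → trans (eval-byFirst p x) (horner-zero zeros (x zero) (x ∘ suc)))
  where
  Z : Poly n → Set
  Z q = (∀ e → coeff q e ≡ 0ℤ) × (∀ x → eval q x ≡ 0ℤ)

  pointwise : ∀ x → Decreasing x → All (λ q → eval q x ≡ 0ℤ) (byFirst p)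
  pointwise x d with upperBound x
  ... | N , b = horner-vanishes (byFirst p) x N λ t le →
    trans (sym (eval-byFirst p (consPt t x))) (h (consPt t x) (proj₁ (b t le) , proj₂ (b t le) , d))

  gather : ∀ qs → (∀ x → Decreasing x → All (λ q → eval q x ≡ 0ℤ) qs) → All Z qs
  gather []       f = []
  gather (q ∷ qs) f = identity-theorem q (λ x d → All.head (f x d)) ∷ gather qs (λ x d → All.tail (f x d))

  zeros : All Z (byFirst p)
  zeros = gather (byFirst p) pointwise

  horner-zero : ∀ {qs} → All Z qs → ∀ t x → horner qs t x ≡ 0ℤ
  horner-zero []       t x = refl
  horner-zero (z ∷ zs) t x =
    trans (cong₂ (λ u v → u + t * v) (proj₂ z x) (horner-zero zs t x)) (cong (_+_ 0ℤ) (ℤP.*-zeroʳ t))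

-- Polynomial functions and their comparison at good points.

-- 1 is excluded so that the factors 1 - x_j can be cancelled.
Good : ∀ {n} → Pt n → Set
Good x = (∀ i j → i ≢ j → x i ≢ x j) × (∀ j → x j ≢ 1ℤ)

Decreasing⇒Good : ∀ {n} (x : Pt n) → Decreasing x → Good x
Decreasing⇒Good {zero}  x d = (λ ()) , (λ ())
Decreasing⇒Good {suc n} x (g , b , d) with Decreasing⇒Good (x ∘ suc) d
... | dist , n1 = dist′ , λ { zero e → ℤP.<⇒≢ g (sym e) ; (suc j) → n1 j }
  where
  dist′ : ∀ i j → i ≢ j → x i ≢ x j
  dist′ zero    zero    ne e = ne refl
  dist′ zero    (suc j) ne e = ℤP.<⇒≢ (b j) (sym e)
  dist′ (suc i) zero    ne e = ℤP.<⇒≢ (b i) e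
  dist′ (suc i) (suc j) ne e = dist i j (ne ∘ cong suc) e

-- Partition functions are defined through their values; a representing polynomial is carried only
-- to pass to points that are not good.
record IsPoly {n} (f : Pt n → ℤ) : Set where
  constructor isPoly
  field
    poly    : Poly n
    correct : ∀ x → eval poly x ≡ f x

diffP : ∀ {n} → Poly n → Poly n → Poly n
diffP p q = p ++ scaleP (- 1ℤ) q

eval-diffP : ∀ {n} (p q : Poly n) x → eval (diffP p q) x ≡ eval p x - eval q x
eval-diffP p q x = trans (eval-++ p _ x)
  (cong (λ z → eval p x + z) (trans (eval-scaleP (- 1ℤ) q x) (ℤP.-1*i≡-i (eval q x))))

-- Identities are proved at good points, where differences of coordinates can be cancelled, but used
-- at the origin, where all coordinates coincide. This is the passage between the two.
agree-everywhere : ∀ {n} {f g : Pt n → ℤ} → IsPoly f → IsPoly g →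
  (∀ x → Good x → f x ≡ g x) → ∀ x → f x ≡ g x
agree-everywhere (isPoly p pf) (isPoly q qg) h x =
  trans (sym (pf x)) (trans (ℤP.i-j≡0⇒i≡j _ _ (trans (sym (eval-diffP p q x)) (proj₂ zeroes x))) (qg x))
  where
  zeroes = identity-theorem (diffP p q) λ y d →
    trans (eval-diffP p q y)
      (ℤP.i≡j⇒i-j≡0 (trans (pf y) (trans (h y (Decreasing⇒Good y d)) (sym (qg y)))))

coeff-++ : ∀ {n} (p q : Poly n) e → coeff (p ++ q) e ≡ coeff p e + coeff q e
coeff-++ []            q e = sym (ℤP.+-identityˡ _)
coeff-++ ((c , e′) ∷ p) q e = trans (cong (_+_ c′) (coeff-++ p q e)) (sym (ℤP.+-assoc c′ (coeff p e) (coeff q e)))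
  where
  c′ : ℤ
  c′ = if ⌊ VecP.≡-dec ℕ._≟_ e′ e ⌋ then c else 0ℤ

coeff-neg : ∀ {n} (p : Poly n) e → coeff (scaleP (- 1ℤ) p) e ≡ - coeff p e
coeff-neg []             e = refl
coeff-neg ((c , e′) ∷ p) e with ⌊ VecP.≡-dec ℕ._≟_ e′ e ⌋
... | true  = trans (cong₂ _+_ (ℤP.-1*i≡-i c) (coeff-neg p e)) (sym (ℤP.neg-distrib-+ c (coeff p e)))
... | false = trans (cong (_+_ 0ℤ) (coeff-neg p e)) (sym (ℤP.neg-distrib-+ 0ℤ (coeff p e)))

eval-determines : ∀ {n} (p q : Poly n) → (∀ x → eval p x ≡ eval q x) → p ≈P q
eval-determines p q h e = ℤP.i-j≡0⇒i≡j _ _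
  (trans (sym (trans (coeff-++ p _ e) (cong (_+_ (coeff p e)) (coeff-neg q e))))
         (proj₁ (identity-theorem (diffP p q) λ x _ → trans (eval-diffP p q x) (ℤP.i≡j⇒i-j≡0 (h x))) e))

eval-poly : ∀ {n} (p : Poly n) → IsPoly (eval p)
eval-poly p = isPoly p λ _ → refl

const-poly : ∀ {n} (c : ℤ) → IsPoly {n} (λ _ → c)
const-poly c = isPoly ((c , replicate _ 0) ∷ []) λ x →
  trans (ℤP.+-identityʳ _) (trans (cong (_*_ c) (evalM-one _ x)) (ℤP.*-identityʳ c))
  where
  evalM-one : ∀ n (x : Pt n) → evalM (replicate n 0) x ≡ 1ℤ
  evalM-one zero    x = refl
  evalM-one (suc n) x = trans (ℤP.*-identityˡ _) (evalM-one n (x ∘ suc))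

+-poly : ∀ {n} {f g : Pt n → ℤ} → IsPoly f → IsPoly g → IsPoly (λ x → f x + g x)
+-poly (isPoly p pf) (isPoly q qg) = isPoly (p ++ q) λ x → trans (eval-++ p q x) (cong₂ _+_ (pf x) (qg x))

scale-poly : ∀ {n} s {f : Pt n → ℤ} → IsPoly f → IsPoly (λ x → s * f x)
scale-poly s (isPoly p pf) = isPoly (scaleP s p) λ x → trans (eval-scaleP s p x) (cong (_*_ s) (pf x))

oneMinusX-poly : ∀ {n} j {f : Pt n → ℤ} → IsPoly f → IsPoly (λ x → (1ℤ - x j) * f x)
oneMinusX-poly j (isPoly p pf) =
  isPoly (oneMinusX j p) λ x → trans (eval-oneMinusX j p x) (cong (_*_ (1ℤ - x j)) (pf x))

*-poly : ∀ {n} {f g : Pt n → ℤ} → IsPoly f → IsPoly g → IsPoly (λ x → f x * g x)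
*-poly {n} {f} {g} (isPoly p pf) gp = go p pf
  where
  mono : ∀ (e : Mono n) (c : ℤ) → IsPoly (λ x → c * evalM e x * g x)
  mono e c = isPoly (List.map (λ t → c * proj₁ t , Vec.zipWith ℕ._+_ e (proj₂ t)) (IsPoly.poly gp))
    λ x → trans (ev (IsPoly.poly gp) x) (cong (_*_ (c * evalM e x)) (IsPoly.correct gp x))
    where
    evM : ∀ {n} (e e′ : Mono n) x → evalM (Vec.zipWith ℕ._+_ e e′) x ≡ evalM e x * evalM e′ x
    evM []      []        x = refl
    evM (k ∷ e) (k′ ∷ e′) x =
      trans (cong₂ _*_ (ℤP.^-distribˡ-+-* (x zero) k k′) (evM e e′ (x ∘ suc)))
            (alg (x zero ^ k) (x zero ^ k′) (evalM e (x ∘ suc)) (evalM e′ (x ∘ suc)))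
      where
      alg : ∀ a b c d → a * b * (c * d) ≡ a * c * (b * d)
      alg = solve-∀
    ev : ∀ q x → eval (List.map (λ t → c * proj₁ t , Vec.zipWith ℕ._+_ e (proj₂ t)) q) x
                 ≡ c * evalM e x * eval q x
    ev []              x = sym (ℤP.*-zeroʳ (c * evalM e x))
    ev ((c′ , e′) ∷ q) x =
      trans (cong₂ (λ u v → c * c′ * u + v) (evM e e′ x) (ev q x))
            (alg c c′ (evalM e x) (evalM e′ x) (eval q x))
      where
      alg : ∀ c c′ m m′ r → c * c′ * (m * m′) + c * m * r ≡ c * m * (c′ * m′ + r)
      alg = solve-∀
  go : ∀ {f} p → (∀ x → eval p x ≡ f x) → IsPoly (λ x → f x * g x)
  go []            h = isPoly [] λ x → cong (_* g x) (h x)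
  go {f} ((c , e) ∷ p) h with mono e c | go {eval p} p (λ _ → refl)
  ... | isPoly m mc | isPoly r rc = isPoly (m ++ r) λ x →
    trans (eval-++ m r x) (trans (cong₂ _+_ (mc x) (rc x))
      (trans (sym (ℤP.*-distribʳ-+ (g x) (c * evalM e x) (eval p x))) (cong (_* g x) (h x))))

-- Inversions, adjacent transpositions and ascents.

countLt : ℕ → List ℕ → ℕ
countLt a []      = 0
countLt a (b ∷ l) = (if b <ᵇ a then 1 else 0) ℕ.+ countLt a l

invL : List ℕ → ℕ
invL []      = 0
invL (a ∷ l) = countLt a l ℕ.+ invL l

<ᵇ-true : ∀ {x y} → x ℕ.< y → (x <ᵇ y) ≡ true
<ᵇ-true {x} {y} h with x <ᵇ y | ℕP.<⇒<ᵇ h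
... | true | _ = refl

<ᵇ-false : ∀ {x y} → ¬ (x ℕ.< y) → (x <ᵇ y) ≡ false
<ᵇ-false {x} {y} h with x <ᵇ y in eq
... | false = refl
... | true  = contradiction (ℕP.<ᵇ⇒< x y (subst T (sym eq) tt)) h

countLt-swap : ∀ a l x y r → countLt a (l ++ y ∷ x ∷ r) ≡ countLt a (l ++ x ∷ y ∷ r)
countLt-swap a []      x y r = alg (if y <ᵇ a then 1 else 0) (if x <ᵇ a then 1 else 0) (countLt a r)
  where
  alg : ∀ p q s → p ℕ.+ (q ℕ.+ s) ≡ q ℕ.+ (p ℕ.+ s)
  alg p q s = trans (sym (ℕP.+-assoc p q s)) (trans (cong (ℕ._+ s) (ℕP.+-comm p q)) (ℕP.+-assoc q p s))
countLt-swap a (b ∷ l) x y r = cong (_ ℕ.+_) (countLt-swap a l x y r)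

invL-swap : ∀ l x y r → x ℕ.< y → invL (l ++ y ∷ x ∷ r) ≡ suc (invL (l ++ x ∷ y ∷ r))
invL-swap [] x y r h rewrite <ᵇ-true h | <ᵇ-false (ℕP.<⇒≯ h) =
  cong suc (trans (sym (ℕP.+-assoc (countLt y r) (countLt x r) (invL r)))
    (trans (cong (ℕ._+ invL r) (ℕP.+-comm (countLt y r) (countLt x r)))
           (ℕP.+-assoc (countLt x r) (countLt y r) (invL r))))
invL-swap (b ∷ l) x y r h =
  trans (cong₂ ℕ._+_ (countLt-swap b l x y r) (invL-swap l x y r h)) (ℕP.+-suc _ _)

tab : ∀ {n} → (Fin n → ℕ) → List ℕ
tab = List.tabulate

inv : ∀ {n} → (Fin n → ℕ) → ℕ
inv w = invL (tab w)

inv-cong : ∀ {n} {w w′ : Fin n → ℕ} → w ≗ w′ → inv w ≡ inv w′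
inv-cong h = cong invL (ListP.tabulate-cong h)

countTrue-++ : ∀ p q → countTrue (p ++ q) ≡ countTrue p ℕ.+ countTrue q
countTrue-++ []          q = refl
countTrue-++ (true  ∷ p) q = cong suc (countTrue-++ p q)
countTrue-++ (false ∷ p) q = countTrue-++ p q

-- `len` runs a double loop over all pairs of indices; the recursive count is the one whose change
-- under an adjacent exchange is easy to follow.
len≡inv : ∀ {n} (w : Fin n → ℕ) → len w ≡ inv w
len≡inv {zero}  w = refl
len≡inv {suc n} w = trans (countTrue-++ (row zero) _) (cong₂ ℕ._+_ first rest)
  where
  row : Fin (suc n) → List Bool
  row i = List.map (λ j → (toℕ i <ᵇ toℕ j) ∧ (w j <ᵇ w i)) (allFin (suc n))
  tail-map : ∀ {A : Set} (f : Fin (suc n) → A) → List.map f (List.tabulate suc) ≡ List.map (f ∘ suc) (allFin n)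
  tail-map f = trans (ListP.map-tabulate suc f) (sym (ListP.map-tabulate id (f ∘ suc)))
  count : ∀ {k} (f : Fin k → ℕ) a →
    countTrue (List.map (λ j → f j <ᵇ a) (allFin k)) ≡ countLt a (tab f)
  count {zero}  f a = refl
  count {suc k} f a = trans (cong (λ l → countTrue ((f zero <ᵇ a) ∷ l))
      (trans (ListP.map-tabulate suc (λ j → f j <ᵇ a)) (sym (ListP.map-tabulate id (λ j → f (suc j) <ᵇ a)))))
    (step (f zero <ᵇ a))
    where
    step : ∀ b → countTrue (b ∷ List.map (λ j → f (suc j) <ᵇ a) (allFin k)) ≡
                 (if b then 1 else 0) ℕ.+ countLt a (tab (f ∘ suc))
    step true  = cong suc (count (f ∘ suc) a)
    step false = count (f ∘ suc) a
  first : countTrue (row zero) ≡ countLt (w zero) (tab (w ∘ suc))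
  first = trans (cong countTrue (tail-map (λ j → (0 <ᵇ toℕ j) ∧ (w j <ᵇ w zero)))) (count (w ∘ suc) (w zero))
  countTrue-concatMap : ∀ {A : Set} (f g : A → List Bool) → (∀ x → countTrue (f x) ≡ countTrue (g x)) →
    ∀ xs → countTrue (concatMap f xs) ≡ countTrue (concatMap g xs)
  countTrue-concatMap f g h []       = refl
  countTrue-concatMap f g h (x ∷ xs) =
    trans (countTrue-++ (f x) _) (trans (cong₂ ℕ._+_ (h x) (countTrue-concatMap f g h xs)) (sym (countTrue-++ (g x) _)))
  rest : countTrue (concatMap row (List.tabulate suc)) ≡ inv (w ∘ suc)
  rest = trans (cong (countTrue ∘ List.concat) (tail-map row))
    (trans (countTrue-concatMap (row ∘ suc) _
             (λ i → cong countTrue (tail-map (λ j → (toℕ (suc i) <ᵇ toℕ j) ∧ (w j <ᵇ w (suc i))))) (allFin n))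
           (len≡inv (w ∘ suc)))

-- `swapAt` decides equalities and does not reduce under `suc`; this equation turns the proofs about
-- it into structural inductions.
swapAt-suc : ∀ {m} (i : Fin m) (j : Fin (suc m)) → swapAt (suc i) (suc j) ≡ suc (swapAt i j)
swapAt-suc i j with j Fin.≟ inject₁ i
... | yes _ = refl
... | no  _ with j Fin.≟ suc i
...   | yes _ = refl
...   | no  _ = refl

swapAt-left : ∀ {m} (i : Fin m) → swapAt i (inject₁ i) ≡ suc i
swapAt-left zero    = refl
swapAt-left (suc i) = trans (swapAt-suc i (inject₁ i)) (cong suc (swapAt-left i))

swapAt-right : ∀ {m} (i : Fin m) → swapAt i (suc i) ≡ inject₁ i
swapAt-right zero    = refl
swapAt-right (suc i) = trans (swapAt-suc i (suc i)) (cong suc (swapAt-right i))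

swapAt-involutive : ∀ {m} (i : Fin m) j → swapAt i (swapAt i j) ≡ j
swapAt-involutive zero    zero          = refl
swapAt-involutive zero    (suc zero)    = refl
swapAt-involutive zero    (suc (suc j)) = refl
swapAt-involutive (suc i) zero          = refl
swapAt-involutive (suc i) (suc j)       =
  trans (cong (swapAt (suc i)) (swapAt-suc i j))
    (trans (swapAt-suc i (swapAt i j)) (cong suc (swapAt-involutive i j)))

Asc : ∀ {m} → (Fin (suc m) → ℕ) → Fin m → Set
Asc w i = w (inject₁ i) ℕ.< w (suc i)

asc? : ∀ {m} (w : Fin (suc m) → ℕ) i → Dec (Asc w i)
asc? w i = w (inject₁ i) ℕ.<? w (suc i)

Inj : ∀ {n} {A : Set} → (Fin n → A) → Set
Inj w = ∀ i j → w i ≡ w j → i ≡ j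

Inj-swap : ∀ {m} {A : Set} (i : Fin m) {w : Fin (suc m) → A} → Inj w → Inj (w ∘ swapAt i)
Inj-swap i inj j k eq =
  trans (sym (swapAt-involutive i j)) (trans (cong (swapAt i) (inj _ _ eq)) (swapAt-involutive i k))

inject₁≢suc : ∀ {m} (i : Fin m) → inject₁ i ≢ suc i
inject₁≢suc (suc i) e = inject₁≢suc i (FinP.suc-injective e)

¬asc⇒desc : ∀ {m} {w : Fin (suc m) → ℕ} → Inj w → ∀ i → ¬ Asc w i → w (suc i) ℕ.< w (inject₁ i)
¬asc⇒desc inj i h = ℕP.≤∧≢⇒< (ℕP.≮⇒≥ h) (λ e → inject₁≢suc i (sym (inj _ _ e)))

¬asc⇒asc-swap : ∀ {m} {w : Fin (suc m) → ℕ} → Inj w → ∀ i → ¬ Asc w i → Asc (w ∘ swapAt i) i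
¬asc⇒asc-swap {w = w} inj i h rewrite swapAt-left i | swapAt-right i = ¬asc⇒desc inj i h

tab-swap : ∀ {m} (i : Fin m) {A : Set} (w : Fin (suc m) → A) → ∃ λ l → ∃ λ r →
  List.tabulate w ≡ l ++ w (inject₁ i) ∷ w (suc i) ∷ r ×
  List.tabulate (w ∘ swapAt i) ≡ l ++ w (suc i) ∷ w (inject₁ i) ∷ r
tab-swap zero    w = [] , _ , refl , refl
tab-swap (suc i) w with tab-swap i (w ∘ suc)
... | l , r , e , e′ = w zero ∷ l , r , cong (w zero ∷_) e ,
  cong (w zero ∷_) (trans (ListP.tabulate-cong (λ j → cong w (swapAt-suc i j))) e′)

inv-asc : ∀ {m} (w : Fin (suc m) → ℕ) i → Asc w i → inv (w ∘ swapAt i) ≡ suc (inv w)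
inv-asc w i h with tab-swap i w
... | l , r , e , e′ = trans (cong invL e′) (trans (invL-swap l _ _ r h) (cong (suc ∘ invL) (sym e)))

inv-desc : ∀ {m} {w : Fin (suc m) → ℕ} → Inj w → ∀ i → ¬ Asc w i → inv w ≡ suc (inv (w ∘ swapAt i))
inv-desc {w = w} inj i h =
  trans (inv-cong (λ j → cong w (sym (swapAt-involutive i j))))
        (inv-asc (w ∘ swapAt i) i (¬asc⇒asc-swap inj i h))

-- Distance at least two and adjacency as inductive relations, so that facts about two
-- transpositions go by recursion on the pair of positions.
data Far : ∀ {m} → Fin m → Fin m → Set where
  far-right : ∀ {m} {j : Fin m} → Far zero (suc (suc j))
  far-left  : ∀ {m} {i : Fin m} → Far (suc (suc i)) zero
  far-suc   : ∀ {m} {i j : Fin m} → Far i j → Far (suc i) (suc j)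

data Next : ∀ {m} → Fin m → Fin m → Set where
  next-zero : ∀ {m} → Next {suc (suc m)} zero (suc zero)
  next-suc  : ∀ {m} {i j : Fin m} → Next i j → Next (suc i) (suc j)

data Position {m} (i j : Fin m) : Set where
  same  : i ≡ j → Position i j
  far   : Far i j → Position i j
  below : Next i j → Position i j
  above : Next j i → Position i j

position : ∀ {m} (i j : Fin m) → Position i j
position zero          zero          = same refl
position zero          (suc zero)    = below next-zero
position zero          (suc (suc j)) = far far-right
position (suc zero)    zero          = above next-zero
position (suc (suc i)) zero          = far far-left
position (suc i)       (suc j) with position i j
... | same e  = same (cong suc e)
... | far f   = far (far-suc f)
... | below n = below (next-suc n)
... | above n = above (next-suc n)

far-sym : ∀ {m} {i j : Fin m} → Far i j → Far j i
far-sym far-right   = far-left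
far-sym far-left    = far-right
far-sym (far-suc f) = far-suc (far-sym f)

swapAt-far-left : ∀ {m} {i j : Fin m} → Far i j → swapAt i (inject₁ j) ≡ inject₁ j
swapAt-far-left far-right = refl
swapAt-far-left far-left  = refl
swapAt-far-left (far-suc {i = i} {j} f) = trans (swapAt-suc i (inject₁ j)) (cong suc (swapAt-far-left f))

swapAt-far-right : ∀ {m} {i j : Fin m} → Far i j → swapAt i (suc j) ≡ suc j
swapAt-far-right far-right = refl
swapAt-far-right {i = suc (suc i)} far-left = swapAt-suc (suc i) zero
swapAt-far-right (far-suc {i = i} {j} f) = trans (swapAt-suc i (suc j)) (cong suc (swapAt-far-right f))

swapAt²-suc : ∀ {m} (i i′ : Fin m) j → swapAt (suc i) (swapAt (suc i′) (suc j)) ≡ suc (swapAt i (swapAt i′ j))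
swapAt²-suc i i′ j = trans (cong (swapAt (suc i)) (swapAt-suc i′ j)) (swapAt-suc i (swapAt i′ j))

swapAt-comm : ∀ {m} {i j : Fin m} → Far i j → ∀ k → swapAt i (swapAt j k) ≡ swapAt j (swapAt i k)
swapAt-comm (far-right {j = j}) zero       = refl
swapAt-comm (far-right {j = j}) (suc zero) =
  trans (cong (swapAt zero) (swapAt-suc (suc j) zero)) refl
swapAt-comm (far-right {j = j}) (suc (suc k)) =
  trans (cong (swapAt zero) (trans (swapAt-suc (suc j) (suc k)) (cong suc (swapAt-suc j k))))
        (sym (trans (swapAt-suc (suc j) (suc k)) (cong suc (swapAt-suc j k))))
swapAt-comm (far-left {i = i}) zero       = refl
swapAt-comm (far-left {i = i}) (suc zero) = sym (cong (swapAt zero) (swapAt-suc (suc i) zero))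
swapAt-comm (far-left {i = i}) (suc (suc k)) =
  trans (trans (swapAt-suc (suc i) (suc k)) (cong suc (swapAt-suc i k)))
        (sym (cong (swapAt zero) (trans (swapAt-suc (suc i) (suc k)) (cong suc (swapAt-suc i k)))))
swapAt-comm (far-suc f) zero = refl
swapAt-comm (far-suc {i = i} {j} f) (suc k) =
  trans (swapAt²-suc i j k) (trans (cong suc (swapAt-comm f k)) (sym (swapAt²-suc j i k)))

swapAt-braid : ∀ {m} {i j : Fin m} → Next i j → ∀ k →
  swapAt i (swapAt j (swapAt i k)) ≡ swapAt j (swapAt i (swapAt j k))
swapAt-braid next-zero zero                = refl
swapAt-braid next-zero (suc zero)          = refl
swapAt-braid next-zero (suc (suc zero))    = refl
swapAt-braid next-zero (suc (suc (suc k))) = refl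
swapAt-braid (next-suc n) zero = refl
swapAt-braid (next-suc {i = i} {j} n) (suc k) =
  trans (sw i j k) (trans (cong suc (swapAt-braid n k)) (sym (sw j i k)))
  where
  sw : ∀ i j k → swapAt (suc i) (swapAt (suc j) (swapAt (suc i) (suc k))) ≡ suc (swapAt i (swapAt j (swapAt i k)))
  sw i j k = trans (cong (λ z → swapAt (suc i) (swapAt (suc j) z)) (swapAt-suc i k)) (swapAt²-suc i j (swapAt i k))

next-inject : ∀ {m} {i j : Fin m} → Next i j → inject₁ j ≡ suc i
next-inject next-zero    = refl
next-inject (next-suc n) = cong suc (next-inject n)

swapAt-next-right : ∀ {m} {i j : Fin m} → Next i j → swapAt i (suc j) ≡ suc j
swapAt-next-right next-zero = refl
swapAt-next-right (next-suc {i = i} {j} n) = trans (swapAt-suc i (suc j)) (cong suc (swapAt-next-right n))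

swapAt-next-left : ∀ {m} {i j : Fin m} → Next i j → swapAt j (inject₁ i) ≡ inject₁ i
swapAt-next-left next-zero = refl
swapAt-next-left (next-suc {i = i} {j} n) = trans (swapAt-suc j (inject₁ i)) (cong suc (swapAt-next-left n))

FirstAscent : ∀ {m} → (Fin (suc m) → ℕ) → List (Fin m) → Maybe (Fin m) → Set
FirstAscent w l nothing  = All (λ i → ¬ Asc w i) l
FirstAscent w l (just i) = Asc w i

mutual
  firstAscent-All : ∀ {m} (w : Fin (suc m) → ℕ) → FirstAscent w (allFin m) (firstAscent w)
  firstAscent-All {m} w with allFin m
  -- Abstracting `allFin m` leaves the search applied to a variable, which is what determines the
  -- underscore below.
  ... | l = search-spec m w l

  -- The search inside firstAscent has no name of its own; the underscore is solved by the use above.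
  search-spec : ∀ m (w : Fin (suc m) → ℕ) (l : List (Fin m)) → FirstAscent w l _
  search-spec m w []      = []
  search-spec m w (i ∷ l) with w (inject₁ i) <ᵇ w (suc i) in eq
  ... | true  = ℕP.<ᵇ⇒< _ _ (subst T (sym eq) tt)
  ... | false = extend _ (λ lt → subst T eq (ℕP.<⇒<ᵇ lt)) (search-spec m w l)
    where
    extend : ∀ r → ¬ Asc w i → FirstAscent w l r → FirstAscent w (i ∷ l) r
    extend nothing  ¬a h = ¬a ∷ h
    extend (just _) ¬a h = h

no-first-ascent : ∀ {m} (w : Fin (suc m) → ℕ) → firstAscent w ≡ nothing → ∀ i → ¬ Asc w i
no-first-ascent w eq i = All.lookup (subst (FirstAscent w _) eq (firstAscent-All w)) (∈-allFin i)

first-ascent : ∀ {m} (w : Fin (suc m) → ℕ) {i} → firstAscent w ≡ just i → Asc w i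
first-ascent w eq = subst (FirstAscent w _) eq (firstAscent-All w)

-- Divided differences of monomials.

setPair : ∀ {m} → Fin m → Mono (suc m) → ℕ → ℕ → Mono (suc m)
setPair i e u v = (e [ inject₁ i ]≔ u) [ suc i ]≔ v

-- The factors of a monomial that an exchange at `i` leaves alone.
evalRest : ∀ {m} → Fin m → Mono (suc m) → Pt (suc m) → ℤ
evalRest zero    (p ∷ q ∷ e) x = evalM e (λ j → x (suc (suc j)))
evalRest (suc i) (k ∷ e)     x = x zero ^ k * evalRest i e (x ∘ suc)

evalM-setPair : ∀ {m} (i : Fin m) e u v (x : Pt (suc m)) →
  evalM (setPair i e u v) x ≡ evalRest i e x * (x (inject₁ i) ^ u * x (suc i) ^ v)
evalM-setPair zero (p ∷ q ∷ e) u v x = alg (x zero ^ u) (x (suc zero) ^ v) (evalM e (λ j → x (suc (suc j))))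
  where
  alg : ∀ a b c → a * (b * c) ≡ c * (a * b)
  alg = solve-∀
evalM-setPair (suc i) (k ∷ e) u v x =
  trans (cong (_*_ (x zero ^ k)) (evalM-setPair i e u v (x ∘ suc)))
        (sym (ℤP.*-assoc (x zero ^ k) (evalRest i e (x ∘ suc)) (x (suc (inject₁ i)) ^ u * x (suc (suc i)) ^ v)))

setPair-lookup : ∀ {m} (i : Fin m) e → setPair i e (lookup e (inject₁ i)) (lookup e (suc i)) ≡ e
setPair-lookup zero    (p ∷ q ∷ e) = refl
setPair-lookup (suc i) (k ∷ e)     = cong (k ∷_) (setPair-lookup i e)

evalRest-swap : ∀ {m} (i : Fin m) e (x : Pt (suc m)) → evalRest i e (x ∘ swapAt i) ≡ evalRest i e x
evalRest-swap zero    (p ∷ q ∷ e) x = refl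
evalRest-swap (suc i) (k ∷ e)     x = cong (_*_ (x zero ^ k))
  (trans (evalRest-cong i e (λ j → cong x (swapAt-suc i j))) (evalRest-swap i e (x ∘ suc)))
  where
  evalRest-cong : ∀ {m} (i : Fin m) e {x y : Pt (suc m)} → x ≗ y → evalRest i e x ≡ evalRest i e y
  evalRest-cong zero    (p ∷ q ∷ e) h = evalM-cong e (λ j → h (suc (suc j)))
  evalRest-cong (suc i) (k ∷ e)     h = cong₂ _*_ (cong (_^ k) (h zero)) (evalRest-cong i e (h ∘ suc))

-- A telescoping sum: the first term is split off and `s` raised by one. The summands enter only
-- through their values, so one statement serves both halves of `ddMono`, with `C` carrying the sign
-- and the untouched factors.
geometric : ∀ {n} d r s (α β C : ℤ) (h : ℕ → ℤ × Mono n) (x : Pt n) →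
  (∀ k → proj₁ (h k) * evalM (proj₂ (h k)) x ≡ C * (α ^ (r ℕ.+ d ∸ 1 ∸ k) * β ^ (s ℕ.+ k))) →
  (α - β) * eval (List.applyUpTo h d) x ≡ C * (α ^ (r ℕ.+ d) * β ^ s - α ^ r * β ^ (s ℕ.+ d))
geometric zero r s α β C h x hyp =
  trans (ℤP.*-zeroʳ (α - β)) (sym (trans (cong (_*_ C) (trans
    (cong₂ (λ u v → α ^ u * β ^ s - α ^ r * β ^ v) (ℕP.+-identityʳ r) (ℕP.+-identityʳ s))
    (ℤP.i≡j⇒i-j≡0 {α ^ r * β ^ s} refl))) (ℤP.*-zeroʳ C)))
geometric (suc d) r s α β C h x hyp = begin
  (α - β) * (proj₁ (h 0) * evalM (proj₂ (h 0)) x + eval (List.applyUpTo (h ∘ suc) d) x)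
    ≡⟨ cong (λ z → (α - β) * (z + eval (List.applyUpTo (h ∘ suc) d) x))
         (trans (hyp 0) (cong₂ (λ u v → C * (α ^ u * β ^ v)) e1 (ℕP.+-identityʳ s))) ⟩
  (α - β) * (C * (α ^ (r ℕ.+ d) * β ^ s) + eval (List.applyUpTo (h ∘ suc) d) x)
    ≡⟨ alg₁ α β (C * (α ^ (r ℕ.+ d) * β ^ s)) (eval (List.applyUpTo (h ∘ suc) d) x) ⟩
  (α - β) * (C * (α ^ (r ℕ.+ d) * β ^ s)) + (α - β) * eval (List.applyUpTo (h ∘ suc) d) x
    ≡⟨ cong (_+_ ((α - β) * (C * (α ^ (r ℕ.+ d) * β ^ s))))
         (geometric d r (suc s) α β C (h ∘ suc) x λ k → trans (hyp (suc k))
           (cong₂ (λ u v → C * (α ^ u * β ^ v))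
             (trans (cong (λ z → z ∸ 1 ∸ suc k) (ℕP.+-suc r d)) (sym (ℕP.∸-+-assoc (r ℕ.+ d) 1 k)))
             (ℕP.+-suc s k))) ⟩
  (α - β) * (C * (α ^ (r ℕ.+ d) * β ^ s)) + C * (α ^ (r ℕ.+ d) * (β * β ^ s) - α ^ r * β ^ suc (s ℕ.+ d))
    ≡⟨ alg₂ α β C (α ^ (r ℕ.+ d)) (β ^ s) (α ^ r * β ^ suc (s ℕ.+ d)) ⟩
  C * (α * α ^ (r ℕ.+ d) * β ^ s - α ^ r * β ^ suc (s ℕ.+ d))
    ≡⟨ cong₂ (λ u v → C * (α ^ u * β ^ s - α ^ r * β ^ v)) (sym (ℕP.+-suc r d)) (sym (ℕP.+-suc s d)) ⟩
  C * (α ^ (r ℕ.+ suc d) * β ^ s - α ^ r * β ^ (s ℕ.+ suc d)) ∎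
  where
  open ≡-Reasoning
  e1 : r ℕ.+ suc d ∸ 1 ∸ 0 ≡ r ℕ.+ d
  e1 = cong (_∸ 1) (ℕP.+-suc r d)
  alg₁ : ∀ a b c d → (a - b) * (c + d) ≡ (a - b) * c + (a - b) * d
  alg₁ = solve-∀
  alg₂ : ∀ a b C p q w → (a - b) * (C * (p * q)) + C * (p * (b * q) - w) ≡ C * (a * p * q - w)
  alg₂ = solve-∀

ddMono-eval : ∀ {m} (i : Fin m) c e (x : Pt (suc m)) →
  (x (inject₁ i) - x (suc i)) * eval (ddMono i (c , e)) x ≡ c * evalM e x - c * evalM e (x ∘ swapAt i)
ddMono-eval i c e x = begin
  (α - β) * eval (ddMono i (c , e)) x
    ≡⟨ cong (_*_ (α - β)) (trans (eval-++ (List.map h₁ (upTo (p ∸ q))) _ x)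
         (cong₂ (λ u v → eval u x + eval v x) (ListP.map-applyUpTo id h₁ (p ∸ q)) (ListP.map-applyUpTo id h₂ (q ∸ p)))) ⟩
  (α - β) * (eval (List.applyUpTo h₁ (p ∸ q)) x + eval (List.applyUpTo h₂ (q ∸ p)) x)
    ≡⟨ ℤP.*-distribˡ-+ (α - β) (eval (List.applyUpTo h₁ (p ∸ q)) x) (eval (List.applyUpTo h₂ (q ∸ p)) x) ⟩
  (α - β) * eval (List.applyUpTo h₁ (p ∸ q)) x + (α - β) * eval (List.applyUpTo h₂ (q ∸ p)) x
    ≡⟨ cases (ℕP.≤-total q p) ⟩
  c * (R * (α ^ p * β ^ q)) - c * (R * (α ^ q * β ^ p))
    ≡⟨ cong₂ (λ u v → c * u - c * v) (sym plain) (sym swapped) ⟩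
  c * evalM e x - c * evalM e (x ∘ swapAt i) ∎
  where
  open ≡-Reasoning
  α β R : ℤ
  α = x (inject₁ i)
  β = x (suc i)
  R = evalRest i e x
  p q : ℕ
  p = lookup e (inject₁ i)
  q = lookup e (suc i)
  h₁ h₂ : ℕ → ℤ × Mono _
  h₁ k = c , setPair i e (p ∸ 1 ∸ k) (q ℕ.+ k)
  h₂ k = - c , setPair i e (q ∸ 1 ∸ k) (p ℕ.+ k)
  plain : evalM e x ≡ R * (α ^ p * β ^ q)
  plain = trans (cong (λ e → evalM e x) (sym (setPair-lookup i e))) (evalM-setPair i e p q x)
  swapped : evalM e (x ∘ swapAt i) ≡ R * (α ^ q * β ^ p)
  swapped = trans (cong (λ e → evalM e (x ∘ swapAt i)) (sym (setPair-lookup i e)))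
    (trans (evalM-setPair i e p q (x ∘ swapAt i))
      (trans (cong₂ (λ u v → evalRest i e (x ∘ swapAt i) * (u ^ p * v ^ q))
               (cong x (swapAt-left i)) (cong x (swapAt-right i)))
        (cong₂ _*_ (evalRest-swap i e x) (ℤP.*-comm (β ^ p) (α ^ q)))))
  part : ∀ c p q → q ℕ.≤ p →
    (α - β) * eval (List.applyUpTo (λ k → c , setPair i e (p ∸ 1 ∸ k) (q ℕ.+ k)) (p ∸ q)) x
      ≡ c * R * (α ^ p * β ^ q - α ^ q * β ^ p)
  part c p q le = trans
    (geometric (p ∸ q) q q α β (c * R) (λ k → c , setPair i e (p ∸ 1 ∸ k) (q ℕ.+ k)) x λ k →
      trans (cong (_*_ c) (evalM-setPair i e (p ∸ 1 ∸ k) (q ℕ.+ k) x))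
        (trans (sym (ℤP.*-assoc c R (α ^ (p ∸ 1 ∸ k) * β ^ (q ℕ.+ k))))
          (cong (λ z → c * R * (α ^ (z ∸ 1 ∸ k) * β ^ (q ℕ.+ k))) (sym (ℕP.m+[n∸m]≡n le)))))
    (cong (λ z → c * R * (α ^ z * β ^ q - α ^ q * β ^ z)) (ℕP.m+[n∸m]≡n le))
  nil : ∀ c p q → q ℕ.≤ p →
    (α - β) * eval (List.applyUpTo (λ k → c , setPair i e (q ∸ 1 ∸ k) (p ℕ.+ k)) (q ∸ p)) x ≡ 0ℤ
  nil c p q le = trans (cong (λ d → (α - β) * eval (List.applyUpTo (λ k → c , setPair i e (q ∸ 1 ∸ k) (p ℕ.+ k)) d) x)
                         (ℕP.m≤n⇒m∸n≡0 le)) (ℤP.*-zeroʳ (α - β))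
  -- One of the two sums is empty, according to which exponent is larger.
  cases : (q ℕ.≤ p) ⊎ (p ℕ.≤ q) →
    (α - β) * eval (List.applyUpTo h₁ (p ∸ q)) x + (α - β) * eval (List.applyUpTo h₂ (q ∸ p)) x
      ≡ c * (R * (α ^ p * β ^ q)) - c * (R * (α ^ q * β ^ p))
  cases (inj₁ le) = trans (cong₂ _+_ (part c p q le) (nil (- c) p q le)) (alg c R (α ^ p * β ^ q) (α ^ q * β ^ p))
    where
    alg : ∀ c R u v → c * R * (u - v) + 0ℤ ≡ c * (R * u) - c * (R * v)
    alg = solve-∀
  cases (inj₂ le) = trans (cong₂ _+_ (nil c q p le) (part (- c) q p le)) (alg c R (α ^ p * β ^ q) (α ^ q * β ^ p))
    where
    alg : ∀ c R u v → 0ℤ + - c * R * (v - u) ≡ c * (R * u) - c * (R * v)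
    alg = solve-∀

divDiff-eval : ∀ {m} (i : Fin m) p (x : Pt (suc m)) →
  (x (inject₁ i) - x (suc i)) * eval (divDiff i p) x ≡ eval p x - eval p (x ∘ swapAt i)
divDiff-eval i []            x = ℤP.*-zeroʳ (x (inject₁ i) - x (suc i))
divDiff-eval i ((c , e) ∷ p) x = begin
  Δ * eval (ddMono i (c , e) ++ divDiff i p) x
    ≡⟨ cong (_*_ Δ) (eval-++ (ddMono i (c , e)) (divDiff i p) x) ⟩
  Δ * (eval (ddMono i (c , e)) x + eval (divDiff i p) x)
    ≡⟨ ℤP.*-distribˡ-+ Δ (eval (ddMono i (c , e)) x) (eval (divDiff i p) x) ⟩
  Δ * eval (ddMono i (c , e)) x + Δ * eval (divDiff i p) x
    ≡⟨ cong₂ _+_ (ddMono-eval i c e x) (divDiff-eval i p x) ⟩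
  (c * evalM e x - c * evalM e sx) + (eval p x - eval p sx)
    ≡⟨ alg (c * evalM e x) (c * evalM e sx) (eval p x) (eval p sx) ⟩
  (c * evalM e x + eval p x) - (c * evalM e sx + eval p sx) ∎
  where
  open ≡-Reasoning
  Δ : ℤ
  Δ = x (inject₁ i) - x (suc i)
  sx : Pt _
  sx = x ∘ swapAt i
  alg : ∀ a b c d → (a - b) + (c - d) ≡ (a + c) - (b + d)
  alg = solve-∀

divDiff-All : ∀ {m} {P Q : ℤ × Mono (suc m) → Set} (i : Fin m) →
  (∀ t → P t → All Q (ddMono i t)) → ∀ {p} → All P p → All Q (divDiff i p)
divDiff-All i h []       = []
divDiff-All i h (a ∷ as) = AllP.++⁺ (h _ a) (divDiff-All i h as)

-- The degree equation makes iterated divided differences terminate and controls constant terms; the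
-- two strict bounds keep the exponents inside the staircase.
record DDTerm {m} (i : Fin m) (e e′ : Mono (suc m)) : Set where
  field
    u v     : ℕ
    shape   : e′ ≡ setPair i e u v
    degree  : suc (u ℕ.+ v) ≡ lookup e (inject₁ i) ℕ.+ lookup e (suc i)
    u-small : u ℕ.< lookup e (inject₁ i) ⊔ lookup e (suc i)
    v-small : v ℕ.< lookup e (inject₁ i) ⊔ lookup e (suc i)

ddMono-terms : ∀ {m} (i : Fin m) c e → All (DDTerm i e ∘ proj₂) (ddMono i (c , e))
ddMono-terms i c e = AllP.++⁺
  (AllP.map⁺ (AllP.applyUpTo⁺₁ id (p ∸ q) λ {k} lt → record
    { u = p ∸ 1 ∸ k ; v = q ℕ.+ k ; shape = refl ; degree = deg p q k lt
    ; u-small = ℕP.≤-trans (usm p q k lt) (ℕP.m≤m⊔n p q) ; v-small = ℕP.≤-trans (vsm p q k lt) (ℕP.m≤m⊔n p q) }))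
  (AllP.map⁺ (AllP.applyUpTo⁺₁ id (q ∸ p) λ {k} lt → record
    { u = q ∸ 1 ∸ k ; v = p ℕ.+ k ; shape = refl ; degree = trans (deg q p k lt) (ℕP.+-comm q p)
    ; u-small = ℕP.≤-trans (usm q p k lt) (ℕP.m≤n⊔m p q) ; v-small = ℕP.≤-trans (vsm q p k lt) (ℕP.m≤n⊔m p q) }))
  where
  p q : ℕ
  p = lookup e (inject₁ i)
  q = lookup e (suc i)
  vsm : ∀ p q k → k ℕ.< p ∸ q → suc (q ℕ.+ k) ℕ.≤ p
  vsm p q k lt = subst (ℕ._≤ p) (ℕP.+-suc q k)
    (ℕP.≤-trans (ℕP.+-monoʳ-≤ q lt) (ℕP.≤-reflexive (ℕP.m+[n∸m]≡n {q} {p} (ℕP.<⇒≤ (ℕP.m∸n≢0⇒n<m {p} {q} λ z → case subst (k ℕ.<_) z lt of λ ())))))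
  usm : ∀ p q k → k ℕ.< p ∸ q → suc (p ∸ 1 ∸ k) ℕ.≤ p
  usm zero    q k lt = contradiction lt (subst (λ z → ¬ (k ℕ.< z)) (sym (ℕP.0∸n≡0 q)) λ ())
  usm (suc p) q k lt = s≤s (ℕP.m∸n≤m p k)
  deg : ∀ p q k → k ℕ.< p ∸ q → suc (p ∸ 1 ∸ k ℕ.+ (q ℕ.+ k)) ≡ p ℕ.+ q
  deg zero    q k lt = contradiction lt (subst (λ z → ¬ (k ℕ.< z)) (sym (ℕP.0∸n≡0 q)) λ ())
  deg (suc p) q k lt = cong suc (begin
    p ∸ k ℕ.+ (q ℕ.+ k)  ≡⟨ cong (p ∸ k ℕ.+_) (ℕP.+-comm q k) ⟩
    p ∸ k ℕ.+ (k ℕ.+ q)  ≡⟨ sym (ℕP.+-assoc (p ∸ k) k q) ⟩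
    p ∸ k ℕ.+ k ℕ.+ q    ≡⟨ cong (ℕ._+ q) (ℕP.m∸n+n≡m (ℕP.≤-trans (ℕP.m≤n+m k q) (ℕP.≤-pred (vsm (suc p) q k lt)))) ⟩
    p ℕ.+ q              ∎)
    where open ≡-Reasoning

-- Degree and the staircase.

deg : ∀ {n} → Mono n → ℕ
deg = Vec.sum

deg-setPair : ∀ {m} (i : Fin m) e u v →
  deg (setPair i e u v) ℕ.+ (lookup e (inject₁ i) ℕ.+ lookup e (suc i)) ≡ deg e ℕ.+ (u ℕ.+ v)
deg-setPair zero (p ∷ q ∷ e) u v = ℕ-alg u v (deg e) p q
  where
  open import Data.Nat.Tactic.RingSolver using () renaming (solve-∀ to solveℕ)
  ℕ-alg : ∀ u v d p q → u ℕ.+ (v ℕ.+ d) ℕ.+ (p ℕ.+ q) ≡ p ℕ.+ (q ℕ.+ d) ℕ.+ (u ℕ.+ v)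
  ℕ-alg = solveℕ
deg-setPair (suc i) (k ∷ e) u v =
  trans (ℕP.+-assoc k _ _) (trans (cong (k ℕ.+_) (deg-setPair i e u v)) (sym (ℕP.+-assoc k _ _)))

deg-DDTerm : ∀ {m} {i : Fin m} {e e′} → DDTerm i e e′ → suc (deg e′) ≡ deg e
deg-DDTerm {i = i} {e} {e′} t = ℕP.+-cancelʳ-≡ (u ℕ.+ v) _ _ (begin
  suc (deg e′) ℕ.+ (u ℕ.+ v)         ≡⟨ sym (ℕP.+-suc (deg e′) (u ℕ.+ v)) ⟩
  deg e′ ℕ.+ suc (u ℕ.+ v)            ≡⟨ cong₂ (λ a b → deg a ℕ.+ b) shape degree ⟩
  deg (setPair i e u v) ℕ.+ (lookup e (inject₁ i) ℕ.+ lookup e (suc i)) ≡⟨ deg-setPair i e u v ⟩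
  deg e ℕ.+ (u ℕ.+ v)                ∎)
  where
  open ≡-Reasoning
  open DDTerm t

Stair : ∀ {n} → Mono n → Set
Stair []            = ⊤
Stair {suc n} (k ∷ e) = k ℕ.≤ n × Stair e

-- Multiplication by 1 - x_{i+1} leaves the staircase only at i+1, and N_i leads back into it.
StairUpTo : ∀ {m} → Fin m → Mono (suc m) → Set
StairUpTo {suc m} zero    (p ∷ q ∷ e) = p ℕ.≤ suc m × q ℕ.≤ suc m × Stair e
StairUpTo {suc m} (suc i) (k ∷ e)     = k ℕ.≤ suc m × StairUpTo i e

stair-relax : ∀ {m} (i : Fin m) e → Stair e → StairUpTo i e
stair-relax zero    (p ∷ q ∷ e) (a , b , c) = a , ℕP.m≤n⇒m≤1+n b , c
stair-relax (suc i) (k ∷ e)     (a , b)     = a , stair-relax i e b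

stair-incr : ∀ {m} (i : Fin m) e → Stair e → StairUpTo i (e [ suc i ]≔ suc (lookup e (suc i)))
stair-incr zero    (p ∷ q ∷ e) (a , b , c) = a , s≤s b , c
stair-incr (suc i) (k ∷ e)     (a , b)     = a , stair-incr i e b

-- Both old exponents are at most the bound of the left position, which is one more than that of the
-- right position; the strict inequalities make up for that one.
stair-setPair : ∀ {m} (i : Fin m) e u v → StairUpTo i e →
  u ℕ.< lookup e (inject₁ i) ⊔ lookup e (suc i) → v ℕ.< lookup e (inject₁ i) ⊔ lookup e (suc i) →
  Stair (setPair i e u v)
stair-setPair zero (p ∷ q ∷ e) u v (a , b , c) hu hv =
  ℕP.<⇒≤ (ℕP.<-≤-trans hu (ℕP.⊔-lub a b)) , ℕP.≤-pred (ℕP.<-≤-trans hv (ℕP.⊔-lub a b)) , c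
stair-setPair (suc i) (k ∷ e) u v (a , b) hu hv = a , stair-setPair i e u v b hu hv

divDiff-stair : ∀ {m} (i : Fin m) {p} → All (StairUpTo i ∘ proj₂) p → All (Stair ∘ proj₂) (divDiff i p)
divDiff-stair i = divDiff-All i λ { (c , e) s → All.map
  (λ t → let open DDTerm t in subst Stair (sym shape) (stair-setPair i e u v s u-small v-small))
  (ddMono-terms i c e) }

-- Inside the staircase the last exponent is 0, so the last coordinate is never read.
stair-eval : ∀ {m} {p : Poly (suc m)} → All (Stair ∘ proj₂) p → ∀ {x y : Pt (suc m)} →
  (∀ j → x (inject₁ j) ≡ y (inject₁ j)) → eval p x ≡ eval p y
stair-eval []                     h = refl
stair-eval {p = (c , e) ∷ p} (s ∷ ss) h = cong₂ _+_ (cong (_*_ c) (mono e s h)) (stair-eval ss h)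
  where
  mono : ∀ {m} (e : Mono (suc m)) → Stair e → ∀ {x y : Pt (suc m)} →
    (∀ j → x (inject₁ j) ≡ y (inject₁ j)) → evalM e x ≡ evalM e y
  mono {zero}  (zero ∷ []) s       h = refl
  mono {suc m} (k ∷ e)     (_ , s) h = cong₂ _*_ (cong (_^ k) (h zero)) (mono e s (h ∘ suc))

staircase-stair : ∀ {m} → Stair (staircase {m})
staircase-stair {zero}  = z≤n , tt
staircase-stair {suc m} = ℕP.≤-refl , staircase-stair {m}

inv≤staircase : ∀ {m} (w : Fin (suc m) → ℕ) → inv w ℕ.≤ deg (staircase {m})
inv≤staircase {zero}  w = z≤n
inv≤staircase {suc m} w =
  ℕP.+-mono-≤ (count (w zero) (w ∘ suc)) (inv≤staircase (w ∘ suc))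
  where
  count : ∀ {k} a (f : Fin k → ℕ) → countLt a (tab f) ℕ.≤ k
  count {zero}  a f = z≤n
  count {suc k} a f with f zero <ᵇ a
  ... | true  = s≤s (count a (f ∘ suc))
  ... | false = ℕP.m≤n⇒m≤1+n (count a (f ∘ suc))

-- Hence the fuel n·n of the definitions suffices: a chain of ascending exchanges is no longer than
-- the number of boxes of the staircase.
deg-staircase : ∀ {m} → deg (staircase {m}) ℕ.≤ suc m ℕ.* suc m
deg-staircase {zero}  = z≤n
deg-staircase {suc m} = ℕP.≤-trans (ℕP.+-monoʳ-≤ (suc m) (deg-staircase {m}))
  (ℕP.≤-trans (ℕP.+-mono-≤ (ℕP.n≤1+n (suc m)) (ℕP.*-monoʳ-≤ (suc m) (ℕP.n≤1+n (suc m)))) ℕP.≤-refl)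

-- The Schubert and Grothendieck operators, their commutation and braid relations.

φ : ℤ → ℤ → ℤ
φ t ξ = 1ℤ - t * ξ

-- t = 0 gives the Schubert operator and t = 1 the Grothendieck operator.
record DivOp (t : ℤ) : Set where
  field
    op       : ∀ {m} → Fin m → Poly (suc m) → Poly (suc m)
    op-eval  : ∀ {m} (i : Fin m) p x → (x (inject₁ i) - x (suc i)) * eval (op i p) x ≡
               φ t (x (suc i)) * eval p x - φ t (x (inject₁ i)) * eval p (x ∘ swapAt i)
    op-stair : ∀ {m} (i : Fin m) {p} → All (Stair ∘ proj₂) p → All (Stair ∘ proj₂) (op i p)
    -- A lower bound on degrees: multiplication by 1 - t x only adds terms of higher degree.
    op-deg   : ∀ {m} (i : Fin m) {p} d → All ((d ℕ.≤_) ∘ deg ∘ proj₂) p → All ((d ℕ.≤_) ∘ suc ∘ deg ∘ proj₂) (op i p)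

divDiff-deg : ∀ {m} (i : Fin m) {p} d → All ((d ℕ.≤_) ∘ deg ∘ proj₂) p → All ((d ℕ.≤_) ∘ suc ∘ deg ∘ proj₂) (divDiff i p)
divDiff-deg i d = divDiff-All i λ { (c , e) le → All.map
  (λ t → ℕP.≤-trans le (ℕP.≤-reflexive (sym (deg-DDTerm t)))) (ddMono-terms i c e) }

schubertOp : DivOp 0ℤ
schubertOp = record
  { op       = divDiff
  ; op-eval  = λ i p x → trans (divDiff-eval i p x)
                 (alg (eval p x) (eval p (x ∘ swapAt i)) (x (suc i)) (x (inject₁ i)))
  ; op-stair = λ i {p} s → divDiff-stair i (All.map (λ {t} → stair-relax i (proj₂ t)) s)
  ; op-deg   = divDiff-deg }
  where
  alg : ∀ a b u v → a - b ≡ (1ℤ - 0ℤ * u) * a - (1ℤ - 0ℤ * v) * b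
  alg = solve-∀

deg-incr : ∀ {n} (j : Fin n) (e : Mono n) → deg (e [ j ]≔ suc (lookup e j)) ≡ suc (deg e)
deg-incr zero    (k ∷ e) = refl
deg-incr (suc j) (k ∷ e) = trans (cong (k ℕ.+_) (deg-incr j e)) (ℕP.+-suc k (deg e))

grothendieckOp : DivOp 1ℤ
grothendieckOp = record
  { op       = λ i p → divDiff i (oneMinusX (suc i) p)
  ; op-eval  = λ i p x → trans (divDiff-eval i (oneMinusX (suc i) p) x)
      (trans (cong₂ _-_ (eval-oneMinusX (suc i) p x)
               (trans (eval-oneMinusX (suc i) p (x ∘ swapAt i)) (cong (λ z → (1ℤ - x z) * eval p (x ∘ swapAt i)) (swapAt-right i))))
             (alg (eval p x) (eval p (x ∘ swapAt i)) (x (suc i)) (x (inject₁ i))))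
  ; op-stair = λ i {p} s → divDiff-stair i (AllP.++⁺ (All.map (λ {t} → stair-relax i (proj₂ t)) s)
      (AllP.map⁺ (AllP.map⁺ (All.map (λ {t} → stair-incr i (proj₂ t)) s))))
  ; op-deg   = λ i {p} d h → divDiff-deg i d (AllP.++⁺ h
      (AllP.map⁺ (AllP.map⁺ (All.map (λ {t} le → ℕP.≤-trans (ℕP.m≤n⇒m≤1+n le)
        (ℕP.≤-reflexive (sym (deg-incr (suc i) (proj₂ t))))) h)))) }
  where
  alg : ∀ a b u v → (1ℤ - u) * a - (1ℤ - v) * b ≡ (1ℤ - 1ℤ * u) * a - (1ℤ - 1ℤ * v) * b
  alg = solve-∀

mutual
  firstAscent-cong : ∀ {m} {w w′ : Fin (suc m) → ℕ} → w ≗ w′ → firstAscent w ≡ firstAscent w′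
  firstAscent-cong {m} {w} {w′} h with allFin m
  ... | l = search-cong m w w′ h l

  -- The underscores are the anonymous search again, determined by the call above.
  search-cong : ∀ m (w w′ : Fin (suc m) → ℕ) → w ≗ w′ → ∀ (l : List (Fin m)) → _ ≡ _
  search-cong m w w′ h []      = refl
  search-cong m w w′ h (i ∷ l) rewrite h (inject₁ i) | h (suc i) with w′ (inject₁ i) <ᵇ w′ (suc i)
  ... | true  = refl
  ... | false = search-cong m w w′ h l

Good-swap : ∀ {m} (i : Fin m) {x : Pt (suc m)} → Good x → Good (x ∘ swapAt i)
Good-swap i (d , n) =
  (λ j k ne → d _ _ (λ e → ne (trans (sym (swapAt-involutive i j)) (trans (cong (swapAt i) e) (swapAt-involutive i k))))) ,
  (λ j → n _)

Good-diff : ∀ {n} {x : Pt n} → Good x → ∀ {j k} → j ≢ k → x j - x k ≢ 0ℤ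
Good-diff (d , _) ne e = d _ _ ne (ℤP.i-j≡0⇒i≡j _ _ e)

cancel : ∀ z {u v} → z ≢ 0ℤ → z * u ≡ z * v → u ≡ v
cancel z {u} {v} nz = ℤP.*-cancelˡ-≡ z u v ⦃ ℤ.≢-nonZero nz ⦄

-- `f` is the operator at `i` applied to `g`, as values at good points: two routes to one polynomial
-- produce different lists of terms, so an equation between lists would be too strong.
record Related {m} (t : ℤ) (i : Fin m) (f g : Poly (suc m)) : Set where
  constructor related
  field
    at : ∀ x → Good x → (x (inject₁ i) - x (suc i)) * eval f x ≡
      φ t (x (suc i)) * eval g x - φ t (x (inject₁ i)) * eval g (x ∘ swapAt i)

related-at : ∀ {m t} {i : Fin m} {f g} → Related t i f g → ∀ {y} → Good y →
  ∀ {a b} → y (inject₁ i) ≡ a → y (suc i) ≡ b →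
  (a - b) * eval f y ≡ φ t b * eval g y - φ t a * eval g (y ∘ swapAt i)
related-at r gy refl refl = Related.at r _ gy

-- With denominators cleared, both orders of the two operators give the same combination of the four
-- values of `h` under the two commuting exchanges.
related-far : ∀ {m t} {i j : Fin m} → Far i j → ∀ {f g₁ g₂ h} →
  Related t j f g₁ → Related t i g₁ h → Related t j g₂ h → Related t i f g₂
related-far {t = t} {i} {j} ij {f} {g₁} {g₂} {h} r₁ r₂ r₃ = related λ x gx →
  cancel (x (inject₁ j) - x (suc j)) (Good-diff gx (inject₁≢suc j))
    (alg (x (inject₁ i)) (x (suc i)) (x (inject₁ j)) (x (suc j))
         (φ t (x (inject₁ i))) (φ t (x (suc i))) (φ t (x (inject₁ j))) (φ t (x (suc j)))
         (eval f x) (eval g₁ x) (eval g₁ (x ∘ swapAt j)) (eval g₂ x) (eval g₂ (x ∘ swapAt i))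
         (eval h x) (eval h (x ∘ swapAt i)) (eval h (x ∘ swapAt j)) (eval h (x ∘ swapAt j ∘ swapAt i))
      (Related.at r₁ x gx) (Related.at r₂ x gx)
      (related-at r₂ (Good-swap j gx) (cong x (swapAt-far-left ji)) (cong x (swapAt-far-right ji)))
      (Related.at r₃ x gx)
      (trans (related-at r₃ (Good-swap i gx) (cong x (swapAt-far-left ij)) (cong x (swapAt-far-right ij)))
        (cong (λ z → φ t (x (suc j)) * eval h (x ∘ swapAt i) - φ t (x (inject₁ j)) * z)
          (eval-cong h (λ k → cong x (swapAt-comm ij k))))))
  where
  ji = far-sym ij
  alg : ∀ a b c d A B C D f g gj g₂ g₂i k ki kj kji →
    (c - d) * f ≡ D * g - C * gj → (a - b) * g ≡ B * k - A * ki → (a - b) * gj ≡ B * kj - A * kji →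
    (c - d) * g₂ ≡ D * k - C * kj → (c - d) * g₂i ≡ D * ki - C * kji →
    (c - d) * ((a - b) * f) ≡ (c - d) * (B * g₂ - A * g₂i)
  alg a b c d A B C D f g gj g₂ g₂i k ki kj kji e₁ e₂ e₃ e₄ e₅ = begin
    (c - d) * ((a - b) * f)                           ≡⟨ s₁ (c - d) (a - b) f ⟩
    (a - b) * ((c - d) * f)                           ≡⟨ cong (_*_ (a - b)) e₁ ⟩
    (a - b) * (D * g - C * gj)                        ≡⟨ s₂ (a - b) D C g gj ⟩
    D * ((a - b) * g) - C * ((a - b) * gj)            ≡⟨ cong₂ (λ u v → D * u - C * v) e₂ e₃ ⟩
    D * (B * k - A * ki) - C * (B * kj - A * kji)     ≡⟨ s₃ A B C D k ki kj kji ⟩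
    B * (D * k - C * kj) - A * (D * ki - C * kji)     ≡⟨ cong₂ (λ u v → B * u - A * v) (sym e₄) (sym e₅) ⟩
    B * ((c - d) * g₂) - A * ((c - d) * g₂i)          ≡⟨ sym (s₂ (c - d) B A g₂ g₂i) ⟩
    (c - d) * (B * g₂ - A * g₂i)                      ∎
    where
    open ≡-Reasoning
    s₁ : ∀ u v w → u * (v * w) ≡ v * (u * w)
    s₁ = solve-∀
    s₂ : ∀ u D C g gj → u * (D * g - C * gj) ≡ D * (u * g) - C * (u * gj)
    s₂ = solve-∀
    s₃ : ∀ A B C D k ki kj kji → D * (B * k - A * ki) - C * (B * kj - A * kji) ≡ B * (D * k - C * kj) - A * (D * ki - C * kji)
    s₃ = solve-∀

-- The common numerator of both sides of the braid relation, over (α-β)(α-γ)(β-γ).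
braidSum : (A B C k kp kq kpq kqp kpqp : ℤ) → ℤ
braidSum A B C k kp kq kpq kqp kpqp =
  B * C * (C * k - B * kq) - A * C * (C * kp - A * kpq) + A * B * (B * kqp - A * kpqp)

module Braid {m} {p q : Fin m} (pq : Next p q) (t : ℤ) where

  record Coords (y : Pt (suc m)) (a b c : ℤ) : Set where
    constructor coords
    field
      first  : y (inject₁ p) ≡ a
      second : y (suc p) ≡ b
      third  : y (suc q) ≡ c

  coords-p : ∀ {y a b c} → Coords y a b c → Coords (y ∘ swapAt p) b a c
  coords-p {y} (coords ea eb ec) = coords
    (trans (cong y (swapAt-left p)) eb) (trans (cong y (swapAt-right p)) ea) (trans (cong y (swapAt-next-right pq)) ec)

  coords-q : ∀ {y a b c} → Coords y a b c → Coords (y ∘ swapAt q) a c b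
  coords-q {y} (coords ea eb ec) = coords
    (trans (cong y (swapAt-next-left pq)) ea)
    (trans (cong y (trans (cong (swapAt q) (sym (next-inject pq))) (swapAt-left q))) ec)
    (trans (cong y (trans (swapAt-right q) (next-inject pq))) eb)

  at-p : ∀ {f g} → Related t p f g → ∀ {y a b c} → Good y → Coords y a b c →
    (a - b) * eval f y ≡ φ t b * eval g y - φ t a * eval g (y ∘ swapAt p)
  at-p r gy (coords ea eb _) = related-at r gy ea eb

  at-q : ∀ {f g} → Related t q f g → ∀ {y a b c} → Good y → Coords y a b c →
    (b - c) * eval f y ≡ φ t c * eval g y - φ t b * eval g (y ∘ swapAt q)
  at-q r {y} gy (coords _ eb ec) = related-at r gy (trans (cong y (next-inject pq)) eb) ec

  module _ (k : Poly (suc m)) (x : Pt (suc m)) (gx : Good x) where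
    α β γ A B C Φ : ℤ
    α = x (inject₁ p)
    β = x (suc p)
    γ = x (suc q)
    A = φ t α
    B = φ t β
    C = φ t γ
    Φ = braidSum A B C (eval k x) (eval k (x ∘ swapAt p)) (eval k (x ∘ swapAt q))
          (eval k (x ∘ swapAt p ∘ swapAt q)) (eval k (x ∘ swapAt q ∘ swapAt p)) (eval k (x ∘ swapAt p ∘ swapAt q ∘ swapAt p))

    co : Coords x α β γ
    co = coords refl refl refl

    p≢q : inject₁ p ≢ suc q
    p≢q e = ℕP.<⇒≢ (s≤s (ℕP.<⇒≤ lt)) (trans (sym (FinP.toℕ-inject₁ p)) (cong toℕ e))
      where
      lt : toℕ p ℕ.< toℕ q
      lt = ℕP.≤-reflexive (trans (cong toℕ (sym (next-inject pq))) (FinP.toℕ-inject₁ q))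

    αβ≢0 : α - β ≢ 0ℤ
    αβ≢0 = Good-diff gx (inject₁≢suc p)
    αγ≢0 : α - γ ≢ 0ℤ
    αγ≢0 = Good-diff gx p≢q
    βγ≢0 : β - γ ≢ 0ℤ
    βγ≢0 = Good-diff gx (λ e → inject₁≢suc q (trans (next-inject pq) e))

    -- The inner operator makes `h` symmetric in the exchanged pair, so its four values reduce to
    -- three. What remains is the alternating sum, over the six orders of the coordinates, of
    -- `B * C * C` times the value of `k`.
    numerator-q : ∀ {g h} → Related t p g h → Related t q h k →
      (α - β) * ((α - γ) * (C * eval g x - B * eval g (x ∘ swapAt q))) ≡ Φ
    numerator-q {g} {h} r₁ r₂ = alg α β γ A B C (eval g x) (eval g (x ∘ swapAt q))
      (eval h x) (eval h (x ∘ swapAt p)) (eval h (x ∘ swapAt q)) (eval h (x ∘ swapAt q ∘ swapAt p))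
      (eval k x) (eval k (x ∘ swapAt q)) (eval k (x ∘ swapAt p)) (eval k (x ∘ swapAt p ∘ swapAt q))
      (eval k (x ∘ swapAt q ∘ swapAt p)) (eval k (x ∘ swapAt p ∘ swapAt q ∘ swapAt p)) βγ≢0
      (at-p r₁ gx co) (at-p r₁ (Good-swap q gx) (coords-q co))
      (at-q r₂ gx co)
      (trans (at-q r₂ (Good-swap q gx) (coords-q co))
        (cong (λ z → B * eval k (x ∘ swapAt q) - C * z) (eval-cong k λ j → cong x (swapAt-involutive q j))))
      (at-q r₂ (Good-swap p gx) (coords-p co))
      (trans (at-q r₂ (Good-swap p (Good-swap q gx)) (coords-p (coords-q co)))
        (cong (λ z → B * eval k (x ∘ swapAt q ∘ swapAt p) - A * z)
          (eval-cong k λ j → cong x (sym (swapAt-braid pq j)))))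
      where
      alg : ∀ α β γ A B C g gq h hp hq hqp k kq kp kpq kqp kqpq → β - γ ≢ 0ℤ →
        (α - β) * g ≡ B * h - A * hp → (α - γ) * gq ≡ C * hq - A * hqp →
        (β - γ) * h ≡ C * k - B * kq → (γ - β) * hq ≡ B * kq - C * k →
        (α - γ) * hp ≡ C * kp - A * kpq → (α - β) * hqp ≡ B * kqp - A * kqpq →
        (α - β) * ((α - γ) * (C * g - B * gq)) ≡ braidSum A B C k kp kq kpq kqp kqpq
      alg α β γ A B C g gq h hp hq hqp k kq kp kpq kqp kqpq nz e₁ e₂ e₃ e₄ e₅ e₆ = begin
        (α - β) * ((α - γ) * (C * g - B * gq))
          ≡⟨ s₁ (α - β) (α - γ) C B g gq ⟩
        (α - γ) * (C * ((α - β) * g)) - (α - β) * (B * ((α - γ) * gq))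
          ≡⟨ cong₂ (λ u v → (α - γ) * (C * u) - (α - β) * (B * v)) e₁ (trans e₂ (cong (λ z → C * z - A * hqp) hq≡h)) ⟩
        (α - γ) * (C * (B * h - A * hp)) - (α - β) * (B * (C * h - A * hqp))
          ≡⟨ s₂ α β γ A B C h hp hqp ⟩
        B * C * ((β - γ) * h) - A * C * ((α - γ) * hp) + A * B * ((α - β) * hqp)
          ≡⟨ cong₂ _+_ (cong₂ (λ u v → B * C * u - A * C * v) e₃ e₅) (cong (_*_ (A * B)) e₆) ⟩
        braidSum A B C k kp kq kpq kqp kqpq ∎
        where
        open ≡-Reasoning
        s₀ : ∀ a b u → (b - a) * u ≡ - ((a - b) * u)
        s₀ = solve-∀
        s₀′ : ∀ u v → - (u - v) ≡ v - u
        s₀′ = solve-∀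
        hq≡h : hq ≡ h
        hq≡h = cancel (β - γ) nz (trans (trans (s₀ γ β hq) (cong -_ e₄)) (trans (s₀′ (B * kq) (C * k)) (sym e₃)))
        s₁ : ∀ u v C B g gq → u * (v * (C * g - B * gq)) ≡ v * (C * (u * g)) - u * (B * (v * gq))
        s₁ = solve-∀
        s₂ : ∀ α β γ A B C h hp hqp → (α - γ) * (C * (B * h - A * hp)) - (α - β) * (B * (C * h - A * hqp)) ≡
          B * C * ((β - γ) * h) - A * C * ((α - γ) * hp) + A * B * ((α - β) * hqp)
        s₂ = solve-∀

    -- The other order reaches the same sum. Here two contributions to the coefficient of `h` have
    -- to be collected, and this is where the form of `φ` enters.
    numerator-p : ∀ {g h} → Related t q g h → Related t p h k →
      (β - γ) * ((α - γ) * (B * eval g x - A * eval g (x ∘ swapAt p))) ≡ Φ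
    numerator-p {g} {h} r₁ r₂ = alg α β γ A B C (affine t α β γ) (eval g x) (eval g (x ∘ swapAt p))
      (eval h x) (eval h (x ∘ swapAt p)) (eval h (x ∘ swapAt q)) (eval h (x ∘ swapAt p ∘ swapAt q))
      (eval k x) (eval k (x ∘ swapAt q)) (eval k (x ∘ swapAt p)) (eval k (x ∘ swapAt p ∘ swapAt q))
      (eval k (x ∘ swapAt q ∘ swapAt p)) (eval k (x ∘ swapAt p ∘ swapAt q ∘ swapAt p)) αβ≢0
      (at-q r₁ gx co) (at-q r₁ (Good-swap p gx) (coords-p co))
      (at-p r₂ gx co)
      (trans (at-p r₂ (Good-swap p gx) (coords-p co))
        (cong (λ z → A * eval k (x ∘ swapAt p) - B * z) (eval-cong k λ j → cong x (swapAt-involutive p j))))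
      (at-p r₂ (Good-swap q gx) (coords-q co))
      (at-p r₂ (Good-swap q (Good-swap p gx)) (coords-q (coords-p co)))
      where
      -- φ is affine, so B (α - γ) - A (β - γ) = C (α - β).
      affine : ∀ t α β γ u → ((1ℤ - t * β) * (α - γ) - (1ℤ - t * α) * (β - γ)) * u ≡ (1ℤ - t * γ) * ((α - β) * u)
      affine = solve-∀
      alg : ∀ α β γ A B C → (∀ u → (B * (α - γ) - A * (β - γ)) * u ≡ C * ((α - β) * u)) → ∀ g gp h hp hq hpq k kq kp kpq kqp kpqp → α - β ≢ 0ℤ →
        (β - γ) * g ≡ C * h - B * hq → (α - γ) * gp ≡ C * hp - A * hpq →
        (α - β) * h ≡ B * k - A * kp → (β - α) * hp ≡ A * kp - B * k →
        (α - γ) * hq ≡ C * kq - A * kqp → (β - γ) * hpq ≡ C * kpq - B * kpqp →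
        (β - γ) * ((α - γ) * (B * g - A * gp)) ≡ braidSum A B C k kp kq kpq kqp kpqp
      alg α β γ A B C aff g gp h hp hq hpq k kq kp kpq kqp kpqp nz e₁ e₂ e₃ e₄ e₅ e₆ = begin
        (β - γ) * ((α - γ) * (B * g - A * gp))
          ≡⟨ s₁ (β - γ) (α - γ) B A g gp ⟩
        (α - γ) * (B * ((β - γ) * g)) - (β - γ) * (A * ((α - γ) * gp))
          ≡⟨ cong₂ (λ u v → (α - γ) * (B * u) - (β - γ) * (A * v)) e₁ (trans e₂ (cong (λ z → C * z - A * hpq) hp≡h)) ⟩
        (α - γ) * (B * (C * h - B * hq)) - (β - γ) * (A * (C * h - A * hpq))
          ≡⟨ s₂ (α - γ) (β - γ) A B C h hq hpq ⟩
        C * ((B * (α - γ) - A * (β - γ)) * h) - B * B * ((α - γ) * hq) + A * A * ((β - γ) * hpq)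
          ≡⟨ cong₂ _+_ (cong₂ (λ u v → C * u - B * B * v) (trans (aff h) (cong (_*_ C) e₃)) e₅) (cong (_*_ (A * A)) e₆) ⟩
        C * (C * (B * k - A * kp)) - B * B * (C * kq - A * kqp) + A * A * (C * kpq - B * kpqp)
          ≡⟨ s₃ A B C k kp kq kpq kqp kpqp ⟩
        braidSum A B C k kp kq kpq kqp kpqp ∎
        where
        open ≡-Reasoning
        s₀ : ∀ a b u → (b - a) * u ≡ - ((a - b) * u)
        s₀ = solve-∀
        s₀′ : ∀ u v → - (u - v) ≡ v - u
        s₀′ = solve-∀
        hp≡h : hp ≡ h
        hp≡h = cancel (α - β) nz (trans (trans (s₀ β α hp) (cong -_ e₄)) (trans (s₀′ (A * kp) (B * k)) (sym e₃)))
        s₁ : ∀ u v C B g gq → u * (v * (C * g - B * gq)) ≡ v * (C * (u * g)) - u * (B * (v * gq))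
        s₁ = solve-∀
        s₂ : ∀ u v A B C h hq hpq → u * (B * (C * h - B * hq)) - v * (A * (C * h - A * hpq)) ≡
          C * ((B * u - A * v) * h) - B * B * (u * hq) + A * A * (v * hpq)
        s₂ = solve-∀
        s₃ : ∀ A B C k kp kq kpq kqp kpqp →
          C * (C * (B * k - A * kp)) - B * B * (C * kq - A * kqp) + A * A * (C * kpq - B * kpqp) ≡
          B * C * (C * k - B * kq) - A * C * (C * kp - A * kpq) + A * B * (B * kqp - A * kpqp)
        s₃ = solve-∀

  -- The braid relation: both `f` and the operator at `p` applied to `g₂` are `Φ` divided by
  -- (α-β)(α-γ)(β-γ).
  related-below : ∀ {f g₁ h₁ g₂ h₂ k} → Related t q f g₁ → Related t p g₁ h₁ → Related t q h₁ k →
    Related t q g₂ h₂ → Related t p h₂ k → Related t p f g₂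
  related-below {f} {g₁} {h₁} {g₂} {h₂} {k} r₁ r₂ r₃ r₄ r₅ = related λ x gx →
    cancel (α k x gx - γ k x gx) (αγ≢0 k x gx) (cancel (β k x gx - γ k x gx) (βγ≢0 k x gx)
      (trans (trans (alg (β k x gx - γ k x gx) (α k x gx - γ k x gx) (α k x gx - β k x gx) (eval f x))
               (cong (λ z → (α k x gx - β k x gx) * ((α k x gx - γ k x gx) * z)) (at-q r₁ gx (co k x gx))))
        (trans (numerator-q k x gx r₂ r₃) (sym (numerator-p k x gx r₄ r₅)))))
    where
    alg : ∀ a b c f → a * (b * (c * f)) ≡ c * (b * (a * f))
    alg = solve-∀

  related-above : ∀ {f g₁ h₁ g₂ h₂ k} → Related t p f g₁ → Related t q g₁ h₁ → Related t p h₁ k →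
    Related t p g₂ h₂ → Related t q h₂ k → Related t q f g₂
  related-above {f} {g₁} {h₁} {g₂} {h₂} {k} r₁ r₂ r₃ r₄ r₅ = related λ x gx →
    -- The left position of `q` is `inject₁ q`, equal to `suc p` only propositionally.
    trans (cong (λ z → (z - γ k x gx) * eval f x) (cong x (next-inject pq)))
    (trans (cancel (α k x gx - γ k x gx) (αγ≢0 k x gx) (cancel (α k x gx - β k x gx) (αβ≢0 k x gx)
      (trans (trans (alg (α k x gx - β k x gx) (α k x gx - γ k x gx) (β k x gx - γ k x gx) (eval f x))
               (cong (λ z → (β k x gx - γ k x gx) * ((α k x gx - γ k x gx) * z)) (at-p r₁ gx (co k x gx))))
        (trans (numerator-p k x gx r₂ r₃) (sym (numerator-q k x gx r₄ r₅))))))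
    (cong (λ z → φ t (γ k x gx) * eval g₂ x - φ t z * eval g₂ (x ∘ swapAt q)) (sym (cong x (next-inject pq)))))
    where
    alg : ∀ a b c f → a * (b * (c * f)) ≡ c * (b * (a * f))
    alg = solve-∀

-- Both families of polynomials, and their independence of the chosen ascents.

module Family {t : ℤ} (O : DivOp t) where
  open DivOp O

  family : ∀ {m} → ℕ → (Fin (suc m) → ℕ) → Poly (suc m)
  family zero    w = (1ℤ , staircase) ∷ []
  family (suc k) w with firstAscent w
  ... | nothing = (1ℤ , staircase) ∷ []
  ... | just i  = op i (family k (w ∘ swapAt i))

  family-step : ∀ {m} k (w : Fin (suc m) → ℕ) {i} → firstAscent w ≡ just i →
    family (suc k) w ≡ op i (family k (w ∘ swapAt i))
  family-step k w eq with firstAscent w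
  family-step k w refl | just _ = refl

  family-stop : ∀ {m} k (w : Fin (suc m) → ℕ) → firstAscent w ≡ nothing → family k w ≡ (1ℤ , staircase) ∷ []
  family-stop zero    w eq = refl
  family-stop (suc k) w eq with firstAscent w
  family-stop (suc k) w refl | nothing = refl

  family-cong : ∀ {m} k {w w′ : Fin (suc m) → ℕ} → w ≗ w′ → family k w ≡ family k w′
  family-cong zero    h = refl
  family-cong (suc k) {w} {w′} h with firstAscent w in eq
  ... | nothing = sym (family-stop (suc k) w′ (trans (sym (firstAscent-cong h)) eq))
  ... | just i  = trans (cong (op i) (family-cong k (λ j → h (swapAt i j))))
                        (sym (family-step k w′ (trans (sym (firstAscent-cong h)) eq)))

  -- The number of steps from `w` to the longest element is the size of the staircase minus `inv w`;
  -- the fuel must cover them.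
  Enough : ∀ {m} → ℕ → (Fin (suc m) → ℕ) → Set
  Enough {m} k w = deg (staircase {m}) ℕ.≤ k ℕ.+ inv w

  enough-step : ∀ {m} k (w : Fin (suc m) → ℕ) i → Asc w i → Enough (suc k) w → Enough k (w ∘ swapAt i)
  enough-step {m} k w i a h rewrite inv-asc w i a = subst (deg (staircase {m}) ℕ.≤_) (sym (ℕP.+-suc k (inv w))) h

  ¬enough-zero : ∀ {m} (w : Fin (suc m) → ℕ) i → Asc w i → ¬ Enough zero w
  ¬enough-zero w i a h = ℕP.<⇒≱ (ℕP.≤-reflexive (sym (inv-asc w i a)))
    (ℕP.≤-trans (inv≤staircase (w ∘ swapAt i)) h)

  family-suc : ∀ {m} k (w : Fin (suc m) → ℕ) → Enough k w → family (suc k) w ≡ family k w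
  family-suc k w h with firstAscent w in eq
  ... | nothing = sym (family-stop k w eq)
  family-suc zero    w h | just i = contradiction h (¬enough-zero w i (first-ascent w eq))
  family-suc (suc k) w h | just i =
    trans (cong (op i) (family-suc k (w ∘ swapAt i) (enough-step k w i (first-ascent w eq) h)))
          (sym (family-step k w eq))

  op-related : ∀ {m} (i : Fin m) f → Related t i (op i f) f
  op-related i f = related λ x _ → op-eval i f x

  asc-far : ∀ {m} {i j : Fin m} (w : Fin (suc m) → ℕ) → Far j i → Asc w i → Asc (w ∘ swapAt j) i
  asc-far w f = subst₂ ℕ._<_ (cong w (sym (swapAt-far-left f))) (cong w (sym (swapAt-far-right f)))

  -- Two adjacent ascents mean three increasing values, so both routes of three exchanges to their
  -- reversal ascend at every step.
  module Chain {m} {p q : Fin m} (pq : Next p q) (w : Fin (suc m) → ℕ) (ap : Asc w p) (aq : Asc w q) where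
    aq′ : w (suc p) ℕ.< w (suc q)
    aq′ = subst (λ z → w z ℕ.< w (suc q)) (next-inject pq) aq

    sq-p : swapAt q (suc p) ≡ suc q
    sq-p = trans (cong (swapAt q) (sym (next-inject pq))) (swapAt-left q)

    sp-q : swapAt p (inject₁ q) ≡ inject₁ p
    sp-q = trans (cong (swapAt p) (next-inject pq)) (swapAt-right p)

    p-then-q : Asc (w ∘ swapAt p) q
    p-then-q = subst₂ ℕ._<_ (cong w (sym sp-q)) (cong w (sym (swapAt-next-right pq))) (ℕP.<-trans ap aq′)

    pq-then-p : Asc (w ∘ swapAt p ∘ swapAt q) p
    pq-then-p = subst₂ ℕ._<_
      (cong w (sym (trans (cong (swapAt p) (swapAt-next-left pq)) (swapAt-left p))))
      (cong w (sym (trans (cong (swapAt p) sq-p) (swapAt-next-right pq)))) aq′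

    q-then-p : Asc (w ∘ swapAt q) p
    q-then-p = subst₂ ℕ._<_ (cong w (sym (swapAt-next-left pq))) (cong w (sym sq-p)) (ℕP.<-trans ap aq′)

    qp-then-q : Asc (w ∘ swapAt q ∘ swapAt p) q
    qp-then-q = subst₂ ℕ._<_
      (cong w (sym (trans (cong (swapAt q) sp-q) (swapAt-next-left pq))))
      (cong w (sym (trans (cong (swapAt q) (swapAt-next-right pq)) (trans (swapAt-right q) (next-inject pq))))) ap

  -- The recursion follows the first ascent `j`, while the relation is wanted at every ascent `i`.
  -- By induction on the fuel the steps after `w ∘ swapAt j` and `w ∘ swapAt i` may use any ascent,
  -- and commutation or the braid relation joins the two routes.
  family-related : ∀ {m} k (w : Fin (suc m) → ℕ) i → Asc w i → Enough (suc k) w →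
    Related t i (family (suc k) w) (family k (w ∘ swapAt i))
  family-related k w i a h with firstAscent w in eq
  ... | nothing = contradiction a (no-first-ascent w eq i)
  ... | just j  with position i j
  ...   | same refl = op-related i (family k (w ∘ swapAt i))
  family-related zero w i a h | just j | far f =
    contradiction (enough-step 0 w j (first-ascent w eq) h) (¬enough-zero (w ∘ swapAt j) i (asc-far w (far-sym f) a))
  family-related (suc k) w i a h | just j | far f =
    related-far f (op-related j _)
      (family-related k (w ∘ swapAt j) i (asc-far w (far-sym f) a) (enough-step (suc k) w j aj h))
      (subst (Related t j _) (family-cong k (λ l → cong w (swapAt-comm f l)))
        (family-related k (w ∘ swapAt i) j (asc-far w f aj) (enough-step (suc k) w i a h)))
    where aj = first-ascent w eq
  -- Two adjacent ascents leave at least three steps to the longest element, so a total fuel of 1 or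
  -- 2 contradicts `Enough`.
  family-related zero w i a h | just j | below n =
    contradiction (enough-step 0 w j (first-ascent w eq) h) (¬enough-zero (w ∘ swapAt j) i (Chain.q-then-p n w a (first-ascent w eq)))
  family-related (suc zero) w i a h | just j | below n =
    contradiction (enough-step 0 (w ∘ swapAt j) i q-then-p (enough-step 1 w j (first-ascent w eq) h)) (¬enough-zero (w ∘ swapAt j ∘ swapAt i) j qp-then-q)
    where open Chain n w a (first-ascent w eq)
  family-related (suc (suc k)) w i a h | just j | below n =
    Braid.related-below n t (op-related j _)
      (family-related (suc k) (w ∘ swapAt j) i q-then-p e₁)
      (family-related k (w ∘ swapAt j ∘ swapAt i) j qp-then-q (enough-step (suc k) (w ∘ swapAt j) i q-then-p e₁))
      (family-related (suc k) (w ∘ swapAt i) j p-then-q e₂)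
      (subst (Related t i _) (family-cong k (λ l → cong w (swapAt-braid n l)))
        (family-related k (w ∘ swapAt i ∘ swapAt j) i pq-then-p (enough-step (suc k) (w ∘ swapAt i) j p-then-q e₂)))
    where
    open Chain n w a (first-ascent w eq)
    e₁ = enough-step (suc (suc k)) w j (first-ascent w eq) h
    e₂ = enough-step (suc (suc k)) w i a h
  family-related zero w i a h | just j | above n =
    contradiction (enough-step 0 w j (first-ascent w eq) h) (¬enough-zero (w ∘ swapAt j) i (Chain.p-then-q n w (first-ascent w eq) a))
  family-related (suc zero) w i a h | just j | above n =
    contradiction (enough-step 0 (w ∘ swapAt j) i p-then-q (enough-step 1 w j (first-ascent w eq) h)) (¬enough-zero (w ∘ swapAt j ∘ swapAt i) j pq-then-p)
    where open Chain n w (first-ascent w eq) a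
  family-related (suc (suc k)) w i a h | just j | above n =
    Braid.related-above n t (op-related j _)
      (family-related (suc k) (w ∘ swapAt j) i p-then-q e₁)
      (family-related k (w ∘ swapAt j ∘ swapAt i) j pq-then-p (enough-step (suc k) (w ∘ swapAt j) i p-then-q e₁))
      (family-related (suc k) (w ∘ swapAt i) j q-then-p e₂)
      (subst (Related t i _) (family-cong k (λ l → sym (cong w (swapAt-braid n l))))
        (family-related k (w ∘ swapAt i ∘ swapAt j) i qp-then-q (enough-step (suc k) (w ∘ swapAt i) j q-then-p e₂)))
    where
    open Chain n w (first-ascent w eq) a
    e₁ = enough-step (suc (suc k)) w j (first-ascent w eq) h
    e₂ = enough-step (suc (suc k)) w i a h

  fam : ∀ {m} → (Fin (suc m) → ℕ) → Poly (suc m)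
  fam {m} = family (suc m ℕ.* suc m)

  fam-cong : ∀ {m} {w w′ : Fin (suc m) → ℕ} → w ≗ w′ → fam w ≡ fam w′
  fam-cong {m} = family-cong (suc m ℕ.* suc m)

  fam-asc : ∀ {m} (w : Fin (suc m) → ℕ) i → Asc w i → Related t i (fam w) (fam (w ∘ swapAt i))
  fam-asc {m} w i a = subst (λ p → Related t i p (fam (w ∘ swapAt i))) (family-suc (suc m ℕ.* suc m) w enough)
    (family-related (suc m ℕ.* suc m) w i a (ℕP.m≤n⇒m≤1+n enough))
    where
    enough : Enough (suc m ℕ.* suc m) w
    enough = ℕP.≤-trans (deg-staircase {m}) (ℕP.m≤m+n (suc m ℕ.* suc m) (inv w))

  fam-desc : ∀ {m} {w : Fin (suc m) → ℕ} → Inj w → ∀ i → ¬ Asc w i → Related t i (fam (w ∘ swapAt i)) (fam w)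
  fam-desc {w = w} inj i d = subst (Related t i _) (fam-cong (λ j → cong w (swapAt-involutive i j)))
    (fam-asc (w ∘ swapAt i) i (¬asc⇒asc-swap inj i d))

  -- An image of the operator at `i` is symmetric at `i`: the exchange changes the sign of both
  -- numerator and denominator of its defining quotient.
  fam-symmetric : ∀ {m} (w : Fin (suc m) → ℕ) i → Asc w i → ∀ x → Good x → eval (fam w) (x ∘ swapAt i) ≡ eval (fam w) x
  fam-symmetric w i a x gx = cancel (β - α) (Good-diff gx (inject₁≢suc i ∘ sym)) (trans
    (related-at (fam-asc w i a) (Good-swap i gx) (cong x (swapAt-left i)) (cong x (swapAt-right i)))
    (trans (cong (λ z → φ t α * eval (fam (w ∘ swapAt i)) (x ∘ swapAt i) - φ t β * z)
              (eval-cong (fam (w ∘ swapAt i)) (λ j → cong x (swapAt-involutive i j))))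
      (trans (alg (φ t α * eval (fam (w ∘ swapAt i)) (x ∘ swapAt i)) (φ t β * eval (fam (w ∘ swapAt i)) x))
        (trans (cong -_ (sym (Related.at (fam-asc w i a) x gx))) (alg₂ α β (eval (fam w) x))))))
    where
    α β : ℤ
    α = x (inject₁ i)
    β = x (suc i)
    alg : ∀ u v → u - v ≡ - (v - u)
    alg = solve-∀
    alg₂ : ∀ a b u → - ((a - b) * u) ≡ (b - a) * u
    alg₂ = solve-∀

  family-stair : ∀ {m} k (w : Fin (suc m) → ℕ) → All (Stair ∘ proj₂) (family k w)
  family-stair zero    w = staircase-stair ∷ []
  family-stair (suc k) w with firstAscent w
  ... | nothing = staircase-stair ∷ []
  ... | just i  = op-stair i (family-stair k (w ∘ swapAt i))

  -- A lower bound on every term, each operator lowering degrees by at most one. It makes constant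
  -- terms vanish as soon as there is an inversion.
  family-deg : ∀ {m} k (w : Fin (suc m) → ℕ) → All ((inv w ℕ.≤_) ∘ deg ∘ proj₂) (family k w)
  family-deg zero    w = inv≤staircase w ∷ []
  family-deg (suc k) w with firstAscent w in eq
  ... | nothing = inv≤staircase w ∷ []
  ... | just i  = All.map ℕP.≤-pred
    (op-deg i (suc (inv w)) (subst (λ z → All ((z ℕ.≤_) ∘ deg ∘ proj₂) (family k (w ∘ swapAt i)))
      (inv-asc w i (first-ascent w eq)) (family-deg k (w ∘ swapAt i))))

  fam-at-0 : ∀ {m} (w : Fin (suc m) → ℕ) → inv w ≢ 0 → eval (fam w) (λ _ → 0ℤ) ≡ 0ℤ
  fam-at-0 {m} w nz = go (All.map (ℕP.<-≤-trans (ℕP.n≢0⇒n>0 nz)) (family-deg (suc m ℕ.* suc m) w))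
    where
    mono : ∀ {n} (e : Mono n) → 0 ℕ.< deg e → evalM e (λ _ → 0ℤ) ≡ 0ℤ
    mono (zero ∷ e)  h = trans (ℤP.*-identityˡ (evalM e (λ _ → 0ℤ))) (mono e h)
    mono (suc k ∷ e) h = refl
    go : ∀ {n} {p : Poly n} → All ((0 ℕ.<_) ∘ deg ∘ proj₂) p → eval p (λ _ → 0ℤ) ≡ 0ℤ
    go []                  = refl
    go {p = (c , e) ∷ p} (h ∷ hs) = cong₂ _+_ (trans (cong (_*_ c) (mono e h)) (ℤP.*-zeroʳ c)) (go hs)

-- Lehmer codes and dominant permutations.

countLt-mono : ∀ {a b} l → a ℕ.≤ b → countLt a l ℕ.≤ countLt b l
countLt-mono []      h = z≤n
countLt-mono {a} {b} (c ∷ l) h with c <ᵇ a in eq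
... | false = ℕP.≤-trans (countLt-mono l h) (ℕP.m≤n+m (countLt b l) _)
... | true rewrite <ᵇ-true (ℕP.<-≤-trans (ℕP.<ᵇ⇒< c a (subst T (sym eq) tt)) h) = s≤s (countLt-mono l h)

-- The Lehmer code.
code : ∀ {n} → (Fin n → ℕ) → Mono n
code {zero}  w = []
code {suc n} w = countLt (w zero) (tab (w ∘ suc)) ∷ code (w ∘ suc)

code-cong : ∀ {n} {w w′ : Fin n → ℕ} → w ≗ w′ → code w ≡ code w′
code-cong {zero}  h = refl
code-cong {suc n} h = cong₂ _∷_ (cong₂ countLt (h zero) (ListP.tabulate-cong (h ∘ suc))) (code-cong (h ∘ suc))

code-asc : ∀ {m} (w : Fin (suc m) → ℕ) i → Asc w i → lookup (code w) (inject₁ i) ℕ.≤ lookup (code w) (suc i)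
code-asc w zero    a rewrite <ᵇ-false (ℕP.<⇒≯ a) = countLt-mono (tab (λ j → w (suc (suc j)))) (ℕP.<⇒≤ a)
code-asc w (suc i) a = code-asc (w ∘ suc) i a

code-desc : ∀ {m} (w : Fin (suc m) → ℕ) i → w (suc i) ℕ.< w (inject₁ i) →
  lookup (code w) (suc i) ℕ.< lookup (code w) (inject₁ i)
code-desc w zero    d rewrite <ᵇ-true d = s≤s (countLt-mono (tab (λ j → w (suc (suc j)))) (ℕP.<⇒≤ d))
code-desc w (suc i) d = code-desc (w ∘ suc) i d

code-swap : ∀ {m} (w : Fin (suc m) → ℕ) i → Asc w i →
  code (w ∘ swapAt i) ≡ setPair i (code w) (suc (lookup (code w) (suc i))) (lookup (code w) (inject₁ i))
code-swap w zero    a rewrite <ᵇ-true a | <ᵇ-false (ℕP.<⇒≯ a) = refl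
code-swap w (suc i) a = cong₂ _∷_ head (trans (code-cong (λ j → cong w (swapAt-suc i j))) (code-swap (w ∘ suc) i a))
  where
  head : countLt (w zero) (tab (λ j → w (swapAt (suc i) (suc j)))) ≡ countLt (w zero) (tab (w ∘ suc))
  head with tab-swap i (w ∘ suc)
  ... | l , r , e , e′ = trans (cong (countLt (w zero)) (trans (ListP.tabulate-cong (λ j → cong w (swapAt-suc i j))) e′))
    (trans (countLt-swap (w zero) l _ _ r) (cong (countLt (w zero)) (sym e)))

setPair-left : ∀ {m} (i : Fin m) e u v → lookup (setPair i e u v) (inject₁ i) ≡ u
setPair-left zero    (p ∷ q ∷ e) u v = refl
setPair-left (suc i) (k ∷ e)     u v = setPair-left i e u v

setPair-right : ∀ {m} (i : Fin m) e u v → lookup (setPair i e u v) (suc i) ≡ v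
setPair-right zero    (p ∷ q ∷ e) u v = refl
setPair-right (suc i) (k ∷ e)     u v = setPair-right i e u v

setPair-other : ∀ {m} (i : Fin m) e u v k → swapAt i k ≡ k → lookup (setPair i e u v) k ≡ lookup e k
setPair-other zero    (p ∷ q ∷ e) u v (suc (suc k)) h = refl
setPair-other (suc i) (_ ∷ e)     u v zero          h = refl
setPair-other (suc i) (_ ∷ e)     u v (suc k)       h =
  setPair-other i e u v k (FinP.suc-injective (trans (sym (swapAt-suc i k)) h))

-- The descent just before the ascent found is what keeps the code a partition in `fam-dominant`.
leastAscent : ∀ {m} (w : Fin (suc m) → ℕ) →
  (∀ i → ¬ Asc w i) ⊎ (∃ λ i → Asc w i × (∀ p → Next p i → ¬ Asc w p))
leastAscent {zero}  w = inj₁ λ ()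
leastAscent {suc m} w with asc? w zero
... | yes a = inj₂ (zero , a , λ p ())
... | no ¬a with leastAscent (w ∘ suc)
...   | inj₁ none        = inj₁ λ { zero → ¬a ; (suc i) → none i }
...   | inj₂ (i , a , h) = inj₂ (suc i , a , λ { zero next-zero → ¬a ; (suc p) (next-suc n) → h p n })

Partition : ∀ {m} → Mono (suc m) → Set
Partition e = ∀ i → lookup e (suc i) ℕ.≤ lookup e (inject₁ i)

module Dominant {t : ℤ} (O : DivOp t) where
  open Family O

  code-staircase : ∀ {m} (w : Fin (suc m) → ℕ) → (∀ i → w (suc i) ℕ.< w (inject₁ i)) → code w ≡ staircase {m}
  code-staircase {zero}  w d = refl
  code-staircase {suc m} w d = cong₂ _∷_ (all-smaller (w zero) (w ∘ suc) (d zero) (d ∘ suc)) (code-staircase (w ∘ suc) (d ∘ suc))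
    where
    all-smaller : ∀ {m} a (f : Fin (suc m) → ℕ) → f zero ℕ.< a → (∀ i → f (suc i) ℕ.< f (inject₁ i)) → countLt a (tab f) ≡ suc m
    all-smaller {zero}  a f h d rewrite <ᵇ-true h = refl
    all-smaller {suc m} a f h d rewrite <ᵇ-true h = cong suc (all-smaller a (f ∘ suc) (ℕP.<-trans (d zero) h) (d ∘ suc))

  -- At the least ascent a partition code is flat, and the exchange adds one box there. The operator
  -- removes that box again, because the terms with `t` cancel; so the induction from the longest
  -- element gives the monomial of the code in both families.
  fam-dominant : ∀ {m} k (w : Fin (suc m) → ℕ) → Inj w → Partition (code w) → deg (staircase {m}) ℕ.≤ k ℕ.+ inv w →
    ∀ x → Good x → eval (fam w) x ≡ evalM (code w) x
  fam-dominant {m} k w inj part en x gx with leastAscent w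
  ... | inj₁ none = trans (cong (λ p → eval p x) (family-stop (suc m ℕ.* suc m) w stop))
      (trans (alg (evalM (staircase {m}) x))
        (cong (λ e → evalM e x) (sym (code-staircase w λ i → ¬asc⇒desc inj i (none i)))))
    where
    alg : ∀ a → 1ℤ * a + 0ℤ ≡ a
    alg = solve-∀
    stop : firstAscent w ≡ nothing
    stop with firstAscent w in eq
    ... | nothing = refl
    ... | just i  = contradiction (first-ascent w eq) (none i)
  fam-dominant zero    w inj part en x gx | inj₂ (i , a , _) = contradiction en (¬enough-zero w i a)
  fam-dominant (suc k) w inj part en x gx | inj₂ (i , a , least) =
    cancel (α - β) (Good-diff gx (inject₁≢suc i)) (trans (Related.at (fam-asc w i a) x gx)
      (trans (cong₂ (λ u v → φ t β * u - φ t α * v) (at-swap x gx) (at-swap (x ∘ swapAt i) (Good-swap i gx)))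
        (trans (cong₂ (λ u v → φ t β * u - φ t α * v) (evalM-setPair i e (suc q) q x) swapped)
          (trans (alg t α β R (α ^ q) (β ^ q)) (cong (_*_ (α - β)) (sym plain))))))
    where
    e = code w
    q : ℕ
    q = lookup e (suc i)
    α β R : ℤ
    α = x (inject₁ i)
    β = x (suc i)
    R = evalRest i e x
    flat : lookup e (inject₁ i) ≡ q
    flat = ℕP.≤-antisym (code-asc w i a) (part i)
    code′ : code (w ∘ swapAt i) ≡ setPair i e (suc q) q
    code′ = trans (code-swap w i a) (cong (setPair i e (suc q)) flat)
    left-of : ∀ {j} → swapAt i (inject₁ j) ≡ inject₁ j → lookup (setPair i e (suc q) q) (inject₁ j) ≡ lookup e (inject₁ j)
    left-of {j} = setPair-other i e (suc q) q (inject₁ j)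
    right-of : ∀ {j} → swapAt i (suc j) ≡ suc j → lookup (setPair i e (suc q) q) (suc j) ≡ lookup e (suc j)
    right-of {j} = setPair-other i e (suc q) q (suc j)
    part′ : Partition (setPair i e (suc q) q)
    part′ j with position i j
    ... | same refl = subst₂ ℕ._≤_ (sym (setPair-right i e (suc q) q)) (sym (setPair-left i e (suc q) q)) (ℕP.n≤1+n q)
    ... | far f = subst₂ ℕ._≤_ (sym (right-of (swapAt-far-right f))) (sym (left-of (swapAt-far-left f))) (part j)
    ... | below n = subst₂ ℕ._≤_ (sym (right-of (swapAt-next-right n)))
        (sym (trans (cong (lookup (setPair i e (suc q) q)) (next-inject n)) (setPair-right i e (suc q) q)))
        (ℕP.≤-trans (part j) (ℕP.≤-reflexive (cong (lookup e) (next-inject n))))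
    ... | above n = subst₂ ℕ._≤_
        (sym (trans (cong (lookup (setPair i e (suc q) q)) (sym (next-inject n))) (setPair-left i e (suc q) q)))
        (sym (left-of (swapAt-next-left n)))
        (subst (λ z → suc z ℕ.≤ lookup e (inject₁ j)) (trans (cong (lookup e) (sym (next-inject n))) flat)
          (code-desc w j (¬asc⇒desc inj j (least j n))))
    at-swap : ∀ y → Good y → eval (fam (w ∘ swapAt i)) y ≡ evalM (setPair i e (suc q) q) y
    at-swap y gy = trans (fam-dominant k (w ∘ swapAt i) (Inj-swap i inj) (subst Partition (sym code′) part′)
        (enough-step k w i a en) y gy) (cong (λ e → evalM e y) code′)
    swapped : evalM (setPair i e (suc q) q) (x ∘ swapAt i) ≡ R * (β ^ suc q * α ^ q)
    swapped = trans (evalM-setPair i e (suc q) q (x ∘ swapAt i))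
      (trans (cong₂ (λ u v → evalRest i e (x ∘ swapAt i) * (u ^ suc q * v ^ q)) (cong x (swapAt-left i)) (cong x (swapAt-right i)))
        (cong (_* (β ^ suc q * α ^ q)) (evalRest-swap i e x)))
    plain : evalM e x ≡ R * (α ^ q * β ^ q)
    plain = trans (cong (λ e → evalM e x) (sym (trans (cong (λ z → setPair i e z q) (sym flat)) (setPair-lookup i e))))
      (evalM-setPair i e q q x)
    alg : ∀ t α β R u v → (1ℤ - t * β) * (R * (α * u * v)) - (1ℤ - t * α) * (R * (β * v * u)) ≡ (α - β) * (R * (u * v))
    alg = solve-∀

  -- Without inversions the code is zero, hence a partition, and the constant term is that of the
  -- monomial 1.
  fam-one : ∀ {m} (w : Fin (suc m) → ℕ) → Inj w → inv w ≡ 0 → eval (fam w) (λ _ → 0ℤ) ≡ 1ℤ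
  fam-one {m} w inj z = trans
    (agree-everywhere (eval-poly (fam w)) (isPoly ((1ℤ , code w) ∷ []) (λ x → alg (evalM (code w) x)))
      (fam-dominant (deg (staircase {m})) w inj part (ℕP.m≤m+n _ (inv w))) (λ _ → 0ℤ))
    (trans (cong (λ e → evalM e (λ _ → 0ℤ)) (zeros w z)) (one (suc m)))
    where
    alg : ∀ a → 1ℤ * a + 0ℤ ≡ a
    alg = solve-∀
    zeros : ∀ {n} (w : Fin n → ℕ) → inv w ≡ 0 → code w ≡ replicate n 0
    zeros {zero}  w z = refl
    zeros {suc n} w z = cong₂ _∷_ (ℕP.m+n≡0⇒m≡0 _ z) (zeros (w ∘ suc) (ℕP.m+n≡0⇒n≡0 (countLt (w zero) (tab (w ∘ suc))) z))
    one : ∀ n → evalM (replicate n 0) (λ _ → 0ℤ) ≡ 1ℤ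
    one zero    = refl
    one (suc n) = trans (ℤP.*-identityˡ (evalM (replicate n 0) (λ _ → 0ℤ))) (one n)
    part : Partition (code w)
    part i = subst (λ e → lookup e (suc i) ℕ.≤ lookup e (inject₁ i)) (sym (zeros w z))
      (ℕP.≤-trans (ℕP.≤-reflexive (VecP.lookup-replicate (suc i) 0)) z≤n)

-- Constant terms of iterated divided differences.

-- The letter at the head acts last.
divDiffs : ∀ {m} → List (Fin m) → Poly (suc m) → Poly (suc m)
divDiffs []      p = p
divDiffs (i ∷ u) p = divDiff i (divDiffs u p)

divDiffs-snoc : ∀ {m} (u : List (Fin m)) i p → divDiffs (u ++ i ∷ []) p ≡ divDiffs u (divDiff i p)
divDiffs-snoc []      i p = refl
divDiffs-snoc (j ∷ u) i p = cong (divDiff j) (divDiffs-snoc u i p)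

-- The last variable does not occur, so its coordinate may be replaced by 0; by symmetry so may
-- every other one in turn, until the value is that at the origin.
symmetric-stair-zero : ∀ {m} (p : Poly (suc m)) → All (Stair ∘ proj₂) p →
  (∀ i x → eval p (x ∘ swapAt i) ≡ eval p x) → eval p (λ _ → 0ℤ) ≡ 0ℤ → ∀ x → eval p x ≡ 0ℤ
symmetric-stair-zero {m} p st sy z x =
  trans (sym (clear-all (allFin (suc m)) x)) (trans (eval-cong p (λ j → cleared (allFin (suc m)) x j (∈-allFin j))) z)
  where
  clear : Fin (suc m) → Pt (suc m) → Pt (suc m)
  clear j x k with j Fin.≟ k
  ... | yes _ = 0ℤ
  ... | no  _ = x k

  clear-here : ∀ j x → clear j x j ≡ 0ℤ
  clear-here j x with j Fin.≟ j
  ... | yes _ = refl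
  ... | no ne = contradiction refl ne

  clear-other : ∀ {j k} x → j ≢ k → clear j x k ≡ x k
  clear-other {j} {k} x ne with j Fin.≟ k
  ... | yes e = contradiction e ne
  ... | no  _ = refl

  clear-swap : ∀ i x → clear (suc i) (x ∘ swapAt i) ∘ swapAt i ≗ clear (inject₁ i) x
  clear-swap i x k with suc i Fin.≟ swapAt i k | inject₁ i Fin.≟ k
  ... | yes _ | yes _ = refl
  ... | no  _ | no  _ = cong x (swapAt-involutive i k)
  ... | yes e | no ne = contradiction (trans (sym (swapAt-right i)) (trans (cong (swapAt i) e) (swapAt-involutive i k))) ne
  ... | no ne | yes e = contradiction (trans (sym (swapAt-left i)) (cong (swapAt i) e)) ne

  clear-invariant : ∀ j x → eval p (clear j x) ≡ eval p x
  -- Downwards from the last position: an adjacent exchange carries the cleared coordinate one place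
  -- to the left.
  clear-invariant = >-weakInduction (λ j → ∀ x → eval p (clear j x) ≡ eval p x)
    (λ x → stair-eval st (λ j → clear-other x (λ e → FinP.fromℕ≢inject₁ e)))
    (λ i h x → trans (eval-cong p (λ k → sym (clear-swap i x k)))
      (trans (sy i (clear (suc i) (x ∘ swapAt i))) (trans (h (x ∘ swapAt i)) (sy i x))))

  clear-all : ∀ js x → eval p (List.foldr clear x js) ≡ eval p x
  clear-all []       x = refl
  clear-all (j ∷ js) x = trans (clear-invariant j (List.foldr clear x js)) (clear-all js x)

  cleared : ∀ js x k → k ∈ js → List.foldr clear x js k ≡ 0ℤ
  cleared (j ∷ js) x k (here refl) = clear-here j (List.foldr clear x js)
  cleared (j ∷ js) x k (there h) with j Fin.≟ k
  ... | yes _ = refl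
  ... | no  _ = cleared js x k h

-- Induction on a bound for the degree: each divided difference has smaller degree and satisfies the
-- same hypotheses, so it vanishes, which makes the polynomial symmetric.
derivatives-determine : ∀ {m} (p : Poly (suc m)) → All (Stair ∘ proj₂) p →
  (∀ u → eval (divDiffs u p) (λ _ → 0ℤ) ≡ 0ℤ) → ∀ x → eval p x ≡ 0ℤ
derivatives-determine {m} p = go (suc (bound p)) p (bounded p)
  where
  bound : Poly (suc m) → ℕ
  bound []            = 0
  bound ((_ , e) ∷ p) = deg e ⊔ bound p

  bounded : ∀ p → All ((ℕ._< suc (bound p)) ∘ deg ∘ proj₂) p
  bounded []            = []
  bounded ((c , e) ∷ p) = s≤s (ℕP.m≤m⊔n (deg e) (bound p)) ∷
    All.map (λ h → ℕP.<-≤-trans h (s≤s (ℕP.m≤n⊔m (deg e) (bound p)))) (bounded p)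

  go : ∀ d (p : Poly (suc m)) → All ((ℕ._< d) ∘ deg ∘ proj₂) p → All (Stair ∘ proj₂) p →
    (∀ u → eval (divDiffs u p) (λ _ → 0ℤ) ≡ 0ℤ) → ∀ x → eval p x ≡ 0ℤ
  go zero    []      []       st h x = refl
  go (suc d) p       b        st h x = symmetric-stair-zero p st sy (h []) x
    where
    lower : ∀ i → All ((ℕ._< d) ∘ deg ∘ proj₂) (divDiff i p)
    lower i = divDiff-All i (λ { (c , e) lt → All.map
      (λ t → ℕP.≤-pred (subst (ℕ._< suc d) (sym (deg-DDTerm t)) lt)) (ddMono-terms i c e) }) b
    vanish : ∀ i x → eval (divDiff i p) x ≡ 0ℤ
    vanish i = go d (divDiff i p) (lower i) (divDiff-stair i (All.map (λ {t} → stair-relax i (proj₂ t)) st))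
      (λ u → trans (cong (λ q → eval q (λ _ → 0ℤ)) (sym (divDiffs-snoc u i p))) (h (u ++ i ∷ [])))
    sy : ∀ i x → eval p (x ∘ swapAt i) ≡ eval p x
    sy i x = sym (ℤP.i-j≡0⇒i≡j _ _ (trans (sym (divDiff-eval i p x))
      (trans (cong (_*_ (x (inject₁ i) - x (suc i))) (vanish i x)) (ℤP.*-zeroʳ (x (inject₁ i) - x (suc i))))))

-- The lattice model: one column.

-- The state of a horizontal edge: the labels of the BPD pipe and of the co-BPD pipe along it.
H : Set
H = Maybe (ℕ × ℕ)

-- Sign of a BPD crossing with left label l and bottom label b: −1 if the pipes cross, +1 if they only touch.
sgn : ℕ → ℕ → ℤ
sgn l b = if l <ᵇ b then -1ℤ else 1ℤ

-- The nilCoxeter rule: a crossing of co-BPD pipes counts only if the smaller label comes from the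
-- left.
below? : ℕ → ℕ → ℤ
below? z c = if z <ᵇ c then 1ℤ else 0ℤ

-- Weighted sum over all fillings of one column by tiles. Every vertical edge carries exactly one of a BPD
-- pipe (moving up) and a co-BPD pipe (moving down); the first argument is the co-BPD label entering from
-- above, if any, and a is the BPD label entering at the bottom. The continuation receives the labels on the
-- right edges and the BPD label leaving at the top (0 if there is none).
column : ∀ {k} → Lab → ℕ → ℤ → Vec H k → (Vec H k → ℕ → ℤ) → ℤ
column nothing  a y []                 F = F [] a
-- No co-BPD pipe may leave through the bottom.
column (just _) a y []                 F = 0ℤ
-- The remaining clauses are, in order, the BPD tiles `vert`; `elbowBR` or `blank`; `elbowTL` or
-- `cross`; `horiz`. The weight `y` falls on the tiles with a pipe on the bottom or right edge.
column nothing  a y (nothing ∷ hs)     F = y * column nothing a y hs (λ q b → F (nothing ∷ q) b)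
column (just c) a y (nothing ∷ hs)     F =
  y * column nothing a y hs (λ q b → F (just (b , c) ∷ q) 0) + column (just c) a y hs (λ q _ → F (nothing ∷ q) 0)
column nothing  a y (just (x , z) ∷ hs) F =
  column (just z) a y hs (λ q _ → F (nothing ∷ q) x) +
  y * column nothing a y hs (λ q b → sgn x b * F (just (b ⊓ x , z) ∷ q) (b ⊔ x))
column (just c) a y (just (x , z) ∷ hs) F =
  - (y * below? z c) * column (just c) a y hs (λ q _ → F (just (x , z) ∷ q) 0)

column-cong : ∀ {k} S a y (hs : Vec H k) {F G} → (∀ q b → F q b ≡ G q b) → column S a y hs F ≡ column S a y hs G
column-cong nothing  a y []             e = e [] a
column-cong (just c) a y []             e = refl
column-cong nothing  a y (nothing ∷ hs) e = cong (_*_ y) (column-cong nothing a y hs (λ q b → e (nothing ∷ q) b))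
column-cong (just c) a y (nothing ∷ hs) e =
  cong₂ (λ u v → y * u + v) (column-cong nothing a y hs (λ q b → e (just (b , c) ∷ q) 0))
                            (column-cong (just c) a y hs (λ q _ → e (nothing ∷ q) 0))
column-cong nothing  a y (just (x , z) ∷ hs) e =
  cong₂ (λ u v → u + y * v) (column-cong (just z) a y hs (λ q _ → e (nothing ∷ q) x))
                            (column-cong nothing a y hs (λ q b → cong (_*_ (sgn x b)) (e (just (b ⊓ x , z) ∷ q) (b ⊔ x))))
column-cong (just c) a y (just (x , z) ∷ hs) e =
  cong (_*_ (- (y * below? z c))) (column-cong (just c) a y hs (λ q _ → e (just (x , z) ∷ q) 0))

column-linear : ∀ {k} S a y (hs : Vec H k) s t F G →
  column S a y hs (λ q b → s * F q b + t * G q b) ≡ s * column S a y hs F + t * column S a y hs G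
column-linear nothing  a y []             s t F G = refl
column-linear (just c) a y []             s t F G = sym (cong₂ _+_ (ℤP.*-zeroʳ s) (ℤP.*-zeroʳ t))
column-linear nothing  a y (nothing ∷ hs) s t F G =
  trans (cong (_*_ y) (column-linear nothing a y hs s t F′ G′)) (alg y s t (column nothing a y hs F′) (column nothing a y hs G′))
  where
  F′ G′ : _ → _ → ℤ
  F′ q b = F (nothing ∷ q) b
  G′ q b = G (nothing ∷ q) b
  alg : ∀ y s t f g → y * (s * f + t * g) ≡ s * (y * f) + t * (y * g)
  alg = solve-∀
column-linear (just c) a y (nothing ∷ hs) s t F G =
  trans (cong₂ (λ u v → y * u + v) (column-linear nothing a y hs s t F₁ G₁) (column-linear (just c) a y hs s t F₂ G₂))
        (alg y s t (column nothing a y hs F₁) (column nothing a y hs G₁) (column (just c) a y hs F₂) (column (just c) a y hs G₂))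
  where
  F₁ G₁ F₂ G₂ : _ → _ → ℤ
  F₁ q b = F (just (b , c) ∷ q) 0
  G₁ q b = G (just (b , c) ∷ q) 0
  F₂ q _ = F (nothing ∷ q) 0
  G₂ q _ = G (nothing ∷ q) 0
  alg : ∀ y s t f g f′ g′ → y * (s * f + t * g) + (s * f′ + t * g′) ≡ s * (y * f + f′) + t * (y * g + g′)
  alg = solve-∀
column-linear nothing a y (just (x , z) ∷ hs) s t F G =
  trans (cong₂ (λ u v → u + y * v) (column-linear (just z) a y hs s t F₁ G₁)
          (trans (column-cong nothing a y hs (λ q b → alg₂ s t (sgn x b) (F (just (b ⊓ x , z) ∷ q) (b ⊔ x)) (G (just (b ⊓ x , z) ∷ q) (b ⊔ x))))
                 (column-linear nothing a y hs s t F₂ G₂)))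
        (alg y s t (column (just z) a y hs F₁) (column (just z) a y hs G₁) (column nothing a y hs F₂) (column nothing a y hs G₂))
  where
  F₁ G₁ F₂ G₂ : _ → _ → ℤ
  F₁ q _ = F (nothing ∷ q) x
  G₁ q _ = G (nothing ∷ q) x
  F₂ q b = sgn x b * F (just (b ⊓ x , z) ∷ q) (b ⊔ x)
  G₂ q b = sgn x b * G (just (b ⊓ x , z) ∷ q) (b ⊔ x)
  alg : ∀ y s t f g f′ g′ → (s * f + t * g) + y * (s * f′ + t * g′) ≡ s * (f + y * f′) + t * (g + y * g′)
  alg = solve-∀
  alg₂ : ∀ s t u f g → u * (s * f + t * g) ≡ s * (u * f) + t * (u * g)
  alg₂ = solve-∀
column-linear (just c) a y (just (x , z) ∷ hs) s t F G =
  trans (cong (_*_ (- (y * below? z c))) (column-linear (just c) a y hs s t F′ G′))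
        (alg (- (y * below? z c)) s t (column (just c) a y hs F′) (column (just c) a y hs G′))
  where
  F′ G′ : _ → _ → ℤ
  F′ q _ = F (just (x , z) ∷ q) 0
  G′ q _ = G (just (x , z) ∷ q) 0
  alg : ∀ y s t f g → y * (s * f + t * g) ≡ s * (y * f) + t * (y * g)
  alg = solve-∀

column-zero : ∀ {k} S a y (hs : Vec H k) {F} → (∀ q b → F q b ≡ 0ℤ) → column S a y hs F ≡ 0ℤ
column-zero S a y hs {F} e = trans (column-cong S a y hs {F} {λ q b → 0ℤ * 0ℤ + 0ℤ * 0ℤ} e)
  (column-linear S a y hs 0ℤ 0ℤ (λ _ _ → 0ℤ) (λ _ _ → 0ℤ))

column-scale : ∀ {k} S a y (hs : Vec H k) s F → column S a y hs (λ q b → s * F q b) ≡ s * column S a y hs F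
column-scale S a y hs s F =
  trans (column-cong S a y hs (λ q b → alg s (F q b)))
    (trans (column-linear S a y hs s 0ℤ F F) (sym (alg s (column S a y hs F))))
  where
  alg : ∀ s f → s * f ≡ s * f + 0ℤ * f
  alg = solve-∀

column-+ : ∀ {k} S a y (hs : Vec H k) F G → column S a y hs (λ q b → F q b + G q b) ≡ column S a y hs F + column S a y hs G
column-+ S a y hs F G =
  trans (column-cong S a y hs (λ q b → alg (F q b) (G q b)))
    (trans (column-linear S a y hs 1ℤ 1ℤ F G) (sym (alg (column S a y hs F) (column S a y hs G))))
  where
  alg : ∀ f g → f + g ≡ 1ℤ * f + 1ℤ * g
  alg = solve-∀

column-scale-+ : ∀ {k} S a y (hs : Vec H k) s F G →
  column S a y hs (λ q b → s * F q b + G q b) ≡ s * column S a y hs F + column S a y hs G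
column-scale-+ S a y hs s F G =
  trans (column-+ S a y hs (λ q b → s * F q b) G) (cong (_+ column S a y hs G) (column-scale S a y hs s F))

-- Two adjacent columns.

PairSum : Set
PairSum = ∀ {k} → Lab → Lab → Vec H k → (Vec H k → ℕ → ℕ → ℤ) → ℤ

-- Summation over the fillings of the top row of a strip with column weights y₁, y₂.
topRow : ℤ → ℤ → PairSum → ∀ {k} → H → Lab → Lab → Vec H k → (Vec H (suc k) → ℕ → ℕ → ℤ) → ℤ
topRow y₁ y₂ P nothing (just c₁) (just c₂) hs F =
  - (y₁ * y₂ * below? c₁ c₂) * P nothing (just c₂) hs (λ r b₁ _ → F (just (b₁ , c₁) ∷ r) 0 0) +
  y₂ * P (just c₁) nothing hs (λ r _ b₂ → F (just (b₂ , c₂) ∷ r) 0 0) +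
  P (just c₁) (just c₂) hs (λ r _ _ → F (nothing ∷ r) 0 0)
topRow y₁ y₂ P nothing (just c) nothing hs F =
  y₁ * (P nothing (just c) hs (λ r b₁ _ → F (nothing ∷ r) 0 b₁) +
        y₂ * P nothing nothing hs (λ r b₁ b₂ → sgn b₁ b₂ * F (just (b₂ ⊓ b₁ , c) ∷ r) 0 (b₂ ⊔ b₁))) +
  y₂ * P (just c) nothing hs (λ r _ b₂ → F (nothing ∷ r) 0 b₂)
topRow y₁ y₂ P nothing nothing (just c) hs F =
  y₁ * (y₂ * P nothing nothing hs (λ r b₁ b₂ → F (just (b₂ , c) ∷ r) b₁ 0) +
        P nothing (just c) hs (λ r b₁ _ → F (nothing ∷ r) b₁ 0))
topRow y₁ y₂ P nothing nothing nothing hs F = y₁ * (y₂ * P nothing nothing hs (λ r b₁ b₂ → F (nothing ∷ r) b₁ b₂))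
topRow y₁ y₂ P (just (x , z)) (just c₁) (just c₂) hs F =
  - (y₁ * below? z c₁) * (- (y₂ * below? z c₂) * P (just c₁) (just c₂) hs (λ r _ _ → F (just (x , z) ∷ r) 0 0))
topRow y₁ y₂ P (just (x , z)) (just c) nothing hs F =
  - (y₁ * below? z c) * (P (just c) (just z) hs (λ r _ _ → F (nothing ∷ r) 0 x) +
    y₂ * P (just c) nothing hs (λ r _ b₂ → sgn x b₂ * F (just (b₂ ⊓ x , z) ∷ r) 0 (b₂ ⊔ x)))
topRow y₁ y₂ P (just (x , z)) nothing (just c) hs F =
  (y₂ * P (just z) nothing hs (λ r _ b₂ → F (just (b₂ , c) ∷ r) x 0) + P (just z) (just c) hs (λ r _ _ → F (nothing ∷ r) x 0)) +
  y₁ * (- (y₂ * below? z c) * P nothing (just c) hs (λ r b₁ _ → sgn x b₁ * F (just (b₁ ⊓ x , z) ∷ r) (b₁ ⊔ x) 0))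
topRow y₁ y₂ P (just (x , z)) nothing nothing hs F =
  y₂ * P (just z) nothing hs (λ r _ b₂ → F (nothing ∷ r) x b₂) +
  y₁ * (P nothing (just z) hs (λ r b₁ _ → sgn x b₁ * F (nothing ∷ r) (b₁ ⊔ x) (b₁ ⊓ x)) +
        y₂ * P nothing nothing hs (λ r b₁ b₂ →
          sgn x b₁ * (sgn (b₁ ⊓ x) b₂ * F (just (b₂ ⊓ (b₁ ⊓ x) , z) ∷ r) (b₁ ⊔ x) (b₂ ⊔ (b₁ ⊓ x)))))

-- Any pair sum obeying the row recursion. A linear combination of strips, with the bottom labels in
-- either order, can then take the place of a single one.
record Strip (y₁ y₂ : ℤ) : Set where
  field
    sum    : PairSum
    expand : ∀ {k} h S₁ S₂ (hs : Vec H k) F → sum S₁ S₂ (h ∷ hs) F ≡ topRow y₁ y₂ sum h S₁ S₂ hs F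

module TwoColumns (a₁ a₂ : ℕ) (y₁ y₂ : ℤ) where

  pair : PairSum
  pair S₁ S₂ hs F = column S₁ a₁ y₁ hs (λ q b₁ → column S₂ a₂ y₂ q (λ r b₂ → F r b₁ b₂))

  pair-cong : ∀ {k} S₁ S₂ (hs : Vec H k) {F G} → (∀ r b₁ b₂ → F r b₁ b₂ ≡ G r b₁ b₂) → pair S₁ S₂ hs F ≡ pair S₁ S₂ hs G
  pair-cong S₁ S₂ hs e = column-cong S₁ a₁ y₁ hs (λ q b₁ → column-cong S₂ a₂ y₂ q (λ r b₂ → e r b₁ b₂))

  pair-linear : ∀ {k} S₁ S₂ (hs : Vec H k) s t F G →
    pair S₁ S₂ hs (λ r b₁ b₂ → s * F r b₁ b₂ + t * G r b₁ b₂) ≡ s * pair S₁ S₂ hs F + t * pair S₁ S₂ hs G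
  pair-linear S₁ S₂ hs s t F G =
    trans (column-cong S₁ a₁ y₁ hs (λ q b₁ → column-linear S₂ a₂ y₂ q s t (λ r b₂ → F r b₁ b₂) (λ r b₂ → G r b₁ b₂)))
      (column-linear S₁ a₁ y₁ hs s t (λ q b₁ → column S₂ a₂ y₂ q (λ r b₂ → F r b₁ b₂)) (λ q b₁ → column S₂ a₂ y₂ q (λ r b₂ → G r b₁ b₂)))

  pair-scale : ∀ {k} S₁ S₂ (hs : Vec H k) s F → pair S₁ S₂ hs (λ r b₁ b₂ → s * F r b₁ b₂) ≡ s * pair S₁ S₂ hs F
  pair-scale S₁ S₂ hs s F =
    trans (column-cong S₁ a₁ y₁ hs (λ q b₁ → column-scale S₂ a₂ y₂ q s (λ r b₂ → F r b₁ b₂)))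
      (column-scale S₁ a₁ y₁ hs s (λ q b₁ → column S₂ a₂ y₂ q (λ r b₂ → F r b₁ b₂)))

  private
    C₂ : ∀ {k} → Lab → Vec H k → (Vec H k → ℕ → ℤ) → ℤ
    C₂ S hs F = column S a₂ y₂ hs F

  -- The first column is unfolded, then the second; what remains is moving scalars out of the inner
  -- sums by linearity.
  pair-expand : ∀ {k} h S₁ S₂ (hs : Vec H k) F → pair S₁ S₂ (h ∷ hs) F ≡ topRow y₁ y₂ pair h S₁ S₂ hs F
  pair-expand nothing (just c₁) (just c₂) hs F =
    trans (cong₂ (λ u v → y₁ * u + v)
      (column-scale nothing a₁ y₁ hs (- (y₂ * below? c₁ c₂)) (λ q b → C₂ (just c₂) q (λ r _ → F (just (b , c₁) ∷ r) 0 0)))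
      (column-scale-+ (just c₁) a₁ y₁ hs y₂ (λ q _ → C₂ nothing q (λ r b → F (just (b , c₂) ∷ r) 0 0)) (λ q _ → C₂ (just c₂) q (λ r _ → F (nothing ∷ r) 0 0))))
      (alg y₁ y₂ (below? c₁ c₂) (pair nothing (just c₂) hs (λ r b₁ _ → F (just (b₁ , c₁) ∷ r) 0 0))
        (pair (just c₁) nothing hs (λ r _ b₂ → F (just (b₂ , c₂) ∷ r) 0 0)) (pair (just c₁) (just c₂) hs (λ r _ _ → F (nothing ∷ r) 0 0)))
    where
    alg : ∀ y₁ y₂ i p q r → y₁ * (- (y₂ * i) * p) + (y₂ * q + r) ≡ - (y₁ * y₂ * i) * p + y₂ * q + r
    alg = solve-∀
  pair-expand nothing (just c) nothing hs F =
    cong₂ (λ u v → y₁ * u + v)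
      (trans (column-+ nothing a₁ y₁ hs (λ q b → C₂ (just c) q (λ r _ → F (nothing ∷ r) 0 b))
               (λ q b → y₂ * C₂ nothing q (λ r b₂ → sgn b b₂ * F (just (b₂ ⊓ b , c) ∷ r) 0 (b₂ ⊔ b))))
        (cong (_+_ (pair nothing (just c) hs (λ r b₁ _ → F (nothing ∷ r) 0 b₁)))
          (column-scale nothing a₁ y₁ hs y₂ (λ q b → C₂ nothing q (λ r b₂ → sgn b b₂ * F (just (b₂ ⊓ b , c) ∷ r) 0 (b₂ ⊔ b))))))
      (column-scale (just c) a₁ y₁ hs y₂ (λ q _ → C₂ nothing q (λ r b₂ → F (nothing ∷ r) 0 b₂)))
  pair-expand nothing nothing (just c) hs F =
    cong (_*_ y₁) (column-scale-+ nothing a₁ y₁ hs y₂ (λ q b → C₂ nothing q (λ r b₂ → F (just (b₂ , c) ∷ r) b 0))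
                     (λ q b → C₂ (just c) q (λ r _ → F (nothing ∷ r) b 0)))
  pair-expand nothing nothing nothing hs F =
    cong (_*_ y₁) (column-scale nothing a₁ y₁ hs y₂ (λ q b → C₂ nothing q (λ r b₂ → F (nothing ∷ r) b b₂)))
  pair-expand (just (x , z)) (just c₁) (just c₂) hs F =
    cong (_*_ (- (y₁ * below? z c₁)))
      (column-scale (just c₁) a₁ y₁ hs (- (y₂ * below? z c₂)) (λ q _ → C₂ (just c₂) q (λ r _ → F (just (x , z) ∷ r) 0 0)))
  pair-expand (just (x , z)) (just c) nothing hs F =
    cong (_*_ (- (y₁ * below? z c)))
      (trans (column-+ (just c) a₁ y₁ hs (λ q _ → C₂ (just z) q (λ r _ → F (nothing ∷ r) 0 x))
               (λ q _ → y₂ * C₂ nothing q (λ r b₂ → sgn x b₂ * F (just (b₂ ⊓ x , z) ∷ r) 0 (b₂ ⊔ x))))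
        (cong (_+_ (pair (just c) (just z) hs (λ r _ _ → F (nothing ∷ r) 0 x)))
          (column-scale (just c) a₁ y₁ hs y₂ (λ q _ → C₂ nothing q (λ r b₂ → sgn x b₂ * F (just (b₂ ⊓ x , z) ∷ r) 0 (b₂ ⊔ x))))))
  pair-expand (just (x , z)) nothing (just c) hs F =
    cong₂ (λ u v → u + y₁ * v)
      (column-scale-+ (just z) a₁ y₁ hs y₂ (λ q _ → C₂ nothing q (λ r b₂ → F (just (b₂ , c) ∷ r) x 0)) (λ q _ → C₂ (just c) q (λ r _ → F (nothing ∷ r) x 0)))
      (trans (column-cong nothing a₁ y₁ hs (λ q b → trans
          (alg (sgn x b) (- (y₂ * below? z c)) (C₂ (just c) q (λ r _ → F (just (b ⊓ x , z) ∷ r) (b ⊔ x) 0)))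
          (cong (_*_ (- (y₂ * below? z c))) (sym (column-scale (just c) a₂ y₂ q (sgn x b) (λ r _ → F (just (b ⊓ x , z) ∷ r) (b ⊔ x) 0))))))
        (column-scale nothing a₁ y₁ hs (- (y₂ * below? z c)) (λ q b → C₂ (just c) q (λ r _ → sgn x b * F (just (b ⊓ x , z) ∷ r) (b ⊔ x) 0))))
    where
    alg : ∀ s t u → s * (t * u) ≡ t * (s * u)
    alg = solve-∀
  pair-expand (just (x , z)) nothing nothing hs F =
    cong₂ (λ u v → u + y₁ * v)
      (column-scale (just z) a₁ y₁ hs y₂ (λ q _ → C₂ nothing q (λ r b₂ → F (nothing ∷ r) x b₂)))
      (trans (column-cong nothing a₁ y₁ hs (λ q b → trans
          (alg (sgn x b) y₂ (C₂ (just z) q (λ r _ → F (nothing ∷ r) (b ⊔ x) (b ⊓ x)))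
             (C₂ nothing q (λ r b₂ → sgn (b ⊓ x) b₂ * F (just (b₂ ⊓ (b ⊓ x) , z) ∷ r) (b ⊔ x) (b₂ ⊔ (b ⊓ x)))))
          (cong₂ (λ u v → u + y₂ * v)
            (sym (column-scale (just z) a₂ y₂ q (sgn x b) (λ r _ → F (nothing ∷ r) (b ⊔ x) (b ⊓ x))))
            (sym (column-scale nothing a₂ y₂ q (sgn x b) (λ r b₂ → sgn (b ⊓ x) b₂ * F (just (b₂ ⊓ (b ⊓ x) , z) ∷ r) (b ⊔ x) (b₂ ⊔ (b ⊓ x))))))))
        (trans (column-+ nothing a₁ y₁ hs (λ q b → C₂ (just z) q (λ r _ → sgn x b * F (nothing ∷ r) (b ⊔ x) (b ⊓ x)))
                  (λ q b → y₂ * C₂ nothing q (λ r b₂ → sgn x b * (sgn (b ⊓ x) b₂ * F (just (b₂ ⊓ (b ⊓ x) , z) ∷ r) (b ⊔ x) (b₂ ⊔ (b ⊓ x))))))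
          (cong (_+_ (pair nothing (just z) hs (λ r b₁ _ → sgn x b₁ * F (nothing ∷ r) (b₁ ⊔ x) (b₁ ⊓ x))))
            (column-scale nothing a₁ y₁ hs y₂
              (λ q b → C₂ nothing q (λ r b₂ → sgn x b * (sgn (b ⊓ x) b₂ * F (just (b₂ ⊓ (b ⊓ x) , z) ∷ r) (b ⊔ x) (b₂ ⊔ (b ⊓ x)))))))))
    where
    alg : ∀ s y u v → s * (u + y * v) ≡ s * u + y * (s * v)
    alg = solve-∀

  pairStrip : Strip y₁ y₂
  pairStrip = record { sum = pair ; expand = pair-expand }

-- `topRow` is linear in the pair sum, so the recursion passes to combinations. This is how the
-- R-matrix is placed below a strip.
combineStrips : ∀ {y₁ y₂} → ℤ → ℤ → Strip y₁ y₂ → Strip y₁ y₂ → Strip y₁ y₂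
combineStrips {y₁} {y₂} s t P Q = record
  { sum    = λ S₁ S₂ hs F → s * P.sum S₁ S₂ hs F + t * Q.sum S₁ S₂ hs F
  ; expand = λ h S₁ S₂ hs F → trans (cong₂ (λ u v → s * u + t * v) (P.expand h S₁ S₂ hs F) (Q.expand h S₁ S₂ hs F)) (go h S₁ S₂ hs F) }
  where
  module P = Strip P
  module Q = Strip Q
  a₁ : ∀ u y s t p q → s * (u * (y * p)) + t * (u * (y * q)) ≡ u * (y * (s * p + t * q))
  a₁ = solve-∀
  a₃ : ∀ i y s t p q p′ q′ p″ q″ → s * (i * p + y * p′ + p″) + t * (i * q + y * q′ + q″) ≡
    i * (s * p + t * q) + y * (s * p′ + t * q′) + (s * p″ + t * q″)
  a₃ = solve-∀
  b₁ : ∀ i y s t p q p′ q′ → s * (i * (p + y * p′)) + t * (i * (q + y * q′)) ≡ i * ((s * p + t * q) + y * (s * p′ + t * q′))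
  b₁ = solve-∀
  b₂ : ∀ y s t p q p′ q′ → s * (y * p + p′) + t * (y * q + q′) ≡ y * (s * p + t * q) + (s * p′ + t * q′)
  b₂ = solve-∀
  b₃ : ∀ i y s t p q p′ q′ → s * (i * (y * p + p′)) + t * (i * (y * q + q′)) ≡ i * (y * (s * p + t * q) + (s * p′ + t * q′))
  b₃ = solve-∀
  c₁ : ∀ s t p q p′ q′ → s * (p + p′) + t * (q + q′) ≡ (s * p + t * q) + (s * p′ + t * q′)
  c₁ = solve-∀
  d₁ : ∀ y s t p q → s * (y * p) + t * (y * q) ≡ y * (s * p + t * q)
  d₁ = solve-∀
  go : ∀ {k} h S₁ S₂ (hs : Vec H k) F →
    s * topRow y₁ y₂ P.sum h S₁ S₂ hs F + t * topRow y₁ y₂ Q.sum h S₁ S₂ hs F ≡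
    topRow y₁ y₂ (λ S₁ S₂ hs F → s * P.sum S₁ S₂ hs F + t * Q.sum S₁ S₂ hs F) h S₁ S₂ hs F
  go nothing (just c₁) (just c₂) hs F = a₃ (- (y₁ * y₂ * below? c₁ c₂)) y₂ s t
    (P.sum nothing (just c₂) hs (λ r b₁ _ → F (just (b₁ , c₁) ∷ r) 0 0)) (Q.sum nothing (just c₂) hs (λ r b₁ _ → F (just (b₁ , c₁) ∷ r) 0 0))
    (P.sum (just c₁) nothing hs (λ r _ b₂ → F (just (b₂ , c₂) ∷ r) 0 0)) (Q.sum (just c₁) nothing hs (λ r _ b₂ → F (just (b₂ , c₂) ∷ r) 0 0))
    (P.sum (just c₁) (just c₂) hs (λ r _ _ → F (nothing ∷ r) 0 0)) (Q.sum (just c₁) (just c₂) hs (λ r _ _ → F (nothing ∷ r) 0 0))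
  go nothing (just c) nothing hs F =
    trans (c₁ s t (y₁ * (p₁ + y₂ * p₂)) (y₁ * (q₁ + y₂ * q₂)) (y₂ * p₃) (y₂ * q₃))
      (cong₂ _+_ (b₁ y₁ y₂ s t p₁ q₁ p₂ q₂) (d₁ y₂ s t p₃ q₃))
    where
    p₁ q₁ p₂ q₂ p₃ q₃ : ℤ
    p₁ = P.sum nothing (just c) hs (λ r b₁ _ → F (nothing ∷ r) 0 b₁)
    q₁ = Q.sum nothing (just c) hs (λ r b₁ _ → F (nothing ∷ r) 0 b₁)
    p₂ = P.sum nothing nothing hs (λ r b₁ b₂ → sgn b₁ b₂ * F (just (b₂ ⊓ b₁ , c) ∷ r) 0 (b₂ ⊔ b₁))
    q₂ = Q.sum nothing nothing hs (λ r b₁ b₂ → sgn b₁ b₂ * F (just (b₂ ⊓ b₁ , c) ∷ r) 0 (b₂ ⊔ b₁))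
    p₃ = P.sum (just c) nothing hs (λ r _ b₂ → F (nothing ∷ r) 0 b₂)
    q₃ = Q.sum (just c) nothing hs (λ r _ b₂ → F (nothing ∷ r) 0 b₂)
  go nothing nothing (just c) hs F = b₃ y₁ y₂ s t
    (P.sum nothing nothing hs (λ r b₁ b₂ → F (just (b₂ , c) ∷ r) b₁ 0)) (Q.sum nothing nothing hs (λ r b₁ b₂ → F (just (b₂ , c) ∷ r) b₁ 0))
    (P.sum nothing (just c) hs (λ r b₁ _ → F (nothing ∷ r) b₁ 0)) (Q.sum nothing (just c) hs (λ r b₁ _ → F (nothing ∷ r) b₁ 0))
  go nothing nothing nothing hs F = a₁ y₁ y₂ s t
    (P.sum nothing nothing hs (λ r b₁ b₂ → F (nothing ∷ r) b₁ b₂)) (Q.sum nothing nothing hs (λ r b₁ b₂ → F (nothing ∷ r) b₁ b₂))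
  go (just (x , z)) (just c₁) (just c₂) hs F = a₁ (- (y₁ * below? z c₁)) (- (y₂ * below? z c₂)) s t
    (P.sum (just c₁) (just c₂) hs (λ r _ _ → F (just (x , z) ∷ r) 0 0)) (Q.sum (just c₁) (just c₂) hs (λ r _ _ → F (just (x , z) ∷ r) 0 0))
  go (just (x , z)) (just c) nothing hs F = b₁ (- (y₁ * below? z c)) y₂ s t
    (P.sum (just c) (just z) hs (λ r _ _ → F (nothing ∷ r) 0 x)) (Q.sum (just c) (just z) hs (λ r _ _ → F (nothing ∷ r) 0 x))
    (P.sum (just c) nothing hs (λ r _ b₂ → sgn x b₂ * F (just (b₂ ⊓ x , z) ∷ r) 0 (b₂ ⊔ x)))
    (Q.sum (just c) nothing hs (λ r _ b₂ → sgn x b₂ * F (just (b₂ ⊓ x , z) ∷ r) 0 (b₂ ⊔ x)))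
  go (just (x , z)) nothing (just c) hs F =
    trans (c₁ s t (y₂ * p₁ + p₂) (y₂ * q₁ + q₂) (y₁ * (j * p₃)) (y₁ * (j * q₃)))
      (cong₂ _+_ (b₂ y₂ s t p₁ q₁ p₂ q₂) (a₁ y₁ j s t p₃ q₃))
    where
    j p₁ q₁ p₂ q₂ p₃ q₃ : ℤ
    j = - (y₂ * below? z c)
    p₁ = P.sum (just z) nothing hs (λ r _ b₂ → F (just (b₂ , c) ∷ r) x 0)
    q₁ = Q.sum (just z) nothing hs (λ r _ b₂ → F (just (b₂ , c) ∷ r) x 0)
    p₂ = P.sum (just z) (just c) hs (λ r _ _ → F (nothing ∷ r) x 0)
    q₂ = Q.sum (just z) (just c) hs (λ r _ _ → F (nothing ∷ r) x 0)
    p₃ = P.sum nothing (just c) hs (λ r b₁ _ → sgn x b₁ * F (just (b₁ ⊓ x , z) ∷ r) (b₁ ⊔ x) 0)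
    q₃ = Q.sum nothing (just c) hs (λ r b₁ _ → sgn x b₁ * F (just (b₁ ⊓ x , z) ∷ r) (b₁ ⊔ x) 0)
  go (just (x , z)) nothing nothing hs F =
    trans (c₁ s t (y₂ * p₁) (y₂ * q₁) (y₁ * (p₂ + y₂ * p₃)) (y₁ * (q₂ + y₂ * q₃)))
      (cong₂ _+_ (d₁ y₂ s t p₁ q₁) (b₁ y₁ y₂ s t p₂ q₂ p₃ q₃))
    where
    p₁ q₁ p₂ q₂ p₃ q₃ : ℤ
    p₁ = P.sum (just z) nothing hs (λ r _ b₂ → F (nothing ∷ r) x b₂)
    q₁ = Q.sum (just z) nothing hs (λ r _ b₂ → F (nothing ∷ r) x b₂)
    p₂ = P.sum nothing (just z) hs (λ r b₁ _ → sgn x b₁ * F (nothing ∷ r) (b₁ ⊔ x) (b₁ ⊓ x))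
    q₂ = Q.sum nothing (just z) hs (λ r b₁ _ → sgn x b₁ * F (nothing ∷ r) (b₁ ⊔ x) (b₁ ⊓ x))
    p₃ = P.sum nothing nothing hs (λ r b₁ b₂ →
          sgn x b₁ * (sgn (b₁ ⊓ x) b₂ * F (just (b₂ ⊓ (b₁ ⊓ x) , z) ∷ r) (b₁ ⊔ x) (b₂ ⊔ (b₁ ⊓ x))))
    q₃ = Q.sum nothing nothing hs (λ r b₁ b₂ →
          sgn x b₁ * (sgn (b₁ ⊓ x) b₂ * F (just (b₂ ⊓ (b₁ ⊓ x) , z) ∷ r) (b₁ ⊔ x) (b₂ ⊔ (b₁ ⊓ x))))

-- The R-matrix and the Yang-Baxter equation.

below?-antisym : ∀ c₁ c₂ → below? c₁ c₂ * below? c₂ c₁ ≡ 0ℤ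
below?-antisym c₁ c₂ with c₁ ℕ.<? c₂
... | yes h rewrite <ᵇ-true h | <ᵇ-false (ℕP.<⇒≯ h) = refl
... | no  h rewrite <ᵇ-false h = ℤP.*-zeroˡ (below? c₂ c₁)

-- The R-matrix of the lattice model on a pair of BPD labels.
exchange : ℤ → ℤ → (ℕ → ℕ → ℤ) → ℕ → ℕ → ℤ
exchange y₁ y₂ G b₁ b₂ = if b₁ <ᵇ b₂ then y₁ * G b₁ b₂ - (y₂ - y₁) * G b₂ b₁ else y₂ * G b₁ b₂

module _ (y₁ y₂ : ℤ) (G : ℕ → ℕ → ℤ) where

  exchange-asc : ∀ {b₁ b₂} → b₁ ℕ.< b₂ → exchange y₁ y₂ G b₁ b₂ ≡ y₁ * G b₁ b₂ - (y₂ - y₁) * G b₂ b₁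
  exchange-asc h rewrite <ᵇ-true h = refl

  exchange-desc : ∀ {b₁ b₂} → ¬ (b₁ ℕ.< b₂) → exchange y₁ y₂ G b₁ b₂ ≡ y₂ * G b₁ b₂
  exchange-desc h rewrite <ᵇ-false h = refl

sgn-cross : ∀ {l b} → l ℕ.< b → sgn l b ≡ -1ℤ
sgn-cross h rewrite <ᵇ-true h = refl

sgn-touch : ∀ {l b} → ¬ (l ℕ.< b) → sgn l b ≡ 1ℤ
sgn-touch h rewrite <ᵇ-false h = refl

-- Signed sorted functions are eigenvectors: the sign turns the off-diagonal term into the missing
-- multiple y₂ - y₁, so a crossing of the two labels absorbs the R-matrix.
exchange-sorted : ∀ y₁ y₂ (G : ℕ → ℕ → ℤ) b₁ b₂ →
  exchange y₁ y₂ (λ b₁ b₂ → sgn b₁ b₂ * G (b₂ ⊓ b₁) (b₂ ⊔ b₁)) b₁ b₂ ≡ y₂ * (sgn b₁ b₂ * G (b₂ ⊓ b₁) (b₂ ⊔ b₁))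
exchange-sorted y₁ y₂ G b₁ b₂ with b₁ ℕ.<? b₂
... | no  h = exchange-desc y₁ y₂ (λ b₁ b₂ → sgn b₁ b₂ * G (b₂ ⊓ b₁) (b₂ ⊔ b₁)) h
... | yes h = trans (exchange-asc y₁ y₂ (λ b₁ b₂ → sgn b₁ b₂ * G (b₂ ⊓ b₁) (b₂ ⊔ b₁)) h)
  (trans (cong₂ (λ u v → y₁ * u - (y₂ - y₁) * v)
      (cong (_* G (b₂ ⊓ b₁) (b₂ ⊔ b₁)) (sgn-cross h))
      (cong₂ _*_ (sgn-touch (ℕP.<⇒≯ h)) (cong₂ G (ℕP.⊓-comm b₁ b₂) (ℕP.⊔-comm b₁ b₂))))
    (trans (alg y₁ y₂ (G (b₂ ⊓ b₁) (b₂ ⊔ b₁))) (cong (λ s → y₂ * (s * G (b₂ ⊓ b₁) (b₂ ⊔ b₁))) (sym (sgn-cross h)))))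
  where
  alg : ∀ y₁ y₂ g → y₁ * (-1ℤ * g) - (y₂ - y₁) * (1ℤ * g) ≡ y₂ * (-1ℤ * g)
  alg = solve-∀

-- One formula covers both orders of the labels, thanks to the sign in `sgn`; its second term is a
-- crossing with coefficient y₂ - y₁.
exchange-elbow : ∀ y₁ y₂ (G : ℕ → ℕ → ℤ) b₁ b₂ →
  exchange y₁ y₂ (λ b₁ b₂ → G b₂ b₁) b₁ b₂ ≡ y₁ * G b₂ b₁ + (y₂ - y₁) * (sgn b₁ b₂ * G (b₂ ⊓ b₁) (b₂ ⊔ b₁))
exchange-elbow y₁ y₂ G b₁ b₂ with b₁ ℕ.<? b₂
... | yes h = trans (exchange-asc y₁ y₂ (λ b₁ b₂ → G b₂ b₁) h)
  (trans (alg y₁ (y₂ - y₁) (G b₂ b₁) (G b₁ b₂))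
    (cong₂ (λ s g → y₁ * G b₂ b₁ + (y₂ - y₁) * (s * g)) (sym (sgn-cross h))
      (sym (cong₂ G (ℕP.m≥n⇒m⊓n≡n (ℕP.<⇒≤ h)) (ℕP.m≥n⇒m⊔n≡m (ℕP.<⇒≤ h))))))
  where
  alg : ∀ y d u v → y * u - d * v ≡ y * u + d * (-1ℤ * v)
  alg = solve-∀
... | no  h = trans (exchange-desc y₁ y₂ (λ b₁ b₂ → G b₂ b₁) h)
  (trans (alg y₁ y₂ (G b₂ b₁))
    (cong₂ (λ s g → y₁ * G b₂ b₁ + (y₂ - y₁) * (s * g)) (sym (sgn-touch h))
      (sym (cong₂ G (ℕP.m≤n⇒m⊓n≡m (ℕP.≮⇒≥ h)) (ℕP.m≤n⇒m⊔n≡n (ℕP.≮⇒≥ h))))))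
  where
  alg : ∀ y₁ y₂ u → y₂ * u ≡ y₁ * u + (y₂ - y₁) * (1ℤ * u)
  alg = solve-∀

exchange-left : ∀ y₁ y₂ (G : ℕ → ℕ → ℤ) x b →
  exchange y₁ y₂ G x b ≡ y₁ * G x b + (y₂ - y₁) * (sgn x b * G (b ⊔ x) (b ⊓ x))
exchange-left y₁ y₂ G x b = exchange-elbow y₁ y₂ (λ u v → G v u) x b

exchange-right : ∀ y₁ y₂ (G : ℕ → ℕ → ℤ) x b → exchange y₁ y₂ G (b ⊔ x) (b ⊓ x) ≡ y₂ * G (b ⊔ x) (b ⊓ x)
exchange-right y₁ y₂ G x b = exchange-desc y₁ y₂ G (ℕP.≤⇒≯ (ℕP.≤-trans (ℕP.m⊓n≤m b x) (ℕP.m≤m⊔n b x)))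

-- Sorting three labels in the two orders given by the Yang–Baxter move.
module _ (y₁ y₂ : ℤ) (G : ℕ → ℕ → ℕ → ℤ) (x : ℕ) where

  threefold : ℕ → ℕ → ℤ
  threefold b₁ b₂ = sgn x b₁ * (sgn (b₁ ⊓ x) b₂ * G (b₂ ⊓ (b₁ ⊓ x)) (b₁ ⊔ x) (b₂ ⊔ (b₁ ⊓ x)))

  private
    value : ∀ {b₁ b₂ s t l m u v} → sgn x b₁ ≡ s → b₁ ⊓ x ≡ l → sgn l b₂ ≡ t → b₂ ⊓ l ≡ m → b₁ ⊔ x ≡ u → b₂ ⊔ l ≡ v →
      threefold b₁ b₂ ≡ s * (t * G m u v)
    value refl refl refl refl refl refl = refl

  -- The braid relation for signed sorting: the R-matrix passes two crossings with the pipe `x`. The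
  -- cases are the relative orders of the three labels.
  exchange-threefold : ∀ b₁ b₂ → exchange y₁ y₂ threefold b₁ b₂ ≡
    sgn x b₁ * (sgn (b₁ ⊓ x) b₂ * exchange y₁ y₂ (G (b₂ ⊓ (b₁ ⊓ x))) (b₁ ⊔ x) (b₂ ⊔ (b₁ ⊓ x)))
  exchange-threefold b₁ b₂ with b₁ ℕ.<? b₂
  exchange-threefold b₁ b₂ | no h = trans (exchange-desc y₁ y₂ threefold h)
    (trans (alg y₂ (sgn x b₁) (sgn (b₁ ⊓ x) b₂) (G (b₂ ⊓ (b₁ ⊓ x)) (b₁ ⊔ x) (b₂ ⊔ (b₁ ⊓ x))))
      (cong (λ g → sgn x b₁ * (sgn (b₁ ⊓ x) b₂ * g)) (sym (exchange-desc y₁ y₂ (G (b₂ ⊓ (b₁ ⊓ x)))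
        (ℕP.≤⇒≯ (ℕP.⊔-lub (ℕP.≤-trans (ℕP.≮⇒≥ h) (ℕP.m≤m⊔n b₁ x)) (ℕP.≤-trans (ℕP.m⊓n≤m b₁ x) (ℕP.m≤m⊔n b₁ x))))))))
    where
    alg : ∀ y s t g → y * (s * (t * g)) ≡ s * (t * (y * g))
    alg = solve-∀
  exchange-threefold b₁ b₂ | yes h with x ℕ.<? b₁ | x ℕ.<? b₂
  ... | yes p | no  q = contradiction (ℕP.<-trans p h) q
  ... | yes p | yes q
    rewrite exchange-asc y₁ y₂ threefold h
          | value {b₁} {b₂} (sgn-cross p) (ℕP.m≥n⇒m⊓n≡n (ℕP.<⇒≤ p)) (sgn-cross q) (ℕP.m≥n⇒m⊓n≡n (ℕP.<⇒≤ q)) (ℕP.m≥n⇒m⊔n≡m (ℕP.<⇒≤ p)) (ℕP.m≥n⇒m⊔n≡m (ℕP.<⇒≤ q))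
          | value {b₂} {b₁} (sgn-cross q) (ℕP.m≥n⇒m⊓n≡n (ℕP.<⇒≤ q)) (sgn-cross p) (ℕP.m≥n⇒m⊓n≡n (ℕP.<⇒≤ p)) (ℕP.m≥n⇒m⊔n≡m (ℕP.<⇒≤ q)) (ℕP.m≥n⇒m⊔n≡m (ℕP.<⇒≤ p))
          | ℕP.m≥n⇒m⊓n≡n (ℕP.<⇒≤ p) | ℕP.m≥n⇒m⊓n≡n (ℕP.<⇒≤ q) | ℕP.m≥n⇒m⊔n≡m (ℕP.<⇒≤ p) | ℕP.m≥n⇒m⊔n≡m (ℕP.<⇒≤ q)
          | sgn-cross p | sgn-cross q | exchange-asc y₁ y₂ (G x) h
    = alg y₁ (y₂ - y₁) (G x b₁ b₂) (G x b₂ b₁)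
    where
    alg : ∀ y d u v → y * (-1ℤ * (-1ℤ * u)) - d * (-1ℤ * (-1ℤ * v)) ≡ -1ℤ * (-1ℤ * (y * u - d * v))
    alg = solve-∀
  ... | no p | yes q
    rewrite exchange-asc y₁ y₂ threefold h
          | value {b₁} {b₂} (sgn-touch p) (ℕP.m≤n⇒m⊓n≡m (ℕP.≮⇒≥ p)) (sgn-cross h) (ℕP.m≥n⇒m⊓n≡n (ℕP.<⇒≤ h)) (ℕP.m≤n⇒m⊔n≡n (ℕP.≮⇒≥ p)) (ℕP.m≥n⇒m⊔n≡m (ℕP.<⇒≤ h))
          | value {b₂} {b₁} (sgn-cross q) (ℕP.m≥n⇒m⊓n≡n (ℕP.<⇒≤ q)) (sgn-touch p) (ℕP.m≤n⇒m⊓n≡m (ℕP.≮⇒≥ p)) (ℕP.m≥n⇒m⊔n≡m (ℕP.<⇒≤ q)) (ℕP.m≤n⇒m⊔n≡n (ℕP.≮⇒≥ p))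
          | ℕP.m≤n⇒m⊓n≡m (ℕP.≮⇒≥ p) | ℕP.m≥n⇒m⊓n≡n (ℕP.<⇒≤ h) | ℕP.m≤n⇒m⊔n≡n (ℕP.≮⇒≥ p) | ℕP.m≥n⇒m⊔n≡m (ℕP.<⇒≤ h)
          | sgn-touch p | sgn-cross h | exchange-asc y₁ y₂ (G b₁) q
    = alg y₁ (y₂ - y₁) (G b₁ x b₂) (G b₁ b₂ x)
    where
    alg : ∀ y d u v → y * (1ℤ * (-1ℤ * u)) - d * (-1ℤ * (1ℤ * v)) ≡ 1ℤ * (-1ℤ * (y * u - d * v))
    alg = solve-∀
  ... | no p | no q
    rewrite exchange-asc y₁ y₂ threefold h
          | value {b₁} {b₂} (sgn-touch p) (ℕP.m≤n⇒m⊓n≡m (ℕP.≮⇒≥ p)) (sgn-cross h) (ℕP.m≥n⇒m⊓n≡n (ℕP.<⇒≤ h)) (ℕP.m≤n⇒m⊔n≡n (ℕP.≮⇒≥ p)) (ℕP.m≥n⇒m⊔n≡m (ℕP.<⇒≤ h))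
          | value {b₂} {b₁} (sgn-touch q) (ℕP.m≤n⇒m⊓n≡m (ℕP.≮⇒≥ q)) (sgn-touch (ℕP.<⇒≯ h)) (ℕP.m≤n⇒m⊓n≡m (ℕP.<⇒≤ h)) (ℕP.m≤n⇒m⊔n≡n (ℕP.≮⇒≥ q)) (ℕP.m≤n⇒m⊔n≡n (ℕP.<⇒≤ h))
          | ℕP.m≤n⇒m⊓n≡m (ℕP.≮⇒≥ p) | ℕP.m≥n⇒m⊓n≡n (ℕP.<⇒≤ h) | ℕP.m≤n⇒m⊔n≡n (ℕP.≮⇒≥ p) | ℕP.m≥n⇒m⊔n≡m (ℕP.<⇒≤ h)
          | sgn-touch p | sgn-cross h | exchange-desc y₁ y₂ (G b₁) {x} {b₂} q
    = alg y₁ y₂ (G b₁ x b₂)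
    where
    alg : ∀ y₁ y₂ u → y₁ * (1ℤ * (-1ℤ * u)) - (y₂ - y₁) * (1ℤ * (1ℤ * u)) ≡ 1ℤ * (-1ℤ * (y₂ * u))
    alg = solve-∀

-- Sliding the R-matrix through the strip, row by row; the four clauses are indexed by the content of the
-- two vertical edges above the strip.
module Train {a₁ a₂ : ℕ} {y₁ y₂ : ℤ} (R : Strip y₂ y₁) where
  open TwoColumns a₁ a₂ y₁ y₂
  open Strip R renaming (sum to right; expand to right-expand)

  D : ℤ
  D = y₂ - y₁

  -- Below the last row the R-matrix acts on the two entry labels; this condition is all that ties
  -- `R` to the strip with the weights in the other order.
  Base : Set
  Base = ∀ S₁ S₂ F → right S₁ S₂ [] F ≡ pair S₁ S₂ [] (λ r → exchange y₁ y₂ (F r))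

  module _ (base : Base) where

    -- In the names, `c` stands for a co-BPD pipe and `b` for a BPD pipe on an upper vertical edge.
    -- A row changes the content of these edges, so the four statements recur into one another.
    train-cc : ∀ {k} c₁ c₂ (hs : Vec H k) F → right (just c₁) (just c₂) hs F ≡
      y₁ * pair (just c₁) (just c₂) hs F - y₁ * D * below? c₁ c₂ * pair (just c₂) (just c₁) hs F
    train-cb : ∀ {k} c (hs : Vec H k) F → right (just c) nothing hs F ≡ y₂ * pair (just c) nothing hs F
    train-bc : ∀ {k} c (hs : Vec H k) F → right nothing (just c) hs F ≡
      y₁ * pair nothing (just c) hs F + D * pair (just c) nothing hs (λ r b₁ b₂ → F r b₂ b₁)
    train-bb : ∀ {k} (hs : Vec H k) F → right nothing nothing hs F ≡ pair nothing nothing hs (λ r → exchange y₁ y₂ (F r))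

    train-cc c₁ c₂ [] F = trans (base (just c₁) (just c₂) F) (alg y₁ (y₁ * D * below? c₁ c₂))
      where
      alg : ∀ u v → 0ℤ ≡ u * 0ℤ - v * 0ℤ
      alg = solve-∀
    train-cc c₁ c₂ (nothing ∷ hs) F = begin
      right (just c₁) (just c₂) (nothing ∷ hs) F
        ≡⟨ right-expand nothing (just c₁) (just c₂) hs F ⟩
      topRow y₂ y₁ right nothing (just c₁) (just c₂) hs F
        ≡⟨ cong₂ _+_ (cong₂ (λ u v → - (y₂ * y₁ * below? c₁ c₂) * u + y₁ * v) (train-bc c₂ hs F₁) (train-cb c₁ hs F₂))
             (train-cc c₁ c₂ hs F₀) ⟩
      - (y₂ * y₁ * below? c₁ c₂) * (y₁ * L₁ + D * L₁′) + y₁ * (y₂ * L₂) + (y₁ * L₀ - y₁ * D * below? c₁ c₂ * L₀′)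
        -- The `L₃` term completes the second top row. It asks for both c₁ < c₂ and c₂ < c₁: two
        -- co-BPD pipes that have crossed cannot cross back.
        ≡⟨ alg y₁ y₂ (below? c₁ c₂) (below? c₂ c₁) L₁ L₁′ L₂ L₀ L₀′ L₃ ⟩
      y₁ * (- (y₁ * y₂ * below? c₁ c₂) * L₁ + y₂ * L₂ + L₀) -
        y₁ * D * below? c₁ c₂ * (- (y₁ * y₂ * below? c₂ c₁) * L₃ + y₂ * L₁′ + L₀′) -
        (below? c₁ c₂ * below? c₂ c₁) * (y₁ * D * (y₁ * y₂) * L₃)
        ≡⟨ cong₂ (λ u v → u - v * (y₁ * D * (y₁ * y₂) * L₃))
             (cong₂ (λ u v → y₁ * u - y₁ * D * below? c₁ c₂ * v) (sym (pair-expand nothing (just c₁) (just c₂) hs F))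
               (sym (pair-expand nothing (just c₂) (just c₁) hs F))) (below?-antisym c₁ c₂) ⟩
      y₁ * pair (just c₁) (just c₂) (nothing ∷ hs) F - y₁ * D * below? c₁ c₂ * pair (just c₂) (just c₁) (nothing ∷ hs) F
        - 0ℤ * (y₁ * D * (y₁ * y₂) * L₃)
        ≡⟨ drop (y₁ * pair (just c₁) (just c₂) (nothing ∷ hs) F - y₁ * D * below? c₁ c₂ * pair (just c₂) (just c₁) (nothing ∷ hs) F)
             (y₁ * D * (y₁ * y₂) * L₃) ⟩
      y₁ * pair (just c₁) (just c₂) (nothing ∷ hs) F - y₁ * D * below? c₁ c₂ * pair (just c₂) (just c₁) (nothing ∷ hs) F ∎
      where
      open ≡-Reasoning
      F₀ F₁ F₂ : _ → ℕ → ℕ → ℤ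
      F₁ r b₁ _ = F (just (b₁ , c₁) ∷ r) 0 0
      F₂ r _ b₂ = F (just (b₂ , c₂) ∷ r) 0 0
      F₀ r _ _ = F (nothing ∷ r) 0 0
      L₀ L₀′ L₁ L₁′ L₂ L₃ : ℤ
      L₁  = pair nothing (just c₂) hs F₁
      L₁′ = pair (just c₂) nothing hs (λ r b₁ b₂ → F₁ r b₂ b₁)
      L₂  = pair (just c₁) nothing hs F₂
      L₀  = pair (just c₁) (just c₂) hs F₀
      L₀′ = pair (just c₂) (just c₁) hs F₀
      L₃  = pair nothing (just c₁) hs (λ r b₁ _ → F (just (b₁ , c₂) ∷ r) 0 0)
      alg : ∀ y₁ y₂ i j a a′ b c c′ d →
        - (y₂ * y₁ * i) * (y₁ * a + (y₂ - y₁) * a′) + y₁ * (y₂ * b) + (y₁ * c - y₁ * (y₂ - y₁) * i * c′) ≡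
        y₁ * (- (y₁ * y₂ * i) * a + y₂ * b + c) - y₁ * (y₂ - y₁) * i * (- (y₁ * y₂ * j) * d + y₂ * a′ + c′) -
        (i * j) * (y₁ * (y₂ - y₁) * (y₁ * y₂) * d)
      alg = solve-∀
      drop : ∀ u v → u - 0ℤ * v ≡ u
      drop = solve-∀
    train-cc c₁ c₂ (just (x , z) ∷ hs) F = begin
      right (just c₁) (just c₂) (just (x , z) ∷ hs) F
        ≡⟨ right-expand (just (x , z)) (just c₁) (just c₂) hs F ⟩
      - (y₂ * below? z c₁) * (- (y₁ * below? z c₂) * right (just c₁) (just c₂) hs F₀)
        ≡⟨ cong (λ u → - (y₂ * below? z c₁) * (- (y₁ * below? z c₂) * u)) (train-cc c₁ c₂ hs F₀) ⟩
      - (y₂ * below? z c₁) * (- (y₁ * below? z c₂) * (y₁ * L₀ - y₁ * D * below? c₁ c₂ * L₀′))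
        ≡⟨ alg y₁ y₂ D (below? c₁ c₂) (below? z c₁) (below? z c₂) L₀ L₀′ ⟩
      y₁ * (- (y₁ * below? z c₁) * (- (y₂ * below? z c₂) * L₀)) -
        y₁ * D * below? c₁ c₂ * (- (y₁ * below? z c₂) * (- (y₂ * below? z c₁) * L₀′))
        ≡⟨ cong₂ (λ u v → y₁ * u - y₁ * D * below? c₁ c₂ * v) (sym (pair-expand (just (x , z)) (just c₁) (just c₂) hs F))
               (sym (pair-expand (just (x , z)) (just c₂) (just c₁) hs F)) ⟩
      y₁ * pair (just c₁) (just c₂) (just (x , z) ∷ hs) F - y₁ * D * below? c₁ c₂ * pair (just c₂) (just c₁) (just (x , z) ∷ hs) F ∎
      where
      open ≡-Reasoning
      F₀ : _ → ℕ → ℕ → ℤ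
      F₀ r _ _ = F (just (x , z) ∷ r) 0 0
      L₀ L₀′ : ℤ
      L₀  = pair (just c₁) (just c₂) hs F₀
      L₀′ = pair (just c₂) (just c₁) hs F₀
      alg : ∀ y₁ y₂ d i j k a b → - (y₂ * j) * (- (y₁ * k) * (y₁ * a - y₁ * d * i * b)) ≡
        y₁ * (- (y₁ * j) * (- (y₂ * k) * a)) - y₁ * d * i * (- (y₁ * k) * (- (y₂ * j) * b))
      alg = solve-∀

    train-cb c [] F = trans (base (just c) nothing F) (sym (ℤP.*-zeroʳ y₂))
    train-cb c (nothing ∷ hs) F = begin
      right (just c) nothing (nothing ∷ hs) F
        ≡⟨ right-expand nothing (just c) nothing hs F ⟩
      topRow y₂ y₁ right nothing (just c) nothing hs F
        ≡⟨ cong₂ (λ u v → y₂ * u + y₁ * v) (cong₂ (λ u v → u + y₁ * v) (train-bc c hs F₁) bb) (train-cb c hs F₃) ⟩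
      y₂ * ((y₁ * L₁ + D * L₃) + y₁ * (y₂ * L₂)) + y₁ * (y₂ * L₃)
        ≡⟨ alg y₁ y₂ L₁ L₂ L₃ ⟩
      y₂ * (y₁ * (L₁ + y₂ * L₂) + y₂ * L₃)
        ≡⟨ cong (_*_ y₂) (sym (pair-expand nothing (just c) nothing hs F)) ⟩
      y₂ * pair (just c) nothing (nothing ∷ hs) F ∎
      where
      open ≡-Reasoning
      F₁ F₂ F₃ : _ → ℕ → ℕ → ℤ
      F₁ r b₁ _ = F (nothing ∷ r) 0 b₁
      F₂ r b₁ b₂ = sgn b₁ b₂ * F (just (b₂ ⊓ b₁ , c) ∷ r) 0 (b₂ ⊔ b₁)
      F₃ r _ b₂ = F (nothing ∷ r) 0 b₂
      L₁ L₂ L₃ : ℤ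
      L₁ = pair nothing (just c) hs F₁
      L₂ = pair nothing nothing hs F₂
      L₃ = pair (just c) nothing hs F₃
      bb : right nothing nothing hs F₂ ≡ y₂ * L₂
      bb = trans (train-bb hs F₂) (trans (pair-cong nothing nothing hs (λ r b₁ b₂ →
        exchange-sorted y₁ y₂ (λ m M → F (just (m , c) ∷ r) 0 M) b₁ b₂)) (pair-scale nothing nothing hs y₂ F₂))
      alg : ∀ y₁ y₂ a b c → y₂ * ((y₁ * a + (y₂ - y₁) * c) + y₁ * (y₂ * b)) + y₁ * (y₂ * c) ≡ y₂ * (y₁ * (a + y₂ * b) + y₂ * c)
      alg = solve-∀
    train-cb c (just (x , z) ∷ hs) F = begin
      right (just c) nothing (just (x , z) ∷ hs) F
        ≡⟨ right-expand (just (x , z)) (just c) nothing hs F ⟩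
      topRow y₂ y₁ right (just (x , z)) (just c) nothing hs F
        ≡⟨ cong₂ (λ u v → - (y₂ * below? z c) * (u + y₁ * v)) (train-cc c z hs F₁) (train-cb c hs F₂) ⟩
      - (y₂ * below? z c) * ((y₁ * L₁ - y₁ * D * below? c z * L₁′) + y₁ * (y₂ * L₂))
        -- The surplus term of `train-cc` for the labels c, z meets the factor that requires z < c.
        ≡⟨ alg y₁ y₂ D (below? z c) (below? c z) L₁ L₁′ L₂ ⟩
      y₂ * (- (y₁ * below? z c) * (L₁ + y₂ * L₂)) + (below? z c * below? c z) * (y₂ * (y₁ * D * L₁′))
        ≡⟨ cong₂ (λ u v → y₂ * u + v * (y₂ * (y₁ * D * L₁′))) (sym (pair-expand (just (x , z)) (just c) nothing hs F)) (below?-antisym z c) ⟩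
      y₂ * pair (just c) nothing (just (x , z) ∷ hs) F + 0ℤ * (y₂ * (y₁ * D * L₁′))
        ≡⟨ drop (y₂ * pair (just c) nothing (just (x , z) ∷ hs) F) (y₂ * (y₁ * D * L₁′)) ⟩
      y₂ * pair (just c) nothing (just (x , z) ∷ hs) F ∎
      where
      open ≡-Reasoning
      F₁ F₂ : _ → ℕ → ℕ → ℤ
      F₁ r _ _ = F (nothing ∷ r) 0 x
      F₂ r _ b₂ = sgn x b₂ * F (just (b₂ ⊓ x , z) ∷ r) 0 (b₂ ⊔ x)
      L₁ L₁′ L₂ : ℤ
      L₁ = pair (just c) (just z) hs F₁
      L₁′ = pair (just z) (just c) hs F₁
      L₂ = pair (just c) nothing hs F₂
      alg : ∀ y₁ y₂ d i j a a′ b → - (y₂ * i) * ((y₁ * a - y₁ * d * j * a′) + y₁ * (y₂ * b)) ≡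
        y₂ * (- (y₁ * i) * (a + y₂ * b)) + (i * j) * (y₂ * (y₁ * d * a′))
      alg = solve-∀
      drop : ∀ u v → u + 0ℤ * v ≡ u
      drop = solve-∀

    train-bc c [] F = trans (base nothing (just c) F) (alg y₁ D)
      where
      alg : ∀ u v → 0ℤ ≡ u * 0ℤ + v * 0ℤ
      alg = solve-∀
    train-bc c (nothing ∷ hs) F = begin
      right nothing (just c) (nothing ∷ hs) F
        ≡⟨ right-expand nothing nothing (just c) hs F ⟩
      topRow y₂ y₁ right nothing nothing (just c) hs F
        ≡⟨ cong₂ (λ u v → y₂ * (y₁ * u + v)) bb (train-bc c hs F₂) ⟩
      y₂ * (y₁ * (y₁ * L₁ + D * L₃) + (y₁ * L₂ + D * L₂′))
        ≡⟨ alg y₁ y₂ L₁ L₂ L₂′ L₃ ⟩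
      y₁ * (y₁ * (y₂ * L₁ + L₂)) + D * (y₁ * (L₂ + y₂ * L₃) + y₂ * L₂′)
        ≡⟨ cong₂ (λ u v → y₁ * u + D * v) (sym (pair-expand nothing nothing (just c) hs F))
             (sym (pair-expand nothing (just c) nothing hs (λ r b₁ b₂ → F r b₂ b₁))) ⟩
      y₁ * pair nothing (just c) (nothing ∷ hs) F + D * pair (just c) nothing (nothing ∷ hs) (λ r b₁ b₂ → F r b₂ b₁) ∎
      where
      open ≡-Reasoning
      F₁ F₂ F₃ : _ → ℕ → ℕ → ℤ
      F₁ r b₁ b₂ = F (just (b₂ , c) ∷ r) b₁ 0
      F₂ r b₁ _ = F (nothing ∷ r) b₁ 0
      F₃ r b₁ b₂ = sgn b₁ b₂ * F (just (b₂ ⊓ b₁ , c) ∷ r) (b₂ ⊔ b₁) 0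
      L₁ L₂ L₂′ L₃ : ℤ
      L₁ = pair nothing nothing hs F₁
      L₂ = pair nothing (just c) hs F₂
      L₂′ = pair (just c) nothing hs (λ r b₁ b₂ → F₂ r b₂ b₁)
      L₃ = pair nothing nothing hs F₃
      bb : right nothing nothing hs F₁ ≡ y₁ * L₁ + D * L₃
      bb = trans (train-bb hs F₁) (trans (pair-cong nothing nothing hs (λ r b₁ b₂ →
        exchange-elbow y₁ y₂ (λ m M → F (just (m , c) ∷ r) M 0) b₁ b₂)) (pair-linear nothing nothing hs y₁ D F₁ F₃))
      alg : ∀ y₁ y₂ a b b′ c → y₂ * (y₁ * (y₁ * a + (y₂ - y₁) * c) + (y₁ * b + (y₂ - y₁) * b′)) ≡
        y₁ * (y₁ * (y₂ * a + b)) + (y₂ - y₁) * (y₁ * (b + y₂ * c) + y₂ * b′)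
      alg = solve-∀
    train-bc c (just (x , z) ∷ hs) F = begin
      right nothing (just c) (just (x , z) ∷ hs) F
        ≡⟨ right-expand (just (x , z)) nothing (just c) hs F ⟩
      topRow y₂ y₁ right (just (x , z)) nothing (just c) hs F
        ≡⟨ cong₂ _+_ (cong₂ (λ u v → y₁ * u + v) (train-cb z hs F₁) (train-cc z c hs F₂))
             (cong (λ u → y₂ * (- (y₁ * below? z c) * u)) (train-bc c hs F₃)) ⟩
      (y₁ * (y₂ * L₁) + (y₁ * L₂ - y₁ * D * below? z c * L₂′)) + y₂ * (- (y₁ * below? z c) * (y₁ * L₃ + D * L₃′))
        ≡⟨ alg y₁ y₂ D (below? z c) L₁ L₂ L₂′ L₃ L₃′ ⟩
      y₁ * ((y₂ * L₁ + L₂) + y₁ * (- (y₂ * below? z c) * L₃)) + D * (- (y₁ * below? z c) * (L₂′ + y₂ * L₃′))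
        ≡⟨ cong₂ (λ u v → y₁ * u + D * v) (sym (pair-expand (just (x , z)) nothing (just c) hs F))
             (sym (pair-expand (just (x , z)) (just c) nothing hs (λ r b₁ b₂ → F r b₂ b₁))) ⟩
      y₁ * pair nothing (just c) (just (x , z) ∷ hs) F + D * pair (just c) nothing (just (x , z) ∷ hs) (λ r b₁ b₂ → F r b₂ b₁) ∎
      where
      open ≡-Reasoning
      F₁ F₂ F₃ : _ → ℕ → ℕ → ℤ
      F₁ r _ b₂ = F (just (b₂ , c) ∷ r) x 0
      F₂ r _ _ = F (nothing ∷ r) x 0
      F₃ r b₁ _ = sgn x b₁ * F (just (b₁ ⊓ x , z) ∷ r) (b₁ ⊔ x) 0
      L₁ L₂ L₂′ L₃ L₃′ : ℤ
      L₁ = pair (just z) nothing hs F₁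
      L₂ = pair (just z) (just c) hs F₂
      L₂′ = pair (just c) (just z) hs F₂
      L₃ = pair nothing (just c) hs F₃
      L₃′ = pair (just c) nothing hs (λ r b₁ b₂ → F₃ r b₂ b₁)
      alg : ∀ y₁ y₂ d i a b b′ c c′ → (y₁ * (y₂ * a) + (y₁ * b - y₁ * d * i * b′)) + y₂ * (- (y₁ * i) * (y₁ * c + d * c′)) ≡
        y₁ * ((y₂ * a + b) + y₁ * (- (y₂ * i) * c)) + d * (- (y₁ * i) * (b′ + y₂ * c′))
      alg = solve-∀

    train-bb [] F = base nothing nothing F
    train-bb (nothing ∷ hs) F = begin
      right nothing nothing (nothing ∷ hs) F
        ≡⟨ right-expand nothing nothing nothing hs F ⟩
      y₂ * (y₁ * right nothing nothing hs F₁)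
        ≡⟨ cong (λ u → y₂ * (y₁ * u)) (train-bb hs F₁) ⟩
      y₂ * (y₁ * pair nothing nothing hs (λ r → exchange y₁ y₂ (F₁ r)))
        ≡⟨ alg y₁ y₂ (pair nothing nothing hs (λ r → exchange y₁ y₂ (F₁ r))) ⟩
      y₁ * (y₂ * pair nothing nothing hs (λ r → exchange y₁ y₂ (F₁ r)))
        ≡⟨ sym (pair-expand nothing nothing nothing hs (λ r → exchange y₁ y₂ (F r))) ⟩
      pair nothing nothing (nothing ∷ hs) (λ r → exchange y₁ y₂ (F r)) ∎
      where
      open ≡-Reasoning
      F₁ : _ → ℕ → ℕ → ℤ
      F₁ r b₁ b₂ = F (nothing ∷ r) b₁ b₂
      alg : ∀ a b c → b * (a * c) ≡ a * (b * c)
      alg = solve-∀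
    train-bb (just (x , z) ∷ hs) F = begin
      right nothing nothing (just (x , z) ∷ hs) F
        ≡⟨ right-expand (just (x , z)) nothing nothing hs F ⟩
      topRow y₂ y₁ right (just (x , z)) nothing nothing hs F
        ≡⟨ cong₂ (λ u v → y₁ * u + y₂ * v) (train-cb z hs F₁) (cong₂ (λ u v → u + y₁ * v) (train-bc z hs F₂) bb) ⟩
      y₁ * (y₂ * L₁) + y₂ * ((y₁ * L₂ + D * L₂′) + y₁ * L₃)
        ≡⟨ alg y₁ y₂ D L₁ L₂ L₂′ L₃ ⟩
      y₂ * (y₁ * L₁ + D * L₂′) + y₁ * (y₂ * L₂ + y₂ * L₃)
        ≡⟨ cong₂ (λ u v → y₂ * u + y₁ * (v + y₂ * L₃)) (sym e₁) (sym e₂) ⟩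
      topRow y₁ y₂ pair (just (x , z)) nothing nothing hs (λ r → exchange y₁ y₂ (F r))
        ≡⟨ sym (pair-expand (just (x , z)) nothing nothing hs (λ r → exchange y₁ y₂ (F r))) ⟩
      pair nothing nothing (just (x , z) ∷ hs) (λ r → exchange y₁ y₂ (F r)) ∎
      where
      open ≡-Reasoning
      F₁ F₂ F₃ : _ → ℕ → ℕ → ℤ
      F₁ r _ b₂ = F (nothing ∷ r) x b₂
      F₂ r b₁ _ = sgn x b₁ * F (nothing ∷ r) (b₁ ⊔ x) (b₁ ⊓ x)
      F₃ r = threefold y₁ y₂ (λ m u v → F (just (m , z) ∷ r) u v) x
      L₁ L₂ L₂′ L₃ : ℤ
      L₁ = pair (just z) nothing hs F₁
      L₂ = pair nothing (just z) hs F₂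
      L₂′ = pair (just z) nothing hs (λ r b₁ b₂ → F₂ r b₂ b₁)
      L₃ = pair nothing nothing hs (λ r b₁ b₂ → sgn x b₁ * (sgn (b₁ ⊓ x) b₂ *
             exchange y₁ y₂ (F (just (b₂ ⊓ (b₁ ⊓ x) , z) ∷ r)) (b₁ ⊔ x) (b₂ ⊔ (b₁ ⊓ x))))
      bb : right nothing nothing hs F₃ ≡ L₃
      bb = trans (train-bb hs F₃) (pair-cong nothing nothing hs (λ r b₁ b₂ →
        exchange-threefold y₁ y₂ (λ m u v → F (just (m , z) ∷ r) u v) x b₁ b₂))
      e₁ : pair (just z) nothing hs (λ r _ b₂ → exchange y₁ y₂ (F (nothing ∷ r)) x b₂) ≡ y₁ * L₁ + D * L₂′
      e₁ = trans (pair-cong (just z) nothing hs (λ r _ b₂ → exchange-left y₁ y₂ (F (nothing ∷ r)) x b₂))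
        (pair-linear (just z) nothing hs y₁ D F₁ (λ r b₁ b₂ → F₂ r b₂ b₁))
      e₂ : pair nothing (just z) hs (λ r b₁ _ → sgn x b₁ * exchange y₁ y₂ (F (nothing ∷ r)) (b₁ ⊔ x) (b₁ ⊓ x)) ≡ y₂ * L₂
      e₂ = trans (pair-cong nothing (just z) hs (λ r b₁ _ → trans
          (cong (_*_ (sgn x b₁)) (exchange-right y₁ y₂ (F (nothing ∷ r)) x b₁))
          (swap (sgn x b₁) y₂ (F (nothing ∷ r) (b₁ ⊔ x) (b₁ ⊓ x)))))
        (pair-scale nothing (just z) hs y₂ F₂)
        where
        swap : ∀ a b c → a * (b * c) ≡ b * (a * c)
        swap = solve-∀
      alg : ∀ y₁ y₂ d a b b′ c → y₁ * (y₂ * a) + y₂ * ((y₁ * b + d * b′) + y₁ * c) ≡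
        y₂ * (y₁ * a + d * b′) + y₁ * (y₂ * b + y₂ * c)
      alg = solve-∀

-- This is `train-cc` for the strip obtained by applying the R-matrix to the entry labels; the two
-- branches are those of `exchange`.
two-columns : ∀ {k} a₁ a₂ y₁ y₂ c₁ c₂ (hs : Vec H k) F →
  let open TwoColumns using (pair) in
  y₁ * pair a₁ a₂ y₁ y₂ (just c₁) (just c₂) hs F
    - y₁ * (y₂ - y₁) * below? c₁ c₂ * pair a₁ a₂ y₁ y₂ (just c₂) (just c₁) hs F ≡
  (if a₁ <ᵇ a₂
    then y₁ * pair a₁ a₂ y₂ y₁ (just c₁) (just c₂) hs F - (y₂ - y₁) * pair a₂ a₁ y₂ y₁ (just c₁) (just c₂) hs F
    else y₂ * pair a₁ a₂ y₂ y₁ (just c₁) (just c₂) hs F)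
two-columns a₁ a₂ y₁ y₂ c₁ c₂ hs F with a₁ ℕ.<? a₂
... | yes h rewrite <ᵇ-true h = trans (sym (Train.train-cc R base c₁ c₂ hs F)) (alg y₁ (y₂ - y₁) p q)
  where
  open TwoColumns
  R : Strip y₂ y₁
  R = combineStrips y₁ (- (y₂ - y₁)) (pairStrip a₁ a₂ y₂ y₁) (pairStrip a₂ a₁ y₂ y₁)
  p q : ℤ
  p = pair a₁ a₂ y₂ y₁ (just c₁) (just c₂) hs F
  q = pair a₂ a₁ y₂ y₁ (just c₁) (just c₂) hs F
  alg : ∀ a d p q → a * p + - d * q ≡ a * p - d * q
  alg = solve-∀
  zz : ∀ a d → a * 0ℤ + - d * 0ℤ ≡ 0ℤ
  zz = solve-∀
  base : Train.Base {a₁} {a₂} R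
  base (just _) (just _) F = zz y₁ (y₂ - y₁)
  base (just _) nothing  F = zz y₁ (y₂ - y₁)
  base nothing  (just _) F = zz y₁ (y₂ - y₁)
  base nothing  nothing  F = trans (alg y₁ (y₂ - y₁) (F [] a₁ a₂) (F [] a₂ a₁)) (sym (exchange-asc y₁ y₂ (F []) h))
... | no h rewrite <ᵇ-false h = trans (sym (Train.train-cc R base c₁ c₂ hs F)) (alg y₂ p)
  where
  open TwoColumns
  R : Strip y₂ y₁
  R = combineStrips y₂ 0ℤ (pairStrip a₁ a₂ y₂ y₁) (pairStrip a₁ a₂ y₂ y₁)
  p : ℤ
  p = pair a₁ a₂ y₂ y₁ (just c₁) (just c₂) hs F
  alg : ∀ a p → a * p + 0ℤ * p ≡ a * p
  alg = solve-∀
  base : Train.Base {a₁} {a₂} R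
  base (just _) (just _) F = trans (alg y₂ 0ℤ) (ℤP.*-zeroʳ y₂)
  base (just _) nothing  F = trans (alg y₂ 0ℤ) (ℤP.*-zeroʳ y₂)
  base nothing  (just _) F = trans (alg y₂ 0ℤ) (ℤP.*-zeroʳ y₂)
  base nothing  nothing  F = trans (alg y₂ (F [] a₁ a₂)) (sym (exchange-desc y₁ y₂ (F []) h))

-- Finite sums over lists and words.

sumL : ∀ {A : Set} → List A → (A → ℤ) → ℤ
sumL []       f = 0ℤ
sumL (x ∷ xs) f = f x + sumL xs f

sumL-cong : ∀ {A : Set} (xs : List A) {f g : A → ℤ} → (∀ x → f x ≡ g x) → sumL xs f ≡ sumL xs g
sumL-cong []       e = refl
sumL-cong (x ∷ xs) e = cong₂ _+_ (e x) (sumL-cong xs e)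

sumL-linear : ∀ {A : Set} (xs : List A) s t (f g : A → ℤ) →
  sumL xs (λ x → s * f x + t * g x) ≡ s * sumL xs f + t * sumL xs g
sumL-linear []       s t f g = sym (cong₂ _+_ (ℤP.*-zeroʳ s) (ℤP.*-zeroʳ t))
sumL-linear (x ∷ xs) s t f g =
  trans (cong (_+_ (s * f x + t * g x)) (sumL-linear xs s t f g)) (alg s t (f x) (g x) (sumL xs f) (sumL xs g))
  where
  alg : ∀ s t a b c d → (s * a + t * b) + (s * c + t * d) ≡ s * (a + c) + t * (b + d)
  alg = solve-∀

sumL-+ : ∀ {A : Set} (xs : List A) (f g : A → ℤ) → sumL xs (λ x → f x + g x) ≡ sumL xs f + sumL xs g
sumL-+ xs f g = trans (sumL-cong xs (λ x → alg (f x) (g x))) (trans (sumL-linear xs 1ℤ 1ℤ f g) (sym (alg (sumL xs f) (sumL xs g))))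
  where
  alg : ∀ a b → a + b ≡ 1ℤ * a + 1ℤ * b
  alg = solve-∀

sumL-scale : ∀ {A : Set} (xs : List A) s (f : A → ℤ) → sumL xs (λ x → s * f x) ≡ s * sumL xs f
sumL-scale []       s f = sym (ℤP.*-zeroʳ s)
sumL-scale (x ∷ xs) s f = trans (cong (_+_ (s * f x)) (sumL-scale xs s f)) (sym (ℤP.*-distribˡ-+ s (f x) (sumL xs f)))

sumL-zero : ∀ {A : Set} (xs : List A) → sumL xs (λ _ → 0ℤ) ≡ 0ℤ
sumL-zero []       = refl
sumL-zero (x ∷ xs) = trans (ℤP.+-identityˡ (sumL xs (λ _ → 0ℤ))) (sumL-zero xs)

sumL-++ : ∀ {A : Set} (xs ys : List A) f → sumL (xs ++ ys) f ≡ sumL xs f + sumL ys f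
sumL-++ []       ys f = sym (ℤP.+-identityˡ (sumL ys f))
sumL-++ (x ∷ xs) ys f = trans (cong (_+_ (f x)) (sumL-++ xs ys f)) (sym (ℤP.+-assoc (f x) (sumL xs f) (sumL ys f)))

sumL-comm : ∀ {A B : Set} (xs : List A) (ys : List B) (f : A → B → ℤ) →
  sumL xs (λ x → sumL ys (f x)) ≡ sumL ys (λ y → sumL xs (λ x → f x y))
sumL-comm []       ys f = sym (sumL-zero ys)
sumL-comm (x ∷ xs) ys f = trans (cong (_+_ (sumL ys (f x))) (sumL-comm xs ys f))
  (sym (sumL-+ ys (f x) (λ y → sumL xs (λ x → f x y))))

sumL-map : ∀ {A B : Set} (g : A → B) (xs : List A) f → sumL (List.map g xs) f ≡ sumL xs (f ∘ g)
sumL-map g []       f = refl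
sumL-map g (x ∷ xs) f = cong (_+_ (f (g x))) (sumL-map g xs f)

sumL-concatMap : ∀ {A B : Set} (g : A → List B) (xs : List A) f → sumL (concatMap g xs) f ≡ sumL xs (λ x → sumL (g x) f)
sumL-concatMap g []       f = refl
sumL-concatMap g (x ∷ xs) f = trans (sumL-++ (g x) (concatMap g xs) f) (cong (_+_ (sumL (g x) f)) (sumL-concatMap g xs f))

sumL-allVecs : ∀ {A : Set} (xs : List A) k (f : Vec A (suc k) → ℤ) →
  sumL (allVecs xs (suc k)) f ≡ sumL xs (λ x → sumL (allVecs xs k) (λ v → f (x ∷ v)))
sumL-allVecs xs k f = trans (sumL-concatMap (λ x → List.map (x ∷_) (allVecs xs k)) xs f)
  (sumL-cong xs (λ x → sumL-map (x ∷_) (allVecs xs k) f))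

swapV : ∀ {m} {A : Set} → Fin m → Vec A (suc m) → Vec A (suc m)
swapV zero    (x ∷ y ∷ v) = y ∷ x ∷ v
swapV (suc i) (x ∷ v)     = x ∷ swapV i v

swapV-involutive : ∀ {m} {A : Set} (i : Fin m) (v : Vec A (suc m)) → swapV i (swapV i v) ≡ v
swapV-involutive zero    (x ∷ y ∷ v) = refl
swapV-involutive (suc i) (x ∷ v)     = cong (x ∷_) (swapV-involutive i v)

lookup-swapV : ∀ {m} {A : Set} (i : Fin m) (v : Vec A (suc m)) j → lookup (swapV i v) j ≡ lookup v (swapAt i j)
lookup-swapV zero    (x ∷ y ∷ v) zero          = refl
lookup-swapV zero    (x ∷ y ∷ v) (suc zero)    = refl
lookup-swapV zero    (x ∷ y ∷ v) (suc (suc j)) = refl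
lookup-swapV (suc i) (x ∷ v)     zero          = refl
lookup-swapV (suc i) (x ∷ v)     (suc j)       = trans (lookup-swapV i v j) (cong (lookup (x ∷ v)) (sym (swapAt-suc i j)))

tabulate-swapV : ∀ {m} {A : Set} (i : Fin m) (f : Fin (suc m) → A) → tabulate (f ∘ swapAt i) ≡ swapV i (tabulate f)
tabulate-swapV zero    f = refl
tabulate-swapV (suc i) f = cong (f zero ∷_)
  (trans (VecP.tabulate-cong (λ j → cong f (swapAt-suc i j))) (tabulate-swapV i (f ∘ suc)))

map-swapV : ∀ {m} {A B : Set} (g : A → B) (i : Fin m) v → Vec.map g (swapV i v) ≡ swapV i (Vec.map g v)
map-swapV g zero    (x ∷ y ∷ v) = refl
map-swapV g (suc i) (x ∷ v)     = cong (g x ∷_) (map-swapV g i v)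

-- Summing over all words, not only permutations, makes the exchange of two letters a plain
-- reindexing.
sumL-swapV : ∀ {m} {A : Set} (i : Fin m) (xs : List A) (f : Vec A (suc m) → ℤ) →
  sumL (allVecs xs (suc m)) (f ∘ swapV i) ≡ sumL (allVecs xs (suc m)) f
sumL-swapV zero xs f = trans (two (f ∘ swapV zero)) (trans (sumL-comm xs xs _) (sym (two f)))
  where
  two : ∀ f → sumL (allVecs xs _) f ≡ sumL xs (λ x → sumL xs (λ y → sumL (allVecs xs _) (λ v → f (x ∷ y ∷ v))))
  two f = trans (sumL-allVecs xs _ f) (sumL-cong xs (λ x → sumL-allVecs xs _ (λ v → f (x ∷ v))))
sumL-swapV (suc i) xs f = trans (sumL-allVecs xs _ (f ∘ swapV (suc i)))
  (trans (sumL-cong xs (λ x → sumL-swapV i xs (λ v → f (x ∷ v)))) (sym (sumL-allVecs xs _ f)))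

sumL-only : ∀ {A : Set} {n} (g : Fin n → A) k (f : A → ℤ) → (∀ i → i ≢ k → f (g i) ≡ 0ℤ) → sumL (List.tabulate g) f ≡ f (g k)
sumL-only g zero    f h = trans (cong (_+_ (f (g zero)))
  (trans (vanish (g ∘ suc) (λ i → h (suc i) (λ ()))) refl)) (ℤP.+-identityʳ (f (g zero)))
  where
  vanish : ∀ {n} (g : Fin n → _) → (∀ i → f (g i) ≡ 0ℤ) → sumL (List.tabulate g) f ≡ 0ℤ
  vanish {zero}  g h = refl
  vanish {suc n} g h = cong₂ _+_ (h zero) (vanish (g ∘ suc) (h ∘ suc))
sumL-only g (suc k) f h =
  trans (cong₂ _+_ (h zero (λ ())) (sumL-only (g ∘ suc) k f (λ i ne → h (suc i) (ne ∘ FinP.suc-injective))))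
        (ℤP.+-identityˡ (f (g (suc k))))

words : ∀ N k → List (Vec (Fin N) k)
words N = allVecs (allFin N)

sumL-only-word : ∀ {N} k (w : Vec (Fin N) k) (f : Vec (Fin N) k → ℤ) → (∀ v → v ≢ w → f v ≡ 0ℤ) → sumL (words N k) f ≡ f w
sumL-only-word zero    []      f h = ℤP.+-identityʳ (f [])
sumL-only-word {N} (suc k) (a ∷ w) f h = trans (sumL-allVecs (allFin N) k f)
  (trans (sumL-only id a (λ x → sumL (words N k) (λ v → f (x ∷ v)))
           (λ i ne → trans (sumL-cong (words N k) (λ v → h (i ∷ v) (ne ∘ VecP.∷-injectiveˡ))) (sumL-zero (words N k))))
         (sumL-only-word k w (λ v → f (a ∷ v)) (λ v ne → h (a ∷ v) (ne ∘ VecP.∷-injectiveʳ))))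

sumL-poly : ∀ {A : Set} {n} (xs : List A) {f : A → Pt n → ℤ} → (∀ a → IsPoly (f a)) → IsPoly (λ x → sumL xs (λ a → f a x))
sumL-poly []       h = const-poly 0ℤ
sumL-poly (a ∷ xs) h = +-poly (h a) (sumL-poly xs h)

-- All columns together.

chain : ∀ {n k} → Vec ℕ n → Vec ℕ n → Vec ℤ n → Vec H k → (Vec H k → ℤ) → ℤ
chain []       []       []       hs E = E hs
-- The BPD label at the top is dropped: a co-BPD pipe enters there, so no BPD pipe leaves.
chain (a ∷ as) (c ∷ cs) (y ∷ ys) hs E = column (just c) a y hs (λ q _ → chain as cs ys q E)

-- The relation for two neighbouring columns, carried past the columns to their left by linearity.
-- The summand `0ℤ * 0ℤ` gives both branches the shape of a linear combination.
chain-exchange : ∀ {m k} (i : Fin m) (as cs : Vec ℕ (suc m)) ys (hs : Vec H k) E →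
  let ya = lookup ys (inject₁ i); yb = lookup ys (suc i) in
  ya * chain as cs ys hs E
    + - (ya * (yb - ya) * below? (lookup cs (inject₁ i)) (lookup cs (suc i))) * chain as (swapV i cs) ys hs E ≡
  (if lookup as (inject₁ i) <ᵇ lookup as (suc i)
    then ya * chain as cs (swapV i ys) hs E + - (yb - ya) * chain (swapV i as) cs (swapV i ys) hs E
    else yb * chain as cs (swapV i ys) hs E + 0ℤ * 0ℤ)
chain-exchange zero (a₁ ∷ a₂ ∷ as) (c₁ ∷ c₂ ∷ cs) (y₁ ∷ y₂ ∷ ys) hs E =
  trans (alg y₁ (y₁ * (y₂ - y₁) * below? c₁ c₂) (p c₁ c₂) (p c₂ c₁))
    (trans (two-columns a₁ a₂ y₁ y₂ c₁ c₂ hs (λ r _ _ → chain as cs ys r E)) (fix (a₁ <ᵇ a₂)))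
  where
  p : ℕ → ℕ → ℤ
  p c c′ = TwoColumns.pair a₁ a₂ y₁ y₂ (just c) (just c′) hs (λ r _ _ → chain as cs ys r E)
  p₁ p₂ : ℤ
  p₁ = TwoColumns.pair a₁ a₂ y₂ y₁ (just c₁) (just c₂) hs (λ r _ _ → chain as cs ys r E)
  p₂ = TwoColumns.pair a₂ a₁ y₂ y₁ (just c₁) (just c₂) hs (λ r _ _ → chain as cs ys r E)
  alg : ∀ a d p q → a * p + - d * q ≡ a * p - d * q
  alg = solve-∀
  fix : ∀ b → (if b then y₁ * p₁ - (y₂ - y₁) * p₂ else y₂ * p₁) ≡ (if b then y₁ * p₁ + - (y₂ - y₁) * p₂ else y₂ * p₁ + 0ℤ * 0ℤ)
  fix true  = sym (alg y₁ (y₂ - y₁) p₁ p₂)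
  fix false = sym (ℤP.+-identityʳ (y₂ * p₁))
chain-exchange (suc i) (a ∷ as) (c ∷ cs) (y ∷ ys) hs E =
  trans (sym (column-linear (just c) a y hs ya (- (ya * (yb - ya) * below? (lookup cs (inject₁ i)) (lookup cs (suc i))))
           (λ q _ → chain as cs ys q E) (λ q _ → chain as (swapV i cs) ys q E)))
    (trans (column-cong (just c) a y hs (λ q _ → chain-exchange i as cs ys q E)) (split (lookup as (inject₁ i) <ᵇ lookup as (suc i))))
  where
  ya yb : ℤ
  ya = lookup ys (inject₁ i)
  yb = lookup ys (suc i)
  split : ∀ b → column (just c) a y hs (λ q _ → if b
      then ya * chain as cs (swapV i ys) q E + - (yb - ya) * chain (swapV i as) cs (swapV i ys) q E
      else yb * chain as cs (swapV i ys) q E + 0ℤ * 0ℤ) ≡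
    (if b then ya * chain (a ∷ as) (c ∷ cs) (y ∷ swapV i ys) hs E + - (yb - ya) * chain (a ∷ swapV i as) (c ∷ cs) (y ∷ swapV i ys) hs E
      else yb * chain (a ∷ as) (c ∷ cs) (y ∷ swapV i ys) hs E + 0ℤ * 0ℤ)
  split true  = column-linear (just c) a y hs ya (- (yb - ya)) (λ q _ → chain as cs (swapV i ys) q E) (λ q _ → chain (swapV i as) cs (swapV i ys) q E)
  split false = trans (column-linear (just c) a y hs yb 0ℤ (λ q _ → chain as cs (swapV i ys) q E) (λ _ _ → 0ℤ))
    (cong (_+_ (yb * chain (a ∷ as) (c ∷ cs) (y ∷ swapV i ys) hs E)) (ℤP.*-zeroˡ (column (just c) a y hs (λ _ _ → 0ℤ))))

column-poly : ∀ {k n} S a (j : Fin n) (hs : Vec H k) {F : Pt n → Vec H k → ℕ → ℤ} → (∀ q b → IsPoly (λ x → F x q b)) →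
  IsPoly (λ x → column S a (1ℤ - x j) hs (F x))
column-poly nothing  a j []             h = h [] a
column-poly (just c) a j []             h = const-poly 0ℤ
column-poly nothing  a j (nothing ∷ hs) h = oneMinusX-poly j (column-poly nothing a j hs (λ q b → h (nothing ∷ q) b))
column-poly (just c) a j (nothing ∷ hs) h = +-poly
  (oneMinusX-poly j (column-poly nothing a j hs (λ q b → h (just (b , c) ∷ q) 0)))
  (column-poly (just c) a j hs (λ q _ → h (nothing ∷ q) 0))
column-poly nothing  a j (just (x , z) ∷ hs) h = +-poly
  (column-poly (just z) a j hs (λ q _ → h (nothing ∷ q) x))
  (oneMinusX-poly j (column-poly nothing a j hs (λ q b → scale-poly (sgn x b) (h (just (b ⊓ x , z) ∷ q) (b ⊔ x)))))
column-poly (just c) a j (just (x , z) ∷ hs) {F} h =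
  subst-poly (λ y → alg (1ℤ - y j) (below? z c) (column (just c) a (1ℤ - y j) hs (λ q _ → F y (just (x , z) ∷ q) 0)))
    (scale-poly (- below? z c) (oneMinusX-poly j (column-poly (just c) a j hs (λ q _ → h (just (x , z) ∷ q) 0))))
  where
  alg : ∀ y i u → - i * (y * u) ≡ - (y * i) * u
  alg = solve-∀
  subst-poly : ∀ {n} {f g : Pt n → ℤ} → (∀ x → f x ≡ g x) → IsPoly f → IsPoly g
  subst-poly e (isPoly p c) = isPoly p (λ x → trans (c x) (e x))

chain-poly : ∀ {k l n} (as cs : Vec ℕ l) (js : Fin l → Fin n) (hs : Vec H k) E →
  IsPoly (λ x → chain as cs (tabulate (λ i → 1ℤ - x (js i))) hs E)
chain-poly []       []       js hs E = const-poly (E hs)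
chain-poly (a ∷ as) (c ∷ cs) js hs E = column-poly (just c) a (js zero) hs (λ q _ → chain-poly as cs (js ∘ suc) q E)

-- The unique filling for increasing co-BPD labels.

-- The co-BPD label c occurs at or below row d.
Occurs : ∀ {k} → ℕ → ℕ → Vec H k → Set
Occurs c d       []                  = ⊥
Occurs c (suc d) (h ∷ hs)            = Occurs c d hs
Occurs c zero    (nothing ∷ hs)      = Occurs c zero hs
Occurs c zero    (just (x , z) ∷ hs) = z ≡ c ⊎ Occurs c zero hs

VanishesAt : ∀ {k} → ℕ → ℕ → (Vec H k → ℕ → ℤ) → Set
VanishesAt c d F = ∀ q b → Occurs c d q → F q b ≡ 0ℤ

-- co-BPD pipes only travel down.
column-descends : ∀ {k} c a y (hs : Vec H k) {F} → VanishesAt c zero F → column (just c) a y hs F ≡ 0ℤ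
column-descends c a y []             v = refl
column-descends c a y (nothing ∷ hs) {F} v =
  trans (cong₂ (λ u w → y * u + w)
      (column-zero nothing a y hs (λ q b → v (just (b , c) ∷ q) 0 (inj₁ refl)))
      (column-descends c a y hs (λ q b o → v (nothing ∷ q) 0 o)))
    (trans (ℤP.+-identityʳ (y * 0ℤ)) (ℤP.*-zeroʳ y))
column-descends c a y (just (x , z) ∷ hs) v =
  trans (cong (_*_ (- (y * below? z c))) (column-descends c a y hs (λ q b o → v (just (x , z) ∷ q) 0 (inj₂ o))))
    (ℤP.*-zeroʳ (- (y * below? z c)))

-- In passing a column a co-BPD label either stays in its row or turns down and reappears lower.
column-keeps : ∀ {k} c d S a y (hs : Vec H k) {F} → Occurs c d hs → VanishesAt c d F → column S a y hs F ≡ 0ℤ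
column-keeps c (suc d) nothing  a y (nothing ∷ hs) o v =
  trans (cong (_*_ y) (column-keeps c d nothing a y hs o (λ q b → v (nothing ∷ q) b))) (ℤP.*-zeroʳ y)
column-keeps c (suc d) (just s) a y (nothing ∷ hs) o v =
  trans (cong₂ (λ u w → y * u + w)
      (column-keeps c d nothing a y hs o (λ q b → v (just (b , s) ∷ q) 0))
      (column-keeps c d (just s) a y hs o (λ q b → v (nothing ∷ q) 0)))
    (trans (ℤP.+-identityʳ (y * 0ℤ)) (ℤP.*-zeroʳ y))
column-keeps c (suc d) nothing  a y (just (x , z) ∷ hs) {F} o v =
  trans (cong₂ (λ u w → u + y * w)
      (column-keeps c d (just z) a y hs o (λ q b → v (nothing ∷ q) x))
      (column-keeps c d nothing a y hs o (λ q b o′ → trans (cong (_*_ (sgn x b)) (v (just (b ⊓ x , z) ∷ q) (b ⊔ x) o′)) (ℤP.*-zeroʳ (sgn x b)))))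
    (trans (ℤP.+-identityˡ (y * 0ℤ)) (ℤP.*-zeroʳ y))
column-keeps c (suc d) (just s) a y (just (x , z) ∷ hs) o v =
  trans (cong (_*_ (- (y * below? z s))) (column-keeps c d (just s) a y hs o (λ q b → v (just (x , z) ∷ q) 0)))
    (ℤP.*-zeroʳ (- (y * below? z s)))
column-keeps c zero nothing  a y (nothing ∷ hs) o v =
  trans (cong (_*_ y) (column-keeps c zero nothing a y hs o (λ q b → v (nothing ∷ q) b))) (ℤP.*-zeroʳ y)
column-keeps c zero (just s) a y (nothing ∷ hs) o v =
  trans (cong₂ (λ u w → y * u + w)
      (column-keeps c zero nothing a y hs o (λ q b o′ → v (just (b , s) ∷ q) 0 (inj₂ o′)))
      (column-keeps c zero (just s) a y hs o (λ q b → v (nothing ∷ q) 0)))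
    (trans (ℤP.+-identityʳ (y * 0ℤ)) (ℤP.*-zeroʳ y))
column-keeps c zero nothing  a y (just (x , .c) ∷ hs) (inj₁ refl) v =
  trans (cong₂ (λ u w → u + y * w)
      (column-descends c a y hs (λ q b → v (nothing ∷ q) x))
      (column-zero nothing a y hs (λ q b → trans (cong (_*_ (sgn x b)) (v (just (b ⊓ x , c) ∷ q) (b ⊔ x) (inj₁ refl))) (ℤP.*-zeroʳ (sgn x b)))))
    (trans (ℤP.+-identityˡ (y * 0ℤ)) (ℤP.*-zeroʳ y))
column-keeps c zero nothing  a y (just (x , z) ∷ hs) (inj₂ o) v =
  trans (cong₂ (λ u w → u + y * w)
      (column-keeps c zero (just z) a y hs o (λ q b → v (nothing ∷ q) x))
      (column-keeps c zero nothing a y hs o (λ q b o′ → trans (cong (_*_ (sgn x b)) (v (just (b ⊓ x , z) ∷ q) (b ⊔ x) (inj₂ o′))) (ℤP.*-zeroʳ (sgn x b)))))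
    (trans (ℤP.+-identityˡ (y * 0ℤ)) (ℤP.*-zeroʳ y))
column-keeps c zero (just s) a y (just (x , .c) ∷ hs) (inj₁ refl) v =
  trans (cong (_*_ (- (y * below? c s))) (column-zero (just s) a y hs (λ q b → v (just (x , c) ∷ q) 0 (inj₁ refl))))
    (ℤP.*-zeroʳ (- (y * below? c s)))
column-keeps c zero (just s) a y (just (x , z) ∷ hs) (inj₂ o) v =
  trans (cong (_*_ (- (y * below? z s))) (column-keeps c zero (just s) a y hs o (λ q b o′ → v (just (x , z) ∷ q) 0 (inj₂ o′))))
    (ℤP.*-zeroʳ (- (y * below? z s)))

chain-keeps : ∀ {n k} c d (as cs : Vec ℕ n) ys (hs : Vec H k) E → Occurs c d hs →
  (∀ q → Occurs c d q → E q ≡ 0ℤ) → chain as cs ys hs E ≡ 0ℤ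
chain-keeps c d []       []       []       hs E o v = v hs o
chain-keeps c d (a ∷ as) (s ∷ cs) (y ∷ ys) hs E o v =
  column-keeps c d (just s) a y hs o (λ q _ o′ → chain-keeps c d as cs ys q E o′ v)

column-vertical : ∀ k a y F → column nothing a y (replicate k nothing) F ≡ y ^ k * F (replicate k nothing) a
column-vertical zero    a y F = sym (ℤP.*-identityˡ (F [] a))
column-vertical (suc k) a y F = trans (cong (_*_ y) (column-vertical k a y (λ q b → F (nothing ∷ q) b)))
  (sym (ℤP.*-assoc y (y ^ k) (F (nothing ∷ replicate k nothing) a)))

-- The first i of k rows are occupied; row r carries the labels α r and r, where r counts from off.
prefix : (ℕ → ℕ) → (k i off : ℕ) → Vec H k
prefix α zero    i       off = []
prefix α (suc k) zero    off = nothing ∷ prefix α k zero (suc off)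
prefix α (suc k) (suc i) off = just (α off , off) ∷ prefix α k i (suc off)

prefix-empty : ∀ α k off → prefix α k zero off ≡ replicate k nothing
prefix-empty α zero    off = refl
prefix-empty α (suc k) off = cong (nothing ∷_) (prefix-empty α k (suc off))

-- Entering above `i` occupied rows, the co-BPD pipe must cross each of them with weight -y, and
-- `VanishesAt` forces it to turn in the first free row. The BPD pipe runs straight up to that row,
-- which accounts for the remaining powers of `y`.
column-prefix : ∀ α k i off c y F → c ≡ off ℕ.+ i → i ℕ.< k → VanishesAt c (suc i) F →
  column (just c) (α c) y (prefix α k i off) F ≡ -1ℤ ^ i * y ^ k * F (prefix α k (suc i) off) 0
column-prefix α (suc k) zero off c y F e lt v with trans e (ℕP.+-identityʳ off)
... | refl =
  trans (cong₂ (λ u w → y * u + w) up (column-descends off (α off) y (prefix α k 0 (suc off)) (λ q b o → v (nothing ∷ q) 0 o)))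
    (alg y (y ^ k) (F (just (α off , off) ∷ prefix α k 0 (suc off)) 0))
  where
  up : column nothing (α off) y (prefix α k 0 (suc off)) (λ q b → F (just (b , off) ∷ q) 0) ≡
       y ^ k * F (just (α off , off) ∷ prefix α k 0 (suc off)) 0
  up rewrite prefix-empty α k (suc off) = column-vertical k (α off) y (λ q b → F (just (b , off) ∷ q) 0)
  alg : ∀ y u f → y * (u * f) + 0ℤ ≡ 1ℤ * (y * u) * f
  alg = solve-∀
column-prefix α (suc k) (suc i) off c y F e (s≤s lt) v =
  trans (cong₂ (λ s u → - (y * s) * u) indicator
      (column-prefix α k i (suc off) c y (λ q _ → F (just (α off , off) ∷ q) 0) (trans e (ℕP.+-suc off i)) lt
        (λ q b o → v (just (α off , off) ∷ q) 0 o)))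
    (alg y (-1ℤ ^ i) (y ^ k) (F (just (α off , off) ∷ prefix α k (suc i) (suc off)) 0))
  where
  indicator : below? off c ≡ 1ℤ
  indicator rewrite e | <ᵇ-true (ℕP.m<m+n off {suc i} (s≤s z≤n)) = refl
  alg : ∀ y s u f → - (y * 1ℤ) * (s * u * f) ≡ -1ℤ * s * (y * u) * f
  alg = solve-∀

idsFrom : ∀ l → ℕ → Vec ℕ l
idsFrom zero    j = []
idsFrom (suc l) j = j ∷ idsFrom l (suc j)

prodPow : ∀ {l} → ℕ → Vec ℤ l → ℤ
prodPow n []       = 1ℤ
prodPow n (y ∷ ys) = y ^ n * prodPow n ys

epsFrom : ℕ → ℕ → ℤ
epsFrom zero    j = 1ℤ
epsFrom (suc l) j = -1ℤ ^ j * epsFrom l (suc j)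

-- With co-BPD labels entering and leaving in increasing order, only the identity filling survives.
chain-identity : ∀ α n l j (ys : Vec ℤ l) E → j ℕ.+ l ≡ n → (∀ c q → Occurs c (suc c) q → E q ≡ 0ℤ) →
  chain (Vec.map α (idsFrom l j)) (idsFrom l j) ys (prefix α n j 0) E ≡ epsFrom l j * prodPow n ys * E (prefix α n n 0)
chain-identity α n zero j [] E e v rewrite trans (sym (ℕP.+-identityʳ j)) e = sym (ℤP.*-identityˡ (E (prefix α n n 0)))
chain-identity α n (suc l) j (y ∷ ys) E e v =
  trans (column-prefix α n j 0 j y (λ q _ → chain (Vec.map α (idsFrom l (suc j))) (idsFrom l (suc j)) ys q E) refl
      (ℕP.≤-trans (ℕP.m≤m+n (suc j) l) (ℕP.≤-reflexive (trans (sym (ℕP.+-suc j l)) e)))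
      -- A label that has come out too low cannot rise in the later columns.
      (λ q _ o → chain-keeps j (suc j) (Vec.map α (idsFrom l (suc j))) (idsFrom l (suc j)) ys q E o (v j)))
    (trans (cong (_*_ (-1ℤ ^ j * y ^ n)) (chain-identity α n l (suc j) ys E (trans (sym (ℕP.+-suc j l)) e) v))
      (alg (-1ℤ ^ j) (y ^ n) (epsFrom l (suc j)) (prodPow n ys) (E (prefix α n n 0))))
  where
  alg : ∀ s u e p f → s * u * (e * p * f) ≡ s * e * (u * p) * f
  alg = solve-∀

prefix-full : ∀ α k off → prefix α k k off ≡ tabulate (λ r → just (α (off ℕ.+ toℕ r) , off ℕ.+ toℕ r))
prefix-full α zero    off = refl
prefix-full α (suc k) off = cong₂ _∷_ (cong (λ z → just (α z , z)) (sym (ℕP.+-identityʳ off)))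
  (trans (prefix-full α k (suc off)) (VecP.tabulate-cong (λ r → cong (λ z → just (α z , z)) (sym (ℕP.+-suc off (toℕ r))))))

idsFrom-tabulate : ∀ l j → idsFrom l j ≡ tabulate (λ r → j ℕ.+ toℕ r)
idsFrom-tabulate zero    j = refl
idsFrom-tabulate (suc l) j = cong₂ _∷_ (sym (ℕP.+-identityʳ j))
  (trans (idsFrom-tabulate l (suc j)) (VecP.tabulate-cong (λ r → sym (ℕP.+-suc j (toℕ r)))))

entry : ∀ {n} → Vec ℕ n → ℕ → ℕ
entry []      k       = 0
entry (a ∷ v) zero    = a
entry (a ∷ v) (suc k) = entry v k

entry-lookup : ∀ {n} (v : Vec ℕ n) r → entry v (toℕ r) ≡ lookup v r
entry-lookup (a ∷ v) zero    = refl
entry-lookup (a ∷ v) (suc r) = entry-lookup v r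

map-entry : ∀ {n} (v : Vec ℕ n) → Vec.map (entry v) (idsFrom n 0) ≡ v
map-entry {n} v = trans (cong (Vec.map (entry v)) (idsFrom-tabulate n 0))
  (trans (sym (VecP.tabulate-∘ (entry v) toℕ)) (trans (VecP.tabulate-cong (entry-lookup v)) (VecP.tabulate∘lookup v)))

exitState : ∀ {n} → Vec ℕ n → Vec H n
exitState v = tabulate (λ r → just (lookup v r , toℕ r))

_≟H_ : ∀ {k} (p q : Vec H k) → Dec (p ≡ q)
_≟H_ = VecP.≡-dec (MaybeP.≡-dec (ProdP.≡-dec ℕ._≟_ ℕ._≟_))

-- BPD pipes leave as the word w, co-BPD pipes in increasing order.
exits : ∀ {n} → Vec ℕ n → Vec H n → ℤ
exits w q = if ⌊ q ≟H exitState w ⌋ then 1ℤ else 0ℤ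

-- In the exit state the co-BPD label c sits in row c, hence not below it.
exits-keeps : ∀ {n} (w : Vec ℕ n) c q → Occurs c (suc c) q → exits w q ≡ 0ℤ
exits-keeps w c q o with q ≟H exitState w
... | no  _    = refl
... | yes refl = ⊥-elim (go (λ r → just (lookup w r , toℕ r)) (lookup w) 0 (suc c) (λ r → refl) ℕP.≤-refl o)
  where
  go : ∀ {k} (f : Fin k → H) (g : Fin k → ℕ) off d → (∀ r → f r ≡ just (g r , off ℕ.+ toℕ r)) → suc c ℕ.≤ off ℕ.+ d →
    ¬ Occurs c d (tabulate f)
  go {suc k} f g off (suc d) e lt o = go (f ∘ suc) (g ∘ suc) (suc off) d
    (λ r → trans (e (suc r)) (cong (λ z → just (g (suc r) , z)) (ℕP.+-suc off (toℕ r)))) (subst (suc c ℕ.≤_) (ℕP.+-suc off d) lt) o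
  go {suc k} f g off zero e lt o with f zero | e zero
  go {suc k} f g off zero e lt (inj₁ eq) | .(just _) | refl =
    ℕP.<⇒≢ (subst (suc c ℕ.≤_) (trans (ℕP.+-identityʳ off) (sym (ℕP.+-identityʳ off))) lt) (sym eq)
  go {suc k} f g off zero e lt (inj₂ o) | .(just _) | refl = go (f ∘ suc) (g ∘ suc) (suc off) zero
    (λ r → trans (e (suc r)) (cong (λ z → just (g (suc r) , z)) (ℕP.+-suc off (toℕ r)))) (ℕP.m≤n⇒m≤1+n lt) o

-- Each of the n columns contributes the n-th power of its weight and a sign from the rows crossed.
-- This produces `Ω` and the global sign.
chain-id : ∀ {n} (a w : Vec ℕ n) (ys : Vec ℤ n) →
  chain a (tabulate toℕ) ys (replicate n nothing) (exits w) ≡ epsFrom n 0 * prodPow n ys * exits w (exitState a)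
chain-id {n} a w ys = trans
  (trans (cong₂ (λ u v → chain u v ys (replicate n nothing) (exits w)) (sym (map-entry a)) (sym (idsFrom-tabulate n 0)))
    (cong (λ u → chain (Vec.map (entry a) (idsFrom n 0)) (idsFrom n 0) ys u (exits w)) (sym (prefix-empty (entry a) n 0))))
  (trans (chain-identity (entry a) n n 0 ys (exits w) refl (exits-keeps w))
    (cong (λ u → epsFrom n 0 * prodPow n ys * exits w u)
      (trans (prefix-full (entry a) n 0) (VecP.tabulate-cong (λ r → cong (λ z → just (z , toℕ r)) (entry-lookup a r))))))

exits-self : ∀ {n} (w : Vec ℕ n) → exits w (exitState w) ≡ 1ℤ
exits-self w with exitState w ≟H exitState w
... | yes _ = refl
... | no ne = contradiction refl ne

exits-other : ∀ {n} (w : Vec ℕ n) q → q ≢ exitState w → exits w q ≡ 0ℤ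
exits-other w q ne with q ≟H exitState w
... | yes e = contradiction e ne
... | no  _ = refl

exitState-injective : ∀ {n} (v w : Vec ℕ n) → exitState v ≡ exitState w → v ≡ w
exitState-injective v w e = trans (sym (VecP.tabulate∘lookup v))
  (trans (VecP.tabulate-cong (λ r → cong proj₁ (MaybeP.just-injective
    (trans (sym (VecP.lookup∘tabulate (λ r → just (lookup v r , toℕ r)) r))
      (trans (cong (λ q → lookup q r) e) (VecP.lookup∘tabulate (λ r → just (lookup w r , toℕ r)) r))))))
    (VecP.tabulate∘lookup w))

-- Iterated divided differences of Grothendieck polynomials.

module Gr = Family grothendieckOp

ysAt : ∀ {n} → Pt n → Vec ℤ n
ysAt x = tabulate (λ j → 1ℤ - x j)

Ω : ∀ {n} → Pt n → ℤ
Ω {n} x = prodPow n (ysAt x)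

prodPow-swapV : ∀ {m} k (i : Fin m) ys → prodPow k (swapV i ys) ≡ prodPow k ys
prodPow-swapV k zero    (y₁ ∷ y₂ ∷ ys) = alg (y₁ ^ k) (y₂ ^ k) (prodPow k ys)
  where
  alg : ∀ a b c → b * (a * c) ≡ a * (b * c)
  alg = solve-∀
prodPow-swapV k (suc i) (y ∷ ys) = cong (_*_ (y ^ k)) (prodPow-swapV k i ys)

Ω-swap : ∀ {m} (i : Fin m) (x : Pt (suc m)) → Ω (x ∘ swapAt i) ≡ Ω x
Ω-swap {m} i x = trans (cong (prodPow (suc m)) (tabulate-swapV i (λ j → 1ℤ - x j))) (prodPow-swapV (suc m) i (ysAt x))

Ω-poly : ∀ {n} → IsPoly {n} Ω
Ω-poly {n} = go n id
  where
  go : ∀ {n l} k (js : Fin l → Fin n) → IsPoly (λ x → prodPow k (tabulate (λ i → 1ℤ - x (js i))))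
  go {l = zero}  k js = const-poly 1ℤ
  go {l = suc l} k js = *-poly (power k) (go k (js ∘ suc))
    where
    power : ∀ k → IsPoly (λ x → (1ℤ - x (js zero)) ^ k)
    power zero    = const-poly 1ℤ
    power (suc k) = oneMinusX-poly (js zero) (power k)

Ω-at-0 : ∀ {n} → Ω {n} (λ _ → 0ℤ) ≡ 1ℤ
Ω-at-0 {n} = go n n
  where
  go : ∀ k l → prodPow k (tabulate {n = l} (λ _ → 1ℤ)) ≡ 1ℤ
  go k zero    = refl
  go k (suc l) = cong₂ _*_ (ℤP.^-zeroˡ k) (go k l)

inj? : ∀ {n} (f : Fin n → ℕ) → Dec (Inj f)
inj? f = FinP.all? (λ i → FinP.all? (λ j → (f i ℕ.≟ f j) →-dec (i Fin.≟ j)))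

asWord : ∀ {n k} → Vec (Fin n) k → Fin k → ℕ
asWord a = lookup (Vec.map toℕ a)

asWord-swap : ∀ {m n} (i : Fin m) (a : Vec (Fin n) (suc m)) → asWord (swapV i a) ≗ asWord a ∘ swapAt i
asWord-swap i a j = trans (cong (λ v → lookup v j) (map-swapV toℕ i a)) (lookup-swapV i (Vec.map toℕ a) j)

Inj-cong : ∀ {n} {A : Set} {f g : Fin n → A} → f ≗ g → Inj f → Inj g
Inj-cong h inj i j e = inj i j (trans (h i) (trans e (sym (h j))))

sorted-is-identity : ∀ {n} (f : Fin n → ℕ) → Inj f → (∀ j → f j ℕ.< n) → inv f ≡ 0 → ∀ j → f j ≡ toℕ j
sorted-is-identity {suc m} f inj bd z = go m f 0 asc z≤n bd
  where
  asc : ∀ i → Asc f i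
  asc i with asc? f i
  ... | yes a = a
  ... | no ¬a = contradiction (trans (sym (inv-desc inj i ¬a)) z) λ ()
  go : ∀ k (f : Fin (suc k) → ℕ) b → (∀ i → Asc f i) → b ℕ.≤ f zero → (∀ j → f j ℕ.< b ℕ.+ suc k) → ∀ j → f j ≡ b ℕ.+ toℕ j
  go zero f b a lo hi zero = trans (ℕP.≤-antisym (ℕP.≤-pred (subst (f zero ℕ.<_) (ℕP.+-comm b 1) (hi zero))) lo) (sym (ℕP.+-identityʳ b))
  go (suc k) f b a lo hi j = cases j
    where
    tail : ∀ j → f (suc j) ≡ suc b ℕ.+ toℕ j
    tail = go k (f ∘ suc) (suc b) (a ∘ suc) (ℕP.<-≤-trans (s≤s lo) (a zero)) (λ j → subst (f (suc j) ℕ.<_) (ℕP.+-suc b (suc k)) (hi (suc j)))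
    cases : ∀ j → f j ≡ b ℕ.+ toℕ j
    cases zero    = trans (ℕP.≤-antisym (ℕP.≤-pred (subst (f zero ℕ.<_) (trans (tail zero) (ℕP.+-identityʳ (suc b))) (a zero))) lo) (sym (ℕP.+-identityʳ b))
    cases (suc j) = trans (tail j) (sym (ℕP.+-suc b (toℕ j)))

-- The permutation s_{i_k} ⋯ s_{i_1} for the word i_k ⋯ i_1 of simple reflections, acting on positions.
cword : ∀ {m} → List (Fin m) → Fin (suc m) → Fin (suc m)
cword []      = id
cword (i ∷ u) = cword u ∘ swapAt i

Inj-cword : ∀ {m} (u : List (Fin m)) → Inj (cword u)
Inj-cword []      i j e = e
Inj-cword (i ∷ u) = Inj-swap i (Inj-cword u)

Inj-toℕ : ∀ {n} {A : Set} {f : A → Fin n} {k} {g : Fin k → A} → Inj (f ∘ g) → Inj (toℕ ∘ f ∘ g)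
Inj-toℕ inj i j e = inj i j (FinP.toℕ-injective e)

inv-swap-≤ : ∀ {m} (f : Fin (suc m) → ℕ) → Inj f → ∀ i → inv (f ∘ swapAt i) ℕ.≤ suc (inv f) × inv f ℕ.≤ suc (inv (f ∘ swapAt i))
inv-swap-≤ f inj i with asc? f i
... | yes a = ℕP.≤-reflexive (inv-asc f i a) , ℕP.m≤n⇒m≤1+n (ℕP.≤-trans (ℕP.n≤1+n (inv f)) (ℕP.≤-reflexive (sym (inv-asc f i a))))
... | no ¬a = ℕP.m≤n⇒m≤1+n (ℕP.≤-trans (ℕP.n≤1+n (inv (f ∘ swapAt i))) (ℕP.≤-reflexive (sym (inv-desc inj i ¬a)))) , ℕP.≤-reflexive (inv-desc inj i ¬a)

inv-cword : ∀ {m} (u : List (Fin m)) → inv (toℕ ∘ cword u) ℕ.≤ length u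
inv-cword {m} []      = ℕP.≤-reflexive (inv-id (suc m) toℕ 0 (λ j → refl))
  where
  none : ∀ n (f : Fin n → ℕ) a → (∀ j → a ℕ.≤ f j) → countLt a (tab f) ≡ 0
  none zero    f a h = refl
  none (suc n) f a h rewrite <ᵇ-false (ℕP.≤⇒≯ (h zero)) = none n (f ∘ suc) a (h ∘ suc)
  inv-id : ∀ n (f : Fin n → ℕ) b → (∀ j → f j ≡ b ℕ.+ toℕ j) → inv f ≡ 0
  inv-id zero    f b h = refl
  inv-id (suc n) f b h = cong₂ ℕ._+_
    (none n (f ∘ suc) (f zero) (λ j → subst₂ ℕ._≤_ (sym (h zero)) (sym (h (suc j))) (ℕP.+-monoʳ-≤ b z≤n)))
    (inv-id n (f ∘ suc) (suc b) (λ j → trans (h (suc j)) (ℕP.+-suc b (toℕ j))))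
inv-cword (i ∷ u) = ℕP.≤-trans (proj₁ (inv-swap-≤ (toℕ ∘ cword u) (Inj-toℕ {f = cword u} {g = id} (Inj-cword u)) i)) (s≤s (inv-cword u))

cvec : ∀ {m} → List (Fin m) → Vec ℕ (suc m)
cvec u = tabulate (toℕ ∘ cword u)

module GrothendieckSide {m : ℕ} (w : Vec (Fin (suc m)) (suc m)) (w-inj : Inj (asWord w)) where
  n : ℕ
  n = suc m

  ε : ℤ
  ε = epsFrom n 0

  E : Vec H n → ℤ
  E = exits (Vec.map toℕ w)

  ∅ : Vec H n
  ∅ = replicate n nothing

  -- Words that are not permutations receive the value 0, so that `X` can sum over a full product of
  -- alphabets.
  G : Vec (Fin n) n → Pt n → ℤ
  G a x = if ⌊ inj? (asWord a) ⌋ then eval (Gr.fam (asWord a)) x else 0ℤ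

  Z : Vec (Fin n) n → Vec ℕ n → Pt n → ℤ
  Z a c x = chain (Vec.map toℕ a) c (ysAt x) ∅ E

  -- The coefficient of w in the derivative of the generating function of Grothendieck polynomials.
  X : Vec ℕ n → Pt n → ℤ
  X c x = sumL (words n n) (λ a → G a x * Z a c x)

  Z-swap : ∀ i a c x → Z a c (x ∘ swapAt i) ≡ chain (Vec.map toℕ a) c (swapV i (ysAt x)) ∅ E
  Z-swap i a c x = cong (λ ys → chain (Vec.map toℕ a) c ys ∅ E) (tabulate-swapV i (λ j → 1ℤ - x j))

  module _ (i : Fin m) (x : Pt n) (gx : Good x) where
    ya yb d : ℤ
    ya = 1ℤ - x (inject₁ i)
    yb = 1ℤ - x (suc i)
    d = yb - ya

    sx : Pt n
    sx = x ∘ swapAt i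

    -- `chain-exchange` at the weights of `x`, with the exchanged weights read as those of the point
    -- `sx`.
    rec : ∀ a c → ya * Z a c x + - (ya * d * below? (lookup c (inject₁ i)) (lookup c (suc i))) * Z a (swapV i c) x ≡
      (if asWord a (inject₁ i) <ᵇ asWord a (suc i) then ya * Z a c sx + - d * Z (swapV i a) c sx else yb * Z a c sx + 0ℤ * 0ℤ)
    rec a c = trans (cong₂ (λ u v → u * Z a c x + - (u * (v - u) * below? (lookup c (inject₁ i)) (lookup c (suc i))) * Z a (swapV i c) x)
        (sym (VecP.lookup∘tabulate (λ j → 1ℤ - x j) (inject₁ i))) (sym (VecP.lookup∘tabulate (λ j → 1ℤ - x j) (suc i))))
      (trans (chain-exchange i (Vec.map toℕ a) c (ysAt x) ∅ E)
        (trans (cong₂ (λ u v → if asWord a (inject₁ i) <ᵇ asWord a (suc i)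
              then u * chain (Vec.map toℕ a) c (swapV i (ysAt x)) ∅ E + - (v - u) * chain (swapV i (Vec.map toℕ a)) c (swapV i (ysAt x)) ∅ E
              else v * chain (Vec.map toℕ a) c (swapV i (ysAt x)) ∅ E + 0ℤ * 0ℤ)
            (VecP.lookup∘tabulate (λ j → 1ℤ - x j) (inject₁ i)) (VecP.lookup∘tabulate (λ j → 1ℤ - x j) (suc i)))
          (cong₂ (λ u v → if asWord a (inject₁ i) <ᵇ asWord a (suc i) then ya * u + - d * v else yb * u + 0ℤ * 0ℤ)
            (sym (Z-swap i a c x))
            (trans (cong (λ z → chain z c (swapV i (ysAt x)) ∅ E) (sym (map-swapV toℕ i a))) (sym (Z-swap i (swapV i a) c x))))))

    -- After the exchange of columns some terms keep the word `a` and others pass to `swapV i a`;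
    -- only the latter are reindexed.
    stay move : Vec ℕ n → Vec (Fin n) n → ℤ
    stay c a = if asWord a (inject₁ i) <ᵇ asWord a (suc i) then G a x * (ya * Z a c sx) else G a x * (yb * Z a c sx)
    move c a = if asWord a (inject₁ i) <ᵇ asWord a (suc i) then G a x * (- d * Z (swapV i a) c sx) else 0ℤ

    split : ∀ c a → G a x * (if asWord a (inject₁ i) <ᵇ asWord a (suc i) then ya * Z a c sx + - d * Z (swapV i a) c sx else yb * Z a c sx + 0ℤ * 0ℤ)
      ≡ stay c a + move c a
    split c a with asWord a (inject₁ i) <ᵇ asWord a (suc i)
    ... | true  = ℤP.*-distribˡ-+ (G a x) (ya * Z a c sx) (- d * Z (swapV i a) c sx)
    ... | false = alg (G a x) (yb * Z a c sx)
      where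
      alg : ∀ g u → g * (u + 0ℤ * 0ℤ) ≡ g * u + 0ℤ
      alg = solve-∀

    -- The twisted Leibniz rule, coefficient by coefficient. At an ascent of `a` its polynomial is
    -- symmetric; at a descent the reindexed term brings in the polynomial of the exchanged word,
    -- and the relation between the two leaves the value at `sx`.
    recombine : ∀ c a → stay c a + move c (swapV i a) ≡ ya * (G a sx * Z a c sx)
    recombine c a with inj? (asWord a) | inj? (asWord (swapV i a))
    ... | no ¬p | yes q = contradiction (Inj-cong (λ j → trans (asWord-swap i a (swapAt i j)) (cong (asWord a) (swapAt-involutive i j))) (Inj-swap i q)) ¬p
    ... | yes p | no ¬q = contradiction (Inj-cong (λ j → sym (asWord-swap i a j)) (Inj-swap i p)) ¬q
    ... | no ¬p | no ¬q = trans (cong₂ _+_ (both (asWord a (inject₁ i) <ᵇ asWord a (suc i)))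
            (one (asWord (swapV i a) (inject₁ i) <ᵇ asWord (swapV i a) (suc i)))) (alg ya (Z a c sx))
      where
      both : ∀ b → (if b then 0ℤ * (ya * Z a c sx) else 0ℤ * (yb * Z a c sx)) ≡ 0ℤ
      both true  = ℤP.*-zeroˡ (ya * Z a c sx)
      both false = ℤP.*-zeroˡ (yb * Z a c sx)
      one : ∀ b → (if b then 0ℤ * (- d * Z (swapV i (swapV i a)) c sx) else 0ℤ) ≡ 0ℤ
      one true  = ℤP.*-zeroˡ (- d * Z (swapV i (swapV i a)) c sx)
      one false = refl
      alg : ∀ y z → 0ℤ + 0ℤ ≡ y * (0ℤ * z)
      alg = solve-∀
    ... | yes p | yes q with asc? (asWord a) i
    ...   | yes α rewrite <ᵇ-true α
                | <ᵇ-false {asWord (swapV i a) (inject₁ i)} {asWord (swapV i a) (suc i)}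
                    (λ lt → ℕP.<⇒≯ α (subst₂ ℕ._<_ (trans (asWord-swap i a (inject₁ i)) (cong (asWord a) (swapAt-left i)))
                       (trans (asWord-swap i a (suc i)) (cong (asWord a) (swapAt-right i))) lt)) =
      trans (cong (λ g → g * (ya * Z a c sx) + 0ℤ) (sym (Gr.fam-symmetric (asWord a) i α x gx)))
        (alg (eval (Gr.fam (asWord a)) sx) ya (Z a c sx))
      where
      alg : ∀ g y z → g * (y * z) + 0ℤ ≡ y * (g * z)
      alg = solve-∀
    ...   | no ¬α rewrite <ᵇ-false ¬α
                | <ᵇ-true {asWord (swapV i a) (inject₁ i)} {asWord (swapV i a) (suc i)}
                    (subst₂ ℕ._<_ (sym (asWord-swap i a (inject₁ i))) (sym (asWord-swap i a (suc i))) (¬asc⇒asc-swap p i ¬α))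
                | swapV-involutive i a =
      trans (alg g₀ g₁ ya yb (Z a c sx))
        (trans (cong (_* Z a c sx) (trans (cong (λ z → yb * g₀ - z) fd) (alg₂ yb ya g₀ g₂)))
          (ℤP.*-assoc ya g₂ (Z a c sx)))
      where
      g₀ g₁ g₂ : ℤ
      g₀ = eval (Gr.fam (asWord a)) x
      g₁ = eval (Gr.fam (asWord (swapV i a))) x
      g₂ = eval (Gr.fam (asWord a)) sx
      alg : ∀ g₀ g₁ a b z → g₀ * (b * z) + g₁ * (- (b - a) * z) ≡ (b * g₀ - (b - a) * g₁) * z
      alg = solve-∀
      alg₂ : ∀ b a g h → b * g - (b * g - a * h) ≡ a * h
      alg₂ = solve-∀
      coords-eq : ∀ p q → (1ℤ - q) - (1ℤ - p) ≡ p - q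
      coords-eq = solve-∀
      φ-one : ∀ p q g h → (1ℤ - 1ℤ * p) * g - (1ℤ - 1ℤ * q) * h ≡ (1ℤ - p) * g - (1ℤ - q) * h
      φ-one = solve-∀
      fd : d * g₁ ≡ yb * g₀ - ya * g₂
      fd = trans (cong₂ (λ u p → u * eval p x) (coords-eq (x (inject₁ i)) (x (suc i))) (Gr.fam-cong (asWord-swap i a)))
        (trans (Related.at (Gr.fam-desc p i ¬α) x gx) (φ-one (x (suc i)) (x (inject₁ i)) g₀ g₂))

    -- So N_i acts on the coefficients through `c` alone: it exchanges two entries or gives 0. The
    -- exchange relation carries a common factor `ya`, whose cancellation requires the coordinates
    -- to differ from 1.
    X-difference : ∀ c → X c x - X c sx ≡ (x (inject₁ i) - x (suc i)) * (below? (lookup c (inject₁ i)) (lookup c (suc i)) * X (swapV i c) x)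
    X-difference c = cancel ya ya≢0 (begin
      ya * (X c x - X c sx)
        ≡⟨ alg₁ ya (X c x) (X c sx) (d * β) (X (swapV i c) x) ⟩
      (ya * X c x + - (ya * (d * β)) * X (swapV i c) x) + (ya * (d * β) * X (swapV i c) x - ya * X c sx)
        ≡⟨ cong (_+ (ya * (d * β) * X (swapV i c) x - ya * X c sx)) main ⟩
      ya * X c sx + (ya * (d * β) * X (swapV i c) x - ya * X c sx)
        ≡⟨ alg₂ ya (X c sx) d β (X (swapV i c) x) ⟩
      ya * (d * (β * X (swapV i c) x))
        ≡⟨ cong (λ z → ya * (z * (β * X (swapV i c) x))) (coords-eq (x (inject₁ i)) (x (suc i))) ⟩
      ya * ((x (inject₁ i) - x (suc i)) * (β * X (swapV i c) x)) ∎)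
      where
      open ≡-Reasoning
      β : ℤ
      β = below? (lookup c (inject₁ i)) (lookup c (suc i))
      ya≢0 : ya ≢ 0ℤ
      ya≢0 e = proj₂ gx (inject₁ i) (sym (ℤP.i-j≡0⇒i≡j _ _ e))
      coords-eq : ∀ p q → (1ℤ - q) - (1ℤ - p) ≡ p - q
      coords-eq = solve-∀
      alg₁ : ∀ y u v e t → y * (u - v) ≡ (y * u + - (y * e) * t) + (y * e * t - y * v)
      alg₁ = solve-∀
      alg₂ : ∀ y v d b t → y * v + (y * (d * b) * t - y * v) ≡ y * (d * (b * t))
      alg₂ = solve-∀
      distribute : ∀ g u s t v → u * (g * s) + t * (g * v) ≡ g * (u * s + t * v)
      distribute = solve-∀
      main : ya * X c x + - (ya * (d * β)) * X (swapV i c) x ≡ ya * X c sx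
      main = begin
        ya * X c x + - (ya * (d * β)) * X (swapV i c) x
          ≡⟨ sym (sumL-linear (words n n) ya (- (ya * (d * β))) (λ a → G a x * Z a c x) (λ a → G a x * Z a (swapV i c) x)) ⟩
        sumL (words n n) (λ a → ya * (G a x * Z a c x) + - (ya * (d * β)) * (G a x * Z a (swapV i c) x))
          ≡⟨ sumL-cong (words n n) (λ a → trans (distribute (G a x) ya (Z a c x) (- (ya * (d * β))) (Z a (swapV i c) x))
               (trans (cong (λ z → G a x * (ya * Z a c x + - z * Z a (swapV i c) x)) (sym (ℤP.*-assoc ya d β)))
                 (trans (cong (_*_ (G a x)) (rec a c)) (split c a)))) ⟩
        sumL (words n n) (λ a → stay c a + move c a)
          ≡⟨ sumL-+ (words n n) (stay c) (move c) ⟩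
        sumL (words n n) (stay c) + sumL (words n n) (move c)
          ≡⟨ cong (_+_ (sumL (words n n) (stay c))) (sym (sumL-swapV i (allFin n) (move c))) ⟩
        sumL (words n n) (stay c) + sumL (words n n) (move c ∘ swapV i)
          ≡⟨ sym (sumL-+ (words n n) (stay c) (move c ∘ swapV i)) ⟩
        sumL (words n n) (λ a → stay c a + move c (swapV i a))
          ≡⟨ sumL-cong (words n n) (recombine c) ⟩
        sumL (words n n) (λ a → ya * (G a sx * Z a c sx))
          ≡⟨ sumL-scale (words n n) ya (λ a → G a sx * Z a c sx) ⟩
        ya * X c sx ∎

  map-toℕ-injective : ∀ {k} (a b : Vec (Fin n) k) → Vec.map toℕ a ≡ Vec.map toℕ b → a ≡ b
  map-toℕ-injective []      []      e = refl
  map-toℕ-injective (x ∷ a) (y ∷ b) e = cong₂ _∷_ (FinP.toℕ-injective (VecP.∷-injectiveˡ e)) (map-toℕ-injective a b (VecP.∷-injectiveʳ e))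

  X-id : ∀ x → X (tabulate toℕ) x ≡ ε * (Ω x * eval (Gr.fam (asWord w)) x)
  X-id x = trans (sumL-only-word n w (λ a → G a x * Z a (tabulate toℕ) x) other) here′
    where
    other : ∀ a → a ≢ w → G a x * Z a (tabulate toℕ) x ≡ 0ℤ
    other a ne = trans (cong (_*_ (G a x)) (trans (chain-id (Vec.map toℕ a) (Vec.map toℕ w) (ysAt x))
        (trans (cong (_*_ (ε * Ω x)) (exits-other (Vec.map toℕ w) (exitState (Vec.map toℕ a))
           (λ e → ne (map-toℕ-injective a w (exitState-injective (Vec.map toℕ a) (Vec.map toℕ w) e))))) (ℤP.*-zeroʳ (ε * Ω x)))))
      (ℤP.*-zeroʳ (G a x))
    alg : ∀ g e o → g * (e * o * 1ℤ) ≡ e * (o * g)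
    alg = solve-∀
    here′ : G w x * Z w (tabulate toℕ) x ≡ ε * (Ω x * eval (Gr.fam (asWord w)) x)
    here′ = trans (cong₂ _*_ Gw (trans (chain-id (Vec.map toℕ w) (Vec.map toℕ w) (ysAt x)) (cong (_*_ (ε * Ω x)) (exits-self (Vec.map toℕ w)))))
      (alg (eval (Gr.fam (asWord w)) x) ε (Ω x))
      where
      Gw : G w x ≡ eval (Gr.fam (asWord w)) x
      Gw with inj? (asWord w)
      ... | yes _ = refl
      ... | no ¬p = contradiction w-inj ¬p

  reduced? : List (Fin m) → Bool
  reduced? u = ⌊ inv (toℕ ∘ cword u) ℕ.≟ length u ⌋

  -- As `Ω` is symmetric, N_i acts on the other factor only. A letter keeping the word reduced is an
  -- ascent of `cword u`, where `X-difference` exchanges two labels; any other letter gives 0.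
  derivative : ∀ u x → Good x → ε * (Ω x * eval (divDiffs u (Gr.fam (asWord w))) x) ≡ (if reduced? u then X (cvec u) x else 0ℤ)
  derivative [] x gx with inv (toℕ ∘ cword {m} []) ℕ.≟ 0
  ... | yes _ = sym (X-id x)
  ... | no ne = contradiction (ℕP.n≤0⇒n≡0 (inv-cword {m} [])) ne
  derivative (i ∷ u) x gx = cancel Δ (Good-diff gx (inject₁≢suc i)) (begin
    Δ * (ε * (Ω x * eval (divDiff i p) x))
      ≡⟨ alg₁ Δ ε (Ω x) (eval (divDiff i p) x) ⟩
    ε * (Ω x * (Δ * eval (divDiff i p) x))
      ≡⟨ cong (λ z → ε * (Ω x * z)) (divDiff-eval i p x) ⟩
    ε * (Ω x * (eval p x - eval p x′))
      ≡⟨ alg₂ ε (Ω x) (eval p x) (eval p x′) ⟩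
    ε * (Ω x * eval p x) - ε * (Ω x * eval p x′)
      ≡⟨ cong (λ o → ε * (Ω x * eval p x) - ε * (o * eval p x′)) (sym (Ω-swap i x)) ⟩
    ε * (Ω x * eval p x) - ε * (Ω x′ * eval p x′)
      ≡⟨ cong₂ _-_ (derivative u x gx) (derivative u x′ (Good-swap i gx)) ⟩
    (if reduced? u then X (cvec u) x else 0ℤ) - (if reduced? u then X (cvec u) x′ else 0ℤ)
      ≡⟨ step ⟩
    Δ * (if reduced? (i ∷ u) then X (cvec (i ∷ u)) x else 0ℤ) ∎)
    where
    open ≡-Reasoning
    p = divDiffs u (Gr.fam (asWord w))
    Δ : ℤ
    Δ = x (inject₁ i) - x (suc i)
    x′ : Pt n
    x′ = x ∘ swapAt i
    c : Fin n → ℕ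
    c = toℕ ∘ cword u
    c-inj : Inj c
    c-inj = Inj-toℕ {f = cword u} {g = id} (Inj-cword u)
    alg₁ : ∀ d e o q → d * (e * (o * q)) ≡ e * (o * (d * q))
    alg₁ = solve-∀
    alg₂ : ∀ e o q r → e * (o * (q - r)) ≡ e * (o * q) - e * (o * r)
    alg₂ = solve-∀
    diff : ∀ β → below? (c (inject₁ i)) (c (suc i)) ≡ β → X (cvec u) x - X (cvec u) x′ ≡ Δ * (β * X (cvec (i ∷ u)) x)
    diff β e = trans (X-difference i x gx (cvec u)) (cong₂ (λ b v → Δ * (b * X v x))
      (trans (cong₂ below? (VecP.lookup∘tabulate c (inject₁ i)) (VecP.lookup∘tabulate c (suc i))) e) (sym (tabulate-swapV i c)))
    step : (if reduced? u then X (cvec u) x else 0ℤ) - (if reduced? u then X (cvec u) x′ else 0ℤ) ≡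
           Δ * (if reduced? (i ∷ u) then X (cvec (i ∷ u)) x else 0ℤ)
    step with inv (toℕ ∘ cword u) ℕ.≟ length u | inv (toℕ ∘ cword (i ∷ u)) ℕ.≟ suc (length u)
    ... | no ne | yes e = contradiction (ℕP.≤-antisym (inv-cword u)
            (ℕP.≤-pred (ℕP.≤-trans (ℕP.≤-reflexive (sym e)) (proj₁ (inv-swap-≤ c c-inj i))))) ne
    ... | no ne | no _  = sym (ℤP.*-zeroʳ Δ)
    ... | yes e | yes e′ with asc? c i
    ...   | yes α = trans (diff 1ℤ (cong (λ b → if b then 1ℤ else 0ℤ) (<ᵇ-true α))) (cong (_*_ Δ) (ℤP.*-identityˡ (X (cvec (i ∷ u)) x)))
    ...   | no ¬α = contradiction (trans (sym e) (trans (inv-desc c-inj i ¬α) (cong suc e′))) (ℕP.<⇒≢ (ℕP.m<n⇒m<1+n (ℕP.n<1+n (length u))))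
    step | yes e | no ne′ with asc? c i
    ... | yes α = contradiction (trans (inv-asc c i α) (cong suc e)) ne′
    ... | no ¬α = trans (diff 0ℤ (cong (λ b → if b then 1ℤ else 0ℤ) (<ᵇ-false ¬α))) (cong (_*_ Δ) (ℤP.*-zeroˡ (X (cvec (i ∷ u)) x)))

  X-poly : ∀ c → IsPoly (X c)
  X-poly c = sumL-poly (words n n) (λ a → *-poly (G-poly a) (chain-poly (Vec.map toℕ a) c id ∅ E))
    where
    G-poly : ∀ a → IsPoly (G a)
    G-poly a with inj? (asWord a)
    ... | yes _ = eval-poly (Gr.fam (asWord a))
    ... | no  _ = const-poly 0ℤ

  idWord : Vec (Fin n) n
  idWord = tabulate id

  -- At the origin only the identity has a nonvanishing Grothendieck polynomial, and every weight
  -- `y` is 1.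
  X-at-0 : ∀ c → X c (λ _ → 0ℤ) ≡ chain (tabulate toℕ) c (replicate n 1ℤ) ∅ E
  X-at-0 c = trans (sumL-only-word n idWord (λ a → G a (λ _ → 0ℤ) * Z a c (λ _ → 0ℤ)) other) here′
    where
    other : ∀ a → a ≢ idWord → G a (λ _ → 0ℤ) * Z a c (λ _ → 0ℤ) ≡ 0ℤ
    other a ne = trans (cong (_* Z a c (λ _ → 0ℤ)) zero′) (ℤP.*-zeroˡ (Z a c (λ _ → 0ℤ)))
      where
      zero′ : G a (λ _ → 0ℤ) ≡ 0ℤ
      zero′ with inj? (asWord a)
      ... | no  _ = refl
      ... | yes p = Gr.fam-at-0 (asWord a) λ z → ne (trans (sym (VecP.tabulate∘lookup a)) (VecP.tabulate-cong λ j →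
          FinP.toℕ-injective (trans (sym (VecP.lookup-map j toℕ a)) (sorted-is-identity (asWord a) p
            (λ j → subst (ℕ._< n) (sym (VecP.lookup-map j toℕ a)) (FinP.toℕ<n (lookup a j))) z j))))
    map-id : Vec.map toℕ idWord ≡ tabulate toℕ
    map-id = sym (VecP.tabulate-∘ toℕ id)
    word-id : asWord idWord ≗ toℕ
    word-id j = trans (VecP.lookup-map j toℕ idWord) (cong toℕ (VecP.lookup∘tabulate id j))
    one : G idWord (λ _ → 0ℤ) ≡ 1ℤ
    one with inj? (asWord idWord)
    ... | yes p = Dominant.fam-one grothendieckOp (asWord idWord) p
            (trans (inv-cong word-id) (ℕP.n≤0⇒n≡0 (inv-cword {m} [])))
    ... | no ¬p = contradiction (Inj-cong (λ j → sym (word-id j)) (λ i j → FinP.toℕ-injective)) ¬p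
    ones : ysAt {n} (λ _ → 0ℤ) ≡ replicate n 1ℤ
    ones = go n
      where
      go : ∀ k → tabulate {n = k} (λ _ → 1ℤ) ≡ replicate k 1ℤ
      go zero    = refl
      go (suc k) = cong (1ℤ ∷_) (go k)
    here′ : G idWord (λ _ → 0ℤ) * Z idWord c (λ _ → 0ℤ) ≡ chain (tabulate toℕ) c (replicate n 1ℤ) ∅ E
    here′ = trans (cong₂ _*_ one (cong₂ (λ a ys → chain a c ys ∅ E) map-id ones)) (ℤP.*-identityˡ (chain (tabulate toℕ) c (replicate n 1ℤ) ∅ E))

  derivative-at-0 : ∀ u → ε * eval (divDiffs u (Gr.fam (asWord w))) (λ _ → 0ℤ) ≡
    (if reduced? u then chain (tabulate toℕ) (cvec u) (replicate n 1ℤ) ∅ E else 0ℤ)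
  derivative-at-0 u = trans (cong (_*_ ε) (sym (trans (cong (_* q) (Ω-at-0 {n})) (ℤP.*-identityˡ q))))
    (trans (agree-everywhere (scale-poly ε (*-poly Ω-poly (eval-poly (divDiffs u (Gr.fam (asWord w)))))) right (derivative u) (λ _ → 0ℤ))
      (cong (λ z → if reduced? u then z else 0ℤ) (X-at-0 (cvec u))))
    where
    q : ℤ
    q = eval (divDiffs u (Gr.fam (asWord w))) (λ _ → 0ℤ)
    right : IsPoly (λ x → if reduced? u then X (cvec u) x else 0ℤ)
    right with reduced? u
    ... | true  = X-poly (cvec u)
    ... | false = const-poly 0ℤ

-- Iterated divided differences of Schubert polynomials.

module Sc = Family schubertOp

schubAux≡family : ∀ {m} k (w : Fin (suc m) → ℕ) → schubAux k w ≡ Sc.family k w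
schubAux≡family zero    w = refl
schubAux≡family (suc k) w with firstAscent w
... | nothing = refl
... | just i  = cong (divDiff i) (schubAux≡family k (w ∘ swapAt i))

grothAux≡family : ∀ {m} k (w : Fin (suc m) → ℕ) → grothAux k w ≡ Gr.family k w
grothAux≡family zero    w = refl
grothAux≡family (suc k) w with firstAscent w
... | nothing = refl
... | just i  = cong (λ p → divDiff i (oneMinusX (suc i) p)) (grothAux≡family k (w ∘ swapAt i))

divDiffs-++ : ∀ {m} (u : List (Fin m)) p q → divDiffs u (p ++ q) ≡ divDiffs u p ++ divDiffs u q
divDiffs-++ []      p q = refl
divDiffs-++ (i ∷ u) p q = trans (cong (divDiff i) (divDiffs-++ u p q)) (ListP.concatMap-++ (ddMono i) (divDiffs u p) (divDiffs u q))

divDiffs-[] : ∀ {m} (u : List (Fin m)) → divDiffs u [] ≡ []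
divDiffs-[] []      = refl
divDiffs-[] (i ∷ u) = cong (divDiff i) (divDiffs-[] u)

divDiffs-concatMap : ∀ {m} {A : Set} (u : List (Fin m)) (f : A → Poly (suc m)) xs x →
  eval (divDiffs u (concatMap f xs)) x ≡ sumL xs (λ a → eval (divDiffs u (f a)) x)
divDiffs-concatMap u f []       x = cong (λ p → eval p x) (divDiffs-[] u)
divDiffs-concatMap u f (a ∷ xs) x = trans (cong (λ p → eval p x) (divDiffs-++ u (f a) (concatMap f xs)))
  (trans (eval-++ (divDiffs u (f a)) (divDiffs u (concatMap f xs)) x) (cong (_+_ (eval (divDiffs u (f a)) x)) (divDiffs-concatMap u f xs x)))

-- The two lists of terms differ in form, since scalars and signs are multiplied in another order;
-- hence the detour through values.
divDiffs-scaleP : ∀ {m} (u : List (Fin m)) s p x → eval (divDiffs u (scaleP s p)) x ≡ s * eval (divDiffs u p) x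
divDiffs-scaleP u s p = agree-everywhere (eval-poly (divDiffs u (scaleP s p))) (scale-poly s (eval-poly (divDiffs u p))) (go u)
  where
  go : ∀ u x → Good x → eval (divDiffs u (scaleP s p)) x ≡ s * eval (divDiffs u p) x
  go []      x gx = eval-scaleP s p x
  go (i ∷ u) x gx = cancel (x (inject₁ i) - x (suc i)) (Good-diff gx (inject₁≢suc i))
    (trans (divDiff-eval i (divDiffs u (scaleP s p)) x)
      (trans (cong₂ _-_ (go u x gx) (go u (x ∘ swapAt i) (Good-swap i gx)))
        (trans (alg₁ s (eval (divDiffs u p) x) (eval (divDiffs u p) (x ∘ swapAt i)))
          (trans (cong (_*_ s) (sym (divDiff-eval i (divDiffs u p) x))) (alg₂ s (x (inject₁ i) - x (suc i)) (eval (divDiff i (divDiffs u p)) x))))))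
    where
    alg₁ : ∀ s a b → s * a - s * b ≡ s * (a - b)
    alg₁ = solve-∀
    alg₂ : ∀ s a b → s * (a * b) ≡ a * (s * b)
    alg₂ = solve-∀

module _ {m : ℕ} (v : Fin (suc m) → ℕ) (v-inj : Inj v) where

  private
    vc-inj : ∀ (u : List (Fin m)) → Inj (v ∘ cword u)
    vc-inj u i j e = Inj-cword u i j (v-inj _ _ e)

  inv≤descended : ∀ (u : List (Fin m)) → inv v ℕ.≤ inv (v ∘ cword u) ℕ.+ length u
  inv≤descended []      = ℕP.≤-reflexive (sym (ℕP.+-identityʳ (inv v)))
  inv≤descended (i ∷ u) = ℕP.≤-trans (inv≤descended u)
    (ℕP.≤-trans (ℕP.+-monoˡ-≤ (length u) (proj₂ (inv-swap-≤ (v ∘ cword u) (vc-inj u) i)))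
      (ℕP.≤-reflexive (sym (ℕP.+-suc (inv (v ∘ cword u ∘ swapAt i)) (length u)))))

  descends? : List (Fin m) → Bool
  descends? u = ⌊ inv (v ∘ cword u) ℕ.+ length u ℕ.≟ inv v ⌋

  -- Each letter of `u` must remove an inversion. The first that fails to do so meets a polynomial
  -- symmetric at that position, and everything is 0 from there on.
  schubert-derivative : ∀ u x → Good x →
    eval (divDiffs u (Sc.fam v)) x ≡ (if descends? u then eval (Sc.fam (v ∘ cword u)) x else 0ℤ)
  schubert-derivative [] x gx with inv v ℕ.+ 0 ℕ.≟ inv v
  ... | yes _ = refl
  ... | no ne = contradiction (ℕP.+-identityʳ (inv v)) ne
  schubert-derivative (i ∷ u) x gx = cancel Δ (Good-diff gx (inject₁≢suc i))
    (trans (divDiff-eval i (divDiffs u (Sc.fam v)) x)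
      (trans (cong₂ _-_ (schubert-derivative u x gx) (schubert-derivative u (x ∘ swapAt i) (Good-swap i gx))) step))
    where
    f : Fin (suc m) → ℕ
    f = v ∘ cword u
    Δ : ℤ
    Δ = x (inject₁ i) - x (suc i)
    down : ¬ Asc f i → eval (Sc.fam f) x - eval (Sc.fam f) (x ∘ swapAt i) ≡ Δ * eval (Sc.fam (f ∘ swapAt i)) x
    down ¬a = sym (trans (Related.at (Sc.fam-desc (vc-inj u) i ¬a) x gx)
      (alg (x (suc i)) (x (inject₁ i)) (eval (Sc.fam f) x) (eval (Sc.fam f) (x ∘ swapAt i))))
      where
      alg : ∀ p q a b → (1ℤ - 0ℤ * p) * a - (1ℤ - 0ℤ * q) * b ≡ a - b
      alg = solve-∀
    step : (if descends? u then eval (Sc.fam f) x else 0ℤ) - (if descends? u then eval (Sc.fam f) (x ∘ swapAt i) else 0ℤ) ≡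
      Δ * (if descends? (i ∷ u) then eval (Sc.fam (f ∘ swapAt i)) x else 0ℤ)
    step with inv f ℕ.+ length u ℕ.≟ inv v | inv (f ∘ swapAt i) ℕ.+ suc (length u) ℕ.≟ inv v
    ... | no ne | yes e = contradiction (ℕP.≤-antisym
            (ℕP.≤-trans (ℕP.+-monoˡ-≤ (length u) (proj₂ (inv-swap-≤ f (vc-inj u) i)))
              (ℕP.≤-reflexive (trans (sym (ℕP.+-suc (inv (f ∘ swapAt i)) (length u))) e))) (inv≤descended u)) ne
    ... | no ne | no _  = sym (ℤP.*-zeroʳ Δ)
    ... | yes e | yes e′ with asc? f i
    ...   | no ¬a = down ¬a
    ...   | yes a = contradiction (trans e (sym e′)) (ℕP.<⇒≢ (subst (λ z → inv f ℕ.+ length u ℕ.< z ℕ.+ suc (length u)) (sym (inv-asc f i a))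
            (ℕP.+-mono-<-≤ (ℕP.n<1+n (inv f)) (ℕP.n≤1+n (length u)))))
    step | yes e | no ne′ with asc? f i
    ... | yes a = trans (ℤP.i≡j⇒i-j≡0 {eval (Sc.fam f) x} (sym (Sc.fam-symmetric f i a x gx))) (sym (ℤP.*-zeroʳ Δ))
    ... | no ¬a = contradiction (trans (ℕP.+-suc (inv (f ∘ swapAt i)) (length u))
            (trans (cong (ℕ._+ length u) (sym (inv-desc (vc-inj u) i ¬a))) e)) ne′

  schubert-derivative-at-0 : ∀ u → eval (divDiffs u (Sc.fam v)) (λ _ → 0ℤ) ≡
    (if descends? u then (if ⌊ inv (v ∘ cword u) ℕ.≟ 0 ⌋ then 1ℤ else 0ℤ) else 0ℤ)
  schubert-derivative-at-0 u =
    trans (agree-everywhere (eval-poly (divDiffs u (Sc.fam v))) right (schubert-derivative u) (λ _ → 0ℤ))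
          (cong (λ z → if descends? u then z else 0ℤ) value)
    where
    right : IsPoly (λ x → if descends? u then eval (Sc.fam (v ∘ cword u)) x else 0ℤ)
    right with descends? u
    ... | true  = eval-poly (Sc.fam (v ∘ cword u))
    ... | false = const-poly 0ℤ
    value : eval (Sc.fam (v ∘ cword u)) (λ _ → 0ℤ) ≡ (if ⌊ inv (v ∘ cword u) ℕ.≟ 0 ⌋ then 1ℤ else 0ℤ)
    value with inv (v ∘ cword u) ℕ.≟ 0
    ... | yes z = Dominant.fam-one schubertOp (v ∘ cword u) (vc-inj u) z
    ... | no nz = Sc.fam-at-0 (v ∘ cword u) nz

-- Signs, and the derivatives of the right-hand side.

alternating : ℕ → ℤ
alternating zero    = 1ℤ
alternating (suc k) = - alternating k

mutual
  negOnePow-alternating : ∀ z → negOnePow z ≡ alternating ∣ z ∣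
  negOnePow-alternating z with ∣ z ∣
  ... | k = go-alternating z k

  -- The underscore is the local recursion of `negOnePow`, determined by the call above.
  go-alternating : ∀ (z : ℤ) k → _ ≡ alternating k
  go-alternating z zero    = refl
  go-alternating z (suc k) = cong -_ (go-alternating z k)

alternating-+ : ∀ a b → alternating (a ℕ.+ b) ≡ alternating a * alternating b
alternating-+ zero    b = sym (ℤP.*-identityˡ (alternating b))
alternating-+ (suc a) b = trans (cong -_ (alternating-+ a b)) (ℤP.neg-distribˡ-* (alternating a) (alternating b))

alternating² : ∀ a → alternating a * alternating a ≡ 1ℤ
alternating² zero    = refl
alternating² (suc a) = trans (alg (alternating a)) (alternating² a)
  where
  alg : ∀ x → - x * - x ≡ x * x
  alg = solve-∀

negOnePow-difference : ∀ a b → negOnePow (+ a - + b) ≡ alternating a * alternating b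
negOnePow-difference a b = trans (negOnePow-alternating (+ a - + b))
  (trans (cong (alternating ∘ ∣_∣) (ℤP.m-n≡m⊖n a b)) (go a b))
  where
  go : ∀ a b → alternating ∣ a ℤ.⊖ b ∣ ≡ alternating a * alternating b
  go a       zero    = trans (cong (alternating ∘ ∣_∣) (ℤP.⊖-≥ {a} {0} z≤n)) (sym (ℤP.*-identityʳ (alternating a)))
  go zero    (suc b) = sym (ℤP.*-identityˡ (alternating (suc b)))
  go (suc a) (suc b) = trans (cong (alternating ∘ ∣_∣) (ℤP.[1+m]⊖[1+n]≡m⊖n a b))
    (trans (go a b) (alg (alternating a) (alternating b)))
    where
    alg : ∀ x y → x * y ≡ - x * - y
    alg = solve-∀

module _ {m : ℕ} (w : Permutation′ (suc m)) where

  valid? : Grid BTile (suc m) → Bool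
  valid? g = inBPD w g ∧ isReducedCo (check g)

  -- The constant term of N_u applied to the summand of a valid grid.
  contribution : List (Fin m) → Grid BTile (suc m) → ℤ
  contribution u g = alternating (inv v) * alternating (inv (oneLine w)) *
    (if ⌊ inv (v ∘ cword u) ℕ.+ length u ℕ.≟ inv v ⌋ then (if ⌊ inv (v ∘ cword u) ℕ.≟ 0 ⌋ then 1ℤ else 0ℤ) else 0ℤ)
    where
    v : Fin (suc m) → ℕ
    v = δC (check g)

  -- The derivative of a Schubert polynomial is known for injective labels; that `δC` of a valid
  -- grid is injective follows later, by tracing its pipes.
  rhs-derivative : (∀ g → valid? g ≡ true → Inj (δC (check g))) → ∀ u →
    eval (divDiffs u (rhs w)) (λ _ → 0ℤ) ≡ sumL (allBGrids (suc m)) (λ g → if valid? g then contribution u g else 0ℤ)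
  rhs-derivative inj u = trans (divDiffs-concatMap u _ (allBGrids (suc m)) (λ _ → 0ℤ)) (sumL-cong (allBGrids (suc m)) each)
    where
    each : ∀ g → eval (divDiffs u (if valid? g
        then scaleP (negOnePow (+ len (δC (check g)) - + len (oneLine w))) (Schubert (δC (check g))) else [])) (λ _ → 0ℤ) ≡
      (if valid? g then contribution u g else 0ℤ)
    each g with valid? g in eq
    ... | false = cong (λ p → eval p (λ _ → 0ℤ)) (divDiffs-[] u)
    ... | true  = trans (divDiffs-scaleP u s (Schubert v) (λ _ → 0ℤ)) (cong₂ _*_ sign
        (trans (cong (λ p → eval (divDiffs u p) (λ _ → 0ℤ)) (schubAux≡family (suc m ℕ.* suc m) v))
               (schubert-derivative-at-0 v (inj g eq) u)))
      where
      v : Fin (suc m) → ℕ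
      v = δC (check g)
      s : ℤ
      s = negOnePow (+ len v - + len (oneLine w))
      sign : s ≡ alternating (inv v) * alternating (inv (oneLine w))
      sign = trans (negOnePow-difference (len v) (len (oneLine w)))
        (cong₂ (λ a b → alternating a * alternating b) (len≡inv v) (len≡inv (oneLine w)))

  rhs-stair : All (Stair ∘ proj₂) (rhs w)
  rhs-stair = go (allBGrids (suc m)) each
    where
    go : ∀ {A : Set} {f : A → Poly (suc m)} xs → (∀ a → All (Stair ∘ proj₂) (f a)) → All (Stair ∘ proj₂) (concatMap f xs)
    go []       h = []
    go (a ∷ xs) h = AllP.++⁺ (h a) (go xs h)
    each : ∀ g → All (Stair ∘ proj₂) (if valid? g
        then scaleP (negOnePow (+ len (δC (check g)) - + len (oneLine w))) (Schubert (δC (check g))) else [])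
    each g with valid? g
    ... | false = []
    ... | true  = AllP.map⁺ (subst (All (Stair ∘ proj₂)) (sym (schubAux≡family (suc m ℕ.* suc m) (δC (check g))))
        (Sc.family-stair (suc m ℕ.* suc m) (δC (check g))))

-- Pipes through a grid, by rows and by columns.

open Edges

Log : Set
Log = List (ℕ × ℕ)

-- What a tile does to a pipe entering vertically and a pipe entering from the left. Read from below this
-- covers the BPD, read from above the co-BPD.
data Move : Set where
  turn drop pass straight meet empty : Move

moveB moveC : BTile → Move
moveB elbowBR = turn
moveB elbowTL = drop
moveB horiz   = pass
moveB vert    = straight
moveB cross   = meet
moveB blank   = empty
moveC elbowBR = turn
moveC elbowTL = drop
moveC horiz   = meet
moveC vert    = empty
moveC cross   = pass
moveC blank   = straight

-- f takes the left and the vertical label to the labels leaving vertically and to the right.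
Crossing : Set
Crossing = ℕ → ℕ → ℕ × ℕ

sortPipes crossPipes : Crossing
sortPipes  l v = v ⊔ l , v ⊓ l
crossPipes l v = v , l

cell : Crossing → Move → Lab → Lab → Lab × Lab × Log
cell f turn     v        l        = nothing , v , []
cell f drop     v        l        = l , nothing , []
cell f pass     v        l        = nothing , l , []
cell f straight v        l        = v , nothing , []
cell f meet     (just v) (just l) = just (proj₁ (f l v)) , just (proj₂ (f l v)) , (l , v) ∷ []
cell f meet     v        l        = v , l , []
cell f empty    v        l        = nothing , nothing , []

-- `row`, `down` and `up` proceed by rows, as the definitions do; `colDown` and `colUp` proceed as
-- `column` does. The log keeps the left and the vertical label of every meeting.
module Network (f : Crossing) (mv : BTile → Move) where

  row : ∀ {n} → Vec BTile n → Lab → Vec Lab n → Vec Lab n × Lab × Log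
  row []       l []       = [] , l , []
  row (t ∷ ts) l (v ∷ vs) =
    let (o , r , x) = cell f (mv t) v l; (os , rr , xs) = row ts r vs in o ∷ os , rr , x ++ xs

  down up : ∀ {n k} → Vec (Vec BTile n) k → Vec Lab k → Vec Lab n → Vec Lab n × Vec Lab k × Log
  down []       []       vs = vs , [] , []
  down (r ∷ rs) (l ∷ ls) vs =
    let (os , x , log) = row r l vs; (os′ , xs , log′) = down rs ls os in os′ , x ∷ xs , log ++ log′
  up []       []       vs = vs , [] , []
  up (r ∷ rs) (l ∷ ls) vs =
    let (os , xs , log) = up rs ls vs; (os′ , x , log′) = row r l os in os′ , x ∷ xs , log ++ log′

  colDown colUp : ∀ {k} → Vec BTile k → Vec Lab k → Lab → Lab × Vec Lab k × Log
  colDown []       []       v = v , [] , []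
  colDown (t ∷ ts) (l ∷ ls) v =
    let (o , r , x) = cell f (mv t) v l; (v′ , rs , xs) = colDown ts ls o in v′ , r ∷ rs , x ++ xs
  colUp []       []       v = v , [] , []
  colUp (t ∷ ts) (l ∷ ls) v =
    let (v′ , rs , xs) = colUp ts ls v; (o , r , x) = cell f (mv t) v′ l in o , r ∷ rs , xs ++ x

outs : ∀ {A B C : Set} → A × B × C → A
outs = proj₁

rights : ∀ {A B C : Set} → A × B × C → B
rights = proj₁ ∘ proj₂

log : ∀ {A B C : Set} → A × B × C → C
log = proj₂ ∘ proj₂

val : (ℕ → ℕ → ℤ) → Log → ℤ
val W []            = 1ℤ
val W ((a , b) ∷ l) = W a b * val W l

val-++ : ∀ W l l′ → val W (l ++ l′) ≡ val W l * val W l′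
val-++ W []            l′ = sym (ℤP.*-identityˡ (val W l′))
val-++ W ((a , b) ∷ l) l′ = trans (cong (_*_ (W a b)) (val-++ W l l′)) (sym (ℤP.*-assoc (W a b) (val W l) (val W l′)))

-- Rows and columns list the same meetings in different orders, so only products of weights are
-- compared.
val-four : ∀ W l₁ l₂ l₃ l₄ l → val W l ≡ val W l₃ * val W l₄ →
  val W ((l₁ ++ l₂) ++ l) ≡ val W (l₁ ++ l₃) * val W (l₂ ++ l₄)
val-four W l₁ l₂ l₃ l₄ l e = trans (val-++ W (l₁ ++ l₂) l)
  (trans (cong₂ _*_ (val-++ W l₁ l₂) e)
    (trans (alg (val W l₁) (val W l₂) (val W l₃) (val W l₄)) (cong₂ _*_ (sym (val-++ W l₁ l₃)) (sym (val-++ W l₂ l₄)))))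
  where
  alg : ∀ a b c d → a * b * (c * d) ≡ a * c * (b * d)
  alg = solve-∀

val-comm : ∀ W l l′ → val W (l ++ l′) ≡ val W (l′ ++ l)
val-comm W l l′ = trans (val-++ W l l′) (trans (ℤP.*-comm (val W l) (val W l′)) (sym (val-++ W l′ l)))

consColumn : ∀ {A : Set} {n k} → Vec A k → Vec (Vec A n) k → Vec (Vec A (suc n)) k
consColumn = Vec.zipWith _∷_

module _ (f : Crossing) (mv : BTile → Move) where
  open Network f mv

  -- Pipes enter a column only from the left and from above, so the first column can be run to its
  -- end before the others start.
  down-rights : ∀ {n k} (col : Vec BTile k) (g : Vec (Vec BTile n) k) ls v vs →
    rights (down (consColumn col g) ls (v ∷ vs)) ≡ rights (down g (rights (colDown col ls v)) vs)
  down-rights []        []      []       v vs = refl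
  down-rights (t ∷ col) (r ∷ g) (l ∷ ls) v vs = cong (_ ∷_) (down-rights col g ls _ _)

  down-val : ∀ W {n k} (col : Vec BTile k) (g : Vec (Vec BTile n) k) ls v vs →
    val W (log (down (consColumn col g) ls (v ∷ vs))) ≡ val W (log (colDown col ls v)) * val W (log (down g (rights (colDown col ls v)) vs))
  down-val W []        []      []       v vs = refl
  down-val W (t ∷ col) (r ∷ g) (l ∷ ls) v vs =
    val-four W (log c₀) (log r₀) (log (colDown col ls (outs c₀))) (log (down g (rights (colDown col ls (outs c₀))) (outs r₀)))
      (log (down (consColumn col g) ls (outs c₀ ∷ outs r₀))) (down-val W col g ls (outs c₀) (outs r₀))
    where
    c₀ = cell f (mv t) v l
    r₀ = row r (rights c₀) vs

  up-outs : ∀ {n k} (col : Vec BTile k) (g : Vec (Vec BTile n) k) ls v vs →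
    outs (up (consColumn col g) ls (v ∷ vs)) ≡ outs (colUp col ls v) ∷ outs (up g (rights (colUp col ls v)) vs)
  up-outs []        []      []       v vs = refl
  up-outs (t ∷ col) (r ∷ g) (l ∷ ls) v vs rewrite up-outs col g ls v vs = refl

  up-rights : ∀ {n k} (col : Vec BTile k) (g : Vec (Vec BTile n) k) ls v vs →
    rights (up (consColumn col g) ls (v ∷ vs)) ≡ rights (up g (rights (colUp col ls v)) vs)
  up-rights []        []      []       v vs = refl
  up-rights (t ∷ col) (r ∷ g) (l ∷ ls) v vs rewrite up-outs col g ls v vs =
    cong (rights (row r (rights (cell f (mv t) (outs (colUp col ls v)) l)) (outs (up g (rights (colUp col ls v)) vs))) ∷_) (up-rights col g ls v vs)

  up-val : ∀ W {n k} (col : Vec BTile k) (g : Vec (Vec BTile n) k) ls v vs →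
    val W (log (up (consColumn col g) ls (v ∷ vs))) ≡ val W (log (colUp col ls v)) * val W (log (up g (rights (colUp col ls v)) vs))
  up-val W []        []      []       v vs = refl
  up-val W (t ∷ col) (r ∷ g) (l ∷ ls) v vs rewrite up-outs col g ls v vs =
    trans (val-comm W (log (up (consColumn col g) ls (v ∷ vs))) (log c₀ ++ log r₀))
      (trans (val-four W (log c₀) (log r₀) (log u₀) (log (up g (rights u₀) vs)) (log (up (consColumn col g) ls (v ∷ vs))) (up-val W col g ls v vs))
        (cong₂ _*_ (val-comm W (log c₀) (log u₀)) (val-comm W (log r₀) (log (up g (rights u₀) vs)))))
    where
    u₀ = colUp col ls v
    c₀ = cell f (mv t) (outs u₀) l
    r₀ = row r (rights c₀) (outs (up g (rights u₀) vs))

-- The definitions enumerate grids by rows, the lattice model by columns.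
sumL-columns : ∀ {A : Set} (xs : List A) n k (F : Vec (Vec A (suc n)) k → ℤ) →
  sumL (allVecs (allVecs xs (suc n)) k) F ≡
  sumL (allVecs xs k) (λ col → sumL (allVecs (allVecs xs n) k) (λ g → F (consColumn col g)))
sumL-columns xs n zero    F = sym (ℤP.+-identityʳ (F [] + 0ℤ))
sumL-columns xs n (suc k) F = begin
  sumL (allVecs (allVecs xs (suc n)) (suc k)) F
    ≡⟨ sumL-allVecs (allVecs xs (suc n)) k F ⟩
  sumL (allVecs xs (suc n)) (λ r → sumL (allVecs (allVecs xs (suc n)) k) (λ g → F (r ∷ g)))
    ≡⟨ sumL-cong (allVecs xs (suc n)) (λ r → sumL-columns xs n k (λ g → F (r ∷ g))) ⟩
  sumL (allVecs xs (suc n)) (λ r → sumL (allVecs xs k) (λ col → sumL (allVecs (allVecs xs n) k) (λ g → F (r ∷ consColumn col g))))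
    ≡⟨ sumL-allVecs xs n _ ⟩
  sumL xs (λ t → sumL (allVecs xs n) (λ r → sumL (allVecs xs k) (λ col → sumL (allVecs (allVecs xs n) k) (λ g → F ((t ∷ r) ∷ consColumn col g)))))
    ≡⟨ sumL-cong xs (λ t → sumL-comm (allVecs xs n) (allVecs xs k) _) ⟩
  sumL xs (λ t → sumL (allVecs xs k) (λ col → sumL (allVecs xs n) (λ r → sumL (allVecs (allVecs xs n) k) (λ g → F ((t ∷ r) ∷ consColumn col g)))))
    ≡⟨ sumL-cong xs (λ t → sumL-cong (allVecs xs k) (λ col → sym (sumL-allVecs (allVecs xs n) k (λ g → F (consColumn (t ∷ col) g))))) ⟩
  sumL xs (λ t → sumL (allVecs xs k) (λ col → sumL (allVecs (allVecs xs n) (suc k)) (λ g → F (consColumn (t ∷ col) g))))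
    ≡⟨ sym (sumL-allVecs xs k _) ⟩
  sumL (allVecs xs (suc k)) (λ col → sumL (allVecs (allVecs xs n) (suc k)) (λ g → F (consColumn col g))) ∎
  where open ≡-Reasoning


-- The partition function at the origin as a sum over tilings.

-- Edges of a column match, given the occupancy by BPD pipes of its top edge and of its left edges.
colOK : ∀ {k} → Vec BTile k → Bool → Vec Bool k → Bool
colOK []       p []       = p
colOK (t ∷ ts) p (q ∷ qs) = (left (bEdges t) == q) ∧ ((top (bEdges t) == p) ∧ colOK ts (bottom (bEdges t)) qs)

rowOK′ : ∀ {n} → Vec BTile n → Bool → Vec Bool n → Bool
rowOK′ []       q []       = true
rowOK′ (t ∷ ts) q (e ∷ es) = (left (bEdges t) == q) ∧ ((top (bEdges t) == e) ∧ rowOK′ ts (right (bEdges t)) es)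

-- Left and top occupancy are arguments and the right side is left open, so that cutting off the
-- first column only replaces the left boundary.
gridOK′ : ∀ {n k} → Vec (Vec BTile n) k → Vec Bool k → Vec Bool n → Bool
gridOK′ []      []       es = allB es
gridOK′ (r ∷ g) (q ∷ qs) es = rowOK′ r q es ∧ gridOK′ g qs (Vec.map (bottom ∘ bEdges) r)

∧-four : ∀ a b c d → (a ∧ b) ∧ (c ∧ d) ≡ (a ∧ c) ∧ (b ∧ d)
∧-four false b c d = refl
∧-four true  b false d = BoolP.∧-zeroʳ b
∧-four true  b true  d = refl

gridOK′-column : ∀ {n k} (col : Vec BTile k) (g : Vec (Vec BTile n) k) qs e es →
  gridOK′ (consColumn col g) qs (e ∷ es) ≡ colOK col e qs ∧ gridOK′ g (Vec.map (right ∘ bEdges) col) es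
gridOK′-column []        []      []       e es = refl
gridOK′-column (t ∷ col) (r ∷ g) (q ∷ qs) e es =
  trans (cong₂ _∧_ (sym (BoolP.∧-assoc (left (bEdges t) == q) (top (bEdges t) == e) (rowOK′ r (right (bEdges t)) es)))
          (gridOK′-column col g qs (bottom (bEdges t)) (Vec.map (bottom ∘ bEdges) r)))
    (trans (∧-four ((left (bEdges t) == q) ∧ (top (bEdges t) == e)) (rowOK′ r (right (bEdges t)) es)
              (colOK col (bottom (bEdges t)) qs) (gridOK′ g (Vec.map (right ∘ bEdges) col) (Vec.map (bottom ∘ bEdges) r)))
      (cong (_∧ (rowOK′ r (right (bEdges t)) es ∧ gridOK′ g (Vec.map (right ∘ bEdges) col) (Vec.map (bottom ∘ bEdges) r)))
        (BoolP.∧-assoc (left (bEdges t) == q) (top (bEdges t) == e) (colOK col (bottom (bEdges t)) qs))))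

occ : Lab → Bool
occ nothing  = false
occ (just _) = true

==-sound : ∀ a b → (a == b) ≡ true → a ≡ b
==-sound true  true  e = refl
==-sound false false e = refl

∧-true : ∀ {a b} → a ∧ b ≡ true → a ≡ true × b ≡ true
∧-true {true} {true} e = refl , refl

occ-B : ∀ f t v l → occ v ≡ bottom (bEdges t) → occ l ≡ left (bEdges t) →
  occ (outs (cell f (moveB t) v l)) ≡ top (bEdges t) × occ (rights (cell f (moveB t) v l)) ≡ right (bEdges t)
occ-B f elbowBR v l ev el = refl , ev
occ-B f elbowTL v l ev el = el , refl
occ-B f horiz   v l ev el = refl , el
occ-B f vert    v l ev el = ev , refl
occ-B f cross (just v) (just l) ev el = refl , refl
occ-B f blank   v l ev el = refl , refl

-- A vertical edge carries a co-BPD pipe exactly where it carries no BPD pipe, hence the negations.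
occ-C : ∀ f t v l → not (occ v) ≡ top (bEdges t) → occ l ≡ left (bEdges t) →
  not (occ (outs (cell f (moveC t) v l))) ≡ bottom (bEdges t) × occ (rights (cell f (moveC t) v l)) ≡ right (bEdges t)
occ-C f elbowBR (just v) l ev el = refl , refl
occ-C f elbowTL v (just l) ev el = refl , refl
occ-C f horiz (just v) (just l) ev el = refl , refl
occ-C f vert    v l ev el = refl , refl
occ-C f cross   v l ev el = refl , el
occ-C f blank   v l ev el = ev , refl

colOK-parts : ∀ {k} t (ts : Vec BTile k) p q qs → colOK (t ∷ ts) p (q ∷ qs) ≡ true →
  left (bEdges t) ≡ q × top (bEdges t) ≡ p × colOK ts (bottom (bEdges t)) qs ≡ true
colOK-parts t ts p q qs e with ∧-true {left (bEdges t) == q} e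
... | e₁ , e₂ with ∧-true {top (bEdges t) == p} e₂
... | e₃ , e₄ = ==-sound _ _ e₁ , ==-sound _ _ e₃ , e₄

occ-colUp : ∀ f {k} (ts : Vec BTile k) p ls a → colOK ts p (Vec.map occ ls) ≡ true →
  occ (outs (Network.colUp f moveB ts ls (just a))) ≡ p ×
  Vec.map occ (rights (Network.colUp f moveB ts ls (just a))) ≡ Vec.map (right ∘ bEdges) ts
occ-colUp f []       p []       a e = sym e , refl
occ-colUp f (t ∷ ts) p (l ∷ ls) a e with colOK-parts t ts p (occ l) (Vec.map occ ls) e
... | el , et , e′ with occ-colUp f ts (bottom (bEdges t)) ls a e′
... | ih₁ , ih₂ with occ-B f t (outs (Network.colUp f moveB ts ls (just a))) l ih₁ (sym el)
... | o , r = trans o et , cong₂ _∷_ r ih₂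

occ-colDown : ∀ f {k} (ts : Vec BTile k) v ls → colOK ts (not (occ v)) (Vec.map occ ls) ≡ true →
  Vec.map occ (rights (Network.colDown f moveC ts ls v)) ≡ Vec.map (right ∘ bEdges) ts
occ-colDown f []       v []       e = refl
occ-colDown f (t ∷ ts) v (l ∷ ls) e with colOK-parts t ts (not (occ v)) (occ l) (Vec.map occ ls) e
... | el , et , e′ with occ-C f t v l (sym et) (sym el)
... | o , r = cong₂ _∷_ r (occ-colDown f ts (outs (cell f (moveC t) v l)) ls
        (subst (λ p → colOK ts p (Vec.map occ ls) ≡ true) (sym o) e′))

-- The default 0 does not show on consistent columns, where both labels are present or both absent.
edge : Lab → Lab → H
edge b nothing  = nothing
edge b (just c) = just (fromMaybe 0 b , c)

edgeStates : ∀ {k} → Vec Lab k → Vec Lab k → Vec H k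
edgeStates = Vec.zipWith edge

negBelow : ℕ → ℕ → ℤ
negBelow z c = - below? z c

module B = Network sortPipes moveB
module C = Network crossPipes moveC

columnTerm : ∀ {k} → Lab → ℕ → Vec Lab k → Vec Lab k → (Vec H k → ℕ → ℤ) → Vec BTile k → ℤ
columnTerm S a bs cs F ts = if colOK ts (not (occ S)) (Vec.map occ cs)
  then val sgn (log (B.colUp ts bs (just a))) * val negBelow (log (C.colDown ts cs S)) *
       F (edgeStates (rights (B.colUp ts bs (just a))) (rights (C.colDown ts cs S))) (fromMaybe 0 (outs (B.colUp ts bs (just a))))
  else 0ℤ

when-true : ∀ b {x y : ℤ} → (b ≡ true → x ≡ y) → (if b then x else 0ℤ) ≡ (if b then y else 0ℤ)
when-true true  h = h refl
when-true false h = refl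

when-scale : ∀ s b {x y : ℤ} → (b ≡ true → x ≡ s * y) → (if b then x else 0ℤ) ≡ s * (if b then y else 0ℤ)
when-scale s true  h = h refl
when-scale s false h = sym (ℤP.*-zeroʳ s)

sum-first-tile : ∀ {k} (K : Vec BTile (suc k) → ℤ) {x₁ x₂ x₃ x₄ x₅ x₆} → let Σ′ = λ t → sumL (allVecs bTiles k) (λ ts → K (t ∷ ts)) in
  Σ′ elbowBR ≡ x₁ → Σ′ elbowTL ≡ x₂ → Σ′ horiz ≡ x₃ → Σ′ vert ≡ x₄ → Σ′ cross ≡ x₅ → Σ′ blank ≡ x₆ →
  sumL (allVecs bTiles (suc k)) K ≡ x₁ + (x₂ + (x₃ + (x₄ + (x₅ + (x₆ + 0ℤ)))))
sum-first-tile {k} K refl refl refl refl refl refl = sumL-allVecs bTiles k K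

column-tilings : ∀ {k} S a (bs cs : Vec Lab k) F → Vec.map occ bs ≡ Vec.map occ cs →
  column S a 1ℤ (edgeStates bs cs) F ≡ sumL (allVecs bTiles k) (columnTerm S a bs cs F)
column-tilings nothing  a [] [] F e = alg (F [] a)
  where
  alg : ∀ x → x ≡ 1ℤ * 1ℤ * x + 0ℤ
  alg = solve-∀
column-tilings (just c) a [] [] F e = refl
column-tilings {suc k} nothing a (nothing ∷ bs) (nothing ∷ cs) F e =
  trans (alg (column nothing a 1ℤ (edgeStates bs cs) F′))
    (sym (sum-first-tile (columnTerm nothing a (nothing ∷ bs) (nothing ∷ cs) F) Z Z Z here′ Z Z))
  where
  e′ = VecP.∷-injectiveʳ e
  Z = sumL-zero (allVecs bTiles k)
  F′ : Vec H k → ℕ → ℤ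
  F′ q b = F (nothing ∷ q) b
  alg : ∀ x → 1ℤ * x ≡ 0ℤ + (0ℤ + (0ℤ + (x + (0ℤ + (0ℤ + 0ℤ)))))
  alg = solve-∀
  here′ : sumL (allVecs bTiles k) (λ ts → columnTerm nothing a (nothing ∷ bs) (nothing ∷ cs) F (vert ∷ ts)) ≡ column nothing a 1ℤ (edgeStates bs cs) F′
  here′ = trans (sumL-cong (allVecs bTiles k) (λ ts → cong (λ l → if colOK ts true (Vec.map occ cs) then val sgn l * val negBelow (log (C.colDown ts cs nothing)) *
      F (nothing ∷ edgeStates (rights (B.colUp ts bs (just a))) (rights (C.colDown ts cs nothing))) (fromMaybe 0 (outs (B.colUp ts bs (just a)))) else 0ℤ)
        (ListP.++-identityʳ (log (B.colUp ts bs (just a)))))) (sym (column-tilings nothing a bs cs F′ e′))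
column-tilings {suc k} (just c) a (nothing ∷ bs) (nothing ∷ cs) F e =
  trans (alg (column nothing a 1ℤ (edgeStates bs cs) F₁) (column (just c) a 1ℤ (edgeStates bs cs) F₂))
    (sym (sum-first-tile (columnTerm (just c) a (nothing ∷ bs) (nothing ∷ cs) F) elbow Z Z Z Z through))
  where
  e′ = VecP.∷-injectiveʳ e
  Z = sumL-zero (allVecs bTiles k)
  F₁ F₂ : Vec H k → ℕ → ℤ
  F₁ q b = F (just (b , c) ∷ q) 0
  F₂ q _ = F (nothing ∷ q) 0
  alg : ∀ x y → 1ℤ * x + y ≡ x + (0ℤ + (0ℤ + (0ℤ + (0ℤ + (y + 0ℤ)))))
  alg = solve-∀
  elbow : sumL (allVecs bTiles k) (λ ts → columnTerm (just c) a (nothing ∷ bs) (nothing ∷ cs) F (elbowBR ∷ ts)) ≡ column nothing a 1ℤ (edgeStates bs cs) F₁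
  elbow = trans (sumL-cong (allVecs bTiles k) (λ ts → cong (λ l → if colOK ts true (Vec.map occ cs) then val sgn l * val negBelow (log (C.colDown ts cs nothing)) *
      F (just (fromMaybe 0 (outs (B.colUp ts bs (just a))) , c) ∷ edgeStates (rights (B.colUp ts bs (just a))) (rights (C.colDown ts cs nothing))) 0 else 0ℤ)
        (ListP.++-identityʳ (log (B.colUp ts bs (just a)))))) (sym (column-tilings nothing a bs cs F₁ e′))
  through : sumL (allVecs bTiles k) (λ ts → columnTerm (just c) a (nothing ∷ bs) (nothing ∷ cs) F (blank ∷ ts)) ≡ column (just c) a 1ℤ (edgeStates bs cs) F₂
  through = trans (sumL-cong (allVecs bTiles k) (λ ts → cong (λ l → if colOK ts false (Vec.map occ cs) then val sgn l * val negBelow (log (C.colDown ts cs (just c))) *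
      F (nothing ∷ edgeStates (rights (B.colUp ts bs (just a))) (rights (C.colDown ts cs (just c)))) 0 else 0ℤ)
        (ListP.++-identityʳ (log (B.colUp ts bs (just a)))))) (sym (column-tilings (just c) a bs cs F₂ e′))
column-tilings {suc k} nothing a (just x ∷ bs) (just z ∷ cs) F e =
  trans (alg (column (just z) a 1ℤ (edgeStates bs cs) F₁) (column nothing a 1ℤ (edgeStates bs cs) F₂))
    (sym (sum-first-tile (columnTerm nothing a (just x ∷ bs) (just z ∷ cs) F) Z elbow Z Z crossing Z))
  where
  e′ = VecP.∷-injectiveʳ e
  Z = sumL-zero (allVecs bTiles k)
  F₁ F₂ : Vec H k → ℕ → ℤ
  F₁ q _ = F (nothing ∷ q) x
  F₂ q b = sgn x b * F (just (b ⊓ x , z) ∷ q) (b ⊔ x)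
  alg : ∀ x y → x + 1ℤ * y ≡ 0ℤ + (x + (0ℤ + (0ℤ + (y + (0ℤ + 0ℤ)))))
  alg = solve-∀
  elbow : sumL (allVecs bTiles k) (λ ts → columnTerm nothing a (just x ∷ bs) (just z ∷ cs) F (elbowTL ∷ ts)) ≡ column (just z) a 1ℤ (edgeStates bs cs) F₁
  elbow = trans (sumL-cong (allVecs bTiles k) (λ ts → cong (λ l → if colOK ts false (Vec.map occ cs) then val sgn l * val negBelow (log (C.colDown ts cs (just z))) *
      F (nothing ∷ edgeStates (rights (B.colUp ts bs (just a))) (rights (C.colDown ts cs (just z)))) x else 0ℤ)
        (ListP.++-identityʳ (log (B.colUp ts bs (just a)))))) (sym (column-tilings (just z) a bs cs F₁ e′))
  crossing : sumL (allVecs bTiles k) (λ ts → columnTerm nothing a (just x ∷ bs) (just z ∷ cs) F (cross ∷ ts)) ≡ column nothing a 1ℤ (edgeStates bs cs) F₂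
  crossing = trans (sumL-cong (allVecs bTiles k) (λ ts → when-true (colOK ts true (Vec.map occ cs)) (step ts)))
    (sym (column-tilings nothing a bs cs F₂ e′))
    where
    step : ∀ ts → colOK ts true (Vec.map occ cs) ≡ true →
      val sgn (log (B.colUp (cross ∷ ts) (just x ∷ bs) (just a))) * val negBelow (log (C.colDown ts cs nothing)) *
        F (edge (rights (cell sortPipes meet (outs (B.colUp ts bs (just a))) (just x))) (just z) ∷
            edgeStates (rights (B.colUp ts bs (just a))) (rights (C.colDown ts cs nothing)))
          (fromMaybe 0 (outs (cell sortPipes meet (outs (B.colUp ts bs (just a))) (just x)))) ≡
      val sgn (log (B.colUp ts bs (just a))) * val negBelow (log (C.colDown ts cs nothing)) *
        F₂ (edgeStates (rights (B.colUp ts bs (just a))) (rights (C.colDown ts cs nothing))) (fromMaybe 0 (outs (B.colUp ts bs (just a))))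
    -- Consistency guarantees a BPD pipe from below, so the two pipes really meet.
    step ts ok with outs (B.colUp ts bs (just a)) | proj₁ (occ-colUp sortPipes ts true bs a (subst (λ o → colOK ts true o ≡ true) (sym e′) ok))
    ... | just b | _ = trans (cong (λ v → v * val negBelow (log (C.colDown ts cs nothing)) *
            F (just (b ⊓ x , z) ∷ edgeStates (rights (B.colUp ts bs (just a))) (rights (C.colDown ts cs nothing))) (b ⊔ x))
          (val-++ sgn (log (B.colUp ts bs (just a))) ((x , b) ∷ [])))
        (alg₂ (val sgn (log (B.colUp ts bs (just a)))) (sgn x b) (val negBelow (log (C.colDown ts cs nothing)))
          (F (just (b ⊓ x , z) ∷ edgeStates (rights (B.colUp ts bs (just a))) (rights (C.colDown ts cs nothing))) (b ⊔ x)))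
      where
      alg₂ : ∀ v s n f → v * (s * 1ℤ) * n * f ≡ v * n * (s * f)
      alg₂ = solve-∀
column-tilings {suc k} (just c) a (just x ∷ bs) (just z ∷ cs) F e =
  trans (alg (- (1ℤ * below? z c) * column (just c) a 1ℤ (edgeStates bs cs) F′))
    (sym (sum-first-tile (columnTerm (just c) a (just x ∷ bs) (just z ∷ cs) F) Z Z crossing Z Z Z))
  where
  e′ = VecP.∷-injectiveʳ e
  Z = sumL-zero (allVecs bTiles k)
  F′ : Vec H k → ℕ → ℤ
  F′ q _ = F (just (x , z) ∷ q) 0
  alg : ∀ x → x ≡ 0ℤ + (0ℤ + (x + (0ℤ + (0ℤ + (0ℤ + 0ℤ)))))
  alg = solve-∀
  alg₂ : ∀ v i n f → v * (- i * n) * f ≡ - (1ℤ * i) * (v * n * f)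
  alg₂ = solve-∀
  crossing : sumL (allVecs bTiles k) (λ ts → columnTerm (just c) a (just x ∷ bs) (just z ∷ cs) F (horiz ∷ ts)) ≡
    - (1ℤ * below? z c) * column (just c) a 1ℤ (edgeStates bs cs) F′
  crossing = trans (sumL-cong (allVecs bTiles k) (λ ts → when-scale (- (1ℤ * below? z c)) (colOK ts false (Vec.map occ cs)) (λ _ →
      trans (cong (λ l → val sgn l * val negBelow ((z , c) ∷ log (C.colDown ts cs (just c))) *
          F (just (x , z) ∷ edgeStates (rights (B.colUp ts bs (just a))) (rights (C.colDown ts cs (just c)))) 0) (ListP.++-identityʳ (log (B.colUp ts bs (just a)))))
        (alg₂ (val sgn (log (B.colUp ts bs (just a)))) (below? z c) (val negBelow (log (C.colDown ts cs (just c))))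
          (F (just (x , z) ∷ edgeStates (rights (B.colUp ts bs (just a))) (rights (C.colDown ts cs (just c)))) 0)))))
    (trans (sumL-scale (allVecs bTiles k) (- (1ℤ * below? z c)) (columnTerm (just c) a bs cs F′))
      (cong (_*_ (- (1ℤ * below? z c))) (sym (column-tilings (just c) a bs cs F′ e′))))

gridTerm : ∀ {n k} → Vec Lab n → Vec Lab n → Vec Lab k → Vec Lab k → (Vec H k → ℤ) → Vec (Vec BTile n) k → ℤ
gridTerm {n} as ss bs cs E g = if gridOK′ g (Vec.map occ cs) (replicate n false)
  then val sgn (log (B.up g bs as)) * val negBelow (log (C.down g cs ss)) * E (edgeStates (rights (B.up g bs as)) (rights (C.down g cs ss)))
  else 0ℤ

-- Induction on the columns. In a consistent column BPD and co-BPD pipes occupy the same right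
-- edges, and these form the left boundary of the remaining grid.
chain-tilings : ∀ {n k} (as ss : Vec ℕ n) (bs cs : Vec Lab k) E → Vec.map occ bs ≡ Vec.map occ cs →
  chain as ss (replicate n 1ℤ) (edgeStates bs cs) E ≡
  sumL (allVecs (allVecs bTiles n) k) (gridTerm (Vec.map just as) (Vec.map just ss) bs cs E)
chain-tilings {zero} {k} [] [] bs cs E e = go k bs cs E
  where
  alg : ∀ x → x ≡ 1ℤ * 1ℤ * x + 0ℤ
  alg = solve-∀
  go : ∀ k (bs cs : Vec Lab k) E → E (edgeStates bs cs) ≡ sumL (allVecs ([] ∷ []) k) (gridTerm [] [] bs cs E)
  go zero    []       []       E = alg (E [])
  go (suc k) (b ∷ bs) (c ∷ cs) E = trans (go k bs cs (λ q → E (edge b c ∷ q)))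
    (sym (trans (sumL-allVecs ([] ∷ []) k (gridTerm [] [] (b ∷ bs) (c ∷ cs) E))
      (trans (ℤP.+-identityʳ (sumL (allVecs ([] ∷ []) k) (λ g → gridTerm [] [] (b ∷ bs) (c ∷ cs) E ([] ∷ g))))
        (sumL-cong (allVecs ([] ∷ []) k) peel))))
    where
    row-[] : ∀ l v → B.row [] l v ≡ ([] , l , [])
    row-[] l [] = refl
    peel : ∀ g → gridTerm [] [] (b ∷ bs) (c ∷ cs) E ([] ∷ g) ≡ gridTerm [] [] bs cs (λ q → E (edge b c ∷ q)) g
    peel g rewrite row-[] b (outs (B.up g bs [])) | ListP.++-identityʳ (log (B.up g bs [])) = refl
chain-tilings {suc n} {k} (a ∷ as) (s ∷ ss) bs cs E e =
  trans (column-tilings (just s) a bs cs F e)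
    (trans (sumL-cong (allVecs bTiles k) each)
      (sym (sumL-columns bTiles n k (gridTerm (Vec.map just (a ∷ as)) (Vec.map just (s ∷ ss)) bs cs E))))
  where
  F : Vec H k → ℕ → ℤ
  F q _ = chain as ss (replicate n 1ℤ) q E
  distribute : ∀ b b′ v n v′ n′ x →
    (if b ∧ b′ then v * v′ * (n * n′) * x else 0ℤ) ≡ (if b then v * n * (if b′ then v′ * n′ * x else 0ℤ) else 0ℤ)
  distribute false b′    v n v′ n′ x = refl
  distribute true  false v n v′ n′ x = sym (ℤP.*-zeroʳ (v * n))
  distribute true  true  v n v′ n′ x = alg v n v′ n′ x
    where
    alg : ∀ v n v′ n′ x → v * v′ * (n * n′) * x ≡ v * n * (v′ * n′ * x)
    alg = solve-∀
  if-factor : ∀ b v x → (if b then v * x else 0ℤ) ≡ (if b then v else 0ℤ) * x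
  if-factor true  v x = refl
  if-factor false v x = sym (ℤP.*-zeroˡ x)
  each : ∀ col → columnTerm (just s) a bs cs F col ≡
    sumL (allVecs (allVecs bTiles n) k) (λ g → gridTerm (Vec.map just (a ∷ as)) (Vec.map just (s ∷ ss)) bs cs E (consColumn col g))
  each col = begin
    (if ok then v * nb * chain as ss (replicate n 1ℤ) (edgeStates bs′ cs′) E else 0ℤ)
      ≡⟨ when-true ok (λ t → cong (_*_ (v * nb)) (trans (chain-tilings as ss bs′ cs′ E (occ-eq t))
           (sumL-cong (allVecs (allVecs bTiles n) k) (λ g → cong (λ o → if gridOK′ g o (replicate n false) then term g else 0ℤ) (occ-colDown crossPipes col (just s) cs t))))) ⟩
    (if ok then v * nb * sumL (allVecs (allVecs bTiles n) k) rest else 0ℤ)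
      ≡⟨ if-factor ok (v * nb) (sumL (allVecs (allVecs bTiles n) k) rest) ⟩
    (if ok then v * nb else 0ℤ) * sumL (allVecs (allVecs bTiles n) k) rest
      ≡⟨ sym (sumL-scale (allVecs (allVecs bTiles n) k) (if ok then v * nb else 0ℤ) rest) ⟩
    sumL (allVecs (allVecs bTiles n) k) (λ g → (if ok then v * nb else 0ℤ) * rest g)
      ≡⟨ sumL-cong (allVecs (allVecs bTiles n) k) (λ g → sym (split g)) ⟩
    sumL (allVecs (allVecs bTiles n) k) (λ g → gridTerm (Vec.map just (a ∷ as)) (Vec.map just (s ∷ ss)) bs cs E (consColumn col g)) ∎
    where
    open ≡-Reasoning
    ok : Bool
    ok = colOK col false (Vec.map occ cs)
    v nb : ℤ
    v = val sgn (log (B.colUp col bs (just a)))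
    nb = val negBelow (log (C.colDown col cs (just s)))
    bs′ cs′ : Vec Lab k
    bs′ = rights (B.colUp col bs (just a))
    cs′ = rights (C.colDown col cs (just s))
    occ-eq : ok ≡ true → Vec.map occ bs′ ≡ Vec.map occ cs′
    occ-eq t = trans (proj₂ (occ-colUp sortPipes col false bs a (subst (λ o → colOK col false o ≡ true) (sym e) t)))
      (sym (occ-colDown crossPipes col (just s) cs t))
    term rest : Vec (Vec BTile n) k → ℤ
    term g = val sgn (log (B.up g bs′ (Vec.map just as))) * val negBelow (log (C.down g cs′ (Vec.map just ss))) *
      E (edgeStates (rights (B.up g bs′ (Vec.map just as))) (rights (C.down g cs′ (Vec.map just ss))))
    rest g = if gridOK′ g (Vec.map (right ∘ bEdges) col) (replicate n false) then term g else 0ℤ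
    split : ∀ g → gridTerm (Vec.map just (a ∷ as)) (Vec.map just (s ∷ ss)) bs cs E (consColumn col g) ≡ (if ok then v * nb else 0ℤ) * rest g
    split g rewrite gridOK′-column col g (Vec.map occ cs) false (replicate n false)
                  | up-val sortPipes moveB sgn col g bs (just a) (Vec.map just as)
                  | down-val crossPipes moveC negBelow col g cs (just s) (Vec.map just ss)
                  | up-rights sortPipes moveB col g bs (just a) (Vec.map just as)
                  | down-rights crossPipes moveC col g cs (just s) (Vec.map just ss) =
      trans (distribute ok (gridOK′ g (Vec.map (right ∘ bEdges) col) (replicate n false)) v nb
               (val sgn (log (B.up g bs′ (Vec.map just as)))) (val negBelow (log (C.down g cs′ (Vec.map just ss))))
               (E (edgeStates (rights (B.up g bs′ (Vec.map just as))) (rights (C.down g cs′ (Vec.map just ss))))))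
        (if-factor ok (v * nb) (rest g))

-- Words of labels along a moving cut.

-- Words of pipe labels along a cut through the grid, and the crossings made while the cut sweeps the grid.
data Steps (f : Crossing) : List ℕ → Log → List ℕ → Set where
  done : ∀ {u} → Steps f u [] u
  step : ∀ {u u′ v log} l x y r → u ≡ l ++ x ∷ y ∷ r → u′ ≡ l ++ proj₁ (f x y) ∷ proj₂ (f x y) ∷ r →
    Steps f u′ log v → Steps f u ((x , y) ∷ log) v

steps-trans : ∀ {f u v w p q} → Steps f u p v → Steps f v q w → Steps f u (p ++ q) w
steps-trans done                  t = t
steps-trans (step l x y r e e′ s) t = step l x y r e e′ (steps-trans s t)

steps-prefix : ∀ {f u v p} w → Steps f u p v → Steps f (w ++ u) p (w ++ v)
steps-prefix w done = done
steps-prefix w (step l x y r e e′ s) =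
  step (w ++ l) x y r (trans (cong (w ++_) e) (sym (ListP.++-assoc w l _))) (trans (cong (w ++_) e′) (sym (ListP.++-assoc w l _))) (steps-prefix w s)

steps-suffix : ∀ {f u v p} w → Steps f u p v → Steps f (u ++ w) p (v ++ w)
steps-suffix w done = done
steps-suffix w (step l x y r e e′ s) =
  step l x y (r ++ w) (trans (cong (_++ w) e) (ListP.++-assoc l _ w)) (trans (cong (_++ w) e′) (ListP.++-assoc l _ w)) (steps-suffix w s)

data Before (a b : ℕ) : List ℕ → Set where
  first : ∀ {l} → b ∈ l → Before a b (a ∷ l)
  later : ∀ {c l} → Before a b l → Before a b (c ∷ l)

before-adjacent : ∀ l {x y r} → Before x y (l ++ x ∷ y ∷ r)
before-adjacent []      = first (here refl)
before-adjacent (c ∷ l) = later (before-adjacent l)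

∈-swap : ∀ {b : ℕ} (l : List ℕ) {x y r} → b ∈ l ++ y ∷ x ∷ r → b ∈ l ++ x ∷ y ∷ r
∈-swap []      (here e)         = there (here e)
∈-swap []      (there (here e)) = here e
∈-swap []      (there (there h)) = there (there h)
∈-swap (c ∷ l) (here e)         = here e
∈-swap (c ∷ l) (there h)        = there (∈-swap l h)

before-swap : ∀ {a b} l {x y r} → Before a b (l ++ y ∷ x ∷ r) → Before a b (l ++ x ∷ y ∷ r) ⊎ (a ≡ y × b ≡ x)
before-swap []      (first (here e))  = inj₂ (refl , e)
before-swap []      (first (there h)) = inj₁ (later (first h))
before-swap []      (later (first h)) = inj₁ (first (there h))
before-swap []      (later (later h)) = inj₁ (later (later h))
before-swap (c ∷ l) (first h)         = inj₁ (first (∈-swap l h))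
before-swap (c ∷ l) (later h) with before-swap l h
... | inj₁ h′ = inj₁ (later h′)
... | inj₂ e  = inj₂ e

Distinct : List ℕ → Set
Distinct l = ∀ {a b} → Before a b l → a ≢ b

before-∈ʳ : ∀ {a b l} → Before a b l → b ∈ l
before-∈ʳ (first h) = there h
before-∈ʳ (later h) = there (before-∈ʳ h)

before-antisym : ∀ {a b l} → Distinct l → Before a b l → ¬ Before b a l
before-antisym d (first h) (first h′) = d (first h) refl
before-antisym d (first h) (later h′) = d (first (before-∈ʳ h′)) refl
before-antisym d (later h) (first h′) = d (first (before-∈ʳ h)) refl
before-antisym d (later h) (later h′) = before-antisym (d ∘ later) h h′

distinct-swap : ∀ l {x y r} → Distinct (l ++ x ∷ y ∷ r) → Distinct (l ++ y ∷ x ∷ r)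
distinct-swap l {x} {y} d h with before-swap l h
... | inj₁ h′           = d h′
... | inj₂ (refl , refl) = λ e → d (before-adjacent l) (sym e)

-- The key `κ` lets the same meetings be compared by entry column or by the labels coming from the
-- word `u`.
Increasing : (ℕ → ℕ) → ℕ × ℕ → Set
Increasing κ (a , b) = κ a ℕ.< κ b

-- Pairs crossed in increasing order start uncrossed and stay crossed.
crossed-before : ∀ {κ u v R} → Steps crossPipes u R v → All (Increasing κ) R → ∀ {p} → p ∈ R → Before (proj₁ p) (proj₂ p) u
crossed-before (step l x y r refl refl s) (i ∷ is) (here refl) = before-adjacent l
crossed-before {κ} (step l x y r refl refl s) (i ∷ is) (there h) with before-swap l (crossed-before {κ} s is h)
... | inj₁ b             = b
... | inj₂ (refl , refl) = contradiction (All.lookup is h) (ℕP.<⇒≯ i)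

stays-crossed : ∀ {κ u v R a b} → Steps crossPipes u R v → All (Increasing κ) R → Before a b u → ¬ κ a ℕ.< κ b → Before a b v
stays-crossed done is h n = h
stays-crossed {κ} (step l x y r refl refl s) (i ∷ is) h n with before-swap l h
... | inj₁ h′            = stays-crossed {κ} s is h′ n
... | inj₂ (refl , refl) = contradiction i n

crossed-after : ∀ {κ u v R} → Steps crossPipes u R v → All (Increasing κ) R → ∀ {p} → p ∈ R → Before (proj₂ p) (proj₁ p) v
crossed-after {κ} (step l x y r refl refl s) (i ∷ is) (here refl) = stays-crossed {κ} s is (before-adjacent l) (ℕP.<⇒≯ i)
crossed-after {κ} (step l x y r refl refl s) (i ∷ is) (there h)   = crossed-after {κ} s is h

sortPair : ℕ × ℕ → ℕ × ℕ
sortPair (a , b) = b ⊓ a , b ⊔ a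

sortPair-increasing : ∀ {a b} → a ℕ.< b → sortPair (a , b) ≡ (a , b)
sortPair-increasing h = cong₂ _,_ (ℕP.m≥n⇒m⊓n≡n (ℕP.<⇒≤ h)) (ℕP.m≥n⇒m⊔n≡m (ℕP.<⇒≤ h))

sortPair-decreasing : ∀ {a b} → b ℕ.< a → sortPair (a , b) ≡ (b , a)
sortPair-decreasing h = cong₂ _,_ (ℕP.m≤n⇒m⊓n≡m (ℕP.<⇒≤ h)) (ℕP.m≤n⇒m⊔n≡n (ℕP.<⇒≤ h))

memB-complete : ∀ p qs → p ∈ qs → memB p qs ≡ true
memB-complete p (q ∷ qs) h with ProdP.≡-dec ℕ._≟_ ℕ._≟_ p q
... | yes _ = refl
memB-complete p (q ∷ qs) (here e)  | no ne = contradiction e ne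
memB-complete p (q ∷ qs) (there h) | no ne = memB-complete p qs h

memB-sound : ∀ p qs → memB p qs ≡ true → p ∈ qs
memB-sound p (q ∷ qs) e with ProdP.≡-dec ℕ._≟_ ℕ._≟_ p q
... | yes e′ = here e′
... | no  _  = there (memB-sound p qs e)

noDup-cons : ∀ p ps → noDup (p ∷ ps) ≡ true → (¬ p ∈ ps) × noDup ps ≡ true
noDup-cons p ps e with memB p ps in eq
... | false = (λ h → case trans (sym eq) (memB-complete p ps h) of λ ()) , e

noDup-cons⁻ : ∀ p ps → ¬ p ∈ ps → noDup ps ≡ true → noDup (p ∷ ps) ≡ true
noDup-cons⁻ p ps n e with memB p ps in eq
... | false = e
... | true  = contradiction (memB-sound p ps eq) n

-- A second meeting of a pair would require it to be uncrossed again, whereas the first meeting has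
-- crossed it.
increasing⇒noDup : ∀ {u v R} → Steps crossPipes u R v → Distinct u → All (Increasing id) R → noDup (List.map sortPair R) ≡ true
increasing⇒noDup done d is = refl
increasing⇒noDup {R = _ ∷ R} (step l x y r refl refl s) d (i ∷ is) =
  noDup-cons⁻ (sortPair (x , y)) (List.map sortPair R) fresh (increasing⇒noDup s (distinct-swap l d) is)
  where
  fresh : ¬ sortPair (x , y) ∈ List.map sortPair R
  fresh h with ∈-map⁻ sortPair h
  ... | (a , b) , h′ , e with trans (sym (sortPair-increasing i)) (trans e (sortPair-increasing (All.lookup is h′)))
  ... | refl = before-antisym (distinct-swap l d) (before-adjacent l) (crossed-before {id} s is h′)

-- `S` collects the pairs that have already met, and every inverted pair of the current word is
-- among them. A meeting in decreasing order would therefore be a repetition.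
noDup⇒increasing : ∀ {u v R} → Steps sortPipes u R v → Distinct u → (S : ℕ × ℕ → Set) →
  (∀ {a b} → Before a b u → b ℕ.< a → S (b , a)) → (∀ p → p ∈ List.map sortPair R → ¬ S p) →
  noDup (List.map sortPair R) ≡ true → All (Increasing id) R
noDup⇒increasing done d S inS new nd = []
noDup⇒increasing {R = _ ∷ R} (step l x y r refl e′ s) d S inS new nd with ℕP.<-cmp x y
... | tri≈ _ eq _ = contradiction eq (d (before-adjacent l))
... | tri> _ _ gt = ⊥-elim (new _ (here refl) (subst S (sym (sortPair-decreasing gt)) (inS (before-adjacent l) gt)))
... | tri< lt _ _ = lt ∷ noDup⇒increasing s (subst Distinct (sym u′≡) (distinct-swap l d)) S′ inS′ new′ (proj₂ (noDup-cons (sortPair (x , y)) (List.map sortPair R) nd))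
  where
  u′≡ = trans e′ (cong₂ (λ p q → l ++ p ∷ q ∷ r) (ℕP.m≥n⇒m⊔n≡m (ℕP.<⇒≤ lt)) (ℕP.m≥n⇒m⊓n≡n (ℕP.<⇒≤ lt)))
  S′ : ℕ × ℕ → Set
  S′ p = S p ⊎ p ≡ (x , y)
  inS′ : ∀ {a b} → Before a b _ → b ℕ.< a → S′ (b , a)
  inS′ {a} {b} h lt′ with before-swap l (subst (Before a b) u′≡ h)
  ... | inj₁ h′            = inj₁ (inS h′ lt′)
  ... | inj₂ (refl , refl) = inj₂ refl
  new′ : ∀ p → p ∈ List.map sortPair R → ¬ S′ p
  new′ p h (inj₁ q)    = new p (there h) q
  new′ p h (inj₂ refl) = proj₁ (noDup-cons (sortPair (x , y)) (List.map sortPair R) nd)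
    (subst (_∈ List.map sortPair R) (sym (sortPair-increasing lt)) h)

invL-steps : ∀ {u v R} → Steps crossPipes u R v → All (Increasing id) R → invL v ≡ length R ℕ.+ invL u
invL-steps done is = refl
invL-steps {R = _ ∷ R} (step l x y r refl refl s) (i ∷ is) =
  trans (invL-steps s is) (trans (cong (length R ℕ.+_) (invL-swap l x y r i)) (ℕP.+-suc (length R) (invL (l ++ x ∷ y ∷ r))))

-- A real crossing adds one inversion and has sign -1; pipes that only touch leave the word
-- unchanged and have sign +1.
invL-sign : ∀ {u v R} → Steps sortPipes u R v → alternating (invL v) ≡ alternating (invL u) * val sgn R
invL-sign {u} done = sym (ℤP.*-identityʳ (alternating (invL u)))
invL-sign {v = v} {R = _ ∷ R} (step l x y r refl refl s) with x ℕ.<? y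
... | yes h = trans (invL-sign s) (trans (cong (λ z → alternating z * val sgn R) swapped)
        (trans (alg (alternating (invL (l ++ x ∷ y ∷ r))) (val sgn R)) (cong (λ z → alternating (invL (l ++ x ∷ y ∷ r)) * (z * val sgn R)) (sym (sgn-cross h)))))
  where
  alg : ∀ a b → - a * b ≡ a * (-1ℤ * b)
  alg = solve-∀
  swapped : invL (l ++ y ⊔ x ∷ y ⊓ x ∷ r) ≡ suc (invL (l ++ x ∷ y ∷ r))
  swapped = trans (cong₂ (λ p q → invL (l ++ p ∷ q ∷ r)) (ℕP.m≥n⇒m⊔n≡m (ℕP.<⇒≤ h)) (ℕP.m≥n⇒m⊓n≡n (ℕP.<⇒≤ h))) (invL-swap l x y r h)
... | no h = trans (invL-sign s) (trans (cong₂ (λ p q → alternating (invL (l ++ p ∷ q ∷ r)) * val sgn R)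
          (ℕP.m≤n⇒m⊔n≡n (ℕP.≮⇒≥ h)) (ℕP.m≤n⇒m⊓n≡m (ℕP.≮⇒≥ h)))
        (trans (cong (_*_ (alternating (invL (l ++ x ∷ y ∷ r)))) (sym (ℤP.*-identityˡ (val sgn R))))
          (cong (λ z → alternating (invL (l ++ x ∷ y ∷ r)) * (z * val sgn R)) (sym (sgn-touch h)))))

mapPair : (ℕ → ℕ) → ℕ × ℕ → ℕ × ℕ
mapPair κ (a , b) = κ a , κ b

steps-map : ∀ κ {u v R} → Steps crossPipes u R v → Steps crossPipes (List.map κ u) (List.map (mapPair κ) R) (List.map κ v)
steps-map κ done = done
steps-map κ (step l x y r refl refl s) = step (List.map κ l) (κ x) (κ y) (List.map κ r) (ListP.map-++ κ l _) (ListP.map-++ κ l _) (steps-map κ s)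

increasing-map : ∀ κ {R} → All (Increasing κ) R → All (Increasing id) (List.map (mapPair κ) R)
increasing-map κ is = AllP.map⁺ is

val-negBelow : ∀ {R} → All (Increasing id) R → val negBelow R ≡ alternating (length R)
val-negBelow [] = refl
val-negBelow {(a , b) ∷ R} (i ∷ is) rewrite <ᵇ-true i = trans (cong (_*_ -1ℤ) (val-negBelow is)) (ℤP.-1*i≡-i (alternating (length R)))

val-negBelow-zero : ∀ R → val negBelow R ≢ 0ℤ → All (Increasing id) R
val-negBelow-zero []            nz = []
val-negBelow-zero ((a , b) ∷ R) nz with a ℕ.<? b
... | yes h = h ∷ val-negBelow-zero R (λ z → nz (trans (cong (_*_ (negBelow a b)) z) (ℤP.*-zeroʳ (negBelow a b))))
... | no  h = contradiction (trans (cong (λ t → - (if t then 1ℤ else 0ℤ) * val negBelow R) (<ᵇ-false h)) (ℤP.*-zeroˡ (val negBelow R))) nz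

-- Inversions of a word and of its reverse.

triangle : ℕ → ℕ
triangle zero    = 0
triangle (suc n) = n ℕ.+ triangle n

countGt : ℕ → List ℕ → ℕ
countGt a []      = 0
countGt a (b ∷ l) = (if a <ᵇ b then 1 else 0) ℕ.+ countGt a l

countGt-++ : ∀ a l l′ → countGt a (l ++ l′) ≡ countGt a l ℕ.+ countGt a l′
countGt-++ a []      l′ = refl
countGt-++ a (b ∷ l) l′ = trans (cong (_ ℕ.+_) (countGt-++ a l l′)) (sym (ℕP.+-assoc (if a <ᵇ b then 1 else 0) (countGt a l) (countGt a l′)))

countGt-reverse : ∀ a l → countGt a (reverse l) ≡ countGt a l
countGt-reverse a []      = refl
countGt-reverse a (b ∷ l) = trans (cong (countGt a) (ListP.unfold-reverse b l)) (trans (countGt-++ a (reverse l) (b ∷ []))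
  (trans (ℕP.+-comm (countGt a (reverse l)) _) (cong₂ ℕ._+_ (ℕP.+-identityʳ _) (countGt-reverse a l))))

invL-snoc : ∀ l a → invL (l ++ a ∷ []) ≡ invL l ℕ.+ countGt a l
invL-snoc []      a = refl
invL-snoc (b ∷ l) a = trans (cong₂ ℕ._+_ (lt l) (invL-snoc l a)) (alg (countLt b l) (if a <ᵇ b then 1 else 0) (invL l) (countGt a l))
  where
  open import Data.Nat.Tactic.RingSolver using () renaming (solve-∀ to solveℕ)
  alg : ∀ p q r s → p ℕ.+ q ℕ.+ (r ℕ.+ s) ≡ p ℕ.+ r ℕ.+ (q ℕ.+ s)
  alg = solveℕ
  lt : ∀ l → countLt b (l ++ a ∷ []) ≡ countLt b l ℕ.+ (if a <ᵇ b then 1 else 0)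
  lt []      = ℕP.+-identityʳ _
  lt (c ∷ l) = trans (cong (_ ℕ.+_) (lt l)) (sym (ℕP.+-assoc (if c <ᵇ b then 1 else 0) (countLt b l) _))

countLt+countGt : ∀ a l → (∀ {b} → b ∈ l → a ≢ b) → countLt a l ℕ.+ countGt a l ≡ length l
countLt+countGt a []      ne = refl
countLt+countGt a (b ∷ l) ne with ℕP.<-cmp a b
... | tri≈ _ e _ = contradiction e (ne (here refl))
... | tri< lt _ _ rewrite <ᵇ-true lt | <ᵇ-false (ℕP.<⇒≯ lt) = trans (ℕP.+-suc _ _) (cong suc (countLt+countGt a l (ne ∘ there)))
... | tri> _ _ gt rewrite <ᵇ-true gt | <ᵇ-false (ℕP.<⇒≯ gt) = cong suc (countLt+countGt a l (ne ∘ there))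

-- Each pair of distinct letters is inverted in exactly one of the two words.
invL-reverse : ∀ l → Distinct l → invL (reverse l) ℕ.+ invL l ≡ triangle (length l)
invL-reverse []      d = refl
invL-reverse (a ∷ l) d = trans (cong (ℕ._+ (countLt a l ℕ.+ invL l))
    (trans (cong invL (ListP.unfold-reverse a l)) (trans (invL-snoc (reverse l) a) (cong (invL (reverse l) ℕ.+_) (countGt-reverse a l)))))
  (trans (alg (invL (reverse l)) (countGt a l) (countLt a l) (invL l))
    (cong₂ ℕ._+_ (countLt+countGt a l (λ h → d (first h))) (invL-reverse l (d ∘ later))))
  where
  open import Data.Nat.Tactic.RingSolver using () renaming (solve-∀ to solveℕ)
  alg : ∀ r g t i → r ℕ.+ g ℕ.+ (t ℕ.+ i) ≡ t ℕ.+ g ℕ.+ (r ℕ.+ i)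
  alg = solveℕ

before-++ : ∀ {a b} l l′ → Before a b (l ++ l′) → Before a b l ⊎ Before a b l′ ⊎ (a ∈ l × b ∈ l′)
before-++ []      l′ h = inj₂ (inj₁ h)
before-++ (c ∷ l) l′ (first h) with ∈-++⁻ l h
... | inj₁ h′ = inj₁ (first h′)
... | inj₂ h′ = inj₂ (inj₂ (here refl , h′))
before-++ (c ∷ l) l′ (later h) with before-++ l l′ h
... | inj₁ h′              = inj₁ (later h′)
... | inj₂ (inj₁ h′)       = inj₂ (inj₁ h′)
... | inj₂ (inj₂ (p , q))  = inj₂ (inj₂ (there p , q))

before-reverse : ∀ {a b} l → Before a b (reverse l) → Before b a l
before-reverse (c ∷ l) h with before-++ (reverse l) (c ∷ []) (subst (Before _ _) (ListP.unfold-reverse c l) h)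
... | inj₁ h′                     = later (before-reverse l h′)
... | inj₂ (inj₁ (first ()))
... | inj₂ (inj₁ (later ()))
... | inj₂ (inj₂ (p , here refl)) = first (subst (_ ∈_) (ListP.reverse-involutive l) (∈-reverse p))
  where
  ∈-reverse : ∀ {a l} → a ∈ l → a ∈ reverse l
  ∈-reverse {a} {l} h = reverse⁺ h

before-tabulate : ∀ {n} (f : Fin n → ℕ) {a b} → Before a b (tab f) → ∃ λ i → ∃ λ j → (toℕ i ℕ.< toℕ j) × f i ≡ a × f j ≡ b
before-tabulate {suc n} f (first h) with ∈-tabulate⁻ h
... | j , e = zero , suc j , s≤s z≤n , refl , sym e
before-tabulate {suc n} f (later h) with before-tabulate (f ∘ suc) h
... | i , j , lt , e , e′ = suc i , suc j , s≤s lt , e , e′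

distinct-tabulate : ∀ {n} {f : Fin n → ℕ} → Inj f → Distinct (tab f)
distinct-tabulate {f = f} inj h eq with before-tabulate f h
... | i , j , lt , refl , refl = ℕP.<⇒≢ lt (cong toℕ (inj i j eq))

distinct-steps : ∀ {u v R} → Steps crossPipes u R v → Distinct u → Distinct v
distinct-steps done d = d
distinct-steps (step l x y r refl refl s) d = distinct-steps s (distinct-swap l d)

∈-steps : ∀ {u v R a} → Steps crossPipes u R v → a ∈ v → a ∈ u
∈-steps done h = h
∈-steps (step l x y r refl refl s) h = ∈-swap l (∈-steps s h)

-- Sweeping a grid with a cut.

catL : Lab → List ℕ
catL nothing  = []
catL (just a) = a ∷ []

catV : ∀ {n} → Vec Lab n → List ℕ
catV []       = []
catV (l ∷ ls) = catL l ++ catV ls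

-- A cell moves the cut from its left and vertical inputs to its vertical and right outputs; only a
-- meeting is recorded as a step.
cell-steps-B : ∀ f t v l → occ v ≡ bottom (bEdges t) → occ l ≡ left (bEdges t) →
  let c = cell f (moveB t) v l in Steps f (catL l ++ catL v) (log c) (catL (outs c) ++ catL (rights c))
cell-steps-B f elbowBR (just v) nothing  ev el = done
cell-steps-B f elbowTL nothing  (just l) ev el = done
cell-steps-B f horiz   nothing  (just l) ev el = done
cell-steps-B f vert    (just v) nothing  ev el = done
cell-steps-B f cross   (just v) (just l) ev el = step [] l v [] refl refl done
cell-steps-B f blank   nothing  nothing  ev el = done

cell-steps-C : ∀ f t v l → not (occ v) ≡ top (bEdges t) → occ l ≡ left (bEdges t) →
  let c = cell f (moveC t) v l in Steps f (catL l ++ catL v) (log c) (catL (outs c) ++ catL (rights c))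
cell-steps-C f elbowBR (just v) nothing  ev el = done
cell-steps-C f elbowTL nothing  (just l) ev el = done
cell-steps-C f horiz   (just v) (just l) ev el = step [] l v [] refl refl done
cell-steps-C f vert    nothing  nothing  ev el = done
cell-steps-C f cross   nothing  (just l) ev el = done
cell-steps-C f blank   (just v) nothing  ev el = done

steps-glue : ∀ {f} l v vs {x} o r {xs} os rr → Steps f (catL l ++ catL v) x (catL o ++ catL r) → Steps f (catL r ++ vs) xs (os ++ catL rr) →
  Steps f (catL l ++ catL v ++ vs) (x ++ xs) ((catL o ++ os) ++ catL rr)
steps-glue {f} l v vs {x} o r os rr s t = steps-trans
  (subst₂ (λ a b → Steps f a x b) (ListP.++-assoc (catL l) (catL v) vs) (ListP.++-assoc (catL o) (catL r) vs) (steps-suffix vs s))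
  (subst (Steps f _ _) (sym (ListP.++-assoc (catL o) os (catL rr))) (steps-prefix (catL o) t))

rowRight : ∀ {n} → Vec BTile n → Bool → Bool
rowRight []       q = q
rowRight (t ∷ ts) q = rowRight ts (right (bEdges t))

rowOK′-parts : ∀ {n} t (ts : Vec BTile n) q e es → rowOK′ (t ∷ ts) q (e ∷ es) ≡ true →
  left (bEdges t) ≡ q × top (bEdges t) ≡ e × rowOK′ ts (right (bEdges t)) es ≡ true
rowOK′-parts t ts q e es h with ∧-true {left (bEdges t) == q} h
... | e₁ , e₂ with ∧-true {top (bEdges t) == e} e₂
... | e₃ , e₄ = ==-sound _ _ e₁ , ==-sound _ _ e₃ , e₄

row-steps-B : ∀ f {n} (ts : Vec BTile n) l vs es → rowOK′ ts (occ l) es ≡ true → Vec.map occ vs ≡ Vec.map (bottom ∘ bEdges) ts →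
  let r = Network.row f moveB ts l vs in
  Vec.map occ (outs r) ≡ es × occ (rights r) ≡ rowRight ts (occ l) × Steps f (catL l ++ catV vs) (log r) (catV (outs r) ++ catL (rights r))
row-steps-B f [] l [] [] ok e = refl , refl , subst (λ w → Steps f w [] (catL l)) (sym (ListP.++-identityʳ (catL l))) done
row-steps-B f (t ∷ ts) l (v ∷ vs) (e ∷ es) ok eq
  with rowOK′-parts t ts (occ l) e es ok
... | el , et , ok′
  with occ-B f t v l (VecP.∷-injectiveˡ eq) (sym el) | cell-steps-B f t v l (VecP.∷-injectiveˡ eq) (sym el)
... | o , r | s
  with row-steps-B f ts (rights (cell f (moveB t) v l)) vs es (subst (λ q → rowOK′ ts q es ≡ true) (sym r) ok′) (VecP.∷-injectiveʳ eq)
... | os , rr , ss = cong₂ _∷_ (trans o et) os , trans rr (cong (rowRight ts) r) ,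
  steps-glue l v (catV vs) (outs c) (rights c) (catV (outs c′)) (rights c′) s ss
  where
  c = cell f (moveB t) v l
  c′ = Network.row f moveB ts (rights c) vs

row-steps-C : ∀ f {n} (ts : Vec BTile n) l vs → rowOK′ ts (occ l) (Vec.map (not ∘ occ) vs) ≡ true →
  let r = Network.row f moveC ts l vs in
  Vec.map (not ∘ occ) (outs r) ≡ Vec.map (bottom ∘ bEdges) ts × occ (rights r) ≡ rowRight ts (occ l) ×
  Steps f (catL l ++ catV vs) (log r) (catV (outs r) ++ catL (rights r))
row-steps-C f [] l [] ok = refl , refl , subst (λ w → Steps f w [] (catL l)) (sym (ListP.++-identityʳ (catL l))) done
row-steps-C f (t ∷ ts) l (v ∷ vs) ok
  with rowOK′-parts t ts (occ l) (not (occ v)) (Vec.map (not ∘ occ) vs) ok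
... | el , et , ok′
  with occ-C f t v l (sym et) (sym el) | cell-steps-C f t v l (sym et) (sym el)
... | o , r | s
  with row-steps-C f ts (rights (cell f (moveC t) v l)) vs (subst (λ q → rowOK′ ts q (Vec.map (not ∘ occ) vs) ≡ true) (sym r) ok′)
... | os , rr , ss = cong₂ _∷_ o os , trans rr (cong (rowRight ts) r) ,
  steps-glue l v (catV vs) (outs c) (rights c) (catV (outs c′)) (rights c′) s ss
  where
  c = cell f (moveC t) v l
  c′ = Network.row f moveC ts (rights c) vs

none : ∀ k → Vec Lab k
none k = replicate k nothing

allB-true : ∀ {n} (es : Vec Bool n) → allB es ≡ true → es ≡ replicate n true
allB-true []          e = refl
allB-true (true ∷ es) e = cong (true ∷_) (allB-true es e)

gridRight : ∀ {n k} → Vec (Vec BTile n) k → Vec Bool k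
gridRight = Vec.map (λ r → rowRight r false)

-- The cut starts along the bottom side and ends along the top side followed by the right side read
-- downwards.
grid-steps-B : ∀ f {n k} (g : Vec (Vec BTile n) k) vs es → gridOK′ g (replicate k false) es ≡ true → Vec.map occ vs ≡ replicate n true →
  let r = Network.up f moveB g (none k) vs in
  Vec.map occ (outs r) ≡ es × Vec.map occ (rights r) ≡ gridRight g × Steps f (catV vs) (log r) (catV (outs r) ++ catV (rights r))
grid-steps-B f [] vs es ok e = trans e (sym (allB-true es ok)) , refl , subst (Steps f (catV vs) []) (sym (ListP.++-identityʳ (catV vs))) done
grid-steps-B f {k = suc k} (r ∷ g) vs es ok e
  with ∧-true {rowOK′ r false es} ok
... | ok₁ , ok₂
  with grid-steps-B f g vs (Vec.map (bottom ∘ bEdges) r) ok₂ e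
... | o , rs , s
  with row-steps-B f r nothing (outs (Network.up f moveB g (none k) vs)) es ok₁ o
... | o′ , r′ , s′ = o′ , cong₂ _∷_ r′ rs ,
  steps-trans s (subst (Steps f _ _) (ListP.++-assoc (catV (outs y)) (catL (rights y)) (catV (rights x))) (steps-suffix (catV (rights x)) s′))
  where
  x = Network.up f moveB g (none k) vs
  y = Network.row f moveB r nothing (outs x)

-- Swept from above, the cut ends along the right side read upwards, hence `reverse`; consistency
-- leaves no co-BPD pipe on the bottom side.
grid-steps-C : ∀ f {n k} (g : Vec (Vec BTile n) k) vs → gridOK′ g (replicate k false) (Vec.map (not ∘ occ) vs) ≡ true →
  let r = Network.down f moveC g (none k) vs in
  Vec.map occ (rights r) ≡ gridRight g × Steps f (catV vs) (log r) (reverse (catV (rights r)))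
grid-steps-C f [] vs ok = refl , subst (Steps f (catV vs) []) (empty-word vs ok) done
  where
  empty-word : ∀ {n} (vs : Vec Lab n) → allB (Vec.map (not ∘ occ) vs) ≡ true → catV vs ≡ []
  empty-word []             ok = refl
  empty-word (nothing ∷ vs) ok = empty-word vs ok
grid-steps-C f {k = suc k} (r ∷ g) vs ok
  with ∧-true {rowOK′ r false (Vec.map (not ∘ occ) vs)} ok
... | ok₁ , ok₂
  with row-steps-C f r nothing vs ok₁
... | o , r′ , s
  with grid-steps-C f g (outs (Network.row f moveC r nothing vs)) (subst (λ es → gridOK′ g (replicate k false) es ≡ true) (sym o) ok₂)
... | rs , s′ = cong₂ _∷_ r′ rs ,
  steps-trans s (subst (Steps f _ _) (trans (cong (reverse (catV (rights y)) ++_) (sym (reverse-catL (rights x))))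
    (sym (ListP.reverse-++ (catL (rights x)) (catV (rights y))))) (steps-suffix (catL (rights x)) s′))
  where
  x = Network.row f moveC r nothing vs
  y = Network.down f moveC g (none k) (outs x)
  reverse-catL : ∀ l → reverse (catL l) ≡ catL l
  reverse-catL nothing  = refl
  reverse-catL (just _) = refl

module _ {f g : Crossing} (P : ℕ × ℕ → Set) (agree : ∀ {l v} → P (l , v) → f l v ≡ g l v) (mv : BTile → Move) where

  cell-agree : ∀ m v l → All P (log (cell f m v l)) → cell f m v l ≡ cell g m v l
  cell-agree turn     v l a = refl
  cell-agree drop     v l a = refl
  cell-agree pass     v l a = refl
  cell-agree straight v l a = refl
  cell-agree meet (just v) (just l) (p ∷ []) = cong (λ q → just (proj₁ q) , just (proj₂ q) , (l , v) ∷ []) (agree p)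
  cell-agree meet (just v) nothing  a = refl
  cell-agree meet nothing  (just l) a = refl
  cell-agree meet nothing  nothing  a = refl
  cell-agree empty    v l a = refl

  row-agree : ∀ {n} (ts : Vec BTile n) l vs → All P (log (Network.row f mv ts l vs)) → Network.row f mv ts l vs ≡ Network.row g mv ts l vs
  row-agree []       l []       a = refl
  row-agree (t ∷ ts) l (v ∷ vs) a
    rewrite sym (cell-agree (mv t) v l (AllP.++⁻ˡ (log (cell f (mv t) v l)) a))
          | sym (row-agree ts (rights (cell f (mv t) v l)) vs (AllP.++⁻ʳ (log (cell f (mv t) v l)) a)) = refl

  -- While the two rules agree the runs carry the same labels, so the meetings of one run decide for
  -- both.
  down-agree : ∀ {n k} (rs : Vec (Vec BTile n) k) ls vs → All P (log (Network.down f mv rs ls vs)) →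
    Network.down f mv rs ls vs ≡ Network.down g mv rs ls vs
  down-agree []       []       vs a = refl
  down-agree (r ∷ rs) (l ∷ ls) vs a
    rewrite sym (row-agree r l vs (AllP.++⁻ˡ (log (Network.row f mv r l vs)) a))
          | sym (down-agree rs ls (outs (Network.row f mv r l vs)) (AllP.++⁻ʳ (log (Network.row f mv r l vs)) a)) = refl

module _ (κ : ℕ → ℕ) (mv : BTile → Move) where
  private
    κL : Lab → Lab
    κL = Maybe.map κ
    κV : ∀ {n} → Vec Lab n → Vec Lab n
    κV = Vec.map κL
    relabel : ∀ {n} {A : Set} → (A → A) → Vec Lab n × A × Log → Vec Lab n × A × Log
    relabel h (o , r , x) = κV o , h r , List.map (mapPair κ) x

  cell-relabel : ∀ m v l → cell crossPipes m (κL v) (κL l) ≡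
    (κL (outs (cell crossPipes m v l)) , κL (rights (cell crossPipes m v l)) , List.map (mapPair κ) (log (cell crossPipes m v l)))
  cell-relabel turn     v l = refl
  cell-relabel drop     v l = refl
  cell-relabel pass     v l = refl
  cell-relabel straight v l = refl
  cell-relabel meet (just v) (just l) = refl
  cell-relabel meet (just v) nothing  = refl
  cell-relabel meet nothing  (just l) = refl
  cell-relabel meet nothing  nothing  = refl
  cell-relabel empty    v l = refl

  row-relabel : ∀ {n} (ts : Vec BTile n) l vs → Network.row crossPipes mv ts (κL l) (κV vs) ≡ relabel κL (Network.row crossPipes mv ts l vs)
  row-relabel []       l []       = refl
  row-relabel (t ∷ ts) l (v ∷ vs)
    rewrite cell-relabel (mv t) v l | row-relabel ts (rights (cell crossPipes (mv t) v l)) vs =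
    cong (λ x → (κL (outs (cell crossPipes (mv t) v l)) ∷ κV (outs (Network.row crossPipes mv ts (rights (cell crossPipes (mv t) v l)) vs))) ,
      κL (rights (Network.row crossPipes mv ts (rights (cell crossPipes (mv t) v l)) vs)) , x)
      (sym (ListP.map-++ (mapPair κ) (log (cell crossPipes (mv t) v l)) _))

  -- `crossPipes` never compares labels, so relabelling the entering pipes relabels the whole run.
  -- Entry labels taken from `u` are reduced in this way to entry columns.
  down-relabel : ∀ {n k} (rs : Vec (Vec BTile n) k) ls vs →
    Network.down crossPipes mv rs (κV ls) (κV vs) ≡ relabel κV (Network.down crossPipes mv rs ls vs)
  down-relabel []       []       vs = refl
  down-relabel (r ∷ rs) (l ∷ ls) vs
    rewrite row-relabel r l vs | down-relabel rs ls (outs (Network.row crossPipes mv r l vs)) =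
    cong (λ x → κV (outs (Network.down crossPipes mv rs ls (outs (Network.row crossPipes mv r l vs)))) ,
        κL (rights (Network.row crossPipes mv r l vs)) ∷ κV (rights (Network.down crossPipes mv rs ls (outs (Network.row crossPipes mv r l vs)))) , x)
      (sym (ListP.map-++ (mapPair κ) (log (Network.row crossPipes mv r l vs)) _))

-- Comparison with the definitions of BPDs and co-BPDs.

module D = Network sortPipes moveC

bTile-cell : ∀ t b l → bTile t b l ≡ (outs (cell sortPipes (moveB t) b l) , rights (cell sortPipes (moveB t) b l))
bTile-cell elbowBR b l = refl
bTile-cell elbowTL b l = refl
bTile-cell horiz   b l = refl
bTile-cell vert    b l = refl
bTile-cell cross (just b) (just l) = refl
bTile-cell cross (just b) nothing  = refl
bTile-cell cross nothing  (just l) = refl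
bTile-cell cross nothing  nothing  = refl
bTile-cell blank   b l = refl

bRow-row : ∀ {n} (ts : Vec BTile n) l bs → bRow ts l bs ≡ (outs (B.row ts l bs) , rights (B.row ts l bs))
bRow-row []       l []       = refl
bRow-row (t ∷ ts) l (b ∷ bs) rewrite bTile-cell t b l | bRow-row ts (rights (cell sortPipes (moveB t) b l)) bs = refl

bRun-up : ∀ {n k} (g : Vec (Vec BTile n) k) bs → bRun g bs ≡ (outs (B.up g (none k) bs) , rights (B.up g (none k) bs))
bRun-up []      bs = refl
bRun-up {k = suc k} (r ∷ g) bs rewrite bRun-up g bs | bRow-row r nothing (outs (B.up g (none k) bs)) = refl

cTile-cell : ∀ t v l → cTile (checkTile t) v l ≡
  (outs (cell sortPipes (moveC t) v l) , rights (cell sortPipes (moveC t) v l) , List.map sortPair (log (cell sortPipes (moveC t) v l)))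
cTile-cell elbowBR v l = refl
cTile-cell elbowTL v l = refl
cTile-cell horiz (just v) (just l) = refl
cTile-cell horiz (just v) nothing  = refl
cTile-cell horiz nothing  (just l) = refl
cTile-cell horiz nothing  nothing  = refl
cTile-cell vert    v l = refl
cTile-cell cross   v l = refl
cTile-cell blank   v l = refl

cRow-row : ∀ {n} (ts : Vec BTile n) l vs → cRow (Vec.map checkTile ts) l vs ≡
  (outs (D.row ts l vs) , rights (D.row ts l vs) , List.map sortPair (log (D.row ts l vs)))
cRow-row []       l []       = refl
cRow-row (t ∷ ts) l (v ∷ vs) rewrite cTile-cell t v l | cRow-row ts (rights (cell sortPipes (moveC t) v l)) vs =
  cong (λ x → (outs (cell sortPipes (moveC t) v l) ∷ outs (D.row ts (rights (cell sortPipes (moveC t) v l)) vs)) ,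
      rights (D.row ts (rights (cell sortPipes (moveC t) v l)) vs) , x)
    (sym (ListP.map-++ sortPair (log (cell sortPipes (moveC t) v l)) _))

-- The definition of δ sorts at every crossing, hence `D`; the lattice model lets pipes always
-- cross, hence `C`. On reduced co-BPDs the two runs will agree.
cRun-down : ∀ {n k} (g : Vec (Vec BTile n) k) vs → cRun (Vec.map (Vec.map checkTile) g) vs ≡
  (rights (D.down g (none k) vs) , List.map sortPair (log (D.down g (none k) vs)))
cRun-down []      vs = refl
cRun-down {k = suc k} (r ∷ g) vs rewrite cRow-row r nothing vs | cRun-down g (outs (D.row r nothing vs)) =
  cong (λ x → rights (D.row r nothing vs) ∷ rights (D.down g (none k) (outs (D.row r nothing vs))) , x)
    (sym (ListP.map-++ sortPair (log (D.row r nothing vs)) _))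

-- The definition tests the right end inside each row; here that test is split off as `rowRight`.
rowOK-columns : ∀ {n} (ts : Vec BTile n) q es →
  rowOK bEdges q ts ∧ allB (Vec.zipWith (λ t e → top (bEdges t) == e) ts es) ≡ rowOK′ ts q es ∧ rowRight ts q
rowOK-columns []       q []       = BoolP.∧-comm q true
rowOK-columns (t ∷ ts) q (e ∷ es) =
  trans (∧-four (left (bEdges t) == q) (rowOK bEdges (right (bEdges t)) ts) (top (bEdges t) == e) _)
    (trans (cong (((left (bEdges t) == q) ∧ (top (bEdges t) == e)) ∧_) (rowOK-columns ts (right (bEdges t)) es))
      (trans (sym (BoolP.∧-assoc ((left (bEdges t) == q) ∧ (top (bEdges t) == e)) (rowOK′ ts (right (bEdges t)) es) (rowRight ts (right (bEdges t)))))
        (cong (_∧ rowRight ts (right (bEdges t))) (BoolP.∧-assoc (left (bEdges t) == q) (top (bEdges t) == e) (rowOK′ ts (right (bEdges t)) es)))))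

gridOK-columns : ∀ {n k} (g : Vec (Vec BTile n) k) es →
  allB (Vec.map (rowOK bEdges false) g) ∧ vertOK bEdges true es g ≡ gridOK′ g (replicate k false) es ∧ allB (gridRight g)
gridOK-columns []      es = trans (cong allB (trans (VecP.map-cong ==-true es) (VecP.map-id es))) (BoolP.∧-comm true (allB es))
  where
  ==-true : ∀ e → (e == true) ≡ e
  ==-true true  = refl
  ==-true false = refl
gridOK-columns {k = suc k} (r ∷ g) es =
  trans (∧-four (rowOK bEdges false r) (allB (Vec.map (rowOK bEdges false) g)) (allB (Vec.zipWith (λ t e → top (bEdges t) == e) r es)) _)
    (trans (cong₂ _∧_ (rowOK-columns r false es) (gridOK-columns g (Vec.map (bottom ∘ bEdges) r)))
      (∧-four (rowOK′ r false es) (rowRight r false) (gridOK′ g (replicate k false) (Vec.map (bottom ∘ bEdges) r)) (allB (gridRight g))))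

isBPD-grid : ∀ {n} (g : Grid BTile n) → isBPD g ≡ gridOK′ g (replicate n false) (replicate n false) ∧ allB (gridRight g)
isBPD-grid {n} g = gridOK-columns g (replicate n false)

check-left : ∀ t → left (cEdges (checkTile t)) ≡ left (bEdges t)
check-left elbowBR = refl
check-left elbowTL = refl
check-left horiz   = refl
check-left vert    = refl
check-left cross   = refl
check-left blank   = refl

check-right : ∀ t → right (cEdges (checkTile t)) ≡ right (bEdges t)
check-right elbowBR = refl
check-right elbowTL = refl
check-right horiz   = refl
check-right vert    = refl
check-right cross   = refl
check-right blank   = refl

check-top : ∀ t → top (cEdges (checkTile t)) ≡ not (top (bEdges t))
check-top elbowBR = refl
check-top elbowTL = refl
check-top horiz   = refl
check-top vert    = refl
check-top cross   = refl
check-top blank   = refl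

check-bottom : ∀ t → bottom (cEdges (checkTile t)) ≡ not (bottom (bEdges t))
check-bottom elbowBR = refl
check-bottom elbowTL = refl
check-bottom horiz   = refl
check-bottom vert    = refl
check-bottom cross   = refl
check-bottom blank   = refl

-- The replacement keeps the horizontal edges and complements the vertical ones, and the conditions
-- on the top and bottom sides are complementary as well.
isCoBPD-check : ∀ {n} (g : Grid BTile n) → isCoBPD (check g) ≡ isBPD g
isCoBPD-check {n} g = cong₂ _∧_ (rows g) (trans (cong (λ es → vertOK cEdges false es (check g)) (falses n)) (verts (replicate n false) g))
  where
  falses : ∀ n → replicate n true ≡ Vec.map not (replicate n false)
  falses zero    = refl
  falses (suc n) = cong (true ∷_) (falses n)
  row′ : ∀ {n} q (ts : Vec BTile n) → rowOK cEdges q (Vec.map checkTile ts) ≡ rowOK bEdges q ts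
  row′ q []       = refl
  row′ q (t ∷ ts) = cong₂ (λ a b → (a == q) ∧ b) (check-left t) (trans (cong (λ b → rowOK cEdges b (Vec.map checkTile ts)) (check-right t)) (row′ _ ts))
  rows : ∀ {n k} (g : Vec (Vec BTile n) k) → allB (Vec.map (rowOK cEdges false) (Vec.map (Vec.map checkTile) g)) ≡ allB (Vec.map (rowOK bEdges false) g)
  rows []      = refl
  rows (r ∷ g) = cong₂ _∧_ (row′ false r) (rows g)
  not-== : ∀ a b → (not a == not b) ≡ (a == b)
  not-== true  true  = refl
  not-== true  false = refl
  not-== false true  = refl
  not-== false false = refl
  tops : ∀ {n} (ts : Vec BTile n) es → allB (Vec.zipWith (λ t e → top (cEdges t) == e) (Vec.map checkTile ts) (Vec.map not es)) ≡
    allB (Vec.zipWith (λ t e → top (bEdges t) == e) ts es)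
  tops []       []       = refl
  tops (t ∷ ts) (e ∷ es) = cong₂ _∧_ (trans (cong (_== not e) (check-top t)) (not-== (top (bEdges t)) e)) (tops ts es)
  bottoms : ∀ {n} (ts : Vec BTile n) → Vec.map (bottom ∘ cEdges) (Vec.map checkTile ts) ≡ Vec.map not (Vec.map (bottom ∘ bEdges) ts)
  bottoms []       = refl
  bottoms (t ∷ ts) = cong₂ _∷_ (check-bottom t) (bottoms ts)
  verts : ∀ {n k} es (g : Vec (Vec BTile n) k) → vertOK cEdges false (Vec.map not es) (Vec.map (Vec.map checkTile) g) ≡ vertOK bEdges true es g
  verts es []      = cong allB (ends es)
    where
    ends : ∀ {n} (es : Vec Bool n) → Vec.map (_== false) (Vec.map not es) ≡ Vec.map (_== true) es
    ends []       = refl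
    ends (e ∷ es) = cong₂ _∷_ (not-== e true) (ends es)
  verts es (r ∷ g) = cong₂ _∧_ (tops r es) (trans (cong (λ es → vertOK cEdges false es (Vec.map (Vec.map checkTile) g)) (bottoms r)) (verts (Vec.map (bottom ∘ bEdges) r) g))

before-tab : ∀ {n} (f : Fin n → ℕ) {i j} → toℕ i ℕ.< toℕ j → Before (f i) (f j) (tab f)
before-tab f {zero}  {suc j} lt       = first (∈-tabulate⁺ j)
before-tab f {suc i} {suc j} (s≤s lt) = later (before-tab (f ∘ suc) lt)

distinct⇒Inj : ∀ {n} (f : Fin n → ℕ) → Distinct (tab f) → Inj f
distinct⇒Inj f d i j e with ℕP.<-cmp (toℕ i) (toℕ j)
... | tri≈ _ eq _ = FinP.toℕ-injective eq
... | tri< lt _ _ = contradiction e (d (before-tab f lt))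
... | tri> _ _ gt = contradiction (sym e) (d (before-tab f gt))

distinct-reverse : ∀ {l} → Distinct (reverse l) → Distinct l
distinct-reverse {l} d h e = d (before-reverse (reverse l) (subst (Before _ _) (sym (ListP.reverse-involutive l)) h)) (sym e)

catV-tabulate : ∀ {n} (f : Fin n → ℕ) → catV (tabulate (just ∘ f)) ≡ tab f
catV-tabulate {zero}  f = refl
catV-tabulate {suc n} f = cong (f zero ∷_) (catV-tabulate (f ∘ suc))

alternating-power : ∀ j → -1ℤ ^ j ≡ alternating j
alternating-power zero    = refl
alternating-power (suc j) = trans (cong (_*_ -1ℤ) (alternating-power j)) (ℤP.-1*i≡-i (alternating j))

epsFrom-triangle : ∀ n → epsFrom n 0 ≡ alternating (triangle n)
epsFrom-triangle n = trans (eps n 0) (cong alternating (from-zero n))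
  where
  sumFrom : ℕ → ℕ → ℕ
  sumFrom zero    j = 0
  sumFrom (suc l) j = j ℕ.+ sumFrom l (suc j)
  eps : ∀ l j → epsFrom l j ≡ alternating (sumFrom l j)
  eps zero    j = refl
  eps (suc l) j = trans (cong₂ _*_ (alternating-power j) (eps l (suc j))) (sym (alternating-+ j (sumFrom l (suc j))))
  snoc : ∀ l j → sumFrom (suc l) j ≡ (j ℕ.+ l) ℕ.+ sumFrom l j
  snoc zero    j = cong (ℕ._+ 0) (sym (ℕP.+-identityʳ j))
  snoc (suc l) j = trans (cong (j ℕ.+_) (snoc l (suc j))) (alg j l (sumFrom l (suc j)))
    where
    open import Data.Nat.Tactic.RingSolver using () renaming (solve-∀ to solveℕ)
    alg : ∀ j l s → j ℕ.+ (suc j ℕ.+ l ℕ.+ s) ≡ j ℕ.+ suc l ℕ.+ (j ℕ.+ s)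
    alg = solveℕ
  from-zero : ∀ n → sumFrom n 0 ≡ triangle n
  from-zero zero    = refl
  from-zero (suc n) = trans (snoc n 0) (cong (n ℕ.+_) (from-zero n))

occ-none : ∀ k → Vec.map occ (none k) ≡ replicate k false
occ-none zero    = refl
occ-none (suc k) = cong (false ∷_) (occ-none k)

edgeStates-none : ∀ k → edgeStates (none k) (none k) ≡ replicate k nothing
edgeStates-none zero    = refl
edgeStates-none (suc k) = cong (nothing ∷_) (edgeStates-none k)

occ-all : ∀ {n} (ls : Vec Lab n) → Vec.map occ ls ≡ replicate n true → ls ≡ tabulate (λ r → just (fromMaybe 0 (lookup ls r)))
occ-all []            e = refl
occ-all (just a ∷ ls) e = cong (just a ∷_) (occ-all ls (VecP.∷-injectiveʳ e))

catV-empty : ∀ {n} (ls : Vec Lab n) → Vec.map occ ls ≡ replicate n false → catV ls ≡ []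
catV-empty []             e = refl
catV-empty (nothing ∷ ls) e = catV-empty ls (VecP.∷-injectiveʳ e)

-- The contribution of a single grid.

module PerGrid {m : ℕ} (w : Permutation′ (suc m)) (g : Grid BTile (suc m)) where
  n : ℕ
  n = suc m

  ids : Vec Lab n
  ids = tabulate (λ c → just (toℕ c))

  inc-id : Inj {n} toℕ
  inc-id i j = FinP.toℕ-injective

  word-ids : catV ids ≡ tab {n} toℕ
  word-ids = catV-tabulate toℕ

  distinct-ids : Distinct (catV ids)
  distinct-ids = subst Distinct (sym word-ids) (distinct-tabulate inc-id)

  runB = B.up g (none n) ids
  runC = C.down g (none n) ids
  runD = D.down g (none n) ids

  v : Fin n → ℕ
  v = δC (check g)

  Consistent : Set
  Consistent = gridOK′ g (replicate n false) (replicate n false) ≡ true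

  occ-ids : Vec.map occ ids ≡ replicate n true
  occ-ids = go n {toℕ}
    where
    go : ∀ k {f : Fin k → ℕ} → Vec.map occ (tabulate (just ∘ f)) ≡ replicate k true
    go zero    = refl
    go (suc k) = cong (true ∷_) (go k)

  not-occ-ids : Vec.map (not ∘ occ) ids ≡ replicate n false
  not-occ-ids = go n {toℕ}
    where
    go : ∀ k {f : Fin k → ℕ} → Vec.map (not ∘ occ) (tabulate (just ∘ f)) ≡ replicate k false
    go zero    = refl
    go (suc k) = cong (false ∷_) (go k)

  module _ (ok : Consistent) where
    private
      okC : gridOK′ g (replicate n false) (Vec.map (not ∘ occ) ids) ≡ true
      okC = subst (λ es → gridOK′ g (replicate n false) es ≡ true) (sym not-occ-ids) ok
      factsB = grid-steps-B sortPipes g ids (replicate n false) ok occ-ids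

    occB : Vec.map occ (rights runB) ≡ gridRight g
    occB = proj₁ (proj₂ factsB)

    stepsB : Steps sortPipes (tab {n} toℕ) (log runB) (catV (rights runB))
    stepsB = subst₂ (λ a b → Steps sortPipes a (log runB) b) word-ids
      (cong (_++ catV (rights runB)) (catV-empty (outs runB) (proj₁ factsB))) (proj₂ (proj₂ factsB))

    occC : Vec.map occ (rights runC) ≡ gridRight g
    occC = proj₁ (grid-steps-C crossPipes g ids okC)

    stepsC : Steps crossPipes (tab {n} toℕ) (log runC) (reverse (catV (rights runC)))
    stepsC = subst (λ a → Steps crossPipes a (log runC) (reverse (catV (rights runC)))) word-ids (proj₂ (grid-steps-C crossPipes g ids okC))

    stepsD : Steps sortPipes (catV ids) (log runD) (reverse (catV (rights runD)))
    stepsD = proj₂ (grid-steps-C sortPipes g ids okC)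

  sort-is-cross : ∀ {l v} → Increasing id (l , v) → sortPipes l v ≡ crossPipes l v
  sort-is-cross h = cong₂ _,_ (ℕP.m≥n⇒m⊔n≡m (ℕP.<⇒≤ h)) (ℕP.m≥n⇒m⊓n≡n (ℕP.<⇒≤ h))

  crossPairs-log : crossPairs (check g) ≡ List.map sortPair (log runD)
  crossPairs-log = cong proj₂ (cRun-down g ids)

  v-rights : ∀ r → v r ≡ fromMaybe 0 (lookup (rights runD) r)
  v-rights r = cong (λ q → fromMaybe 0 (lookup (proj₁ q) r)) (cRun-down g ids)

  δB-rights : δB g ≡ rights runB
  δB-rights = cong proj₂ (bRun-up g ids)

  -- Reducedness of the co-BPD appears here as a condition on the run of `C`: all its crossings are
  -- in increasing order of entry columns.
  record Valid : Set where
    field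
      consistent : Consistent
      full       : gridRight g ≡ replicate n true
      labels     : rights runB ≡ tabulate (λ r → just (oneLine w r))
      increasing : All (Increasing id) (log runC)

  -- Reducedness is given for the sorting rule. There the absence of repeated meetings makes every
  -- meeting a real crossing, and then both rules give the same run.
  valid-sound : valid? w g ≡ true → Valid
  valid-sound e with ∧-true {inBPD w g} e
  ... | e₁ , e₂ with ∧-true {isBPD g} e₁ | ∧-true {isCoBPD (check g)} e₂
  ... | bpd , lab | _ , nd with ∧-true {gridOK′ g (replicate n false) (replicate n false)} (trans (sym (isBPD-grid g)) bpd)
  ... | ok , full = record { consistent = ok ; full = allB-true (gridRight g) full ; labels = trans (sym δB-rights) (eq lab) ; increasing = inc′ }
    where
    eq : ⌊ VecP.≡-dec (MaybeP.≡-dec ℕ._≟_) (δB g) (tabulate (λ r → just (oneLine w r))) ⌋ ≡ true → δB g ≡ tabulate (λ r → just (oneLine w r))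
    eq t with VecP.≡-dec (MaybeP.≡-dec ℕ._≟_) (δB g) (tabulate (λ r → just (oneLine w r)))
    ... | yes p = p
    inc : All (Increasing id) (log runD)
    -- At the start no pair has met, and the word of entry columns has no inversions.
    inc = noDup⇒increasing (stepsD ok) distinct-ids (λ _ → ⊥)
      (λ h lt → absurd (before-tabulate toℕ (subst (Before _ _) word-ids h)) lt) (λ _ _ ()) (trans (cong noDup (sym crossPairs-log)) nd)
      where
      absurd : ∀ {a b} → (∃ λ (i : Fin n) → ∃ λ (j : Fin n) → (toℕ i ℕ.< toℕ j) × toℕ i ≡ a × toℕ j ≡ b) → b ℕ.< a → ⊥
      absurd (i , j , lt , refl , refl) gt = ℕP.<⇒≯ lt gt
    inc′ : All (Increasing id) (log runC)
    inc′ = subst (All (Increasing id) ∘ log) (down-agree (Increasing id) sort-is-cross moveC g (none n) ids inc) inc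

  valid-complete : Valid → valid? w g ≡ true
  valid-complete V = cong₂ _∧_ (cong₂ _∧_ bpd lab) (cong₂ _∧_ (trans (isCoBPD-check g) bpd) nd)
    where
    open Valid V
    allTrue : ∀ k → allB (replicate k true) ≡ true
    allTrue zero    = refl
    allTrue (suc k) = allTrue k
    bpd : isBPD g ≡ true
    bpd = trans (isBPD-grid g) (cong₂ _∧_ consistent (trans (cong allB full) (allTrue n)))
    lab : ⌊ VecP.≡-dec (MaybeP.≡-dec ℕ._≟_) (δB g) (tabulate (λ r → just (oneLine w r))) ⌋ ≡ true
    lab with VecP.≡-dec (MaybeP.≡-dec ℕ._≟_) (δB g) (tabulate (λ r → just (oneLine w r)))
    ... | yes _ = refl
    ... | no ne = contradiction (trans δB-rights labels) ne
    nd : noDup (crossPairs (check g)) ≡ true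
    nd = trans (cong noDup (trans crossPairs-log (cong (List.map sortPair ∘ log)
        (sym (down-agree (Increasing id) (λ h → sym (sort-is-cross h)) moveC g (none n) ids increasing)))))
      (increasing⇒noDup (stepsC consistent) (distinct-tabulate inc-id) increasing)

  module _ (V : Valid) where
    open Valid V

    runs-agree : runC ≡ runD
    runs-agree = down-agree (Increasing id) (λ h → sym (sort-is-cross h)) moveC g (none n) ids increasing

    rightsC : rights runC ≡ tabulate (just ∘ v)
    rightsC = trans (occ-all (rights runC) (trans (occC consistent) full))
      (VecP.tabulate-cong (λ r → cong just (trans (cong (λ q → fromMaybe 0 (lookup (rights q) r)) runs-agree) (sym (v-rights r)))))

    steps-v : Steps crossPipes (tab {n} toℕ) (log runC) (reverse (tab v))
    steps-v = subst (λ l → Steps crossPipes (tab {n} toℕ) (log runC) (reverse l)) (trans (cong catV rightsC) (catV-tabulate v)) (stepsC consistent)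

    v-inj : Inj v
    v-inj = distinct⇒Inj v (distinct-reverse (distinct-steps steps-v (distinct-tabulate inc-id)))

    v-range : ∀ r → ∃ λ k → v r ≡ toℕ {n} k
    v-range r = ∈-tabulate⁻ (∈-steps steps-v (reverse⁺ (∈-tabulate⁺ {f = v} r)))

    inv-toℕ : inv {n} toℕ ≡ 0
    inv-toℕ = ℕP.n≤0⇒n≡0 (inv-cword {m} [])

    -- The crossings turn the increasing word into the exits read upwards, each adding one
    -- inversion; the inversions of `v` are those of the reversed word.
    crossings : length (log runC) ℕ.+ inv v ≡ triangle n
    crossings = trans (cong (ℕ._+ inv v) (sym (trans (invL-steps steps-v increasing) (trans (cong (length (log runC) ℕ.+_) inv-toℕ) (ℕP.+-identityʳ _)))))
      (trans (invL-reverse (tab v) (distinct-tabulate v-inj)) (cong triangle (ListP.length-tabulate v)))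

    signB : val sgn (log runB) ≡ alternating (inv (oneLine w))
    signB = sym (trans (cong (alternating ∘ invL) (sym (trans (cong catV labels) (catV-tabulate (oneLine w)))))
      (trans (invL-sign (stepsB consistent)) (trans (cong (λ z → alternating z * val sgn (log runB)) inv-toℕ) (ℤP.*-identityˡ (val sgn (log runB))))))

  module _ (u : List (Fin m)) where
    c : Fin n → ℕ
    c = toℕ ∘ cword u

    -- `c` as a function on labels, with value 0 outside the range.
    γ : ℕ → ℕ
    γ = entry (cvec u)

    γ-toℕ : ∀ j → γ (toℕ j) ≡ c j
    γ-toℕ j = trans (entry-lookup (cvec u) j) (VecP.lookup∘tabulate c j)

    E : Vec H n → ℤ
    E = exits (Vec.map toℕ (tabulate (w ⟨$⟩ʳ_)))

    runγ = C.down g (none n) (Vec.map just (cvec u))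

    runγ-rights : rights runγ ≡ Vec.map (Maybe.map γ) (rights runC)
    runγ-log : log runγ ≡ List.map (mapPair γ) (log runC)
    private
      relabelled : runγ ≡ (Vec.map (Maybe.map γ) (outs runC) , Vec.map (Maybe.map γ) (rights runC) , List.map (mapPair γ) (log runC))
      relabelled = trans (cong₂ (C.down g) (sym (VecP.map-replicate (Maybe.map γ) nothing n))
          (trans (sym (VecP.tabulate-∘ just c)) (trans (VecP.tabulate-cong (λ j → cong just (sym (γ-toℕ j)))) (VecP.tabulate-∘ (Maybe.map γ) (λ j → just (toℕ j))))))
        (down-relabel γ moveC g (none n) ids)
    runγ-rights = cong rights relabelled
    runγ-log = cong log relabelled

    exit : exitState (Vec.map toℕ (tabulate (w ⟨$⟩ʳ_))) ≡ tabulate (λ r → just (oneLine w r , toℕ r))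
    exit = VecP.tabulate-cong (λ r → cong (λ z → just (z , toℕ r)) (trans (VecP.lookup-map r toℕ (tabulate (w ⟨$⟩ʳ_))) (cong toℕ (VecP.lookup∘tabulate (w ⟨$⟩ʳ_) r))))

    term : ℤ
    term = val sgn (log runB) * val negBelow (log runγ) * E (edgeStates (rights runB) (rights runγ))

    edgeStates-tabulate : ∀ {k} (f : Fin k → ℕ) (h : Fin k → ℕ) → edgeStates (tabulate (just ∘ f)) (tabulate (just ∘ h)) ≡ tabulate (λ r → just (f r , h r))
    edgeStates-tabulate {zero}  f h = refl
    edgeStates-tabulate {suc k} f h = cong (just (f zero , h zero) ∷_) (edgeStates-tabulate (f ∘ suc) (h ∘ suc))

    lookup-eq : ∀ {k} {A : Set} {f h : Fin k → A} → tabulate f ≡ tabulate h → f ≗ h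
    lookup-eq {f = f} {h} e r = trans (sym (VecP.lookup∘tabulate f r)) (trans (cong (λ q → lookup q r) e) (VecP.lookup∘tabulate h r))

    module _ (V : Valid) where
      open Valid V

      states : edgeStates (rights runB) (rights runγ) ≡ tabulate (λ r → just (oneLine w r , γ (v r)))
      states = trans (cong₂ edgeStates labels (trans runγ-rights (trans (cong (Vec.map (Maybe.map γ)) (rightsC V)) (sym (VecP.tabulate-∘ (Maybe.map γ) (just ∘ v))))))
        (edgeStates-tabulate (oneLine w) (γ ∘ v))

      module _ (inverse : ∀ r → γ (v r) ≡ toℕ r) where

        E-one : E (edgeStates (rights runB) (rights runγ)) ≡ 1ℤ
        E-one = trans (cong E (trans states (trans (VecP.tabulate-cong (λ r → cong (λ z → just (oneLine w r , z)) (inverse r))) (sym exit))))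
          (exits-self (Vec.map toℕ (tabulate (w ⟨$⟩ʳ_))))

        -- Of two pipes that cross, the one with the smaller entry column leaves nearer to the top,
        -- and `γ` sends an exit label to its row.
        γ-increasing : All (Increasing γ) (log runC)
        γ-increasing = All.tabulate λ {p} h → go (before-tabulate v (before-reverse (tab v) (crossed-after {id} (steps-v V) increasing h)))
          where
          go : ∀ {a b} → (∃ λ i → ∃ λ j → (toℕ i ℕ.< toℕ j) × v i ≡ a × v j ≡ b) → γ a ℕ.< γ b
          go (i , j , lt , refl , refl) = subst₂ ℕ._<_ (sym (inverse i)) (sym (inverse j)) lt

        signγ : val negBelow (log runγ) ≡ alternating (length (log runC))
        signγ = trans (cong (val negBelow) runγ-log) (trans (val-negBelow (increasing-map γ γ-increasing))
          (cong alternating (ListP.length-map (mapPair γ) (log runC))))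

        crossings-γ : length (log runC) ℕ.+ inv c ≡ triangle n
        crossings-γ = trans (sym (trans (cong invL (sym final)) (trans (invL-steps (steps-map γ (steps-v V)) (increasing-map γ γ-increasing))
            (cong₂ ℕ._+_ (ListP.length-map (mapPair γ) (log runC)) (cong invL (trans (ListP.map-tabulate toℕ γ) (ListP.tabulate-cong γ-toℕ)))))))
          (trans (sym (trans (cong (invL (reverse (tab {n} toℕ)) ℕ.+_) (inv-toℕ V)) (ℕP.+-identityʳ _)))
            (trans (invL-reverse (tab {n} toℕ) (distinct-tabulate inc-id)) (cong triangle (ListP.length-tabulate {n = n} toℕ))))
          where
          final : List.map γ (reverse (tab v)) ≡ reverse (tab {n} toℕ)
          final = trans (ListP.reverse-map γ (tab v)) (cong reverse (trans (ListP.map-tabulate v γ) (ListP.tabulate-cong inverse)))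

        -- A permutation and its inverse have equally many inversions: both numbers complement the
        -- same count of crossings to `triangle n`.
        inv-c : inv c ≡ inv v
        inv-c = ℕP.+-cancelˡ-≡ (length (log runC)) _ _ (trans crossings-γ (sym (crossings V)))

      -- No inversions means that `v ∘ cword u` is the identity, and then a right inverse is also a
      -- left inverse.
      inverse-if-sorted : inv (v ∘ cword u) ≡ 0 → ∀ r → γ (v r) ≡ toℕ r
      inverse-if-sorted z r with v-range V r
      ... | k , e = trans (cong γ e) (trans (γ-toℕ k) (cong toℕ (v-inj V _ _ (trans (sorted k) (sym e)))))
        where
        sorted : ∀ j → v (cword u j) ≡ toℕ j
        sorted = sorted-is-identity (v ∘ cword u) (λ i j e → Inj-cword u i j (v-inj V _ _ e))
          (λ j → subst (ℕ._< n) (sym (proj₂ (v-range V (cword u j)))) (FinP.toℕ<n (proj₁ (v-range V (cword u j))))) z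

      sorted-if-inverse : (∀ r → γ (v r) ≡ toℕ r) → inv (v ∘ cword u) ≡ 0
      sorted-if-inverse inverse = trans (inv-cong sorted) (inv-toℕ V)
        where
        sorted : ∀ j → v (cword u j) ≡ toℕ j
        sorted j with v-range V (cword u j)
        ... | k , e = trans e (cong toℕ (Inj-cword u k j (FinP.toℕ-injective (trans (sym (γ-toℕ k)) (trans (cong γ (sym e)) (inverse (cword u j)))))))

      -- If the labels of `u` are not inverse to `v`, both sides vanish. Otherwise the signs
      -- balance: with `L` co-BPD crossings, `epsFrom n 0` is (-1)^(L + inv v), and the two logs
      -- contribute (-1)^L and (-1)^(inv w).
      valid-term : epsFrom n 0 * (if ⌊ inv c ℕ.≟ length u ⌋ then term else 0ℤ) ≡ contribution w u g
      valid-term with inv (v ∘ cword u) ℕ.≟ 0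
      ... | no nz = trans (cong (λ z → epsFrom n 0 * (if ⌊ inv c ℕ.≟ length u ⌋ then z else 0ℤ)) term-zero)
          (trans (vanish ⌊ inv c ℕ.≟ length u ⌋) (sym (vanish′ ⌊ inv (v ∘ cword u) ℕ.+ length u ℕ.≟ inv v ⌋)))
        where
        term-zero : term ≡ 0ℤ
        term-zero = trans (cong (_*_ (val sgn (log runB) * val negBelow (log runγ)))
            (exits-other (Vec.map toℕ (tabulate (w ⟨$⟩ʳ_))) _ λ e → nz (sorted-if-inverse λ r →
              cong proj₂ (MaybeP.just-injective (lookup-eq {f = λ r → just (oneLine w r , γ (v r))} {h = λ r → just (oneLine w r , toℕ r)} (trans (sym states) (trans e exit)) r)))))
          (ℤP.*-zeroʳ (val sgn (log runB) * val negBelow (log runγ)))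
        vanish : ∀ b → epsFrom n 0 * (if b then 0ℤ else 0ℤ) ≡ 0ℤ
        vanish true  = ℤP.*-zeroʳ (epsFrom n 0)
        vanish false = ℤP.*-zeroʳ (epsFrom n 0)
        vanish′ : ∀ b → alternating (inv v) * alternating (inv (oneLine w)) * (if b then 0ℤ else 0ℤ) ≡ 0ℤ
        vanish′ true  = ℤP.*-zeroʳ (alternating (inv v) * alternating (inv (oneLine w)))
        vanish′ false = ℤP.*-zeroʳ (alternating (inv v) * alternating (inv (oneLine w)))
      ... | yes z = trans (cong (λ b → epsFrom n 0 * (if b then term else 0ℤ)) same-test)
          (balance ⌊ inv (v ∘ cword u) ℕ.+ length u ℕ.≟ inv v ⌋)
        where
        inverse : ∀ r → γ (v r) ≡ toℕ r
        inverse = inverse-if-sorted z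
        same-test : ⌊ inv c ℕ.≟ length u ⌋ ≡ ⌊ inv (v ∘ cword u) ℕ.+ length u ℕ.≟ inv v ⌋
        same-test = isYes-cong (λ e → trans (cong (ℕ._+ length u) z) (trans (sym e) (inv-c inverse)))
          (λ e → trans (inv-c inverse) (trans (sym e) (cong (ℕ._+ length u) z))) (inv c ℕ.≟ length u) (inv (v ∘ cword u) ℕ.+ length u ℕ.≟ inv v)
        L : ℕ
        L = length (log runC)
        value : epsFrom n 0 * term ≡ alternating (inv v) * alternating (inv (oneLine w)) * 1ℤ
        value = trans (cong₂ _*_
            (trans (epsFrom-triangle n) (trans (cong alternating (sym (crossings V))) (alternating-+ L (inv v))))
            (cong₂ _*_ (cong₂ _*_ (signB V) (signγ inverse)) (E-one inverse)))
          (trans (alg (alternating L) (alternating (inv v)) (alternating (inv (oneLine w))))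
            (trans (cong (_* (alternating (inv v) * alternating (inv (oneLine w)))) (alternating² L))
              (alg₂ (alternating (inv v) * alternating (inv (oneLine w))))))
          where
          alg : ∀ l v w → l * v * (w * l * 1ℤ) ≡ l * l * (v * w)
          alg = solve-∀
          alg₂ : ∀ x → 1ℤ * x ≡ x * 1ℤ
          alg₂ = solve-∀
        balance : ∀ b → epsFrom n 0 * (if b then term else 0ℤ) ≡ alternating (inv v) * alternating (inv (oneLine w)) * (if b then 1ℤ else 0ℤ)
        balance true  = value
        balance false = trans (ℤP.*-zeroʳ (epsFrom n 0)) (sym (ℤP.*-zeroʳ (alternating (inv v) * alternating (inv (oneLine w)))))

    -- A nonzero term would make the grid valid. The exit state gives the labels and a full right
    -- side. The nonzero weight makes every crossing increasing for `γ`, so each pair starts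
    -- uncrossed, and the starting word increases.
    invalid-term : Consistent → ¬ Valid → term ≡ 0ℤ
    invalid-term ok ¬V with edgeStates (rights runB) (rights runγ) ≟H exitState (Vec.map toℕ (tabulate (w ⟨$⟩ʳ_)))
    ... | no _ = ℤP.*-zeroʳ (val sgn (log runB) * val negBelow (log runγ))
    ... | yes e with val negBelow (log runγ) ℤ.≟ 0ℤ
    ...   | yes z = trans (cong (λ q → val sgn (log runB) * q * 1ℤ) z) (trans (ℤP.*-identityʳ (val sgn (log runB) * 0ℤ)) (ℤP.*-zeroʳ (val sgn (log runB))))
    ...   | no nz = contradiction V ¬V
      where
      occ-eq : Vec.map occ (rights runB) ≡ Vec.map occ (rights runC)
      occ-eq = trans (occB ok) (sym (occC ok))
      recover : ∀ {k} (bs cs : Vec Lab k) (f : Fin k → ℕ) (h : Fin k → ℕ) → Vec.map occ bs ≡ Vec.map occ cs →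
        edgeStates bs (Vec.map (Maybe.map γ) cs) ≡ tabulate (λ r → just (f r , h r)) →
        bs ≡ tabulate (just ∘ f) × Vec.map occ bs ≡ replicate k true
      recover []            []            f h o e = refl , refl
      recover (just b ∷ bs) (just c ∷ cs) f h o e with recover bs cs (f ∘ suc) (h ∘ suc) (VecP.∷-injectiveʳ o) (VecP.∷-injectiveʳ e)
      ... | e₁ , e₂ = cong₂ _∷_ (cong (just ∘ proj₁) (MaybeP.just-injective (VecP.∷-injectiveˡ e))) e₁ , cong (true ∷_) e₂
      recovered = recover (rights runB) (rights runC) (oneLine w) toℕ occ-eq (trans (cong (edgeStates (rights runB)) (sym runγ-rights)) (trans e exit))
      γ-inc : All (Increasing γ) (log runC)
      γ-inc = AllP.map⁻ (subst (All (Increasing id)) runγ-log (val-negBelow-zero (log runγ) nz))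
      id-inc : All (Increasing id) (log runC)
      id-inc = All.tabulate λ h → go (before-tabulate toℕ (crossed-before {γ} (stepsC ok) γ-inc h))
        where
        go : ∀ {a b} → (∃ λ (i : Fin n) → ∃ λ (j : Fin n) → (toℕ i ℕ.< toℕ j) × toℕ i ≡ a × toℕ j ≡ b) → a ℕ.< b
        go (i , j , lt , refl , refl) = lt
      V : Valid
      V = record { consistent = ok ; full = trans (sym (occB ok)) (proj₂ recovered) ; labels = proj₁ recovered ; increasing = id-inc }

    grid-term : epsFrom n 0 * (if ⌊ inv c ℕ.≟ length u ⌋
        then gridTerm (Vec.map just (tabulate toℕ)) (Vec.map just (cvec u)) (none n) (none n) E g else 0ℤ) ≡
      (if valid? w g then contribution w u g else 0ℤ)
    grid-term rewrite occ-none n | sym (VecP.tabulate-∘ just (toℕ {n})) with valid? w g in eq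
    ... | true rewrite Valid.consistent (valid-sound eq) = valid-term (valid-sound eq)
    ... | false = trans (cong (λ z → epsFrom n 0 * (if ⌊ inv c ℕ.≟ length u ⌋ then z else 0ℤ)) zero′) (vanish ⌊ inv c ℕ.≟ length u ⌋)
      where
      vanish : ∀ b → epsFrom n 0 * (if b then 0ℤ else 0ℤ) ≡ 0ℤ
      vanish true  = ℤP.*-zeroʳ (epsFrom n 0)
      vanish false = ℤP.*-zeroʳ (epsFrom n 0)
      ¬V : ¬ Valid
      ¬V V = case trans (sym eq) (valid-complete V) of λ ()
      zero′ : (if gridOK′ g (replicate n false) (replicate n false) then term else 0ℤ) ≡ 0ℤ
      zero′ with gridOK′ g (replicate n false) (replicate n false) in ok
      ... | false = refl
      ... | true  = invalid-term ok ¬V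

theorem1p1 : (m : ℕ) (w : Permutation′ (suc m)) →
    Grothendieck (oneLine w) ≈P rhs w
theorem1p1 m w = eval-determines (Grothendieck (oneLine w)) (rhs w) λ x →
  ℤP.i-j≡0⇒i≡j _ _ (trans (sym (eval-diffP (Grothendieck (oneLine w)) (rhs w) x)) (derivatives-determine d d-stair d-derivatives x))
  where
  n : ℕ
  n = suc m
  wv : Vec (Fin n) n
  wv = tabulate (w ⟨$⟩ʳ_)
  wv-word : oneLine w ≗ asWord wv
  wv-word r = sym (trans (VecP.lookup-map r toℕ wv) (cong toℕ (VecP.lookup∘tabulate (w ⟨$⟩ʳ_) r)))
  oneLine-inj : Inj (oneLine w)
  oneLine-inj i j e = trans (sym (Perm.inverseˡ w)) (trans (cong (w Perm.⟨$⟩ˡ_) (FinP.toℕ-injective e)) (Perm.inverseˡ w))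
  Gw : Grothendieck (oneLine w) ≡ Gr.fam (asWord wv)
  Gw = trans (grothAux≡family (suc m ℕ.* suc m) (oneLine w)) (Gr.fam-cong wv-word)
  open GrothendieckSide wv (Inj-cong wv-word oneLine-inj) using (ε; E; derivative-at-0)
  d : Poly n
  d = diffP (Grothendieck (oneLine w)) (rhs w)
  d-stair : All (Stair ∘ proj₂) d
  d-stair = AllP.++⁺ (subst (All (Stair ∘ proj₂)) (sym Gw) (Gr.family-stair (suc m ℕ.* suc m) (asWord wv))) (AllP.map⁺ (rhs-stair w))
  -- The lattice model yields `ε` times the derivative; a second factor `ε` removes the sign.
  ε² : ε * ε ≡ 1ℤ
  ε² = trans (cong₂ _*_ (epsFrom-triangle n) (epsFrom-triangle n)) (alternating² (triangle n))

  grothendieck-at-0 : ∀ u → eval (divDiffs u (Grothendieck (oneLine w))) (λ _ → 0ℤ) ≡ eval (divDiffs u (rhs w)) (λ _ → 0ℤ)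
  grothendieck-at-0 u = begin
    eval (divDiffs u (Grothendieck (oneLine w))) (λ _ → 0ℤ)
      ≡⟨ cong (λ p → eval (divDiffs u p) (λ _ → 0ℤ)) Gw ⟩
    q
      ≡⟨ trans (sym (ℤP.*-identityˡ q)) (trans (cong (_* q) (sym ε²)) (ℤP.*-assoc ε ε q)) ⟩
    ε * (ε * q)
      ≡⟨ cong (_*_ ε) (trans (derivative-at-0 u) (cong (λ z → if b then z else 0ℤ)
           (trans (cong (λ hs → chain (tabulate toℕ) (cvec u) (replicate n 1ℤ) hs E) (sym (edgeStates-none n)))
             (chain-tilings (tabulate toℕ) (cvec u) (none n) (none n) E refl)))) ⟩
    ε * (if b then sumL (allBGrids n) K else 0ℤ)
      ≡⟨ distribute b ⟩
    sumL (allBGrids n) (λ g → ε * (if b then K g else 0ℤ))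
      ≡⟨ sumL-cong (allBGrids n) (λ g → PerGrid.grid-term w g u) ⟩
    sumL (allBGrids n) (λ g → if valid? w g then contribution w u g else 0ℤ)
      ≡⟨ sym (rhs-derivative w (λ g e → PerGrid.v-inj w g (PerGrid.valid-sound w g e)) u) ⟩
    eval (divDiffs u (rhs w)) (λ _ → 0ℤ) ∎
    where
    open ≡-Reasoning
    q : ℤ
    q = eval (divDiffs u (Gr.fam (asWord wv))) (λ _ → 0ℤ)
    b : Bool
    b = ⌊ inv (toℕ ∘ cword u) ℕ.≟ length u ⌋
    K : Grid BTile n → ℤ
    K = gridTerm (Vec.map just (tabulate toℕ)) (Vec.map just (cvec u)) (none n) (none n) E
    distribute : ∀ b → ε * (if b then sumL (allBGrids n) K else 0ℤ) ≡ sumL (allBGrids n) (λ g → ε * (if b then K g else 0ℤ))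
    distribute true  = sym (sumL-scale (allBGrids n) ε K)
    distribute false = trans (ℤP.*-zeroʳ ε) (sym (trans (sumL-cong (allBGrids n) (λ _ → ℤP.*-zeroʳ ε)) (sumL-zero (allBGrids n))))

  d-derivatives : ∀ u → eval (divDiffs u d) (λ _ → 0ℤ) ≡ 0ℤ
  d-derivatives u = begin
    eval (divDiffs u d) (λ _ → 0ℤ)
      ≡⟨ cong (λ p → eval p (λ _ → 0ℤ)) (divDiffs-++ u (Grothendieck (oneLine w)) (scaleP (- 1ℤ) (rhs w))) ⟩
    eval (divDiffs u (Grothendieck (oneLine w)) ++ divDiffs u (scaleP (- 1ℤ) (rhs w))) (λ _ → 0ℤ)
      ≡⟨ eval-++ (divDiffs u (Grothendieck (oneLine w))) (divDiffs u (scaleP (- 1ℤ) (rhs w))) (λ _ → 0ℤ) ⟩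
    eval (divDiffs u (Grothendieck (oneLine w))) (λ _ → 0ℤ) + eval (divDiffs u (scaleP (- 1ℤ) (rhs w))) (λ _ → 0ℤ)
      ≡⟨ cong₂ _+_ (grothendieck-at-0 u) (trans (divDiffs-scaleP u (- 1ℤ) (rhs w) (λ _ → 0ℤ)) (ℤP.-1*i≡-i (eval (divDiffs u (rhs w)) (λ _ → 0ℤ)))) ⟩
    eval (divDiffs u (rhs w)) (λ _ → 0ℤ) - eval (divDiffs u (rhs w)) (λ _ → 0ℤ)
      ≡⟨ ℤP.i≡j⇒i-j≡0 {eval (divDiffs u (rhs w)) (λ _ → 0ℤ)} refl ⟩
    0ℤ ∎
    where open ≡-Reasoning
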